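{- Let $m,n\ge1$ be integers, $\lambda\vdash n$ and $\theta\vdash mn$. If $\theta$ is not $m$-splittable, then $\chi^\theta_{m\lambda}=0$. If $\theta$ is $m$-splittable with $m$-split $(\theta^{(0)},\dots,\theta^{(m-1)})$, then there is a sign $\operatorname{sgn}_\theta\in\{1,-1\}$ depending only on $\theta$ and $m$ (and not on $\lambda$) such that \[ \chi_{m\lambda}^{\theta} = z_{\lambda}\, \operatorname{sgn}_\theta \sum_{\lambda^{(0)} \uplus \cdots \uplus \lambda^{(m-1)} = \lambda}\ \prod_{i=0}^{m-1} \chi_{\lambda^{(i)}}^{\theta^{(i)}}\, z_{\lambda^{(i)}}^{ -1}, \] where the sum runs over all ordered $m$-tuples $(\lambda^{(0)},\dots,\lambda^{(m-1)})$ of (possibly empty) partitions whose multiset union of parts is $\lambda$.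
   Context: Partitions are viewed as multisets of parts, $\uplus$ denoting multiset union. For $\lambda\vdash n$, $m\lambda$ is the partition obtained by multiplying each part by $m$. For a partition $\alpha=[1^{a_1}2^{a_2}\cdots]$, $z_\alpha=\prod_i i^{a_i}a_i!$, with $z_\emptyset=1$. $\chi^\theta_\alpha$ is the irreducible character of $S_{|\theta|}$ indexed by $\theta$ at the class of cycle type $\alpha$; by convention $\chi^\theta_\alpha=0$ if $|\theta|\ne|\alpha|$ and $\chi^\emptyset_\emptyset=1$. A set $S\subseteq\mathbb{Z}$ satisfies the charge condition if $S\cap\mathbb{Z}_{\ge0}$ and $\mathbb{Z}_{<0}\setminus S$ are finite and have the same cardinality. For a partition $\lambda=(\lambda_1\ge\lambda_2\ge\cdots)$ (with $\lambda_k=0$ for $k>l(\lambda)$), $S_\lambda=\{\lambda_k-k: k\ge1\}$; $\lambda\mapsto S_\lambda$ is a bijection from partitions to sets satisfying the charge condition. The $m$-split of a set $S$ is $(S_0,\dots,S_{m-1})$ with $S_r=\{a\in\mathbb{Z}: ma+r\in S\}$. A partition $\theta$ is $m$-splittable if every $S_r$ in the $m$-split of $S_\theta$ satisfies the charge condition; its $m$-split is then $(\theta^{(0)},\dots,\theta^{(m-1)})$ where $\theta^{(r)}$ is the partition with $S_{\theta^{(r)}}=S_r$. (Equivalently, $\theta$ has empty $m$-core and the $m$-split is its $m$-quotient.) -}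

module Defs where

open import Data.Bool using (if_then_else_)
open import Data.Fin using (Fin; zero; suc; toℕ; fromℕ; splitAt; combine; remQuot)
import Data.Fin as Fin
open import Data.Fin.Permutation using (Permutation′; _⟨$⟩ʳ_; _⟨$⟩ˡ_; _∘ₚ_; flip; insert; remove) renaming (id to idₚ; _≈_ to _≈ₚ_)
import Data.Fin.Permutation as Perm
open import Data.Fin.Properties using (all?; any?; +↔⊎; remQuot-combine; combine-remQuot; punchIn-injective) renaming (_≟_ to _≟ᶠ_)
open import Data.Integer using (ℤ)
import Data.Integer as ℤ
open import Data.List using (List; []; _∷_; map; foldr; filter; length; merge; mapMaybe; upTo; cartesianProductWith)
open import Data.List.Membership.Propositional using (_∈_)
open import Data.List.Properties using (≡-dec)
open import Data.List.Relation.Unary.All using (All; []; _∷_)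
import Data.List.Relation.Unary.All as All
import Data.List.Relation.Unary.All.Properties as All
open import Data.List.Relation.Binary.Permutation.Propositional using (↭-sym)
open import Data.List.Relation.Binary.Permutation.Propositional.Properties using (All-resp-↭; merge-↭)
open import Data.List.Relation.Unary.Linked using (Linked; []; linked?)
import Data.List.Relation.Unary.Linked as Linked
import Data.List.Relation.Unary.Linked.Properties as Linked
open import Data.List.Relation.Unary.Sorted.TotalOrder.Properties using (merge⁺)
open import Data.List.Relation.Unary.Unique.Propositional using (Unique)
open import Data.Maybe using (Maybe; just; nothing)
open import Data.Nat using (ℕ; zero; suc; _≥_; _≥?_; _^_; _!; NonZero)
import Data.Nat as ℕ
open import Data.Nat.ListAction using (sum; product)
open import Data.Nat.ListAction.Properties using (product≢0)
import Data.Nat.Properties as ℕₚ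
open import Data.Product using (∃-syntax; _×_; _,_; proj₁; proj₂)
open import Data.Rational using (ℚ; 0ℚ; 1ℚ; _+_; _*_; -_; _/_; 1/_; ≢-nonZero)
import Data.Rational.Properties as ℚₚ
open import Data.Rational.Solver using (module +-*-Solver)
open import Data.Sum using ([_,_]′)
open import Data.Sum.Function.Propositional using (_⊎-↔_)
open import Data.Vec using (Vec; []; _∷_; lookup)
import Data.Vec as Vec
open import Function using (_∘_; _⇔_; mk⇔)
open import Function.Construct.Composition using (_↔-∘_)
open import Function.Construct.Symmetry using (↔-sym)
open import Relation.Binary.Properties.DecTotalOrder ℕₚ.≤-decTotalOrder using (≥-decTotalOrder)
open import Relation.Binary.PropositionalEquality using (_≡_; _≢_; refl; sym; trans; cong; cong₂; subst; module ≡-Reasoning)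
open import Relation.Nullary using (Dec; yes; no; does; ¬_)
open import Relation.Nullary.Decidable using (_×-dec_; ¬?; does-⇔; decidable-stable)
open import Relation.Unary using (Pred)
open import Level using (0ℓ)
open import Algebra.Bundles using (CommutativeRing)
open import Algebra.Properties.Semiring.Sum (CommutativeRing.semiring ℚₚ.+-*-commutativeRing) using (sum-syntax; sum-cong-≗; ∑-distrib-+; ∑-comm; *-distribˡ-sum; *-distribʳ-sum; sum-replicate-zero) public
open import Algebra.Properties.CommutativeMonoid.Sum ℚₚ.*-1-commutativeMonoid using () renaming (sum to prod; sum-cong-≗ to prod-cong-≗)

infixl 10 ∏-syntax
∏-syntax : ∀ n → (Fin n → ℚ) → ℚ
∏-syntax n = prod {n}

syntax ∏-syntax n (λ i → x) = ∏[ i < n ] x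

record Partition : Set where
  constructor mkPartition
  field
    parts      : List ℕ
    decreasing : Linked _≥_ parts
    positive   : All NonZero parts

open Partition public

∣_∣ : Partition → ℕ
∣ μ ∣ = sum (parts μ)

infix 4 _⊢_
_⊢_ : Partition → ℕ → Set
μ ⊢ n = ∣ μ ∣ ≡ n

∅ : Partition
∅ = mkPartition [] [] []

scale : (m : ℕ) .{{_ : NonZero m}} → Partition → Partition
scale m μ = mkPartition
  (map (m ℕ.*_) (parts μ))
  (Linked.map⁺ (Linked.map (ℕₚ.*-monoʳ-≤ m) (decreasing μ)))
  (All.map⁺ (All.map (λ {k} k≢0 → let instance _ = k≢0 in ℕₚ.m*n≢0 m k) (positive μ)))

multiplicity : ℕ → Partition → ℕ
multiplicity i μ = length (filter (i ℕ.≟_) (parts μ))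

-- Parts larger than ∣ μ ∣ do not occur, so they would only add factors 1.
z : Partition → ℕ
z μ = product (map (λ i → suc i ^ a i ℕ.* a i !) (upTo ∣ μ ∣))
  where
  a : ℕ → ℕ
  a i = multiplicity (suc i) μ

z≢0 : ∀ μ → NonZero (z μ)
z≢0 μ = product≢0 (All.map⁺ (All.universal factor (upTo ∣ μ ∣)))
  where
  factor : ∀ i → NonZero (suc i ^ multiplicity (suc i) μ ℕ.* multiplicity (suc i) μ !)
  factor i = ℕₚ.m*n≢0 _ _ {{ℕₚ.m^n≢0 (suc i) a}} {{a ℕₚ.!≢0}}
    where a = multiplicity (suc i) μ

z⁻¹ : Partition → ℚ
z⁻¹ μ = (ℤ.+ 1 / z μ) {{z≢0 μ}}

infixr 6 _⊎ᵐ_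
_⊎ᵐ_ : Partition → Partition → Partition
μ ⊎ᵐ ν = mkPartition
  (merge _≥?_ (parts μ) (parts ν))
  (merge⁺ ≥-decTotalOrder (decreasing μ) (decreasing ν))
  (All-resp-↭ (↭-sym (merge-↭ _≥?_ (parts μ) (parts ν))) (All.++⁺ (positive μ) (positive ν)))

⨄ : ∀ {m} → Vec Partition m → Partition
⨄ = Vec.foldr′ _⊎ᵐ_ ∅

toPartition : List ℕ → Maybe Partition
toPartition l with linked? _≥?_ l | All.all? ℕₚ.nonZero? l
... | yes d | yes p = just (mkPartition l d p)
... | _     | _     = nothing

listsUpTo : List ℕ → ℕ → List (List ℕ)
listsUpTo entries zero    = [] ∷ []
listsUpTo entries (suc l) = [] ∷ cartesianProductWith _∷_ entries (listsUpTo entries l)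

-- All partitions with at most n parts, each at most n.
partitionsInSquare : ℕ → List Partition
partitionsInSquare n = mapMaybe toPartition (listsUpTo (upTo (suc n)) n)

tuples : ∀ {A : Set} m → List A → List (Vec A m)
tuples zero    xs = [] ∷ []
tuples (suc m) xs = cartesianProductWith _∷_ xs (tuples m xs)

-- The ordered m-tuples of partitions with multiset union μ.  Each component of
-- such a tuple is a sub-multiset of μ, hence one of the enumerated candidates.
splittings : ∀ m → Partition → List (Vec Partition m)
splittings m μ = filter (λ t → ≡-dec ℕ._≟_ (parts (⨄ t)) (parts μ)) (tuples m (partitionsInSquare ∣ μ ∣))

∑ₗ : ∀ {A : Set} → List A → (A → ℚ) → ℚ
∑ₗ xs f = foldr _+_ 0ℚ (map f xs)

HasCardinality : Pred ℤ 0ℓ → ℕ → Set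
HasCardinality P k = ∃[ xs ] Unique xs × length xs ≡ k × (∀ a → a ∈ xs ⇔ P a)

ChargeCondition : Pred ℤ 0ℓ → Set
ChargeCondition S = ∃[ k ]
  HasCardinality (λ a → ℤ.+ 0 ℤ.≤ a × S a) k × HasCardinality (λ a → a ℤ.< ℤ.+ 0 × ¬ S a) k

-- nth l k is the (k+1)-st entry of l, and 0 beyond the end.
nth : List ℕ → ℕ → ℕ
nth []      k       = 0
nth (x ∷ l) zero    = x
nth (x ∷ l) (suc k) = nth l k

𝕊 : Partition → Pred ℤ 0ℓ
𝕊 μ a = ∃[ k ] a ≡ ℤ.+ nth (parts μ) k ℤ.- ℤ.+ suc k

splitSet : ∀ m → Pred ℤ 0ℓ → Fin m → Pred ℤ 0ℓ
splitSet m S r a = S (ℤ.+ m ℤ.* a ℤ.+ ℤ.+ toℕ r)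

Splittable : ℕ → Partition → Set
Splittable m θ = ∀ r → ChargeCondition (splitSet m (𝕊 θ) r)

IsSplit : ∀ m → Partition → Vec Partition m → Set
IsSplit m θ θs = ∀ r a → 𝕊 (lookup θs r) a ⇔ splitSet m (𝕊 θ) r a

-- An enumeration of the symmetric group, each element once up to _≈ₚ_.
perm : ∀ n → Fin (n !) → Permutation′ n
perm zero    _ = idₚ
perm (suc n) k = insert zero (proj₁ (remQuot {suc n} (n !) k)) (perm n (proj₂ (remQuot {suc n} (n !) k)))

infixr 9 _∙_
_∙_ : ∀ {n} → Permutation′ n → Permutation′ n → Permutation′ n
σ ∙ τ = τ ∘ₚ σ

infix 10 _⁻¹
_⁻¹ : ∀ {n} → Permutation′ n → Permutation′ n
_⁻¹ = flip

sgn : ∀ {n} → Permutation′ n → ℚ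
sgn {n} σ = ∏[ i < n ] ∏[ j < n ]
  (if does ((i Fin.<? j) ×-dec ((σ ⟨$⟩ʳ j) Fin.<? (σ ⟨$⟩ʳ i))) then - 1ℚ else 1ℚ)

-- Elements of the group algebra, as coefficient functions.
ℚ[S_] : ℕ → Set
ℚ[S n ] = Permutation′ n → ℚ

infix 4 _≐_
_≐_ : ∀ {n} → ℚ[S n ] → ℚ[S n ] → Set
x ≐ y = ∀ σ → x σ ≡ y σ

infixl 7 _⋆_
_⋆_ : ∀ {n} → ℚ[S n ] → ℚ[S n ] → ℚ[S n ]
_⋆_ {n} x y σ = ∑[ k < n ! ] (x (perm n k) * y (perm n k ⁻¹ ∙ σ))

infixr 8 _▹_
_▹_ : ∀ {n} → Permutation′ n → ℚ[S n ] → ℚ[S n ]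
(g ▹ y) σ = y (g ⁻¹ ∙ σ)

lincomb : ∀ {n d} → (Fin d → ℚ) → (Fin d → ℚ[S n ]) → ℚ[S n ]
lincomb {d = d} k b σ = ∑[ i < d ] (k i * b i σ)

record IsBasis {n d} (V : Pred ℚ[S n ] 0ℓ) (b : Fin d → ℚ[S n ]) : Set where
  field
    member      : ∀ i → V (b i)
    spanning    : ∀ y → V y → ∃[ k ] y ≐ lincomb k b
    independent : ∀ k → lincomb k b ≐ (λ _ → 0ℚ) → ∀ i → k i ≡ 0ℚ

record IsTrace {n} (V : Pred ℚ[S n ] 0ℓ) (g : Permutation′ n) (t : ℚ) : Set where
  field
    dim     : ℕ
    basis   : Fin dim → ℚ[S n ]
    isBasis : IsBasis V basis
    matrix  : Fin dim → Fin dim → ℚ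
    action  : ∀ j → g ▹ basis j ≐ lincomb (λ i → matrix i j) basis
    trace   : t ≡ ∑[ i < dim ] matrix i i

-- The (row , column) of each entry of the tableau whose rows, of lengths given
-- by the list, are filled with consecutive numbers.
cell : (l : List ℕ) → Fin (sum l) → ℕ × ℕ
cell (a ∷ l) i = [ (λ c → 0 , toℕ c) , (λ j → suc (proj₁ (cell l j)) , proj₂ (cell l j)) ]′ (splitAt a i)

module _ (θ : Partition) where

  row col : Fin ∣ θ ∣ → ℕ
  row i = proj₁ (cell (parts θ) i)
  col i = proj₂ (cell (parts θ) i)

  rowSymmetrizer : ℚ[S ∣ θ ∣ ]
  rowSymmetrizer σ = if does (all? (λ i → row (σ ⟨$⟩ʳ i) ℕ.≟ row i)) then 1ℚ else 0ℚ

  columnAntisymmetrizer : ℚ[S ∣ θ ∣ ]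
  columnAntisymmetrizer σ = if does (all? (λ i → col (σ ⟨$⟩ʳ i) ℕ.≟ col i)) then sgn σ else 0ℚ

  youngSymmetrizer : ℚ[S ∣ θ ∣ ]
  youngSymmetrizer = rowSymmetrizer ⋆ columnAntisymmetrizer

  -- The irreducible representation indexed by θ: the left ideal generated by
  -- the Young symmetrizer, with g acting by _▹_.  (It is absolutely irreducible,
  -- so working over ℚ instead of ℂ does not change its character.)
  Specht : Pred ℚ[S ∣ θ ∣ ] 0ℓ
  Specht y = ∃[ x ] y ≐ x ⋆ youngSymmetrizer

-- The existence of a basis of Specht θ, so that the character can be defined as
-- the trace in that basis: Gaussian elimination, keeping for each basis vector
-- a pivot at which it takes the value 1 and all others vanish.

δ : ∀ {d} → Fin d → Fin d → ℚ
δ i j = if does (i ≟ᶠ j) then 1ℚ else 0ℚ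

∑-δ : ∀ {d} (k : Fin d → ℚ) j → (∑[ i < d ] (k i * δ i j)) ≡ k j
∑-δ {suc d} k zero = begin
  k zero * 1ℚ + ∑[ i < d ] (k (suc i) * 0ℚ)
    ≡⟨ cong₂ _+_ (ℚₚ.*-identityʳ (k zero)) (trans (sum-cong-≗ (λ i → ℚₚ.*-zeroʳ (k (suc i)))) (sum-replicate-zero d)) ⟩
  k zero + 0ℚ
    ≡⟨ ℚₚ.+-identityʳ (k zero) ⟩
  k zero ∎
  where open ≡-Reasoning
∑-δ {suc d} k (suc j) = begin
  k zero * 0ℚ + ∑[ i < d ] (k (suc i) * δ (suc i) (suc j))
    ≡⟨ cong₂ _+_ (ℚₚ.*-zeroʳ (k zero)) (∑-δ (k ∘ suc) j) ⟩
  0ℚ + k (suc j)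
    ≡⟨ ℚₚ.+-identityˡ (k (suc j)) ⟩
  k (suc j) ∎
  where open ≡-Reasoning

∑-neg : ∀ {d} (f : Fin d → ℚ) → (∑[ i < d ] (- f i)) ≡ - (∑[ i < d ] f i)
∑-neg {zero}  f = refl
∑-neg {suc d} f = trans (cong (_+_ (- f zero)) (∑-neg (f ∘ suc))) (sym (ℚₚ.neg-distrib-+ (f zero) _))

module Elimination {X : Set} where

  coords : ∀ {d} → (Fin d → X → ℚ) → (Fin d → X) → (X → ℚ) → X → ℚ
  coords {d} b piv u x = ∑[ i < d ] (u (piv i) * b i x)

  Represented : ∀ {d} → (Fin d → X → ℚ) → (Fin d → X) → (X → ℚ) → Set
  Represented b piv u = ∀ x → u x ≡ coords b piv u x

  represented-∑ : ∀ {d N} (b : Fin d → X → ℚ) (piv : Fin d → X) (k : Fin N → ℚ) (g : Fin N → X → ℚ) →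
    (∀ j → Represented b piv (g j)) → Represented b piv (λ x → ∑[ j < N ] (k j * g j x))
  represented-∑ {d} {N} b piv k g rep x = begin
    (∑[ j < N ] (k j * g j x))
      ≡⟨ sum-cong-≗ (λ j → trans (cong (k j *_) (rep j x)) (*-distribˡ-sum (k j) (λ i → g j (piv i) * b i x))) ⟩
    (∑[ j < N ] ∑[ i < d ] (k j * (g j (piv i) * b i x)))
      ≡⟨ ∑-comm (λ j i → k j * (g j (piv i) * b i x)) ⟩
    (∑[ i < d ] ∑[ j < N ] (k j * (g j (piv i) * b i x)))
      ≡⟨ sum-cong-≗ (λ i → trans (sum-cong-≗ (λ j → sym (ℚₚ.*-assoc (k j) (g j (piv i)) (b i x)))) (sym (*-distribʳ-sum (b i x) (λ j → k j * g j (piv i))))) ⟩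
    (∑[ i < d ] ((∑[ j < N ] (k j * g j (piv i))) * b i x)) ∎
    where open ≡-Reasoning

  module _ {N} (enum : Fin N → X) (W : Pred (X → ℚ) 0ℓ)
    (W-resp : ∀ {u v} → (∀ x → u x ≡ v x) → W u → W v)
    (W-add : ∀ {u v} k → W u → W v → W (λ x → u x + k * v x))
    (W-scale : ∀ {v} k → W v → W (λ x → k * v x))
    (W-determined : ∀ {v} → W v → (∀ i → v (enum i) ≡ 0ℚ) → ∀ x → v x ≡ 0ℚ)
    where

    record Echelon {M} (g : Fin M → X → ℚ) : Set where
      field
        dim    : ℕ
        basis  : Fin dim → X → ℚ
        pivot  : Fin dim → X
        member : ∀ i → W (basis i)
        dual   : ∀ i j → basis i (pivot j) ≡ δ i j
        span   : ∀ k → Represented basis pivot (g k)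

    W-add-∑ : ∀ {d u} (k : Fin d → ℚ) (b : Fin d → X → ℚ) →
      W u → (∀ i → W (b i)) → W (λ x → u x + ∑[ i < d ] (k i * b i x))
    W-add-∑ {zero}      k b wu wb = W-resp (λ x → sym (ℚₚ.+-identityʳ _)) wu
    W-add-∑ {suc d} {u} k b wu wb =
      W-resp (λ x → ℚₚ.+-assoc (u x) _ _) (W-add-∑ (k ∘ suc) (b ∘ suc) (W-add (k zero) wu (wb zero)) (wb ∘ suc))

    echelon : ∀ {M} (g : Fin M → X → ℚ) → (∀ k → W (g k)) → Echelon g
    echelon {zero}  g wg = record
      { dim = 0 ; basis = λ () ; pivot = λ () ; member = λ () ; dual = λ () ; span = λ () }
    echelon {suc M} g wg = extend (any? (λ i → ¬? (v′ (enum i) ℚₚ.≟ 0ℚ)))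
      where
      open ≡-Reasoning
      open Echelon (echelon (g ∘ suc) (wg ∘ suc)) renaming (dim to d; basis to b; pivot to piv)

      v v′ : X → ℚ
      v = g zero
      v′ x = v x + ∑[ i < d ] (- v (piv i) * b i x)

      wv′ : W v′
      wv′ = W-add-∑ (λ i → - v (piv i)) b (wg zero) member

      v′-eq : ∀ x → v′ x ≡ v x + - coords b piv v x
      v′-eq x = cong (v x +_) (trans (sum-cong-≗ (λ i → sym (ℚₚ.neg-distribˡ-* (v (piv i)) (b i x)))) (∑-neg (λ i → v (piv i) * b i x)))

      v′-piv : ∀ j → v′ (piv j) ≡ 0ℚ
      v′-piv j = begin
        v′ (piv j)
          ≡⟨ cong (v (piv j) +_) (sum-cong-≗ (λ i → cong (- v (piv i) *_) (dual i j))) ⟩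
        v (piv j) + ∑[ i < d ] (- v (piv i) * δ i j)
          ≡⟨ cong (v (piv j) +_) (∑-δ (λ i → - v (piv i)) j) ⟩
        v (piv j) + - v (piv j)
          ≡⟨ ℚₚ.+-inverseʳ (v (piv j)) ⟩
        0ℚ ∎

      extend : Dec (∃[ i ] v′ (enum i) ≢ 0ℚ) → Echelon g
      extend (no none) = record
        { dim = d ; basis = b ; pivot = piv ; member = member ; dual = dual
        ; span = λ { zero → span₀ ; (suc k) → span k } }
        where
        v′≡0 : ∀ x → v′ x ≡ 0ℚ
        v′≡0 = W-determined wv′ (λ i → decidable-stable (v′ (enum i) ℚₚ.≟ 0ℚ) (λ ≢0 → none (i , ≢0)))

        span₀ : Represented b piv v
        span₀ x = begin
          v x
            ≡⟨ solve 2 (λ p q → p := (p :+ :- q) :+ q) refl (v x) (coords b piv v x) ⟩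
          (v x + - coords b piv v x) + coords b piv v x
            ≡⟨ cong (_+ coords b piv v x) (trans (sym (v′-eq x)) (v′≡0 x)) ⟩
          0ℚ + coords b piv v x
            ≡⟨ ℚₚ.+-identityˡ _ ⟩
          coords b piv v x ∎
          where open +-*-Solver
      extend (yes (i₀ , q≢0)) = record
        { dim = suc d ; basis = b⁺ ; pivot = piv⁺ ; member = member⁺ ; dual = dual⁺
        ; span = λ { zero → span₀ ; (suc k) → span₊ (g (suc k)) (span k) } }
        where
        p : X
        p = enum i₀
        q : ℚ
        q = v′ p
        instance
          _ = ≢-nonZero q≢0
        b₀ : X → ℚ
        b₀ x = 1/ q * v′ x

        b⁺ : Fin (suc d) → X → ℚ
        b⁺ zero    x = b₀ x
        b⁺ (suc i) x = b i x + - b i p * b₀ x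

        piv⁺ : Fin (suc d) → X
        piv⁺ zero    = p
        piv⁺ (suc i) = piv i

        member⁺ : ∀ i → W (b⁺ i)
        member⁺ zero    = W-scale (1/ q) wv′
        member⁺ (suc i) = W-add (- b i p) (member i) (W-scale (1/ q) wv′)

        b₀-p : b₀ p ≡ 1ℚ
        b₀-p = ℚₚ.*-inverseˡ q

        b₀-piv : ∀ j → b₀ (piv j) ≡ 0ℚ
        b₀-piv j = trans (cong (1/ q *_) (v′-piv j)) (ℚₚ.*-zeroʳ (1/ q))

        dual⁺ : ∀ i j → b⁺ i (piv⁺ j) ≡ δ i j
        dual⁺ zero    zero    = b₀-p
        dual⁺ zero    (suc j) = b₀-piv j
        dual⁺ (suc i) zero    = begin
          b i p + - b i p * b₀ p ≡⟨ cong (λ t → b i p + - b i p * t) b₀-p ⟩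
          b i p + - b i p * 1ℚ   ≡⟨ cong (b i p +_) (ℚₚ.*-identityʳ (- b i p)) ⟩
          b i p + - b i p        ≡⟨ ℚₚ.+-inverseʳ (b i p) ⟩
          0ℚ ∎
        dual⁺ (suc i) (suc j) = begin
          b i (piv j) + - b i p * b₀ (piv j) ≡⟨ cong₂ (λ s t → s + - b i p * t) (dual i j) (b₀-piv j) ⟩
          δ i j + - b i p * 0ℚ               ≡⟨ cong (δ i j +_) (ℚₚ.*-zeroʳ (- b i p)) ⟩
          δ i j + 0ℚ                         ≡⟨ ℚₚ.+-identityʳ (δ i j) ⟩
          δ i j ∎

        coords⁺ : ∀ u x → coords b⁺ piv⁺ u x ≡ u p * b₀ x + (coords b piv u x + - coords b piv u p * b₀ x)
        coords⁺ u x = cong (u p * b₀ x +_) (begin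
          (∑[ i < d ] (u (piv i) * (b i x + - b i p * b₀ x)))
            ≡⟨ sum-cong-≗ (λ i → solve 4 (λ u′ s t r → u′ :* (s :+ :- t :* r) := u′ :* s :+ (u′ :* t) :* (:- r)) refl (u (piv i)) (b i x) (b i p) (b₀ x)) ⟩
          (∑[ i < d ] (u (piv i) * b i x + (u (piv i) * b i p) * (- b₀ x)))
            ≡⟨ ∑-distrib-+ (λ i → u (piv i) * b i x) (λ i → (u (piv i) * b i p) * (- b₀ x)) ⟩
          coords b piv u x + ∑[ i < d ] ((u (piv i) * b i p) * (- b₀ x))
            ≡⟨ cong (coords b piv u x +_) (sym (*-distribʳ-sum (- b₀ x) (λ i → u (piv i) * b i p))) ⟩
          coords b piv u x + coords b piv u p * (- b₀ x)
            ≡⟨ solve 3 (λ s t r → s :+ t :* (:- r) := s :+ (:- t) :* r) refl (coords b piv u x) (coords b piv u p) (b₀ x) ⟩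
          coords b piv u x + - coords b piv u p * b₀ x ∎)
          where open +-*-Solver

        span₊ : ∀ u → Represented b piv u → Represented b⁺ piv⁺ u
        span₊ u rep x = sym (begin
          coords b⁺ piv⁺ u x
            ≡⟨ coords⁺ u x ⟩
          u p * b₀ x + (coords b piv u x + - coords b piv u p * b₀ x)
            ≡⟨ cong₂ (λ s t → u p * b₀ x + (s + - t * b₀ x)) (sym (rep x)) (sym (rep p)) ⟩
          u p * b₀ x + (u x + - u p * b₀ x)
            ≡⟨ solve 3 (λ s t r → s :* r :+ (t :+ (:- s) :* r) := t) refl (u p) (u x) (b₀ x) ⟩
          u x ∎)
          where open +-*-Solver

        q*b₀ : ∀ x → q * b₀ x ≡ v′ x
        q*b₀ x = begin
          q * (1/ q * v′ x) ≡⟨ sym (ℚₚ.*-assoc q (1/ q) (v′ x)) ⟩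
          q * 1/ q * v′ x   ≡⟨ cong (_* v′ x) (ℚₚ.*-inverseʳ q) ⟩
          1ℚ * v′ x         ≡⟨ ℚₚ.*-identityˡ (v′ x) ⟩
          v′ x ∎

        span₀ : Represented b⁺ piv⁺ v
        span₀ x = sym (begin
          coords b⁺ piv⁺ v x
            ≡⟨ coords⁺ v x ⟩
          v p * b₀ x + (coords b piv v x + - coords b piv v p * b₀ x)
            ≡⟨ solve 4 (λ s r t w → s :* r :+ (t :+ (:- w) :* r) := (s :+ :- w) :* r :+ t) refl (v p) (b₀ x) (coords b piv v x) (coords b piv v p) ⟩
          (v p + - coords b piv v p) * b₀ x + coords b piv v x
            ≡⟨ cong (λ s → s * b₀ x + coords b piv v x) (sym (v′-eq p)) ⟩
          q * b₀ x + coords b piv v x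
            ≡⟨ cong (_+ coords b piv v x) (trans (q*b₀ x) (v′-eq x)) ⟩
          (v x + - coords b piv v x) + coords b piv v x
            ≡⟨ solve 2 (λ s t → (s :+ :- t) :+ t := s) refl (v x) (coords b piv v x) ⟩
          v x ∎)
          where open +-*-Solver

insert-cong : ∀ {n} i j {π ρ : Permutation′ n} → π ≈ₚ ρ → insert i j π ≈ₚ insert i j ρ
insert-cong i j π≈ρ k with i ≟ᶠ k
... | yes _ = refl
... | no  _ = cong (Fin.punchIn j) (π≈ρ _)

flip-cong : ∀ {n} {π ρ : Permutation′ n} → π ≈ₚ ρ → π ⁻¹ ≈ₚ ρ ⁻¹
flip-cong {π = π} {ρ} π≈ρ i = begin
  π ⟨$⟩ˡ i                       ≡⟨ cong (π ⟨$⟩ˡ_) (sym (Perm.inverseʳ ρ)) ⟩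
  π ⟨$⟩ˡ (ρ ⟨$⟩ʳ (ρ ⟨$⟩ˡ i))     ≡⟨ cong (π ⟨$⟩ˡ_) (sym (π≈ρ (ρ ⟨$⟩ˡ i))) ⟩
  π ⟨$⟩ˡ (π ⟨$⟩ʳ (ρ ⟨$⟩ˡ i))     ≡⟨ Perm.inverseˡ π ⟩
  ρ ⟨$⟩ˡ i ∎
  where open ≡-Reasoning

index : ∀ {n} → Permutation′ n → Fin (n !)
index {zero}  σ = zero
index {suc n} σ = combine (σ ⟨$⟩ʳ zero) (index (remove zero σ))

perm-index : ∀ {n} (σ : Permutation′ n) → perm n (index σ) ≈ₚ σ
perm-index {suc n} σ i = trans
  (cong (λ p → insert zero (proj₁ p) (perm n (proj₂ p)) ⟨$⟩ʳ i) (remQuot-combine (σ ⟨$⟩ʳ zero) (index (remove zero σ))))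
  (trans (insert-cong zero (σ ⟨$⟩ʳ zero) (perm-index (remove zero σ)) i) (Perm.insert-remove zero σ i))

perm-injective : ∀ n k l → perm n k ≈ₚ perm n l → k ≡ l
perm-injective zero    zero zero _ = refl
perm-injective (suc n) k    l    eq = begin
  k                     ≡⟨ sym (combine-remQuot {suc n} (n !) k) ⟩
  combine j i           ≡⟨ cong₂ combine j≡j′ i≡i′ ⟩
  combine j′ i′         ≡⟨ combine-remQuot {suc n} (n !) l ⟩
  l ∎
  where
  open ≡-Reasoning
  j = proj₁ (remQuot {suc n} (n !) k)
  i = proj₂ (remQuot {suc n} (n !) k)
  j′ = proj₁ (remQuot {suc n} (n !) l)
  i′ = proj₂ (remQuot {suc n} (n !) l)

  j≡j′ : j ≡ j′
  j≡j′ = eq zero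

  i≡i′ : i ≡ i′
  i≡i′ = perm-injective n i i′ (λ t → punchIn-injective j _ _ (begin
    Fin.punchIn j (perm n i ⟨$⟩ʳ t)           ≡⟨ sym (Perm.insert-punchIn zero j (perm n i) t) ⟩
    insert zero j (perm n i) ⟨$⟩ʳ suc t       ≡⟨ eq (suc t) ⟩
    insert zero j′ (perm n i′) ⟨$⟩ʳ suc t     ≡⟨ Perm.insert-punchIn zero j′ (perm n i′) t ⟩
    Fin.punchIn j′ (perm n i′ ⟨$⟩ʳ t)         ≡⟨ cong (λ s → Fin.punchIn s (perm n i′ ⟨$⟩ʳ t)) (sym j≡j′) ⟩
    Fin.punchIn j (perm n i′ ⟨$⟩ʳ t) ∎))

index-perm : ∀ n k → index (perm n k) ≡ k
index-perm n k = perm-injective n _ _ (perm-index (perm n k))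

Respects≈ : ∀ {n} → ℚ[S n ] → Set
Respects≈ {n} x = ∀ (σ τ : Permutation′ n) → σ ≈ₚ τ → x σ ≡ x τ

⋆-respects : ∀ {n} (x y : ℚ[S n ]) → Respects≈ y → Respects≈ (x ⋆ y)
⋆-respects {n} x y ry σ τ σ≈τ = sum-cong-≗ (λ k → cong (x (perm n k) *_)
  (ry _ _ (λ i → cong (perm n k ⟨$⟩ˡ_) (σ≈τ i))))

sgn-respects : ∀ {n} → Respects≈ {n} sgn
sgn-respects σ τ σ≈τ = prod-cong-≗ (λ i → prod-cong-≗ (λ j →
  cong₂ (λ s t → if does ((i Fin.<? j) ×-dec (s Fin.<? t)) then - 1ℚ else 1ℚ) (σ≈τ j) (σ≈τ i)))

module _ (θ : Partition) where

  private
    n = ∣ θ ∣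
    c = youngSymmetrizer θ

  columnAntisymmetrizer-respects : Respects≈ (columnAntisymmetrizer θ)
  columnAntisymmetrizer-respects σ τ σ≈τ = cong₂ (λ p s → if p then s else 0ℚ)
    (does-⇔ (mk⇔ (λ p i → trans (cong (col θ) (sym (σ≈τ i))) (p i)) (λ p i → trans (cong (col θ) (σ≈τ i)) (p i)))
      (all? (λ i → col θ (σ ⟨$⟩ʳ i) ℕ.≟ col θ i)) (all? (λ i → col θ (τ ⟨$⟩ʳ i) ℕ.≟ col θ i)))
    (sgn-respects σ τ σ≈τ)

  youngSymmetrizer-respects : Respects≈ c
  youngSymmetrizer-respects = ⋆-respects (rowSymmetrizer θ) (columnAntisymmetrizer θ) columnAntisymmetrizer-respects

  Specht-respects : ∀ {y} → Specht θ y → Respects≈ y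
  Specht-respects (x , y≐) σ τ σ≈τ =
    trans (y≐ σ) (trans (⋆-respects x c youngSymmetrizer-respects σ τ σ≈τ) (sym (y≐ τ)))

  Specht-generator : ∀ k → Specht θ (perm n k ▹ c)
  Specht-generator k = (λ τ → δ (index τ) k) , λ σ → sym (trans
    (sum-cong-≗ (λ l → trans (cong (λ i → δ i k * (perm n l ▹ c) σ) (index-perm n l)) (ℚₚ.*-comm (δ l k) ((perm n l ▹ c) σ))))
    (∑-δ (λ l → (perm n l ▹ c) σ) k))

  Specht-scale : ∀ {v} k → Specht θ v → Specht θ (λ σ → k * v σ)
  Specht-scale k (x , v≐) = (λ τ → k * x τ) , λ σ → trans (cong (k *_) (v≐ σ))
    (trans (*-distribˡ-sum k (λ l → x (perm n l) * (perm n l ▹ c) σ))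
           (sum-cong-≗ (λ l → sym (ℚₚ.*-assoc k (x (perm n l)) ((perm n l ▹ c) σ)))))

  Specht-+ : ∀ {u v} → Specht θ u → Specht θ v → Specht θ (λ σ → u σ + v σ)
  Specht-+ (x , u≐) (x′ , v≐) = (λ τ → x τ + x′ τ) , λ σ → trans (cong₂ _+_ (u≐ σ) (v≐ σ))
    (trans (sym (∑-distrib-+ (λ l → x (perm n l) * (perm n l ▹ c) σ) (λ l → x′ (perm n l) * (perm n l ▹ c) σ)))
           (sum-cong-≗ (λ l → sym (ℚₚ.*-distribʳ-+ ((perm n l ▹ c) σ) (x (perm n l)) (x′ (perm n l))))))

  Specht-echelon : Elimination.Echelon (perm n) (Specht θ)
    (λ u≐v (x , u≐) → x , λ σ → trans (sym (u≐v σ)) (u≐ σ))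
    (λ k wu wv → Specht-+ wu (Specht-scale k wv))
    Specht-scale
    (λ wv zeros σ → trans (sym (Specht-respects wv _ _ (perm-index σ))) (zeros (index σ)))
    (λ k → perm n k ▹ c)
  Specht-echelon = Elimination.echelon _ _ _ _ _ _ _ Specht-generator

  Specht-trace : ∀ g → ∃[ t ] IsTrace (Specht θ) g t
  Specht-trace g = (∑[ i < dim ] basis i (g ⁻¹ ∙ pivot i)) , record
    { dim     = dim
    ; basis   = basis
    ; isBasis = record
      { member      = member
      ; spanning    = λ y y∈ → (λ i → y (pivot i)) , represented y∈
      ; independent = λ k ≐0 i → trans (sym (∑-δ k i))
          (trans (sum-cong-≗ (λ j → cong (k j *_) (sym (dual j i)))) (≐0 (pivot i)))
      }
    ; matrix  = λ i j → (g ▹ basis j) (pivot i)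
    ; action  = λ j → represented-▹ (member j)
    ; trace   = refl
    }
    where
    open Elimination using (Represented; represented-∑)
    open Elimination.Echelon Specht-echelon

    represented-resp : ∀ {u v} → u ≐ v → Represented basis pivot u → Represented basis pivot v
    represented-resp u≐v rep σ = trans (sym (u≐v σ)) (trans (rep σ)
      (sum-cong-≗ (λ i → cong (_* basis i σ) (u≐v (pivot i)))))

    translate : ∀ h → Represented basis pivot (h ▹ c)
    translate h = represented-resp
      (λ σ → youngSymmetrizer-respects (perm n (index h) ⁻¹ ∙ σ) (h ⁻¹ ∙ σ) (λ i → flip-cong {π = perm n (index h)} {ρ = h} (perm-index h) (σ ⟨$⟩ʳ i)))
      (span (index h))

    represented : ∀ {y} → Specht θ y → Represented basis pivot y
    represented (x , y≐) = represented-resp (λ σ → sym (y≐ σ))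
      (represented-∑ basis pivot (x ∘ perm n) (λ k → perm n k ▹ c) span)

    represented-▹ : ∀ {y} → Specht θ y → Represented basis pivot (g ▹ y)
    represented-▹ (x , y≐) = represented-resp (λ σ → sym (y≐ (g ⁻¹ ∙ σ)))
      (represented-∑ basis pivot (x ∘ perm n) (λ k → (g ∙ perm n k) ▹ c) (λ k → translate (g ∙ perm n k)))

-- i ↦ i + 1, the last element going to zero.
rotation : ∀ a → Permutation′ a
rotation zero    = idₚ
rotation (suc a) = insert (fromℕ a) zero idₚ

-- A permutation of cycle type l: it rotates consecutive blocks of lengths given by l.
cycles : (l : List ℕ) → Permutation′ (sum l)
cycles []      = idₚ
cycles (a ∷ l) = ↔-sym +↔⊎ ↔-∘ ((rotation a ⊎-↔ cycles l) ↔-∘ +↔⊎)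

χ : Partition → Partition → ℚ
χ θ α with ∣ α ∣ ℕ.≟ ∣ θ ∣
... | yes eq = proj₁ (Specht-trace θ (subst Permutation′ eq (cycles (parts α))))
... | no  _  = 0ℚ

{-# OPTIONS --safe #-}
module Submission where

-- Let c be the Young symmetrizer of θ.  By von Neumann's lemma c ⋆ c = κ c with
-- κ ≠ 0, so κ times the character of the Specht module is the class sum
-- A(g) = Σ_h c(h⁻¹ g⁻¹ h).  Frobenius's class function X, the coefficient of
-- x^(θ+δ) in the Vandermonde product times a power sum, is a signed count of
-- fixed colourings.  The three identities ⟨A,A⟩ = κ², ⟨A,X⟩ = κ and ⟨X,X⟩ = 1
-- (the last two because a content lexicographically above θ contributes nothing)
-- give ⟨A - κX, A - κX⟩ = 0, so the character is X.  Reading X off a cycle type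
-- one cycle at a time gives the Murnaghan–Nakayama rule on beads θ_i + N - i:
-- each part a lowers one bead by a.
--
-- For the cycle type m λ every bead keeps its residue modulo m.  Taking N = m K,
-- the Vandermonde sign factors, up to a constant sign, over the residue classes,
-- so the character is a signed sum over the assignments of the parts of λ to the
-- residues, and it vanishes unless every class has K beads, i.e. unless θ is
-- splittable.  A tuple (λ⁽⁰⁾, …) comes from z_λ / ∏ z_λ⁽ⁱ⁾ assignments.
open import Defs
open import Data.Bool using (Bool; if_then_else_; true; false; not; _∧_)
open import Data.Empty using (⊥)
open import Data.Fin using (Fin; zero; suc; toℕ; fromℕ; fromℕ<; splitAt; combine; _↑ˡ_; _↑ʳ_; punchIn; punchOut)
import Data.Fin as Fin
open import Data.Fin.Permutation using (Permutation′; _⟨$⟩ʳ_; _⟨$⟩ˡ_; permutation; transpose; insert) renaming (id to idₚ; _≈_ to _≈ₚ_)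
import Data.Fin.Permutation as Perm
open import Data.Fin.Properties using (all?; any?) renaming (_≟_ to _≟ᶠ_)
import Data.Fin.Properties as Finₚ
open import Data.Integer using (ℤ; -[1+_])
import Data.Integer as ℤ
import Data.Integer.Properties as ℤₚ
import Data.Integer.DivMod as ℤ
open import Data.List using (List; []; _∷_; _++_; map; foldr; filter; length; mapMaybe; upTo)
import Data.List as List
import Data.List.Properties as Listₚ
open import Data.List.Membership.Propositional using (_∈_; _∉_)
import Data.List.Membership.Propositional.Properties as ∈ₚ
open import Data.List.Relation.Unary.All using (All; []; _∷_)
import Data.List.Relation.Unary.All as All
import Data.List.Relation.Unary.All.Properties as Allₚ
open import Data.List.Relation.Unary.Any using (here; there)
open import Data.List.Relation.Unary.AllPairs using (AllPairs; []; _∷_)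
import Data.List.Relation.Unary.AllPairs as AllPairs
open import Data.List.Relation.Unary.Linked using (Linked; []; [-]; _∷_; linked?)
import Data.List.Relation.Unary.Linked as Linked
import Data.List.Relation.Unary.Linked.Properties as Linkedₚ
open import Data.List.Relation.Unary.Unique.Propositional using (Unique)
import Data.List.Relation.Unary.Unique.Propositional.Properties as Uniqueₚ
open import Data.List.Relation.Binary.Permutation.Propositional using (_↭_; ↭-sym; ↭-trans; ↭-refl)
import Data.List.Relation.Binary.Permutation.Propositional as ↭
import Data.List.Relation.Binary.Permutation.Propositional.Properties as ↭ₚ
open import Data.Maybe using (Maybe; just; nothing)
open import Data.Nat using (ℕ; zero; suc; _≤_; _<_; z≤n; s≤s; _≥_; _≥?_; _^_; _!; NonZero)
import Data.Nat as ℕ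
import Data.Nat.DivMod as ℕ
open import Data.Nat.ListAction using (sum; product)
import Data.Nat.Properties as ℕₚ
open import Data.Product using (∃-syntax; Σ-syntax; _×_; _,_; proj₁; proj₂)
open import Data.Rational using (ℚ; 0ℚ; 1ℚ; _+_; _*_; -_; _/_; 1/_)
import Data.Rational as ℚ
import Data.Rational.Properties as ℚₚ
open import Data.Rational.Solver using (module +-*-Solver)
open import Data.Sum using (_⊎_; inj₁; inj₂)
open import Data.Vec using (Vec; []; _∷_; lookup; tabulate; updateAt; replicate; toList)
import Data.Vec as Vec
import Data.Vec.Properties as Vecₚ
open import Function using (_∘_; _⇔_; mk⇔; Equivalence)
open import Relation.Binary.Definitions using (tri<; tri≈; tri>)
open import Relation.Binary.PropositionalEquality using (_≡_; _≢_; refl; sym; trans; cong; cong₂; subst; module ≡-Reasoning)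
open import Relation.Nullary using (Dec; yes; no; does; ¬_; contradiction)
open import Relation.Nullary.Decidable using (_×-dec_; ¬?; does-⇔; decidable-stable; dec-true; dec-false)
open import Algebra.Bundles using (CommutativeRing)
open import Algebra.Properties.CommutativeMonoid.Sum ℚₚ.*-1-commutativeMonoid using () renaming (sum to prod; sum-cong-≗ to prod-cong-≗; sum-permute to prod-permute; ∑-comm to ∏-comm; ∑-distrib-+ to ∏-distrib-*)
open import Algebra.Properties.Semiring.Sum (CommutativeRing.semiring ℚₚ.+-*-commutativeRing) using (∑-permute)
open import Algebra.Properties.CommutativeMonoid.Sum ℕₚ.+-0-commutativeMonoid using () renaming (sum to sumᶠ; sum-cong-≗ to sumᶠ-cong; sum-permute to sumᶠ-permute; sum-remove to sumᶠ-remove)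
open import Relation.Binary.Definitions using (DecidableEquality)
open import Function.Definitions using (Injective)
open import Data.Integer.Solver using () renaming (module +-*-Solver to ℤ-Solver)
open import Data.Unit using (⊤; tt)
import Data.Product.Properties as Productₚ
open import Data.Vec.Relation.Unary.All using ([]; _∷_) renaming (All to Allᵛ)
import Data.Vec.Relation.Unary.All as Allᵛ
open import Data.List.Membership.DecPropositional ℤₚ._≟_ using (_∈?_)
import Data.Rational.Unnormalised as ℚᵘ
import Data.Rational.Unnormalised.Properties as ℚᵘₚ

-- The norm argument bypasses irreducibility and the orthogonality of characters. All functions are
-- rational valued, and `classSum` and `frobenius` are unchanged by `g ↦ g ⁻¹`, so the pairing Σ
-- F(g) H(g) needs no conjugation, and a vanishing norm forces a function to vanish because squares
-- in ℚ are nonnegative. Triangularity enters through two different mechanisms. For ⟨A,X⟩ it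
-- concerns fillings: a filling without repetition in a column whose content is lexicographically at
-- least θ is a column rearrangement of the row numbering. For ⟨X,X⟩ it is the unitriangularity of
-- Kostka numbers, which appear once pairs of colourings are grouped by contingency table. A
-- multiple of m is taken as number of beads because the passage from beads to the set 𝕊 θ then
-- shifts every residue class by the same K. The sign of θ collects two permutation signs, both
-- computed from the beads of θ before any part of λ is removed.

-- Indicators and finite sums of rationals

𝟙 : ∀ {P : Set} → Dec P → ℚ
𝟙 d = if does d then 1ℚ else 0ℚ

𝟙-yes : ∀ {P : Set} (d : Dec P) → P → 𝟙 d ≡ 1ℚ
𝟙-yes d p = cong (λ b → if b then 1ℚ else 0ℚ) (dec-true d p)

𝟙-no : ∀ {P : Set} (d : Dec P) → ¬ P → 𝟙 d ≡ 0ℚ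
𝟙-no d ¬p = cong (λ b → if b then 1ℚ else 0ℚ) (dec-false d ¬p)

𝟙-⇔ : ∀ {P Q : Set} (d : Dec P) (e : Dec Q) → (P → Q) → (Q → P) → 𝟙 d ≡ 𝟙 e
𝟙-⇔ d e f g = cong (λ b → if b then 1ℚ else 0ℚ) (does-⇔ (mk⇔ f g) d e)

𝟙-× : ∀ {P Q : Set} (d : Dec P) (e : Dec Q) → 𝟙 (d ×-dec e) ≡ 𝟙 d * 𝟙 e
𝟙-× (yes _) (yes _) = refl
𝟙-× (yes _) (no _)  = refl
𝟙-× (no _)  (yes _) = refl
𝟙-× (no _)  (no _)  = refl

𝟙-guard : ∀ {P : Set} (d : Dec P) {x y : ℚ} → (P → x ≡ y) → 𝟙 d * x ≡ 𝟙 d * y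
𝟙-guard d@(yes p) h = cong (𝟙 d *_) (h p)
𝟙-guard (no _) {x} {y} h = trans (ℚₚ.*-zeroˡ x) (sym (ℚₚ.*-zeroˡ y))

x≡-x⇒x≡0 : ∀ {x : ℚ} → x ≡ - x → x ≡ 0ℚ
x≡-x⇒x≡0 {x} eq = begin
  x                      ≡⟨ solve 1 (λ y → y := con ℚ.½ :* (y :+ y)) refl x ⟩
  ℚ.½ * (x + x)          ≡⟨ cong (λ y → ℚ.½ * (x + y)) eq ⟩
  ℚ.½ * (x + - x)        ≡⟨ cong (ℚ.½ *_) (ℚₚ.+-inverseʳ x) ⟩
  ℚ.½ * 0ℚ               ≡⟨⟩
  0ℚ ∎
  where
  open ≡-Reasoning
  open +-*-Solver

*-nonZero : ∀ {x y : ℚ} → x * y ≢ 0ℚ → x ≢ 0ℚ × y ≢ 0ℚ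
*-nonZero {x} {y} xy≢0 =
  (λ x≡0 → xy≢0 (trans (cong (_* y) x≡0) (ℚₚ.*-zeroˡ y))) , (λ y≡0 → xy≢0 (trans (cong (x *_) y≡0) (ℚₚ.*-zeroʳ x)))

*-cancelˡ-≢0 : ∀ {r x y : ℚ} → r ≢ 0ℚ → r * x ≡ r * y → x ≡ y
*-cancelˡ-≢0 {r} {x} {y} r≢0 eq = begin
  x                ≡⟨ sym (ℚₚ.*-identityˡ x) ⟩
  1ℚ * x           ≡⟨ cong (_* x) (sym (ℚₚ.*-inverseˡ r)) ⟩
  1/ r * r * x     ≡⟨ ℚₚ.*-assoc (1/ r) r x ⟩
  1/ r * (r * x)   ≡⟨ cong (1/ r *_) eq ⟩
  1/ r * (r * y)   ≡⟨ sym (ℚₚ.*-assoc (1/ r) r y) ⟩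
  1/ r * r * y     ≡⟨ cong (_* y) (ℚₚ.*-inverseˡ r) ⟩
  1ℚ * y           ≡⟨ ℚₚ.*-identityˡ y ⟩
  y ∎
  where
  open ≡-Reasoning
  instance
    _ = ℚ.≢-nonZero r≢0

square≥0 : ∀ x → 0ℚ ℚ.≤ x * x
square≥0 x with ℚₚ.≤-total 0ℚ x
... | inj₁ 0≤x = subst (ℚ._≤ x * x) (ℚₚ.*-zeroˡ x) (ℚₚ.*-monoʳ-≤-nonNeg x {{ℚ.nonNegative 0≤x}} 0≤x)
... | inj₂ x≤0 = subst (ℚ._≤ x * x) (ℚₚ.*-zeroˡ x) (ℚₚ.*-monoʳ-≤-nonPos x {{ℚ.nonPositive x≤0}} x≤0)

square≡0 : ∀ x → x * x ≡ 0ℚ → x ≡ 0ℚ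
square≡0 x eq with x ℚₚ.≟ 0ℚ
... | yes x≡0 = x≡0
... | no  x≢0 = *-cancelˡ-≢0 x≢0 (trans eq (sym (ℚₚ.*-zeroʳ x)))

∑≥0 : ∀ {n} (f : Fin n → ℚ) → (∀ i → 0ℚ ℚ.≤ f i) → 0ℚ ℚ.≤ ∑[ i < n ] f i
∑≥0 {zero}  f f≥0 = ℚₚ.≤-refl
∑≥0 {suc n} f f≥0 = ℚₚ.+-mono-≤ (f≥0 zero) (∑≥0 (f ∘ suc) (f≥0 ∘ suc))

+≡0⇒≡0 : ∀ {x y} → 0ℚ ℚ.≤ x → 0ℚ ℚ.≤ y → x + y ≡ 0ℚ → x ≡ 0ℚ × y ≡ 0ℚ
+≡0⇒≡0 {x} {y} x≥0 y≥0 eq =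
  ℚₚ.≤-antisym (bound (ℚₚ.+-monoʳ-≤ x y≥0) (ℚₚ.+-identityʳ x)) x≥0 , ℚₚ.≤-antisym (bound (ℚₚ.+-monoˡ-≤ y x≥0) (ℚₚ.+-identityˡ y)) y≥0
  where
  bound : ∀ {u v} → u ℚ.≤ x + y → u ≡ v → v ℚ.≤ 0ℚ
  bound u≤ refl = subst (_ ℚ.≤_) eq u≤

-- Positive definiteness of the pairing on functions of the group. It is applied to the difference
-- of `classSum` and `κ` times Frobenius's function.
∑-squares≡0 : ∀ {n} (f : Fin n → ℚ) → (∑[ i < n ] (f i * f i)) ≡ 0ℚ → ∀ i → f i ≡ 0ℚ
∑-squares≡0 {suc n} f eq i with +≡0⇒≡0 (square≥0 (f zero)) (∑≥0 (λ j → f (suc j) * f (suc j)) (λ j → square≥0 (f (suc j)))) eq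
∑-squares≡0 {suc n} f eq zero    | p , q = square≡0 (f zero) p
∑-squares≡0 {suc n} f eq (suc i) | p , q = ∑-squares≡0 (f ∘ suc) q i

∑-zero : ∀ {n} {f : Fin n → ℚ} → (∀ i → f i ≡ 0ℚ) → (∑[ i < n ] f i) ≡ 0ℚ
∑-zero {n} eq = trans (sum-cong-≗ eq) (sum-replicate-zero n)

∑-single : ∀ {n} {f : Fin n → ℚ} j → (∀ i → i ≢ j → f i ≡ 0ℚ) → (∑[ i < n ] f i) ≡ f j
∑-single {suc n} {f} zero    h = trans (cong (f zero +_) (∑-zero (λ i → h (suc i) (λ ())))) (ℚₚ.+-identityʳ (f zero))
∑-single {suc n} {f} (suc j) h =
  trans (cong₂ _+_ (h zero (λ ())) (∑-single j (λ i i≢j → h (suc i) (i≢j ∘ Finₚ.suc-injective)))) (ℚₚ.+-identityˡ (f (suc j)))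

∑-↑ : ∀ a {b} (f : Fin (a ℕ.+ b) → ℚ) → (∑[ k < a ℕ.+ b ] f k) ≡ ∑[ i < a ] f (i ↑ˡ b) + ∑[ j < b ] f (a ↑ʳ j)
∑-↑ zero    f = sym (ℚₚ.+-identityˡ _)
∑-↑ (suc a) f = trans (cong (f zero +_) (∑-↑ a (f ∘ suc))) (sym (ℚₚ.+-assoc (f zero) _ _))

∑-combine : ∀ a {b} (f : Fin (a ℕ.* b) → ℚ) → (∑[ k < a ℕ.* b ] f k) ≡ ∑[ i < a ] ∑[ j < b ] f (combine i j)
∑-combine zero        f = refl
∑-combine (suc a) {b} f = trans (∑-↑ b f) (cong (∑[ j < b ] f (j ↑ˡ a ℕ.* b) +_) (∑-combine a (λ k → f (b ↑ʳ k))))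

-- Written as a sum of ones, so that `fromℕℚ (n !)` is by definition the sum of 1 over the symmetric
-- group.
fromℕℚ : ℕ → ℚ
fromℕℚ n = ∑[ i < n ] 1ℚ

fromℕℚ-suc≢0 : ∀ n → fromℕℚ (suc n) ≢ 0ℚ
fromℕℚ-suc≢0 n eq with proj₁ (+≡0⇒≡0 (ℚₚ.≤-trans (∑≥0 {0} (λ ()) (λ ())) (ℚₚ.nonNegative⁻¹ 1ℚ)) (∑≥0 {n} (λ _ → 1ℚ) (λ _ → ℚₚ.nonNegative⁻¹ 1ℚ)) eq)
... | ()

∑-const : ∀ n x → (∑[ i < n ] x) ≡ fromℕℚ n * x
∑-const n x = trans (sum-cong-≗ {n} (λ _ → sym (ℚₚ.*-identityˡ x))) (sym (*-distribʳ-sum {n} x (λ _ → 1ℚ)))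

-- Sums over the symmetric group

≈ₚ-trans : ∀ {n} (ρ σ τ : Permutation′ n) → ρ ≈ₚ σ → σ ≈ₚ τ → ρ ≈ₚ τ
≈ₚ-trans ρ σ τ p q i = trans (p i) (q i)

perm-injective-≢ : ∀ {n} (σ : Permutation′ n) {i j} → i ≢ j → σ ⟨$⟩ʳ i ≢ σ ⟨$⟩ʳ j
perm-injective-≢ σ i≢j eq = i≢j (trans (sym (Perm.inverseˡ σ)) (trans (cong (σ ⟨$⟩ˡ_) eq) (Perm.inverseˡ σ)))

index-cong : ∀ {n} (σ τ : Permutation′ n) → σ ≈ₚ τ → index σ ≡ index τ
index-cong {n} σ τ σ≈τ = perm-injective n _ _ (λ i → trans (perm-index σ i) (trans (σ≈τ i) (sym (perm-index τ i))))

∑ᴳ : ∀ n → (Permutation′ n → ℚ) → ℚ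
∑ᴳ n f = ∑[ k < n ! ] f (perm n k)

∑ᴳ-cong : ∀ {n} {f h : Permutation′ n → ℚ} → (∀ g → f g ≡ h g) → ∑ᴳ n f ≡ ∑ᴳ n h
∑ᴳ-cong {n} eq = sum-cong-≗ (λ k → eq (perm n k))

∑ᴳ-zero : ∀ {n} {f : Permutation′ n → ℚ} → (∀ g → f g ≡ 0ℚ) → ∑ᴳ n f ≡ 0ℚ
∑ᴳ-zero {n} eq = ∑-zero (λ k → eq (perm n k))

∑ᴳ-comm : ∀ {n} (f : Permutation′ n → Permutation′ n → ℚ) → ∑ᴳ n (λ g → ∑ᴳ n (λ h → f g h)) ≡ ∑ᴳ n (λ h → ∑ᴳ n (λ g → f g h))
∑ᴳ-comm {n} f = ∑-comm (λ k l → f (perm n k) (perm n l))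

∑ᴳ-*ˡ : ∀ {n} x (f : Permutation′ n → ℚ) → x * ∑ᴳ n f ≡ ∑ᴳ n (λ g → x * f g)
∑ᴳ-*ˡ {n} x f = *-distribˡ-sum x (f ∘ perm n)

∑ᴳ-*ʳ : ∀ {n} x (f : Permutation′ n → ℚ) → ∑ᴳ n f * x ≡ ∑ᴳ n (λ g → f g * x)
∑ᴳ-*ʳ {n} x f = *-distribʳ-sum x (f ∘ perm n)

-- The value `Φ (perm n k)` is only pointwise equal to an enumerated permutation. Through `index`
-- the maps become mutually inverse on `Fin (n !)`, and `Respects≈` transports the summand back.
∑ᴳ-bijection : ∀ {n} (f : Permutation′ n → ℚ) → Respects≈ f → (Φ Ψ : Permutation′ n → Permutation′ n) →
  (∀ σ τ → σ ≈ₚ τ → Φ σ ≈ₚ Φ τ) → (∀ σ τ → σ ≈ₚ τ → Ψ σ ≈ₚ Ψ τ) →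
  (∀ σ → Φ (Ψ σ) ≈ₚ σ) → (∀ σ → Ψ (Φ σ) ≈ₚ σ) → ∑ᴳ n f ≡ ∑ᴳ n (f ∘ Φ)
∑ᴳ-bijection {n} f rf Φ Ψ Φ-cong Ψ-cong ΦΨ ΨΦ = trans
  (∑-permute (f ∘ perm n) π)
  (sum-cong-≗ (λ k → rf _ _ (perm-index (Φ (perm n k)))))
  where
  inverse : ∀ (F H : Permutation′ n → Permutation′ n) → (∀ σ τ → σ ≈ₚ τ → F σ ≈ₚ F τ) → (∀ σ → F (H σ) ≈ₚ σ) →
    ∀ k → index (F (perm n (index (H (perm n k))))) ≡ k
  inverse F H F-cong FH k = trans
    (index-cong _ _ (≈ₚ-trans (F (perm n (index (H (perm n k))))) (F (H (perm n k))) (perm n k) (F-cong _ _ (perm-index (H (perm n k)))) (FH (perm n k))))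
    (index-perm n k)
  π : Permutation′ (n !)
  π = permutation (λ k → index (Φ (perm n k))) (λ k → index (Ψ (perm n k))) (inverse Φ Ψ Φ-cong ΦΨ) (inverse Ψ Φ Ψ-cong ΨΦ)

∑ᴳ-left : ∀ {n} (h : Permutation′ n) (f : Permutation′ n → ℚ) → Respects≈ f → ∑ᴳ n f ≡ ∑ᴳ n (λ g → f (h ∙ g))
∑ᴳ-left h f rf = ∑ᴳ-bijection f rf (h ∙_) (h ⁻¹ ∙_)
  (λ σ τ eq i → cong (h ⟨$⟩ʳ_) (eq i)) (λ σ τ eq i → cong (h ⟨$⟩ˡ_) (eq i))
  (λ σ i → Perm.inverseʳ h) (λ σ i → Perm.inverseˡ h)

∑ᴳ-right : ∀ {n} (h : Permutation′ n) (f : Permutation′ n → ℚ) → Respects≈ f → ∑ᴳ n f ≡ ∑ᴳ n (λ g → f (g ∙ h))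
∑ᴳ-right h f rf = ∑ᴳ-bijection f rf (_∙ h) (_∙ h ⁻¹)
  (λ σ τ eq i → eq (h ⟨$⟩ʳ i)) (λ σ τ eq i → eq (h ⟨$⟩ˡ i))
  (λ σ i → cong (σ ⟨$⟩ʳ_) (Perm.inverseˡ h)) (λ σ i → cong (σ ⟨$⟩ʳ_) (Perm.inverseʳ h))

∑ᴳ-inverse : ∀ {n} (f : Permutation′ n → ℚ) → Respects≈ f → ∑ᴳ n f ≡ ∑ᴳ n (λ g → f (g ⁻¹))
∑ᴳ-inverse f rf = ∑ᴳ-bijection f rf _⁻¹ _⁻¹
  (λ σ τ eq → flip-cong {π = σ} {ρ = τ} eq) (λ σ τ eq → flip-cong {π = σ} {ρ = τ} eq)
  (λ σ i → refl) (λ σ i → refl)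

∑ᴳ-single : ∀ {n} (f : Permutation′ n → ℚ) → Respects≈ f → ∀ h → (∀ g → ¬ g ≈ₚ h → f g ≡ 0ℚ) → ∑ᴳ n f ≡ f h
∑ᴳ-single {n} f rf h zeros = trans
  (∑-single (index h) (λ k k≢ → zeros (perm n k) (λ eq → k≢ (trans (sym (index-perm n k)) (index-cong (perm n k) h eq)))))
  (rf _ _ (perm-index h))

∑ᴳ-suc : ∀ {n} (f : Permutation′ (suc n) → ℚ) → ∑ᴳ (suc n) f ≡ ∑[ j < suc n ] ∑ᴳ n (λ g → f (insert zero j g))
∑ᴳ-suc {n} f = trans (∑-combine (suc n) (λ k → f (perm (suc n) k)))
  (sum-cong-≗ (λ j → sum-cong-≗ (λ k → cong (λ p → f (insert zero (proj₁ p) (perm n (proj₂ p)))) (Finₚ.remQuot-combine {suc n} {n !} j k))))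

-- Sums over words, and permutations acting on positions

∑ᵛ : ∀ {N} n → (Vec (Fin N) n → ℚ) → ℚ
∑ᵛ     zero    f = f []
∑ᵛ {N} (suc n) f = ∑[ c < N ] ∑ᵛ n (λ x → f (c ∷ x))

∑ᵛ-cong : ∀ {N} n {f g : Vec (Fin N) n → ℚ} → (∀ x → f x ≡ g x) → ∑ᵛ n f ≡ ∑ᵛ n g
∑ᵛ-cong zero    eq = eq []
∑ᵛ-cong (suc n) eq = sum-cong-≗ (λ c → ∑ᵛ-cong n (λ x → eq (c ∷ x)))

∑ᵛ-zero : ∀ {N} n {f : Vec (Fin N) n → ℚ} → (∀ x → f x ≡ 0ℚ) → ∑ᵛ n f ≡ 0ℚ
∑ᵛ-zero zero    eq = eq []
∑ᵛ-zero (suc n) eq = ∑-zero (λ c → ∑ᵛ-zero n (λ x → eq (c ∷ x)))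

∑ᵛ-*ˡ : ∀ {N} n r (f : Vec (Fin N) n → ℚ) → r * ∑ᵛ n f ≡ ∑ᵛ n (λ x → r * f x)
∑ᵛ-*ˡ zero    r f = refl
∑ᵛ-*ˡ {N} (suc n) r f = trans (*-distribˡ-sum r (λ c → ∑ᵛ n (λ x → f (c ∷ x)))) (sum-cong-≗ (λ c → ∑ᵛ-*ˡ n r (λ x → f (c ∷ x))))

∑ᵛ-*ʳ : ∀ {N} n r (f : Vec (Fin N) n → ℚ) → ∑ᵛ n f * r ≡ ∑ᵛ n (λ x → f x * r)
∑ᵛ-*ʳ n r f = trans (ℚₚ.*-comm _ r) (trans (∑ᵛ-*ˡ n r f) (∑ᵛ-cong n (λ x → ℚₚ.*-comm r (f x))))

∑ᵛ-∑ : ∀ {N} n {k} (f : Vec (Fin N) n → Fin k → ℚ) → ∑ᵛ n (λ x → ∑[ i < k ] f x i) ≡ ∑[ i < k ] ∑ᵛ n (λ x → f x i)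
∑ᵛ-∑ zero    f = refl
∑ᵛ-∑ {N} (suc n) f = trans (sum-cong-≗ {N} (λ c → ∑ᵛ-∑ n (λ x → f (c ∷ x)))) (∑-comm (λ c i → ∑ᵛ n (λ x → f (c ∷ x) i)))

∑ᵛ-comm : ∀ {N} n {M} m (f : Vec (Fin N) n → Vec (Fin M) m → ℚ) → ∑ᵛ n (λ x → ∑ᵛ m (f x)) ≡ ∑ᵛ m (λ y → ∑ᵛ n (λ x → f x y))
∑ᵛ-comm n zero    f = refl
∑ᵛ-comm n {M} (suc m) f = trans (∑ᵛ-∑ n (λ x c → ∑ᵛ m (λ y → f x (c ∷ y)))) (sum-cong-≗ {M} (λ c → ∑ᵛ-comm n m (λ x y → f x (c ∷ y))))

∑ᵛ-∑ᴳ : ∀ {N} n {k} (f : Vec (Fin N) n → Permutation′ k → ℚ) → ∑ᵛ n (λ x → ∑ᴳ k (f x)) ≡ ∑ᴳ k (λ g → ∑ᵛ n (λ x → f x g))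
∑ᵛ-∑ᴳ n {k} f = ∑ᵛ-∑ n (λ x i → f x (perm k i))

∑ᵛ-single : ∀ {N} n {f : Vec (Fin N) n → ℚ} y → (∀ x → x ≢ y → f x ≡ 0ℚ) → ∑ᵛ n f ≡ f y
∑ᵛ-single zero    []      h = refl
∑ᵛ-single (suc n) (c ∷ y) h = trans
  (∑-single c (λ d d≢c → ∑ᵛ-zero n (λ x → h (d ∷ x) (d≢c ∘ Vecₚ.∷-injectiveˡ))))
  (∑ᵛ-single n y (λ x x≢y → h (c ∷ x) (x≢y ∘ Vecₚ.∷-injectiveʳ)))

_≟ᵛ_ : ∀ {N n} (x y : Vec (Fin N) n) → Dec (x ≡ y)
_≟ᵛ_ = Vecₚ.≡-dec _≟ᶠ_

∑ᵛ-𝟙 : ∀ {N} n (f : Vec (Fin N) n → ℚ) y → ∑ᵛ n (λ x → 𝟙 (y ≟ᵛ x) * f x) ≡ f y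
∑ᵛ-𝟙 n f y = trans
  (∑ᵛ-single n y (λ x x≢y → trans (cong (_* f x) (𝟙-no (y ≟ᵛ x) (x≢y ∘ sym))) (ℚₚ.*-zeroˡ (f x))))
  (trans (cong (_* f y) (𝟙-yes (y ≟ᵛ y) refl)) (ℚₚ.*-identityˡ (f y)))

-- Double counting of the graph of `φ`: since `∑ᵛ` is a nested sum with no single index set to
-- permute, both sides are obtained from the sum of `𝟙 (φ x ≟ᵛ y) * f y` over all pairs.
∑ᵛ-bijection : ∀ {N n} (f : Vec (Fin N) n → ℚ) (φ ψ : Vec (Fin N) n → Vec (Fin N) n) →
  (∀ x → φ (ψ x) ≡ x) → (∀ x → ψ (φ x) ≡ x) → ∑ᵛ n f ≡ ∑ᵛ n (f ∘ φ)
∑ᵛ-bijection {N} {n} f φ ψ φψ ψφ = begin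
  ∑ᵛ n f                                                  ≡⟨ ∑ᵛ-cong n (λ y → sym (∑ᵛ-𝟙 n (λ _ → f y) (ψ y))) ⟩
  ∑ᵛ n (λ y → ∑ᵛ n (λ x → 𝟙 (ψ y ≟ᵛ x) * f y))            ≡⟨ ∑ᵛ-comm n n _ ⟩
  ∑ᵛ n (λ x → ∑ᵛ n (λ y → 𝟙 (ψ y ≟ᵛ x) * f y))            ≡⟨ ∑ᵛ-cong n (λ x → ∑ᵛ-cong n (λ y → cong (_* f y)
                                                              (𝟙-⇔ (ψ y ≟ᵛ x) (φ x ≟ᵛ y) (λ { refl → φψ y }) (λ { refl → ψφ x })))) ⟩
  ∑ᵛ n (λ x → ∑ᵛ n (λ y → 𝟙 (φ x ≟ᵛ y) * f y))            ≡⟨ ∑ᵛ-cong n (λ x → ∑ᵛ-𝟙 n f (φ x)) ⟩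
  ∑ᵛ n (f ∘ φ) ∎
  where open ≡-Reasoning

∑ᵛ-++ : ∀ {N} a {b} (f : Vec (Fin N) (a ℕ.+ b) → ℚ) → ∑ᵛ (a ℕ.+ b) f ≡ ∑ᵛ a (λ x → ∑ᵛ b (λ y → f (x Vec.++ y)))
∑ᵛ-++ zero    f = refl
∑ᵛ-++ {N} (suc a) f = sum-cong-≗ {N} (λ c → ∑ᵛ-++ a (λ x → f (c ∷ x)))

infixl 8 _∘ᵛ_
_∘ᵛ_ : ∀ {A : Set} {n} → Vec A n → Permutation′ n → Vec A n
x ∘ᵛ g = tabulate (λ i → lookup x (g ⟨$⟩ʳ i))

∘ᵛ-cong : ∀ {A : Set} {n} (x : Vec A n) (g h : Permutation′ n) → g ≈ₚ h → x ∘ᵛ g ≡ x ∘ᵛ h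
∘ᵛ-cong x g h g≈h = Vecₚ.tabulate-cong (λ i → cong (lookup x) (g≈h i))

∘ᵛ-∙ : ∀ {A : Set} {n} (x : Vec A n) (g h : Permutation′ n) → x ∘ᵛ g ∘ᵛ h ≡ x ∘ᵛ (g ∙ h)
∘ᵛ-∙ x g h = Vecₚ.tabulate-cong (λ i → Vecₚ.lookup∘tabulate (λ j → lookup x (g ⟨$⟩ʳ j)) (h ⟨$⟩ʳ i))

∘ᵛ-id : ∀ {A : Set} {n} (x : Vec A n) (g : Permutation′ n) → (∀ i → g ⟨$⟩ʳ i ≡ i) → x ∘ᵛ g ≡ x
∘ᵛ-id x g eq = trans (Vecₚ.tabulate-cong (λ i → cong (lookup x) (eq i))) (Vecₚ.tabulate∘lookup x)

∘ᵛ-inverseʳ : ∀ {A : Set} {n} (x : Vec A n) (g : Permutation′ n) → x ∘ᵛ g ∘ᵛ g ⁻¹ ≡ x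
∘ᵛ-inverseʳ x g = trans (∘ᵛ-∙ x g (g ⁻¹)) (∘ᵛ-id x (g ∙ g ⁻¹) (λ i → Perm.inverseʳ g))

∘ᵛ-inverseˡ : ∀ {A : Set} {n} (x : Vec A n) (g : Permutation′ n) → x ∘ᵛ g ⁻¹ ∘ᵛ g ≡ x
∘ᵛ-inverseˡ x g = trans (∘ᵛ-∙ x (g ⁻¹) g) (∘ᵛ-id x (g ⁻¹ ∙ g) (λ i → Perm.inverseˡ g))

-- The sign of a permutation

prod-one : ∀ {n} {f : Fin n → ℚ} → (∀ i → f i ≡ 1ℚ) → prod f ≡ 1ℚ
prod-one {zero}  eq = refl
prod-one {suc n} eq = trans (cong₂ _*_ (eq zero) (prod-one (eq ∘ suc))) refl

ε : Bool → ℚ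
ε b = if b then - 1ℚ else 1ℚ

ε² : ∀ b → ε b * ε b ≡ 1ℚ
ε² true  = refl
ε² false = refl

ltᶠ : ∀ {n} → Fin n → Fin n → Bool
ltᶠ i j = does (i Fin.<? j)

ltᶠ-irrefl : ∀ {n} (i : Fin n) → ltᶠ i i ≡ false
ltᶠ-irrefl i = dec-false (i Fin.<? i) (ℕₚ.<-irrefl refl)

ltᶠ-swap : ∀ {n} {i j : Fin n} → i ≢ j → ltᶠ j i ≡ not (ltᶠ i j)
ltᶠ-swap {_} {i} {j} i≢j with ℕₚ.<-cmp (toℕ i) (toℕ j)
... | tri< i<j _ ¬j<i = trans (dec-false (j Fin.<? i) ¬j<i) (cong not (sym (dec-true (i Fin.<? j) i<j)))
... | tri≈ _ i≡j _ = contradiction (Finₚ.toℕ-injective i≡j) i≢j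
... | tri> ¬i<j _ j<i = trans (dec-true (j Fin.<? i) j<i) (cong not (sym (dec-false (i Fin.<? j) ¬i<j)))

no-inversion : ∀ {n} (i j : Fin n) → ε (ltᶠ i j ∧ ltᶠ j i) ≡ 1ℚ
no-inversion i j with i ≟ᶠ j
... | yes refl rewrite ltᶠ-irrefl i = refl
... | no  i≢j rewrite ltᶠ-swap i≢j with ltᶠ i j
... | true  = refl
... | false = refl

inversion : ∀ {n} → Permutation′ n → Fin n → Fin n → ℚ
inversion σ i j = ε (ltᶠ i j ∧ ltᶠ (σ ⟨$⟩ʳ j) (σ ⟨$⟩ʳ i))

sgn² : ∀ {n} (σ : Permutation′ n) → sgn σ * sgn σ ≡ 1ℚ
sgn² {n} σ = trans (sym (∏-distrib-* {n} (λ i → prod (inversion σ i)) (λ i → prod (inversion σ i))))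
  (prod-one (λ i → trans (sym (∏-distrib-* (inversion σ i) (inversion σ i)))
    (prod-one (λ j → ε² (ltᶠ i j ∧ ltᶠ (σ ⟨$⟩ʳ j) (σ ⟨$⟩ʳ i))))))

-- The inversions of σ, reindexed along τ, are compared with those of σ ∙ τ and τ pair by pair.
sgn-comp : ∀ {n} (σ τ : Permutation′ n) → sgn σ ≡ sgn (σ ∙ τ) * sgn τ
sgn-comp {n} σ τ = begin
  ∏∏ (λ a b → ε (ltᶠ a b ∧ ltᶠ (σ ⟨$⟩ʳ b) (σ ⟨$⟩ʳ a)))
    ≡⟨ trans (prod-permute {n} {n} _ τ) (prod-cong-≗ {n} (λ i → prod-permute {n} {n} _ τ)) ⟩
  ∏∏ (λ i j → ε (P i j))
    ≡⟨ ∏∏-cong (λ i j → split i j) ⟩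
  ∏∏ (λ i j → ε (ltᶠ i j ∧ P i j) * ε (ltᶠ j i ∧ P i j))
    ≡⟨ ∏∏-* (λ i j → ε (ltᶠ i j ∧ P i j)) (λ i j → ε (ltᶠ j i ∧ P i j)) ⟩
  ∏∏ (λ i j → ε (ltᶠ i j ∧ P i j)) * ∏∏ (λ i j → ε (ltᶠ j i ∧ P i j))
    ≡⟨ cong (∏∏ (λ i j → ε (ltᶠ i j ∧ P i j)) *_) (∏-comm (λ i j → ε (ltᶠ j i ∧ P i j))) ⟩
  ∏∏ (λ i j → ε (ltᶠ i j ∧ P i j)) * ∏∏ (λ i j → ε (ltᶠ i j ∧ P j i))
    ≡⟨ sym (∏∏-* (λ i j → ε (ltᶠ i j ∧ P i j)) (λ i j → ε (ltᶠ i j ∧ P j i))) ⟩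
  ∏∏ (λ i j → ε (ltᶠ i j ∧ P i j) * ε (ltᶠ i j ∧ P j i))
    ≡⟨ ∏∏-cong (λ i j → regroup i j) ⟩
  ∏∏ (λ i j → ε (ltᶠ i j ∧ ltᶠ (στ j) (στ i)) * ε (ltᶠ i j ∧ ltᶠ (τ ⟨$⟩ʳ j) (τ ⟨$⟩ʳ i)))
    ≡⟨ ∏∏-* (λ i j → ε (ltᶠ i j ∧ ltᶠ (στ j) (στ i))) (λ i j → ε (ltᶠ i j ∧ ltᶠ (τ ⟨$⟩ʳ j) (τ ⟨$⟩ʳ i))) ⟩
  sgn (σ ∙ τ) * sgn τ ∎
  where
  open ≡-Reasoning
  ∏∏ : (Fin n → Fin n → ℚ) → ℚ
  ∏∏ f = ∏[ i < n ] ∏[ j < n ] f i j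

  ∏∏-cong : ∀ {f g} → (∀ i j → f i j ≡ g i j) → ∏∏ f ≡ ∏∏ g
  ∏∏-cong eq = prod-cong-≗ (λ i → prod-cong-≗ (eq i))

  ∏∏-* : ∀ f g → ∏∏ (λ i j → f i j * g i j) ≡ ∏∏ f * ∏∏ g
  ∏∏-* f g = trans (prod-cong-≗ (λ i → ∏-distrib-* (f i) (g i))) (∏-distrib-* (λ i → prod (f i)) (λ i → prod (g i)))

  στ : Fin n → Fin n
  στ i = σ ⟨$⟩ʳ (τ ⟨$⟩ʳ i)

  P : Fin n → Fin n → Bool
  P i j = ltᶠ (τ ⟨$⟩ʳ i) (τ ⟨$⟩ʳ j) ∧ ltᶠ (στ j) (στ i)

  split : ∀ i j → ε (P i j) ≡ ε (ltᶠ i j ∧ P i j) * ε (ltᶠ j i ∧ P i j)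
  split i j with i ≟ᶠ j
  ... | yes refl rewrite ltᶠ-irrefl i | ltᶠ-irrefl (τ ⟨$⟩ʳ i) = refl
  ... | no  i≢j rewrite ltᶠ-swap i≢j with ltᶠ i j
  ... | true  = sym (ℚₚ.*-identityʳ _)
  ... | false = sym (ℚₚ.*-identityˡ _)

  -- For `i < j`, whether `σ` inverts the pair `τ i`, `τ j` is the sum modulo 2 of whether `σ ∙ τ`
  -- and `τ` invert `i`, `j`. The four truth assignments verify this.
  regroup : ∀ i j → ε (ltᶠ i j ∧ P i j) * ε (ltᶠ i j ∧ P j i) ≡
    ε (ltᶠ i j ∧ ltᶠ (στ j) (στ i)) * ε (ltᶠ i j ∧ ltᶠ (τ ⟨$⟩ʳ j) (τ ⟨$⟩ʳ i))
  regroup i j with i ≟ᶠ j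
  ... | yes refl rewrite ltᶠ-irrefl i = refl
  ... | no  i≢j
    rewrite ltᶠ-swap (perm-injective-≢ τ i≢j) | ltᶠ-swap (perm-injective-≢ σ (perm-injective-≢ τ i≢j))
    with ltᶠ i j | ltᶠ (τ ⟨$⟩ʳ i) (τ ⟨$⟩ʳ j) | ltᶠ (στ i) (στ j)
  ... | false | _     | _     = refl
  ... | true  | true  | true  = refl
  ... | true  | true  | false = refl
  ... | true  | false | true  = refl
  ... | true  | false | false = refl

sgn-∙ : ∀ {n} (σ τ : Permutation′ n) → sgn (σ ∙ τ) ≡ sgn σ * sgn τ
sgn-∙ σ τ = begin
  sgn (σ ∙ τ)                     ≡⟨ sym (ℚₚ.*-identityʳ (sgn (σ ∙ τ))) ⟩
  sgn (σ ∙ τ) * 1ℚ                ≡⟨ cong (sgn (σ ∙ τ) *_) (sym (sgn² τ)) ⟩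
  sgn (σ ∙ τ) * (sgn τ * sgn τ)   ≡⟨ sym (ℚₚ.*-assoc (sgn (σ ∙ τ)) (sgn τ) (sgn τ)) ⟩
  sgn (σ ∙ τ) * sgn τ * sgn τ     ≡⟨ cong (_* sgn τ) (sym (sgn-comp σ τ)) ⟩
  sgn σ * sgn τ ∎
  where open ≡-Reasoning

sgn-id : ∀ {n} (σ : Permutation′ n) → (∀ i → σ ⟨$⟩ʳ i ≡ i) → sgn σ ≡ 1ℚ
sgn-id {n} σ eq = trans (sgn-respects σ idₚ eq)
  (prod-one {n} {λ i → prod (inversion {n} idₚ i)} (λ i → prod-one {n} {inversion {n} idₚ i} (no-inversion i)))

sgn-⁻¹ : ∀ {n} (σ : Permutation′ n) → sgn (σ ⁻¹) ≡ sgn σ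
sgn-⁻¹ σ = begin
  sgn (σ ⁻¹)                      ≡⟨ sgn-comp (σ ⁻¹) σ ⟩
  sgn (σ ⁻¹ ∙ σ) * sgn σ          ≡⟨ cong (_* sgn σ) (sgn-id (σ ⁻¹ ∙ σ) (λ i → Perm.inverseˡ σ)) ⟩
  1ℚ * sgn σ                      ≡⟨ ℚₚ.*-identityˡ (sgn σ) ⟩
  sgn σ ∎
  where open ≡-Reasoning

transpose-≢ : ∀ {n} {i j k : Fin n} → k ≢ i → k ≢ j → transpose i j ⟨$⟩ʳ k ≡ k
transpose-≢ {_} {i} {j} {k} k≢i k≢j rewrite dec-false (k ≟ᶠ i) k≢i | dec-false (k ≟ᶠ j) k≢j = refl

transpose-ˡ : ∀ {n} (i j : Fin n) → transpose i j ⟨$⟩ʳ i ≡ j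
transpose-ˡ i j rewrite dec-true (i ≟ᶠ i) refl = refl

transpose-ʳ : ∀ {n} (i j : Fin n) → transpose i j ⟨$⟩ʳ j ≡ i
transpose-ʳ i j with j ≟ᶠ i
... | yes j≡i = j≡i
... | no  _ rewrite dec-true (j ≟ᶠ j) refl = refl

transpose-invariant : ∀ {n} {A : Set} (f : Fin n → A) {i j} → f i ≡ f j → ∀ k → f (transpose i j ⟨$⟩ʳ k) ≡ f k
transpose-invariant f {i} {j} eq k with k ≟ᶠ i
... | yes refl = sym eq
... | no  _ with k ≟ᶠ j
...   | yes refl = eq
...   | no  _ = refl

sgn-transpose-01 : ∀ n → sgn {suc (suc n)} (transpose zero (suc zero)) ≡ - 1ℚ
sgn-transpose-01 n = cong₂ _*_ {x = prod (F zero)} { - 1ℚ} {prod (F (suc zero)) * prod (λ i → prod (F (suc (suc i))))} {1ℚ}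
  (cong (λ p → 1ℚ * (- 1ℚ * p)) (prod-one {f = λ j → F zero (suc (suc j))} (λ j → refl)))
  (cong₂ _*_ {x = prod (F (suc zero))} {1ℚ} {prod (λ i → prod (F (suc (suc i))))} {1ℚ}
    (cong (λ p → 1ℚ * (1ℚ * p)) (prod-one {f = λ j → F (suc zero) (suc (suc j))} (λ j → refl)))
    (prod-one {f = λ i → prod (F (suc (suc i)))} (λ i → cong (λ p → 1ℚ * (1ℚ * p))
      (prod-one {f = λ j → F (suc (suc i)) (suc (suc j))} (λ j → no-inversion {suc (suc n)} (suc (suc i)) (suc (suc j)))))))
  where
  F : Fin (suc (suc n)) → Fin (suc (suc n)) → ℚ
  F = inversion (transpose zero (suc zero))

-- All transpositions are conjugate to the exchange of the first two points, and the conjugating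
-- permutation contributes its sign twice.
sgn-transpose : ∀ {n} {i j : Fin n} → i ≢ j → sgn (transpose i j) ≡ - 1ℚ
sgn-transpose {suc zero} {zero} {zero} i≢j = contradiction refl i≢j
sgn-transpose {suc (suc n)} {i} {j} i≢j = begin
  sgn t                              ≡⟨ solve 2 (λ s u → s := s :* con 1ℚ) refl (sgn t) (sgn h) ⟩
  sgn t * 1ℚ                         ≡⟨ cong (sgn t *_) (sym (sgn² h)) ⟩
  sgn t * (sgn h * sgn h)            ≡⟨ solve 2 (λ s u → s :* (u :* u) := u :* (s :* u)) refl (sgn t) (sgn h) ⟩
  sgn h * (sgn t * sgn h)            ≡⟨ cong₂ _*_ (sym (sgn-⁻¹ h)) (sym (sgn-∙ t h)) ⟩
  sgn (h ⁻¹) * sgn (t ∙ h)           ≡⟨ sym (sgn-∙ (h ⁻¹) (t ∙ h)) ⟩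
  sgn (h ⁻¹ ∙ (t ∙ h))               ≡⟨ sgn-respects (h ⁻¹ ∙ (t ∙ h)) t₀₁ conjugate ⟩
  sgn t₀₁                            ≡⟨ sgn-transpose-01 n ⟩
  - 1ℚ ∎
  where
  open ≡-Reasoning
  open +-*-Solver
  t t₀₁ τ₁ τ₂ h : Permutation′ (suc (suc n))
  t = transpose i j
  t₀₁ = transpose zero (suc zero)
  τ₁ = transpose zero i
  -- After `τ₁` has been chosen to take 0 to `i`, this factor sends 1 to the point that `τ₁` takes
  -- to `j`, without moving 0.
  τ₂ = transpose (suc zero) (τ₁ ⟨$⟩ˡ j)
  h = τ₁ ∙ τ₂

  j′≢0 : zero ≢ τ₁ ⟨$⟩ˡ j
  j′≢0 eq = i≢j (trans (sym (transpose-ˡ zero i)) (trans (cong (τ₁ ⟨$⟩ʳ_) eq) (Perm.inverseʳ τ₁)))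

  h0 : h ⟨$⟩ʳ zero ≡ i
  h0 = trans (cong (τ₁ ⟨$⟩ʳ_) (transpose-≢ {i = suc zero} (λ ()) j′≢0)) (transpose-ˡ zero i)

  h1 : h ⟨$⟩ʳ suc zero ≡ j
  h1 = trans (cong (τ₁ ⟨$⟩ʳ_) (transpose-ˡ (suc zero) (τ₁ ⟨$⟩ˡ j))) (Perm.inverseʳ τ₁)

  back : ∀ {k l} → h ⟨$⟩ʳ k ≡ l → h ⟨$⟩ˡ l ≡ k
  back eq = trans (cong (h ⟨$⟩ˡ_) (sym eq)) (Perm.inverseˡ h)

  conjugate : h ⁻¹ ∙ (t ∙ h) ≈ₚ t₀₁
  conjugate zero          = trans (cong (λ k → h ⟨$⟩ˡ (t ⟨$⟩ʳ k)) h0) (trans (cong (h ⟨$⟩ˡ_) (transpose-ˡ i j)) (back h1))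
  conjugate (suc zero)    = trans (cong (λ k → h ⟨$⟩ˡ (t ⟨$⟩ʳ k)) h1) (trans (cong (h ⟨$⟩ˡ_) (transpose-ʳ i j)) (back h0))
  conjugate k@(suc (suc _)) = trans (cong (h ⟨$⟩ˡ_) (transpose-≢ {i = i} {j} (λ eq → distinct {zero} (trans eq (sym h0)) (λ ())) (λ eq → distinct {suc zero} (trans eq (sym h1)) (λ ())))) (Perm.inverseˡ h)
    where
    distinct : ∀ {l} → h ⟨$⟩ʳ k ≡ h ⟨$⟩ʳ l → k ≢ l → ⊥
    distinct eq k≢l = perm-injective-≢ h k≢l eq

-- Fillings of a diagram

injective⇒surjective : ∀ {m n} {f : Fin m → Fin n} → Injective _≡_ _≡_ f → n ≤ m → ∀ y → ∃[ x ] f x ≡ y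
injective⇒surjective {m} {suc n} {f} inj n≤m y with any? (λ x → f x ≟ᶠ y)
... | yes hit = hit
... | no  miss = contradiction (ℕₚ.≤-trans n≤m (Finₚ.injective⇒≤ {f = λ x → punchOut (y≢f x)} (λ eq → inj (Finₚ.punchOut-injective (y≢f _) (y≢f _) eq)))) ℕₚ.1+n≰n
  where
  y≢f : ∀ x → y ≢ f x
  y≢f x eq = miss (x , sym eq)

injective⇒permutation : ∀ {n} (f : Fin n → Fin n) → Injective _≡_ _≡_ f → Permutation′ n
injective⇒permutation f inj = permutation f (λ y → proj₁ (surj y)) (λ y → proj₂ (surj y)) (λ x → inj (proj₂ (surj (f x))))
  where surj = injective⇒surjective inj ℕₚ.≤-refl

isℕ : ∀ {P : Set} → Dec P → ℕ
isℕ d = if does d then 1 else 0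

isℕ-yes : ∀ {P : Set} (d : Dec P) → P → isℕ d ≡ 1
isℕ-yes d p = cong (λ b → if b then 1 else 0) (dec-true d p)

isℕ-no : ∀ {P : Set} (d : Dec P) → ¬ P → isℕ d ≡ 0
isℕ-no d ¬p = cong (λ b → if b then 1 else 0) (dec-false d ¬p)

isℕ-⇔ : ∀ {P Q : Set} (d : Dec P) (e : Dec Q) → (P → Q) → (Q → P) → isℕ d ≡ isℕ e
isℕ-⇔ d e f g = cong (λ b → if b then 1 else 0) (does-⇔ (mk⇔ f g) d e)

occ : ∀ {A : Set} → DecidableEquality A → ∀ {n} → (Fin n → A) → A → ℕ
occ _≟_ x c = sumᶠ (λ i → isℕ (x i ≟ c))

occ-cong : ∀ {A : Set} (_≟_ : DecidableEquality A) {n} {x y : Fin n → A} → (∀ i → x i ≡ y i) → ∀ c → occ _≟_ x c ≡ occ _≟_ y c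
occ-cong _≟_ eq c = sumᶠ-cong (λ i → cong (λ a → isℕ (a ≟ c)) (eq i))

occ-permute : ∀ {A : Set} (_≟_ : DecidableEquality A) {n} (x : Fin n → A) (σ : Permutation′ n) c → occ _≟_ (λ i → x (σ ⟨$⟩ʳ i)) c ≡ occ _≟_ x c
occ-permute _≟_ x σ c = sym (sumᶠ-permute (λ i → isℕ (x i ≟ c)) σ)

occ-map : ∀ {A B : Set} (_≟_ : DecidableEquality A) (_≟′_ : DecidableEquality B) {f : A → B} → Injective _≡_ _≡_ f →
  ∀ {n} (x : Fin n → A) c → occ _≟′_ (f ∘ x) (f c) ≡ occ _≟_ x c
occ-map _≟_ _≟′_ {f} inj x c = sumᶠ-cong (λ i → isℕ-⇔ (f (x i) ≟′ f c) (x i ≟ c) inj (cong f))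

occ-zero : ∀ {A : Set} (_≟_ : DecidableEquality A) {n} (x : Fin n → A) c → (∀ i → x i ≢ c) → occ _≟_ x c ≡ 0
occ-zero _≟_ {zero}  x c ≢c = refl
occ-zero _≟_ {suc n} x c ≢c = cong₂ ℕ._+_ (isℕ-no (x zero ≟ c) (≢c zero)) (occ-zero _≟_ (x ∘ suc) c (≢c ∘ suc))

occ-const : ∀ {A : Set} (_≟_ : DecidableEquality A) {n} (x : Fin n → A) c → (∀ i → x i ≡ c) → occ _≟_ x c ≡ n
occ-const _≟_ {zero}  x c ≡c = refl
occ-const _≟_ {suc n} x c ≡c = cong₂ ℕ._+_ (isℕ-yes (x zero ≟ c) (≡c zero)) (occ-const _≟_ (x ∘ suc) c (≡c ∘ suc))

occ-↑ : ∀ {A : Set} (_≟_ : DecidableEquality A) m {n} (x : Fin (m ℕ.+ n) → A) c →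
  occ _≟_ x c ≡ occ _≟_ (λ i → x (i ↑ˡ n)) c ℕ.+ occ _≟_ (λ j → x (m ↑ʳ j)) c
occ-↑ _≟_ zero    x c = refl
occ-↑ _≟_ (suc m) x c = trans (cong (isℕ (x zero ≟ c) ℕ.+_) (occ-↑ _≟_ m (x ∘ suc) c)) (sym (ℕₚ.+-assoc (isℕ (x zero ≟ c)) _ _))

positions : ∀ {A : Set} (_≟_ : DecidableEquality A) {n} (x : Fin n → A) c →
  Σ[ e ∈ (Fin (occ _≟_ x c) → Fin n) ] Injective _≡_ _≡_ e × (∀ k → x (e k) ≡ c)
positions _≟_ {zero}  x c = (λ ()) , (λ { {()} }) , λ ()
positions _≟_ {suc n} x c with positions _≟_ (x ∘ suc) c | x zero ≟ c
... | e , inj , e-c | no  _ = suc ∘ e , inj ∘ Finₚ.suc-injective , e-c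
... | e , inj , e-c | yes x₀≡c = (λ { zero → zero ; (suc k) → suc (e k) })
  , (λ { {zero} {zero} _ → refl ; {suc k} {suc l} eq → cong suc (inj (Finₚ.suc-injective eq)) })
  , λ { zero → x₀≡c ; (suc k) → e-c k }

cell-↑ˡ : ∀ a l (i : Fin a) → cell (a ∷ l) (i ↑ˡ sum l) ≡ (0 , toℕ i)
cell-↑ˡ a l i rewrite Finₚ.splitAt-↑ˡ a i (sum l) = refl

cell-↑ʳ : ∀ a l (j : Fin (sum l)) → cell (a ∷ l) (a ↑ʳ j) ≡ (suc (proj₁ (cell l j)) , proj₂ (cell l j))
cell-↑ʳ a l j rewrite Finₚ.splitAt-↑ʳ a (sum l) j = refl

data View (a b : ℕ) : Fin (a ℕ.+ b) → Set where
  left  : ∀ i → View a b (i ↑ˡ b)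
  right : ∀ j → View a b (a ↑ʳ j)

view : ∀ a b k → View a b k
view a b k with splitAt a k in eq
... | inj₁ i = subst (View a b) (Finₚ.splitAt⁻¹-↑ˡ eq) (left i)
... | inj₂ j = subst (View a b) (Finₚ.splitAt⁻¹-↑ʳ eq) (right j)

cell-valid : ∀ l i → proj₂ (cell l i) < nth l (proj₁ (cell l i))
cell-valid (a ∷ l) i with view a (sum l) i
... | left  i′ rewrite cell-↑ˡ a l i′ = Finₚ.toℕ<n i′
... | right j  rewrite cell-↑ʳ a l j = cell-valid l j

cell-injective : ∀ l {i j} → cell l i ≡ cell l j → i ≡ j
cell-injective (a ∷ l) {i} {j} eq with view a (sum l) i | view a (sum l) j
... | left i′  | left j′  rewrite cell-↑ˡ a l i′ | cell-↑ˡ a l j′ = cong (_↑ˡ sum l) (Finₚ.toℕ-injective (cong proj₂ eq))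
... | left i′  | right j′ rewrite cell-↑ˡ a l i′ | cell-↑ʳ a l j′ = contradiction (cong proj₁ eq) (λ ())
... | right i′ | left j′  rewrite cell-↑ʳ a l i′ | cell-↑ˡ a l j′ = contradiction (cong proj₁ eq) (λ ())
... | right i′ | right j′ rewrite cell-↑ʳ a l i′ | cell-↑ʳ a l j′ =
  cong (a ↑ʳ_) (cell-injective l (cong₂ _,_ (ℕₚ.suc-injective (cong proj₁ eq)) (cong proj₂ eq)))

cellAt : ∀ l r c → c < nth l r → ∃[ i ] cell l i ≡ (r , c)
cellAt (a ∷ l) zero    c c<a = fromℕ< c<a ↑ˡ sum l , trans (cell-↑ˡ a l (fromℕ< c<a)) (cong (0 ,_) (Finₚ.toℕ-fromℕ< c<a))
cellAt (a ∷ l) (suc r) c c<  with cellAt l r c c<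
... | i , eq = a ↑ʳ i , trans (cell-↑ʳ a l i) (cong (λ p → suc (proj₁ p) , proj₂ p) eq)

occ-row : ∀ l k → occ ℕ._≟_ (λ i → proj₁ (cell l i)) k ≡ nth l k
occ-row []      k = refl
occ-row (a ∷ l) k = trans (occ-↑ ℕ._≟_ a (λ i → proj₁ (cell (a ∷ l) i)) k) (trans
  (cong₂ ℕ._+_ (occ-cong ℕ._≟_ {y = λ _ → 0} (λ i → cong proj₁ (cell-↑ˡ a l i)) k)
    (occ-cong ℕ._≟_ {y = λ j → suc (proj₁ (cell l j))} (λ j → cong proj₁ (cell-↑ʳ a l j)) k))
  (count k))
  where
  count : ∀ k → occ ℕ._≟_ {a} (λ _ → 0) k ℕ.+ occ ℕ._≟_ (λ j → suc (proj₁ (cell l j))) k ≡ nth (a ∷ l) k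
  count zero    = trans (cong₂ ℕ._+_ (occ-const ℕ._≟_ {a} (λ _ → 0) 0 (λ _ → refl))
    (occ-zero ℕ._≟_ (λ j → suc (proj₁ (cell l j))) 0 (λ _ ()))) (ℕₚ.+-identityʳ a)
  count (suc k) = trans (cong₂ ℕ._+_ (occ-zero ℕ._≟_ {a} (λ _ → 0) (suc k) (λ _ ()))
    (occ-map ℕ._≟_ ℕ._≟_ ℕₚ.suc-injective (λ j → proj₁ (cell l j)) k)) (occ-row l k)

nth-decreasing : ∀ {l} → Linked _≥_ l → ∀ {i j} → i ≤ j → nth l j ≤ nth l i
nth-decreasing {[]}        _  _ = z≤n
nth-decreasing {a ∷ []}    _ {zero} {zero}   _ = ℕₚ.≤-refl
nth-decreasing {a ∷ []}    _ {_} {suc j} _ = z≤n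
nth-decreasing {a ∷ b ∷ l} _ {zero} {zero} _ = ℕₚ.≤-refl
nth-decreasing {a ∷ b ∷ l} (a≥b ∷ d) {zero} {suc j} _ = ℕₚ.≤-trans (nth-decreasing d {zero} {j} z≤n) a≥b
nth-decreasing {a ∷ b ∷ l} (a≥b ∷ d) {suc i} {suc j} (s≤s i≤j) = nth-decreasing d i≤j

-- For decreasing row lengths `T` the witness `h` is the height of column `j`.
firstDrop : ∀ (T : ℕ → ℕ) j k → T k ≤ j → ∃[ h ] h ≤ k × T h ≤ j × (∀ r → r < h → j < T r)
firstDrop T j zero    Tk≤j = 0 , z≤n , Tk≤j , λ r ()
firstDrop T j (suc k) Tk≤j with T 0 ℕ.≤? j
... | yes T0≤j = 0 , z≤n , T0≤j , λ r ()
... | no  T0≰j with firstDrop (T ∘ suc) j k Tk≤j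
...   | h , h≤k , Th≤j , before = suc h , s≤s h≤k , Th≤j , λ { zero _ → ℕₚ.≰⇒> T0≰j ; (suc r) (s≤s r<h) → before r r<h }

-- Filling the diagram of l so that no column repeats an entry: if the content is
-- lexicographically at least l, then entry k occurs exactly in the columns of row k.
module Filling (l : List ℕ) (dec : Linked _≥_ l) (x : Fin (sum l) → ℕ)
  (column-injective : ∀ i j → proj₂ (cell l i) ≡ proj₂ (cell l j) → x i ≡ x j → i ≡ j)
  (lex : ∀ k → (∀ i → i < k → occ ℕ._≟_ x i ≡ nth l i) → nth l k ≤ occ ℕ._≟_ x k) where

  private
    T : ℕ → ℕ
    T = nth l

    rowOf colOf : Fin (sum l) → ℕ
    rowOf i = proj₁ (cell l i)
    colOf i = proj₂ (cell l i)

  record Placed (k : ℕ) : Set where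
    field
      inside : ∀ i → x i ≡ k → colOf i < T k
      hits   : ∀ j → j < T k → ∃[ i ] x i ≡ k × colOf i ≡ j
      counts : occ ℕ._≟_ x k ≡ T k

  -- Suppose `k` stood in a column `j` that row `k` does not reach. That column has height `h ≤ k`,
  -- and by induction it already contains every entry below `h`, so its `h` cells would hold `h + 1`
  -- distinct entries. Hence the entries `k` occupy distinct columns among the first `T k`, and the
  -- lexicographic bound makes them fill all of these.
  step : ∀ k → (∀ r → r < k → Placed r) → Placed k
  step k before = record { inside = inside ; hits = hits ; counts = ℕₚ.≤-antisym count≤ count≥ }
    where
    count≥ : T k ≤ occ ℕ._≟_ x k
    count≥ = lex k (λ i i<k → Placed.counts (before i i<k))

    inside : ∀ i → x i ≡ k → colOf i < T k
    inside i₀ x≡k with colOf i₀ ℕ.<? T k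
    ... | yes inside = inside
    ... | no  outside with firstDrop T (colOf i₀) k (ℕₚ.≮⇒≥ outside)
    ...   | h , h≤k , Th≤j , above = contradiction collision λ { (c , c′ , c<c′ , same) → distinct c c′ c<c′ same }
      where
      j = colOf i₀

      -- An index below `h` selects the cell of that entry in column `j`; the last index `h` stands
      -- for the offending cell with entry `k`.
      pick : (c : Fin (suc h)) → Σ[ i ∈ Fin (sum l) ] colOf i ≡ j × ((toℕ c < h × x i ≡ toℕ c) ⊎ (¬ toℕ c < h × x i ≡ k))
      pick c with toℕ c ℕ.<? h
      ... | no  c≮h = i₀ , refl , inj₂ (c≮h , x≡k)
      ... | yes c<h with Placed.hits (before (toℕ c) (ℕₚ.<-≤-trans c<h h≤k)) j (above (toℕ c) c<h)
      ...   | i , x≡c , col≡j = i , col≡j , inj₁ (c<h , x≡c)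

      row<h : ∀ c → rowOf (proj₁ (pick c)) < h
      row<h c with rowOf (proj₁ (pick c)) ℕ.<? h
      ... | yes r<h = r<h
      ... | no  r≮h = contradiction (ℕₚ.<-≤-trans (cell-valid l (proj₁ (pick c))) (nth-decreasing dec (ℕₚ.≮⇒≥ r≮h)))
        (ℕₚ.≤⇒≯ (subst (T h ≤_) (sym (proj₁ (proj₂ (pick c)))) Th≤j))

      collision : ∃[ c ] ∃[ c′ ] c Fin.< c′ × rowOf (proj₁ (pick c)) ≡ rowOf (proj₁ (pick c′))
      collision with Finₚ.pigeonhole ℕₚ.≤-refl (λ c → fromℕ< (row<h c))
      ... | c , c′ , c<c′ , eq = c , c′ , c<c′ , trans (sym (Finₚ.toℕ-fromℕ< (row<h c))) (trans (cong toℕ eq) (Finₚ.toℕ-fromℕ< (row<h c′)))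

      distinct : ∀ c c′ → c Fin.< c′ → rowOf (proj₁ (pick c)) ≢ rowOf (proj₁ (pick c′))
      distinct c c′ c<c′ same with pick c | pick c′
      ... | i , col≡j , colour | i′ , col′≡j , colour′ with cell-injective l (cong₂ _,_ same (trans col≡j (sym col′≡j)))
      distinct c c′ c<c′ same | i , _ , inj₁ (_ , p) | i , _ , inj₁ (_ , p′) | refl = ℕₚ.<-irrefl (trans (sym p) p′) c<c′
      distinct c c′ c<c′ same | i , _ , inj₁ (c<h , p) | i , _ , inj₂ (_ , p′) | refl = ℕₚ.<-irrefl (trans (sym p) p′) (ℕₚ.<-≤-trans c<h h≤k)
      distinct c c′ c<c′ same | i , _ , inj₂ (c≮h , _) | i , _ , _ | refl =
        c≮h (ℕₚ.<-≤-trans c<c′ (ℕ.s≤s⁻¹ (Finₚ.toℕ<n c′)))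

    entry = positions ℕ._≟_ x k
    e = proj₁ entry

    column : Fin (occ ℕ._≟_ x k) → Fin (T k)
    column c = fromℕ< (inside (e c) (proj₂ (proj₂ entry) c))

    column-inj : Injective _≡_ _≡_ column
    column-inj {c} {d} eq = proj₁ (proj₂ entry) (column-injective (e c) (e d)
      (trans (sym (Finₚ.toℕ-fromℕ< _)) (trans (cong toℕ eq) (Finₚ.toℕ-fromℕ< _)))
      (trans (proj₂ (proj₂ entry) c) (sym (proj₂ (proj₂ entry) d))))

    count≤ : occ ℕ._≟_ x k ≤ T k
    count≤ = Finₚ.injective⇒≤ column-inj

    hits : ∀ j → j < T k → ∃[ i ] x i ≡ k × colOf i ≡ j
    hits j j<Tk with injective⇒surjective column-inj count≥ (fromℕ< j<Tk)
    ... | c , eq = e c , proj₂ (proj₂ entry) c , trans (sym (Finₚ.toℕ-fromℕ< _)) (trans (cong toℕ eq) (Finₚ.toℕ-fromℕ< j<Tk))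

  placed-below : ∀ k r → r < k → Placed r
  placed-below (suc k) r (s≤s r≤k) = step r (λ r′ r′<r → placed-below k r′ (ℕₚ.<-≤-trans r′<r r≤k))

  placed : ∀ k → Placed k
  placed k = placed-below (suc k) k ℕₚ.≤-refl

  rearrange : ∀ i → ∃[ i′ ] cell l i′ ≡ (x i , colOf i)
  rearrange i = cellAt l (x i) (colOf i) (Placed.inside (placed (x i)) i refl)

  -- Each cell moves, within its column, to the row named by its entry. This is the column
  -- permutation that carries the row numbering to the filling `x`; it is injective because a
  -- repeated target would be a repeated entry in one column.
  sorting : Permutation′ (sum l)
  sorting = injective⇒permutation (proj₁ ∘ rearrange) (λ {i} {j} eq →
    let same = trans (sym (proj₂ (rearrange i))) (trans (cong (cell l) eq) (proj₂ (rearrange j)))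
    in column-injective i j (cong proj₂ same) (cong proj₁ same))

-- The Young symmetrizer

LeftInvariant RightCovariant : (θ : Partition) → ℚ[S ∣ θ ∣ ] → Set
LeftInvariant  θ y = ∀ p σ → (∀ i → row θ (p ⟨$⟩ʳ i) ≡ row θ i) → y (p ∙ σ) ≡ y σ
RightCovariant θ y = ∀ q σ → (∀ i → col θ (q ⟨$⟩ʳ i) ≡ col θ i) → y (σ ∙ q) ≡ sgn q * y σ

-- By `von-neumann` these functions form the line spanned by the Young symmetrizer.
record Covariant (θ : Partition) (y : ℚ[S ∣ θ ∣ ]) : Set where
  field
    respects  : Respects≈ y
    invariant : LeftInvariant θ y
    covariant : RightCovariant θ y

⋆-covariant : ∀ θ x y → Respects≈ x → LeftInvariant θ x → Respects≈ y → RightCovariant θ y → Covariant θ (x ⋆ y)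
⋆-covariant θ x y rx lx ry cy = record
  { respects  = ⋆-respects x y ry
  ; invariant = λ p σ p∈R → trans
      (∑ᴳ-left p (λ g → x g * y (g ⁻¹ ∙ (p ∙ σ))) (λ g h g≈h → cong₂ _*_ (rx g h g≈h)
        (ry (g ⁻¹ ∙ (p ∙ σ)) (h ⁻¹ ∙ (p ∙ σ)) (λ i → flip-cong {π = g} {ρ = h} g≈h (p ⟨$⟩ʳ (σ ⟨$⟩ʳ i))))))
      (∑ᴳ-cong (λ g → cong₂ _*_ (lx p g p∈R) (ry ((p ∙ g) ⁻¹ ∙ (p ∙ σ)) (g ⁻¹ ∙ σ) (λ i → cong (g ⟨$⟩ˡ_) (Perm.inverseˡ p)))))
  ; covariant = λ q σ q∈C → trans
      (∑ᴳ-cong (λ g → trans (cong (x g *_) (trans (ry (g ⁻¹ ∙ (σ ∙ q)) ((g ⁻¹ ∙ σ) ∙ q) (λ i → refl)) (cy q (g ⁻¹ ∙ σ) q∈C)))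
        (solve 3 (λ u s v → u :* (s :* v) := s :* (u :* v)) refl (x g) (sgn q) (y (g ⁻¹ ∙ σ)))))
      (sym (∑ᴳ-*ˡ (sgn q) (λ g → x g * y (g ⁻¹ ∙ σ))))
  }
  where open +-*-Solver

⋆-assoc : ∀ {n} (x y z : ℚ[S n ]) → Respects≈ y → Respects≈ z → ∀ σ → ((x ⋆ y) ⋆ z) σ ≡ (x ⋆ (y ⋆ z)) σ
⋆-assoc {n} x y z ry rz σ = begin
  ∑ᴳ n (λ g → ∑ᴳ n (λ h → x h * y (h ⁻¹ ∙ g)) * z (g ⁻¹ ∙ σ))
    ≡⟨ ∑ᴳ-cong (λ g → ∑ᴳ-*ʳ (z (g ⁻¹ ∙ σ)) (λ h → x h * y (h ⁻¹ ∙ g))) ⟩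
  ∑ᴳ n (λ g → ∑ᴳ n (λ h → x h * y (h ⁻¹ ∙ g) * z (g ⁻¹ ∙ σ)))
    ≡⟨ ∑ᴳ-comm (λ g h → x h * y (h ⁻¹ ∙ g) * z (g ⁻¹ ∙ σ)) ⟩
  ∑ᴳ n (λ h → ∑ᴳ n (λ g → x h * y (h ⁻¹ ∙ g) * z (g ⁻¹ ∙ σ)))
    ≡⟨ ∑ᴳ-cong (λ h → ∑ᴳ-left h (λ g → x h * y (h ⁻¹ ∙ g) * z (g ⁻¹ ∙ σ)) (λ g g′ g≈g′ → cong₂ (λ u v → x h * u * v)
         (ry _ _ (λ i → cong (h ⟨$⟩ˡ_) (g≈g′ i))) (rz _ _ (λ i → flip-cong {π = g} {ρ = g′} g≈g′ (σ ⟨$⟩ʳ i))))) ⟩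
  ∑ᴳ n (λ h → ∑ᴳ n (λ g → x h * y (h ⁻¹ ∙ (h ∙ g)) * z ((h ∙ g) ⁻¹ ∙ σ)))
    ≡⟨ ∑ᴳ-cong (λ h → ∑ᴳ-cong (λ g → trans (cong₂ (λ u v → x h * u * v)
         (ry (h ⁻¹ ∙ (h ∙ g)) g (λ i → Perm.inverseˡ h)) (rz ((h ∙ g) ⁻¹ ∙ σ) (g ⁻¹ ∙ (h ⁻¹ ∙ σ)) (λ i → refl))) (ℚₚ.*-assoc (x h) (y g) (z (g ⁻¹ ∙ (h ⁻¹ ∙ σ)))))) ⟩
  ∑ᴳ n (λ h → ∑ᴳ n (λ g → x h * (y g * z (g ⁻¹ ∙ (h ⁻¹ ∙ σ)))))
    ≡⟨ ∑ᴳ-cong (λ h → sym (∑ᴳ-*ˡ (x h) (λ g → y g * z (g ⁻¹ ∙ (h ⁻¹ ∙ σ))))) ⟩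
  ∑ᴳ n (λ h → x h * ∑ᴳ n (λ g → y g * z (g ⁻¹ ∙ (h ⁻¹ ∙ σ)))) ∎
  where open ≡-Reasoning

module Young (θ : Partition) where

  n : ℕ
  n = ∣ θ ∣

  rows : ℚ[S n ]
  rows = rowSymmetrizer θ

  columns : ℚ[S n ]
  columns = columnAntisymmetrizer θ

  c : ℚ[S n ]
  c = youngSymmetrizer θ

  InRows InColumns : Permutation′ n → Set
  InRows    σ = ∀ i → row θ (σ ⟨$⟩ʳ i) ≡ row θ i
  InColumns σ = ∀ i → col θ (σ ⟨$⟩ʳ i) ≡ col θ i

  inRows? : ∀ σ → Dec (InRows σ)
  inRows? σ = all? (λ i → row θ (σ ⟨$⟩ʳ i) ℕ.≟ row θ i)

  inColumns? : ∀ σ → Dec (InColumns σ)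
  inColumns? σ = all? (λ i → col θ (σ ⟨$⟩ʳ i) ℕ.≟ col θ i)

  columns-𝟙 : ∀ σ → columns σ ≡ 𝟙 (inColumns? σ) * sgn σ
  columns-𝟙 σ with does (inColumns? σ)
  ... | true  = sym (ℚₚ.*-identityˡ (sgn σ))
  ... | false = sym (ℚₚ.*-zeroˡ (sgn σ))

  inverse-invariant : (f : Fin n → ℕ) (σ : Permutation′ n) → (∀ i → f (σ ⟨$⟩ʳ i) ≡ f i) → ∀ i → f (σ ⟨$⟩ˡ i) ≡ f i
  inverse-invariant f σ inv i = trans (sym (inv (σ ⟨$⟩ˡ i))) (cong f (Perm.inverseʳ σ))

  rows-respects : Respects≈ rows
  rows-respects σ τ σ≈τ = 𝟙-⇔ (inRows? σ) (inRows? τ)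
    (λ p i → trans (cong (row θ) (sym (σ≈τ i))) (p i)) (λ p i → trans (cong (row θ) (σ≈τ i)) (p i))

  rows-invariant : LeftInvariant θ rows
  rows-invariant p σ p∈R = 𝟙-⇔ (inRows? (p ∙ σ)) (inRows? σ)
    (λ r i → trans (sym (p∈R (σ ⟨$⟩ʳ i))) (r i)) (λ r i → trans (p∈R (σ ⟨$⟩ʳ i)) (r i))

  rows-⁻¹ : ∀ σ → rows (σ ⁻¹) ≡ rows σ
  rows-⁻¹ σ = 𝟙-⇔ (inRows? (σ ⁻¹)) (inRows? σ) (inverse-invariant (row θ) (σ ⁻¹)) (inverse-invariant (row θ) σ)

  columns-covariant : RightCovariant θ columns
  columns-covariant q σ q∈C = begin
    columns (σ ∙ q)                               ≡⟨ columns-𝟙 (σ ∙ q) ⟩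
    𝟙 (inColumns? (σ ∙ q)) * sgn (σ ∙ q)          ≡⟨ cong₂ _*_ (𝟙-⇔ (inColumns? (σ ∙ q)) (inColumns? σ) restrict (λ r i → trans (r (q ⟨$⟩ʳ i)) (q∈C i))) (sgn-∙ σ q) ⟩
    𝟙 (inColumns? σ) * (sgn σ * sgn q)            ≡⟨ solve 3 (λ u s t → u :* (s :* t) := t :* (u :* s)) refl (𝟙 (inColumns? σ)) (sgn σ) (sgn q) ⟩
    sgn q * (𝟙 (inColumns? σ) * sgn σ)            ≡⟨ cong (sgn q *_) (sym (columns-𝟙 σ)) ⟩
    sgn q * columns σ ∎
    where
    open ≡-Reasoning
    open +-*-Solver
    restrict : InColumns (σ ∙ q) → InColumns σ
    restrict r i = begin
      col θ (σ ⟨$⟩ʳ i)                              ≡⟨ cong (λ j → col θ (σ ⟨$⟩ʳ j)) (sym (Perm.inverseʳ q)) ⟩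
      col θ (σ ⟨$⟩ʳ (q ⟨$⟩ʳ (q ⟨$⟩ˡ i)))            ≡⟨ r (q ⟨$⟩ˡ i) ⟩
      col θ (q ⟨$⟩ˡ i)                              ≡⟨ inverse-invariant (col θ) q q∈C i ⟩
      col θ i ∎

  columns-⁻¹ : ∀ σ → columns (σ ⁻¹) ≡ columns σ
  columns-⁻¹ σ = begin
    columns (σ ⁻¹)                                ≡⟨ columns-𝟙 (σ ⁻¹) ⟩
    𝟙 (inColumns? (σ ⁻¹)) * sgn (σ ⁻¹)            ≡⟨ cong₂ _*_ (𝟙-⇔ (inColumns? (σ ⁻¹)) (inColumns? σ) (inverse-invariant (col θ) (σ ⁻¹)) (inverse-invariant (col θ) σ)) (sgn-⁻¹ σ) ⟩
    𝟙 (inColumns? σ) * sgn σ                      ≡⟨ sym (columns-𝟙 σ) ⟩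
    columns σ ∎
    where open ≡-Reasoning

  columns-respects : Respects≈ columns
  columns-respects = columnAntisymmetrizer-respects θ

  c-covariant : Covariant θ c
  c-covariant = ⋆-covariant θ rows columns rows-respects rows-invariant columns-respects columns-covariant

  c-respects : Respects≈ c
  c-respects = Covariant.respects c-covariant

  -- A permutation preserving both the row and the column of every cell is the identity, so a single
  -- term of the convolution survives.
  c-id : c idₚ ≡ 1ℚ
  c-id = trans
    (∑ᴳ-single (λ g → rows g * columns (g ⁻¹ ∙ idₚ)) (λ g h g≈h → cong₂ _*_ (rows-respects g h g≈h)
        (columns-respects (g ⁻¹ ∙ idₚ) (h ⁻¹ ∙ idₚ) (flip-cong {π = g} {ρ = h} g≈h))) idₚ vanish)
    (cong₂ _*_ (𝟙-yes (inRows? idₚ) (λ i → refl))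
      (trans (columns-𝟙 (ι)) (cong₂ _*_ (𝟙-yes (inColumns? (ι)) (λ i → refl)) (sgn-id (ι) (λ i → refl)))))
    where
    ι : Permutation′ n
    ι = idₚ ⁻¹ ∙ idₚ

    vanish : ∀ g → ¬ g ≈ₚ idₚ → rows g * columns (g ⁻¹ ∙ idₚ) ≡ 0ℚ
    vanish g g≉id with inRows? g | inColumns? (g ⁻¹ ∙ idₚ)
    ... | no  g∉R | _       = trans (cong (_* columns (g ⁻¹ ∙ idₚ)) (𝟙-no (inRows? g) g∉R)) (ℚₚ.*-zeroˡ (columns (g ⁻¹ ∙ idₚ)))
    ... | yes _   | no  g∉C = trans (cong (rows g *_) (trans (columns-𝟙 (g ⁻¹ ∙ idₚ)) (trans
      (cong (_* sgn (g ⁻¹ ∙ idₚ)) (𝟙-no (inColumns? (g ⁻¹ ∙ idₚ)) g∉C)) (ℚₚ.*-zeroˡ (sgn (g ⁻¹ ∙ idₚ)))))) (ℚₚ.*-zeroʳ (rows g))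
    ... | yes g∈R | yes g∈C = contradiction (λ i → cell-injective (parts θ) (cong₂ _,_ (g∈R i) (inverse-invariant (col θ) (g ⁻¹) g∈C i))) g≉id

  Collision : (Fin n → ℕ) → Set
  Collision x = ∃[ i ] ∃[ j ] i ≢ j × col θ i ≡ col θ j × x i ≡ x j

  collision? : ∀ x → Dec (Collision x)
  collision? x = any? (λ i → any? (λ j → ¬? (i ≟ᶠ j) ×-dec ((col θ i ℕ.≟ col θ j) ×-dec (x i ℕ.≟ x j))))

  column-injective : ∀ x → ¬ Collision x → ∀ i j → col θ i ≡ col θ j → x i ≡ x j → i ≡ j
  column-injective x none i j col≡ x≡ with i ≟ᶠ j
  ... | yes i≡j = i≡j
  ... | no  i≢j = contradiction (i , j , i≢j , col≡ , x≡) none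

  -- If `σ` takes two cells of one column into one row, their transposition `t` is a column
  -- permutation while its conjugate by `σ` is a row permutation. The two covariance rules then give
  -- `y σ = - y σ`.
  collision⇒zero : ∀ {y} → Covariant θ y → ∀ σ → Collision (λ i → row θ (σ ⟨$⟩ʳ i)) → y σ ≡ 0ℚ
  collision⇒zero {y} cov σ (i , j , i≢j , col≡ , row≡) = x≡-x⇒x≡0 (begin
    y σ                     ≡⟨ sym (invariant p σ p∈R) ⟩
    y (p ∙ σ)               ≡⟨ respects _ _ (λ k → cong (λ l → σ ⟨$⟩ʳ (t ⟨$⟩ʳ l)) (Perm.inverseˡ σ)) ⟩
    y (σ ∙ t)               ≡⟨ covariant t σ (transpose-invariant (col θ) col≡) ⟩
    sgn t * y σ             ≡⟨ cong (_* y σ) (sgn-transpose i≢j) ⟩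
    - 1ℚ * y σ              ≡⟨ sym (ℚₚ.neg-distribˡ-* 1ℚ (y σ)) ⟩
    - (1ℚ * y σ)            ≡⟨ cong -_ (ℚₚ.*-identityˡ (y σ)) ⟩
    - y σ ∎)
    where
    open ≡-Reasoning
    open Covariant cov
    t p : Permutation′ n
    t = transpose i j
    p = σ ∙ (t ∙ σ ⁻¹)
    p∈R : InRows p
    p∈R k = trans (transpose-invariant (λ l → row θ (σ ⟨$⟩ʳ l)) row≡ (σ ⟨$⟩ˡ k)) (cong (row θ) (Perm.inverseʳ σ))

  -- Either `σ` has a collision and both sides vanish, or `σ` factors as a row permutation after a
  -- column permutation, and covariance reduces `y σ` to `y idₚ` by the same sign that it gives for
  -- `c`.
  von-neumann : ∀ {y} → Covariant θ y → ∀ σ → y σ ≡ y idₚ * c σ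
  von-neumann {y} cov σ with collision? (λ i → row θ (σ ⟨$⟩ʳ i))
  ... | yes col = trans (collision⇒zero cov σ col) (sym (trans (cong (y idₚ *_) (collision⇒zero c-covariant σ col)) (ℚₚ.*-zeroʳ (y idₚ))))
  ... | no  none = begin
    y σ                      ≡⟨ factor cov ⟩
    sgn q * y idₚ            ≡⟨ ℚₚ.*-comm (sgn q) (y idₚ) ⟩
    y idₚ * sgn q            ≡⟨ cong (y idₚ *_) (sym (trans (factor c-covariant) (trans (cong (sgn q *_) c-id) (ℚₚ.*-identityʳ (sgn q))))) ⟩
    y idₚ * c σ ∎
    where
    open ≡-Reasoning
    x : Fin n → ℕ
    x i = row θ (σ ⟨$⟩ʳ i)

    content : ∀ k → occ ℕ._≟_ x k ≡ nth (parts θ) k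
    content k = trans (occ-permute ℕ._≟_ (row θ) σ k) (occ-row (parts θ) k)

    -- The row word of `σ` is a rearrangement of the row numbering, so its content is exactly `θ`
    -- and the lexicographic condition holds with equality.
    open Filling (parts θ) (decreasing θ) x (column-injective x none) (λ k _ → ℕₚ.≤-reflexive (sym (content k)))

    q p : Permutation′ n
    q = sorting
    p = σ ∙ q ⁻¹

    p∈R : InRows p
    p∈R k = trans (sym (cong proj₁ (proj₂ (rearrange (q ⟨$⟩ˡ k))))) (cong (row θ) (Perm.inverseʳ q))

    q∈C : InColumns q
    q∈C i = cong proj₂ (proj₂ (rearrange i))

    factor : ∀ {y} → Covariant θ y → y σ ≡ sgn q * y idₚ
    factor {y} cov = begin
      y σ               ≡⟨ respects _ _ (λ i → cong (σ ⟨$⟩ʳ_) (sym (Perm.inverseˡ q))) ⟩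
      y (p ∙ q)         ≡⟨ invariant p q p∈R ⟩
      y q               ≡⟨ respects _ _ (λ i → refl) ⟩
      y (idₚ ∙ q)       ≡⟨ covariant q idₚ q∈C ⟩
      sgn q * y idₚ ∎
      where open Covariant cov

  κ : ℚ
  κ = (c ⋆ c) idₚ

  c⋆c : ∀ σ → (c ⋆ c) σ ≡ κ * c σ
  c⋆c = von-neumann (⋆-covariant θ c c c-respects (Covariant.invariant c-covariant) c-respects (Covariant.covariant c-covariant))

  -- Right multiplication by `c` is the scalar `κ` on the left ideal. It is the map whose trace,
  -- combined with the action of `g`, is computed in two ways below.
  Specht-⋆c : ∀ {y} → Specht θ y → ∀ σ → (y ⋆ c) σ ≡ κ * y σ
  Specht-⋆c {y} (x , y≐) σ = begin
    (y ⋆ c) σ                                            ≡⟨ ∑ᴳ-cong (λ g → cong (_* c (g ⁻¹ ∙ σ)) (y≐ g)) ⟩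
    ((x ⋆ c) ⋆ c) σ                                      ≡⟨ ⋆-assoc x c c c-respects c-respects σ ⟩
    ∑ᴳ n (λ g → x g * (c ⋆ c) (g ⁻¹ ∙ σ))                ≡⟨ ∑ᴳ-cong (λ g → trans (cong (x g *_) (c⋆c (g ⁻¹ ∙ σ)))
                                                             (solve 3 (λ u k v → u :* (k :* v) := k :* (u :* v)) refl (x g) κ (c (g ⁻¹ ∙ σ)))) ⟩
    ∑ᴳ n (λ g → κ * (x g * c (g ⁻¹ ∙ σ)))                ≡⟨ sym (∑ᴳ-*ˡ κ (λ g → x g * c (g ⁻¹ ∙ σ))) ⟩
    κ * (x ⋆ c) σ                                        ≡⟨ cong (κ *_) (sym (y≐ σ)) ⟩
    κ * y σ ∎
    where
    open ≡-Reasoning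
    open +-*-Solver

  -- The trace as a class sum, and its norm

  open Elimination.Echelon (Specht-echelon θ) using (dim; basis; pivot; member; dual; span)

  φ : Permutation′ n → ℚ
  φ g = proj₁ (Specht-trace θ g)

  classSum : Permutation′ n → ℚ
  classSum g = ∑ᴳ n (λ h → c (h ⁻¹ ∙ (g ⁻¹ ∙ h)))

  -- Both sides are the trace on the whole group algebra of y ↦ g ∙ y ⋆ c.
  trace-formula : ∀ g → κ * φ g ≡ classSum g
  trace-formula g = begin
    κ * (∑[ i < dim ] basis i (g ⁻¹ ∙ pivot i))
      ≡⟨ *-distribˡ-sum κ (λ i → basis i (g ⁻¹ ∙ pivot i)) ⟩
    (∑[ i < dim ] (κ * basis i (g ⁻¹ ∙ pivot i)))
      ≡⟨ sum-cong-≗ (λ i → sym (Specht-⋆c (member i) (g ⁻¹ ∙ pivot i))) ⟩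
    (∑[ i < dim ] ∑ᴳ n (λ h → basis i h * c (h ⁻¹ ∙ (g ⁻¹ ∙ pivot i))))
      ≡⟨ sum-cong-≗ (λ i → trans
           (∑ᴳ-left (g ⁻¹) (λ h → basis i h * c (h ⁻¹ ∙ (g ⁻¹ ∙ pivot i))) (λ h h′ h≈h′ → cong₂ _*_ (Specht-respects θ (member i) h h′ h≈h′)
             (c-respects (h ⁻¹ ∙ (g ⁻¹ ∙ pivot i)) (h′ ⁻¹ ∙ (g ⁻¹ ∙ pivot i)) (λ j → flip-cong {π = h} {ρ = h′} h≈h′ (g ⟨$⟩ˡ (pivot i ⟨$⟩ʳ j))))))
           (∑ᴳ-cong (λ h → trans (cong (basis i (g ⁻¹ ∙ h) *_) (c-respects ((g ⁻¹ ∙ h) ⁻¹ ∙ (g ⁻¹ ∙ pivot i)) (h ⁻¹ ∙ pivot i) (λ j → cong (h ⟨$⟩ˡ_) (Perm.inverseʳ g))))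
             (ℚₚ.*-comm (basis i (g ⁻¹ ∙ h)) (c (h ⁻¹ ∙ pivot i)))))) ⟩
    (∑[ i < dim ] ∑ᴳ n (λ h → (h ▹ c) (pivot i) * basis i (g ⁻¹ ∙ h)))
      ≡⟨ ∑-comm (λ i k → (perm n k ▹ c) (pivot i) * basis i (g ⁻¹ ∙ perm n k)) ⟩
    ∑ᴳ n (λ h → ∑[ i < dim ] ((h ▹ c) (pivot i) * basis i (g ⁻¹ ∙ h)))
      -- The inner sum is the pivot expansion of `h ▹ c`, evaluated at `g ⁻¹ ∙ h`.
      ≡⟨ sum-cong-≗ (λ k → sym (span k (g ⁻¹ ∙ perm n k))) ⟩
    classSum g ∎
    where open ≡-Reasoning

  -- The trace formula at the identity: the trace there is the dimension, and every term of the
  -- class sum is `c idₚ`. Its purpose is that `κ` cannot vanish.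
  κ*dim : κ * fromℕℚ dim ≡ fromℕℚ (n !)
  κ*dim = begin
    κ * (∑[ i < dim ] 1ℚ)
      ≡⟨ cong (κ *_) (sum-cong-≗ (λ i → sym (trans (Specht-respects θ (member i) _ _ (λ j → refl)) (trans (dual i i) (𝟙-yes (i ≟ᶠ i) refl))))) ⟩
    κ * φ idₚ
      ≡⟨ trace-formula idₚ ⟩
    ∑ᴳ n (λ h → c (h ⁻¹ ∙ (idₚ ⁻¹ ∙ h)))
      ≡⟨ ∑ᴳ-cong (λ h → trans (c-respects (h ⁻¹ ∙ (idₚ ⁻¹ ∙ h)) idₚ (λ j → Perm.inverseˡ h)) c-id) ⟩
    fromℕℚ (n !) ∎
    where open ≡-Reasoning

  fromℕℚ-!≢0 : ∀ m → fromℕℚ (m !) ≢ 0ℚ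
  fromℕℚ-!≢0 m with m ! | ℕₚ.n≢0⇒n>0 (ℕ.≢-nonZero⁻¹ (m !) {{m ℕₚ.!≢0}})
  ... | suc k | _ = fromℕℚ-suc≢0 k

  κ≢0 : κ ≢ 0ℚ
  κ≢0 κ≡0 = fromℕℚ-!≢0 n (trans (sym κ*dim) (trans (cong (_* fromℕℚ dim) κ≡0) (ℚₚ.*-zeroˡ (fromℕℚ dim))))

  IsClassFunction : (Permutation′ n → ℚ) → Set
  IsClassFunction F = ∀ h g → F (h ∙ (g ∙ h ⁻¹)) ≡ F g

  classSum-respects : Respects≈ classSum
  classSum-respects g g′ g≈g′ = ∑ᴳ-cong (λ h → c-respects (h ⁻¹ ∙ (g ⁻¹ ∙ h)) (h ⁻¹ ∙ (g′ ⁻¹ ∙ h)) (λ i → cong (h ⟨$⟩ˡ_) (flip-cong {π = g} {ρ = g′} g≈g′ (h ⟨$⟩ʳ i))))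

  classSum-class : IsClassFunction classSum
  classSum-class k g = trans
    (∑ᴳ-left k (λ h → c (h ⁻¹ ∙ ((k ∙ (g ∙ k ⁻¹)) ⁻¹ ∙ h))) (λ h h′ h≈h′ → c-respects
      (h ⁻¹ ∙ ((k ∙ (g ∙ k ⁻¹)) ⁻¹ ∙ h)) (h′ ⁻¹ ∙ ((k ∙ (g ∙ k ⁻¹)) ⁻¹ ∙ h′))
      (λ i → trans (flip-cong {π = h} {ρ = h′} h≈h′ _) (cong (λ j → h′ ⟨$⟩ˡ (k ⟨$⟩ʳ (g ⟨$⟩ˡ (k ⟨$⟩ˡ j)))) (h≈h′ i)))))
    (∑ᴳ-cong (λ h → c-respects ((k ∙ h) ⁻¹ ∙ ((k ∙ (g ∙ k ⁻¹)) ⁻¹ ∙ (k ∙ h))) (h ⁻¹ ∙ (g ⁻¹ ∙ h)) (λ i → cong (h ⟨$⟩ˡ_)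
      (trans (Perm.inverseˡ k) (cong (g ⟨$⟩ˡ_) (Perm.inverseˡ k))))))

  -- Inverting the argument reverses the order of the row factor and the column factor of `c`. The
  -- sum over all conjugates lets the two factors rotate cyclically, which restores the order, and
  -- each factor is itself invariant under inversion.
  classSum-⁻¹ : ∀ g → classSum (g ⁻¹) ≡ classSum g
  classSum-⁻¹ g = begin
    ∑ᴳ n (λ h → ∑ᴳ n (λ k → rows k * columns (k ⁻¹ ∙ (h ⁻¹ ∙ (g ∙ h)))))
      ≡⟨ ∑ᴳ-comm (λ h k → rows k * columns (k ⁻¹ ∙ (h ⁻¹ ∙ (g ∙ h)))) ⟩
    ∑ᴳ n (λ k → ∑ᴳ n (λ h → rows k * columns (k ⁻¹ ∙ (h ⁻¹ ∙ (g ∙ h)))))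
      ≡⟨ ∑ᴳ-cong (λ k → ∑ᴳ-cong (λ h → cong (rows k *_)
           (trans (sym (columns-⁻¹ (k ⁻¹ ∙ (h ⁻¹ ∙ (g ∙ h))))) (columns-respects ((k ⁻¹ ∙ (h ⁻¹ ∙ (g ∙ h))) ⁻¹) (h ⁻¹ ∙ (g ⁻¹ ∙ (h ∙ k))) (λ i → refl))))) ⟩
    ∑ᴳ n (λ k → ∑ᴳ n (λ h → rows k * columns (h ⁻¹ ∙ (g ⁻¹ ∙ (h ∙ k)))))
      ≡⟨ ∑ᴳ-cong (λ k → ∑ᴳ-right (k ⁻¹) (λ h → rows k * columns (h ⁻¹ ∙ (g ⁻¹ ∙ (h ∙ k)))) (λ h h′ h≈h′ → cong (rows k *_)
           (columns-respects (h ⁻¹ ∙ (g ⁻¹ ∙ (h ∙ k))) (h′ ⁻¹ ∙ (g ⁻¹ ∙ (h′ ∙ k)))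
             (λ i → trans (flip-cong {π = h} {ρ = h′} h≈h′ _) (cong (λ j → h′ ⟨$⟩ˡ (g ⟨$⟩ˡ j)) (h≈h′ _)))))) ⟩
    ∑ᴳ n (λ k → ∑ᴳ n (λ h → rows k * columns ((h ∙ k ⁻¹) ⁻¹ ∙ (g ⁻¹ ∙ ((h ∙ k ⁻¹) ∙ k)))))
      ≡⟨ ∑ᴳ-cong (λ k → ∑ᴳ-cong (λ h → cong (rows k *_)
           (columns-respects ((h ∙ k ⁻¹) ⁻¹ ∙ (g ⁻¹ ∙ ((h ∙ k ⁻¹) ∙ k))) (k ∙ (h ⁻¹ ∙ (g ⁻¹ ∙ h))) (λ i → cong (λ j → k ⟨$⟩ʳ (h ⟨$⟩ˡ (g ⟨$⟩ˡ (h ⟨$⟩ʳ j)))) (Perm.inverseˡ k))))) ⟩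
    ∑ᴳ n (λ k → ∑ᴳ n (λ h → rows k * columns (k ∙ (h ⁻¹ ∙ (g ⁻¹ ∙ h)))))
      ≡⟨ ∑ᴳ-inverse (λ k → ∑ᴳ n (λ h → rows k * columns (k ∙ (h ⁻¹ ∙ (g ⁻¹ ∙ h))))) (λ k k′ k≈k′ → ∑ᴳ-cong (λ h → cong₂ _*_
           (rows-respects k k′ k≈k′) (columns-respects (k ∙ (h ⁻¹ ∙ (g ⁻¹ ∙ h))) (k′ ∙ (h ⁻¹ ∙ (g ⁻¹ ∙ h))) (λ i → k≈k′ (h ⟨$⟩ˡ (g ⟨$⟩ˡ (h ⟨$⟩ʳ i))))))) ⟩
    ∑ᴳ n (λ k → ∑ᴳ n (λ h → rows (k ⁻¹) * columns (k ⁻¹ ∙ (h ⁻¹ ∙ (g ⁻¹ ∙ h)))))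
      ≡⟨ ∑ᴳ-cong (λ k → ∑ᴳ-cong (λ h → cong (_* columns (k ⁻¹ ∙ (h ⁻¹ ∙ (g ⁻¹ ∙ h)))) (rows-⁻¹ k))) ⟩
    ∑ᴳ n (λ k → ∑ᴳ n (λ h → rows k * columns (k ⁻¹ ∙ (h ⁻¹ ∙ (g ⁻¹ ∙ h)))))
      ≡⟨ sym (∑ᴳ-comm (λ h k → rows k * columns (k ⁻¹ ∙ (h ⁻¹ ∙ (g ⁻¹ ∙ h))))) ⟩
    ∑ᴳ n (λ h → ∑ᴳ n (λ k → rows k * columns (k ⁻¹ ∙ (h ⁻¹ ∙ (g ⁻¹ ∙ h))))) ∎
    where open ≡-Reasoning

  -- A class function takes the same value on all conjugates, so each of the `n !` conjugates of `c`
  -- in `classSum` pairs with it equally.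
  pairing : ∀ F → Respects≈ F → IsClassFunction F → ∑ᴳ n (λ g → classSum g * F g) ≡ fromℕℚ (n !) * ∑ᴳ n (λ g → c (g ⁻¹) * F g)
  pairing F rF class = begin
    ∑ᴳ n (λ g → classSum g * F g)
      ≡⟨ ∑ᴳ-cong (λ g → ∑ᴳ-*ʳ (F g) (λ h → c (h ⁻¹ ∙ (g ⁻¹ ∙ h)))) ⟩
    ∑ᴳ n (λ g → ∑ᴳ n (λ h → c (h ⁻¹ ∙ (g ⁻¹ ∙ h)) * F g))
      ≡⟨ ∑ᴳ-comm (λ g h → c (h ⁻¹ ∙ (g ⁻¹ ∙ h)) * F g) ⟩
    ∑ᴳ n (λ h → ∑ᴳ n (λ g → c (h ⁻¹ ∙ (g ⁻¹ ∙ h)) * F g))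
      ≡⟨ ∑ᴳ-cong (λ h → conjugate h) ⟩
    ∑ᴳ n (λ h → ∑ᴳ n (λ g → c (g ⁻¹) * F g))
      ≡⟨ ∑-const (n !) (∑ᴳ n (λ g → c (g ⁻¹) * F g)) ⟩
    fromℕℚ (n !) * ∑ᴳ n (λ g → c (g ⁻¹) * F g) ∎
    where
    open ≡-Reasoning
    conjugate : ∀ h → ∑ᴳ n (λ g → c (h ⁻¹ ∙ (g ⁻¹ ∙ h)) * F g) ≡ ∑ᴳ n (λ g → c (g ⁻¹) * F g)
    conjugate h = trans
      (∑ᴳ-bijection (λ g → c (h ⁻¹ ∙ (g ⁻¹ ∙ h)) * F g)
        (λ g g′ g≈g′ → cong₂ _*_ (c-respects (h ⁻¹ ∙ (g ⁻¹ ∙ h)) (h ⁻¹ ∙ (g′ ⁻¹ ∙ h)) (λ i → cong (h ⟨$⟩ˡ_) (flip-cong {π = g} {ρ = g′} g≈g′ (h ⟨$⟩ʳ i)))) (rF g g′ g≈g′))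
        (λ g → h ∙ (g ∙ h ⁻¹)) (λ g → h ⁻¹ ∙ (g ∙ h))
        (λ g g′ g≈g′ i → cong (h ⟨$⟩ʳ_) (g≈g′ _)) (λ g g′ g≈g′ i → cong (h ⟨$⟩ˡ_) (g≈g′ _))
        (λ g i → trans (Perm.inverseʳ h) (cong (g ⟨$⟩ʳ_) (Perm.inverseʳ h)))
        (λ g i → trans (Perm.inverseˡ h) (cong (g ⟨$⟩ʳ_) (Perm.inverseˡ h))))
      (∑ᴳ-cong (λ g → cong₂ _*_ (c-respects (h ⁻¹ ∙ ((h ∙ (g ∙ h ⁻¹)) ⁻¹ ∙ h)) (g ⁻¹) (λ i → trans (Perm.inverseˡ h) (cong (g ⟨$⟩ˡ_) (Perm.inverseˡ h)))) (class h g)))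

  -- The function `c ⋆ (h ▹ c)` is left invariant through its first factor and right covariant
  -- through its second, so von Neumann's lemma makes it a multiple of `c`. The sum over `h` then
  -- becomes `c ⋆ c`, giving one factor `κ`, and the remaining sum is again `c ⋆ c`, at the
  -- identity.
  classSum-norm : ∑ᴳ n (λ g → classSum g * classSum g) ≡ fromℕℚ (n !) * (κ * κ)
  classSum-norm = trans (pairing classSum classSum-respects classSum-class) (cong (fromℕℚ (n !) *_) (begin
    ∑ᴳ n (λ g → c (g ⁻¹) * classSum g)
      ≡⟨ ∑ᴳ-cong (λ g → cong (c (g ⁻¹) *_) (sym (classSum-⁻¹ g))) ⟩
    ∑ᴳ n (λ g → c (g ⁻¹) * classSum (g ⁻¹))
      ≡⟨ sym (∑ᴳ-inverse (λ g → c g * classSum g) (λ g g′ g≈g′ → cong₂ _*_ (c-respects g g′ g≈g′) (classSum-respects g g′ g≈g′))) ⟩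
    ∑ᴳ n (λ g → c g * classSum g)
      ≡⟨ ∑ᴳ-cong (λ g → ∑ᴳ-*ˡ (c g) (λ h → c (h ⁻¹ ∙ (g ⁻¹ ∙ h)))) ⟩
    ∑ᴳ n (λ g → ∑ᴳ n (λ h → c g * c (h ⁻¹ ∙ (g ⁻¹ ∙ h))))
      ≡⟨ ∑ᴳ-comm (λ g h → c g * c (h ⁻¹ ∙ (g ⁻¹ ∙ h))) ⟩
    ∑ᴳ n (λ h → (c ⋆ (h ▹ c)) h)
      ≡⟨ ∑ᴳ-cong (λ h → von-neumann (⋆-covariant θ c (h ▹ c) c-respects (Covariant.invariant c-covariant)
           (λ σ τ σ≈τ → c-respects (h ⁻¹ ∙ σ) (h ⁻¹ ∙ τ) (λ i → cong (h ⟨$⟩ˡ_) (σ≈τ i)))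
           (λ q σ q∈C → trans (c-respects (h ⁻¹ ∙ (σ ∙ q)) ((h ⁻¹ ∙ σ) ∙ q) (λ i → refl)) (Covariant.covariant c-covariant q (h ⁻¹ ∙ σ) q∈C))) h) ⟩
    ∑ᴳ n (λ h → (c ⋆ (h ▹ c)) idₚ * c h)
      ≡⟨ ∑ᴳ-cong (λ h → trans (∑ᴳ-*ʳ (c h) (λ g → c g * c (h ⁻¹ ∙ (g ⁻¹ ∙ idₚ)))) (∑ᴳ-cong (λ g →
           solve 3 (λ u v w → u :* v :* w := u :* (w :* v)) refl (c g) (c (h ⁻¹ ∙ (g ⁻¹ ∙ idₚ))) (c h)))) ⟩
    ∑ᴳ n (λ h → ∑ᴳ n (λ g → c g * (c h * c (h ⁻¹ ∙ (g ⁻¹ ∙ idₚ)))))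
      ≡⟨ ∑ᴳ-comm (λ h g → c g * (c h * c (h ⁻¹ ∙ (g ⁻¹ ∙ idₚ)))) ⟩
    ∑ᴳ n (λ g → ∑ᴳ n (λ h → c g * (c h * c (h ⁻¹ ∙ (g ⁻¹ ∙ idₚ)))))
      ≡⟨ ∑ᴳ-cong (λ g → trans (sym (∑ᴳ-*ˡ (c g) (λ h → c h * c (h ⁻¹ ∙ (g ⁻¹ ∙ idₚ))))) (trans (cong (c g *_) (c⋆c (g ⁻¹ ∙ idₚ)))
           (solve 3 (λ u k v → u :* (k :* v) := k :* (u :* v)) refl (c g) κ (c (g ⁻¹ ∙ idₚ))))) ⟩
    ∑ᴳ n (λ g → κ * (c g * c (g ⁻¹ ∙ idₚ)))
      ≡⟨ sym (∑ᴳ-*ˡ κ (λ g → c g * c (g ⁻¹ ∙ idₚ))) ⟩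
    κ * κ ∎))
    where
    open ≡-Reasoning
    open +-*-Solver

-- Alternating functions of beads

sg : ℤ → ℚ
sg (ℤ.+ zero)  = 0ℚ
sg (ℤ.+ suc _) = 1ℚ
sg -[1+ _ ]    = - 1ℚ

sg-neg : ∀ a → sg (ℤ.- a) ≡ - sg a
sg-neg (ℤ.+ zero)  = refl
sg-neg (ℤ.+ suc _) = refl
sg-neg -[1+ _ ]    = refl

sg-swap : ∀ a b → sg (b ℤ.- a) ≡ - sg (a ℤ.- b)
sg-swap a b = trans (cong sg (solve 2 (λ x y → y :- x := :- (x :- y)) refl a b)) (sg-neg (a ℤ.- b))
  where open ℤ-Solver

sg≢0 : ∀ {a b} → sg (a ℤ.- b) ≢ 0ℚ → a ≢ b
sg≢0 {a} sg≢0 refl = sg≢0 (cong sg (ℤₚ.+-inverseʳ a))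

signs : ℤ → List ℤ → ℚ
signs a []      = 1ℚ
signs a (b ∷ u) = sg (a ℤ.- b) * signs a u

-- Only the sign of the Vandermonde product: 0 if an entry repeats, and otherwise the sign of the
-- permutation sorting the list into decreasing order.
vandermonde : List ℤ → ℚ
vandermonde []      = 1ℚ
vandermonde (a ∷ u) = signs a u * vandermonde u

signs≢0 : ∀ {a} u → signs a u ≢ 0ℚ → All (a ≢_) u
signs≢0 []      _ = []
signs≢0 {a} (b ∷ u) ≢0 = sg≢0 (proj₁ (*-nonZero ≢0)) ∷ signs≢0 u (proj₂ (*-nonZero {sg (a ℤ.- b)} ≢0))

vandermonde≢0 : ∀ u → vandermonde u ≢ 0ℚ → Unique u
vandermonde≢0 []      _ = []
vandermonde≢0 (a ∷ u) ≢0 = signs≢0 u (proj₁ (*-nonZero ≢0)) ∷ vandermonde≢0 u (proj₂ (*-nonZero {signs a u} ≢0))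

InRange : ℕ → ℤ → Set
InRange N a = ℤ.+ 0 ℤ.≤ a × a ℤ.< ℤ.+ N

inRange? : ∀ N a → Dec (InRange N a)
inRange? N a = (ℤ.+ 0 ℤ.≤? a) ×-dec (a ℤ.<? ℤ.+ N)

Admissible : ℕ → List ℤ → Set
Admissible N u = length u ≡ N × All (InRange N) u

admissible? : ∀ N u → Dec (Admissible N u)
admissible? N u = (length u ℕ.≟ N) ×-dec All.all? (inRange? N) u

-- The alternating function of N integers which is 1 at (N - 1, …, 1, 0) and
-- vanishes off the rearrangements of this sequence.
E : ℕ → List ℤ → ℚ
E N u = 𝟙 (admissible? N u) * vandermonde u

E-admissible : ∀ {N u} → Admissible N u → E N u ≡ vandermonde u
E-admissible {N} {u} adm = trans (cong (_* vandermonde u) (𝟙-yes (admissible? N u) adm)) (ℚₚ.*-identityˡ (vandermonde u))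

E-inadmissible : ∀ {N u} → ¬ Admissible N u → E N u ≡ 0ℚ
E-inadmissible {N} {u} ¬adm = trans (cong (_* vandermonde u) (𝟙-no (admissible? N u) ¬adm)) (ℚₚ.*-zeroˡ (vandermonde u))

E≢0 : ∀ {N u} → E N u ≢ 0ℚ → Admissible N u × vandermonde u ≢ 0ℚ
E≢0 {N} {u} ≢0 with admissible? N u
... | yes adm = adm , λ eq → ≢0 (trans (E-admissible adm) eq)
... | no ¬adm = contradiction (E-inadmissible ¬adm) ≢0

-- A single adjacent exchange, which changes the sign of an alternating function. Chains of these
-- are used where `↭` alone would not show the sign.
data _~ˢ_ {A : Set} : List A → List A → Set where
  swap : ∀ a b u → (a ∷ b ∷ u) ~ˢ (b ∷ a ∷ u)
  skip : ∀ a {u u′} → u ~ˢ u′ → (a ∷ u) ~ˢ (a ∷ u′)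

~ˢ⇒↭ : ∀ {A : Set} {u u′ : List A} → u ~ˢ u′ → u ↭ u′
~ˢ⇒↭ (swap a b u) = ↭.swap a b ↭-refl
~ˢ⇒↭ (skip a s)   = ↭.prep a (~ˢ⇒↭ s)

signs-~ˢ : ∀ a {u u′} → u ~ˢ u′ → signs a u ≡ signs a u′
signs-~ˢ a (swap b b′ u) = solve 3 (λ s t r → s :* (t :* r) := t :* (s :* r)) refl (sg (a ℤ.- b)) (sg (a ℤ.- b′)) (signs a u)
  where open +-*-Solver
signs-~ˢ a (skip b s)    = cong (sg (a ℤ.- b) *_) (signs-~ˢ a s)

vandermonde-~ˢ : ∀ {u u′} → u ~ˢ u′ → vandermonde u′ ≡ - vandermonde u
vandermonde-~ˢ (swap a b u) = trans
  (cong (λ s → s * signs b u * (signs a u * vandermonde u)) (sg-swap a b))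
  (solve 4 (λ s x y w → (:- s) :* y :* (x :* w) := :- (s :* x :* (y :* w))) refl (sg (a ℤ.- b)) (signs a u) (signs b u) (vandermonde u))
  where open +-*-Solver
vandermonde-~ˢ (skip a {u} s) = trans
  (cong₂ _*_ (sym (signs-~ˢ a s)) (vandermonde-~ˢ s)) (sym (ℚₚ.neg-distribʳ-* (signs a u) (vandermonde u)))

E-~ˢ : ∀ {N u u′} → u ~ˢ u′ → E N u′ ≡ - E N u
E-~ˢ {N} {u} {u′} s = trans
  (cong₂ _*_ (𝟙-⇔ (admissible? N u′) (admissible? N u) (transport (↭-sym (~ˢ⇒↭ s))) (transport (~ˢ⇒↭ s))) (vandermonde-~ˢ s))
  (sym (ℚₚ.neg-distribʳ-* (𝟙 (admissible? N u)) (vandermonde u)))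
  where
  transport : ∀ {w w′} → w ↭ w′ → Admissible N w → Admissible N w′
  transport p (len , rng) = trans (sym (↭ₚ.↭-length p)) len , ↭ₚ.All-resp-↭ p rng

infixl 6 _-ᵛ_
_-ᵛ_ : ∀ {N} → Vec ℤ N → Vec ℕ N → Vec ℤ N
_-ᵛ_ = Vec.zipWith (λ a b → a ℤ.- ℤ.+ b)

-- θ + δ in the notation of symmetric functions.
shifted : ∀ {N} → Vec ℕ N → Vec ℤ N
shifted []               = []
shifted {suc N} (t ∷ ts) = ℤ.+ (t ℕ.+ N) ∷ shifted ts

LexAtLeast : ∀ {N} → Vec ℕ N → Vec ℕ N → Set
LexAtLeast []       []       = ⊤
LexAtLeast (b ∷ bs) (t ∷ ts) = t ≤ b × (b ≡ t → LexAtLeast bs ts)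

LexAtLeast-lookup : ∀ {N} (bs ts : Vec ℕ N) → LexAtLeast bs ts → ∀ c →
  (∀ d → toℕ d < toℕ c → lookup bs d ≡ lookup ts d) → lookup ts c ≤ lookup bs c
LexAtLeast-lookup (b ∷ bs) (t ∷ ts) (t≤b , rest) zero    eq = t≤b
LexAtLeast-lookup (b ∷ bs) (t ∷ ts) (t≤b , rest) (suc c) eq =
  LexAtLeast-lookup bs ts (rest (eq zero (s≤s z≤n))) c (λ d d<c → eq (suc d) (s≤s d<c))

i-j+j : ∀ i j → i ℤ.- j ℤ.+ j ≡ i
i-j+j = solve 2 (λ x y → x :- y :+ y := x) refl
  where open ℤ-Solver

-- The first bead `t + N - b` must be at most `N`, whence `t ≤ b`. If `b ≡ t` it equals `N`, so the
-- other beads, being distinct from it, lie in the range for `N` and the argument repeats.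
E≢0⇒lex : ∀ {N} (ts bs : Vec ℕ N) → E N (toList (shifted ts -ᵛ bs)) ≢ 0ℚ → LexAtLeast bs ts
E≢0⇒lex []       []       _ = tt
E≢0⇒lex {suc N} (t ∷ ts) (b ∷ bs) ≢0 with E≢0 {suc N} {toList (shifted (t ∷ ts) -ᵛ (b ∷ bs))} ≢0
... | (_ , (_ , u₀<) ∷ rng) , V≢0 = t≤b , λ b≡t → E≢0⇒lex ts bs (λ eq → proj₂ (*-nonZero {signs u₀ rest} V≢0)
    (trans (sym (E-admissible (Vecₚ.length-toList (shifted ts -ᵛ bs) , All.zipWith (λ { {a} (rng , u₀≢a) → shrink b≡t {a} rng u₀≢a }) (rng , signs≢0 rest (proj₁ (*-nonZero V≢0)))))) eq))
  where
  u₀ = ℤ.+ (t ℕ.+ N) ℤ.- ℤ.+ b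
  rest = toList (shifted ts -ᵛ bs)

  t≤b : t ≤ b
  t≤b = ℕₚ.+-cancelˡ-≤ N t b (subst (_≤ N ℕ.+ b) (ℕₚ.+-comm t N) (ℕ.s≤s⁻¹
    (ℤₚ.drop‿+<+ (subst (ℤ._< ℤ.+ suc N ℤ.+ ℤ.+ b) (i-j+j (ℤ.+ (t ℕ.+ N)) (ℤ.+ b)) (ℤₚ.+-monoˡ-< (ℤ.+ b) u₀<)))))

  shrink : b ≡ t → ∀ {a} → InRange (suc N) a → u₀ ≢ a → InRange N a
  shrink refl {ℤ.+ k} (0≤a , ℤ.+<+ k<) u₀≢a = 0≤a , ℤ.+<+ (ℕₚ.≤∧≢⇒< (ℕ.s≤s⁻¹ k<) (λ { refl → u₀≢a
    (trans (cong (ℤ._- ℤ.+ t) (ℤₚ.pos-+ t N)) (solve 2 (λ x y → x :+ y :- x := y) refl (ℤ.+ t) (ℤ.+ N))) }))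
    where open ℤ-Solver

shifted-self : ∀ {N} (ts : Vec ℕ N) → shifted ts -ᵛ ts ≡ shifted (replicate N 0)
shifted-self []       = refl
shifted-self {suc N} (t ∷ ts) = cong₂ _∷_ (trans (cong (ℤ._- ℤ.+ t) (ℤₚ.pos-+ t N)) (solve 2 (λ x y → x :+ y :- x := y) refl (ℤ.+ t) (ℤ.+ N))) (shifted-self ts)
  where open ℤ-Solver

shifted-zero-bound : ∀ N → All (λ a → InRange N a) (toList (shifted (replicate N 0)))
shifted-zero-bound zero    = []
shifted-zero-bound (suc N) = (ℤ.+≤+ z≤n , ℤ.+<+ ℕₚ.≤-refl) ∷ All.map (λ { (p , q) → p , ℤₚ.<-trans q (ℤ.+<+ ℕₚ.≤-refl) }) (shifted-zero-bound N)

sg-positive : ∀ {a b} → b ℤ.< a → sg (a ℤ.- b) ≡ 1ℚ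
sg-positive {a} {b} b<a = go (a ℤ.- b) (subst (ℤ._< a ℤ.- b) (ℤₚ.+-inverseʳ b) (ℤₚ.+-monoˡ-< (ℤ.- b) b<a))
  where
  go : ∀ d → ℤ.+ 0 ℤ.< d → sg d ≡ 1ℚ
  go (ℤ.+ suc _) _ = refl
  go (ℤ.+ zero) (ℤ.+<+ ())

signs-positive : ∀ {a u} → All (ℤ._< a) u → signs a u ≡ 1ℚ
signs-positive []       = refl
signs-positive (p ∷ ps) = cong₂ _*_ (sg-positive p) (signs-positive ps)

vandermonde-shifted-zero : ∀ N → vandermonde (toList (shifted (replicate N 0))) ≡ 1ℚ
vandermonde-shifted-zero zero    = refl
vandermonde-shifted-zero (suc N) = cong₂ _*_ (signs-positive (All.map proj₂ (shifted-zero-bound N))) (vandermonde-shifted-zero N)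

E-staircase : ∀ N → E N (toList (shifted (replicate N 0))) ≡ 1ℚ
E-staircase N = trans (E-admissible (Vecₚ.length-toList (shifted (replicate N 0)) , shifted-zero-bound N)) (vandermonde-shifted-zero N)

E-self : ∀ {N} (ts : Vec ℕ N) → E N (toList (shifted ts -ᵛ ts)) ≡ 1ℚ
E-self {N} ts = trans (cong (λ u → E N (toList u)) (shifted-self ts)) (E-staircase N)

-- Frobenius's class function

∘ᵛ-cancel : ∀ {A : Set} {n} {x y : Vec A n} (g : Permutation′ n) → x ∘ᵛ g ≡ y ∘ᵛ g → x ≡ y
∘ᵛ-cancel {x = x} {y} g eq = trans (sym (∘ᵛ-inverseʳ x g)) (trans (cong (_∘ᵛ g ⁻¹) eq) (∘ᵛ-inverseʳ y g))

vec-ext : ∀ {A : Set} {m} {xs ys : Vec A m} → (∀ k → lookup xs k ≡ lookup ys k) → xs ≡ ys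
vec-ext {xs = xs} {ys} eq = trans (sym (Vecₚ.tabulate∘lookup xs)) (trans (Vecₚ.tabulate-cong eq) (Vecₚ.tabulate∘lookup ys))

content : ∀ {N n} → Vec (Fin N) n → Vec ℕ N
content x = tabulate (occ _≟ᶠ_ (lookup x))

content-∘ᵛ : ∀ {N n} (x : Vec (Fin N) n) g → content (x ∘ᵛ g) ≡ content x
content-∘ᵛ x g = Vecₚ.tabulate-cong (λ c → trans
  (occ-cong _≟ᶠ_ (Vecₚ.lookup∘tabulate (λ i → lookup x (g ⟨$⟩ʳ i))) c) (occ-permute _≟ᶠ_ (lookup x) g c))

weight : ∀ {N n} → Vec ℤ N → Vec (Fin N) n → ℚ
weight {N} v x = E N (toList (v -ᵛ content x))

-- Frobenius: the coefficient at v of the Vandermonde product times the power sum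
-- of the cycle type of g, written as a signed count of the colourings fixed by g.
frobenius : ∀ {N n} → Vec ℤ N → Permutation′ n → ℚ
frobenius {N} {n} v g = ∑ᵛ n (λ x → 𝟙 ((x ∘ᵛ g) ≟ᵛ x) * weight v x)

frobenius-respects : ∀ {N n} (v : Vec ℤ N) → Respects≈ {n} (frobenius v)
frobenius-respects {n = n} v g g′ g≈g′ = ∑ᵛ-cong n (λ x → cong (λ y → 𝟙 (y ≟ᵛ x) * weight v x) (∘ᵛ-cong x g g′ g≈g′))

frobenius-⁻¹ : ∀ {N n} (v : Vec ℤ N) (g : Permutation′ n) → frobenius v (g ⁻¹) ≡ frobenius v g
frobenius-⁻¹ {n = n} v g = ∑ᵛ-cong n (λ x → cong (_* weight v x) (𝟙-⇔ ((x ∘ᵛ g ⁻¹) ≟ᵛ x) ((x ∘ᵛ g) ≟ᵛ x)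
  (λ eq → trans (cong (_∘ᵛ g) (sym eq)) (∘ᵛ-inverseˡ x g)) (λ eq → trans (cong (_∘ᵛ g ⁻¹) (sym eq)) (∘ᵛ-inverseʳ x g))))

frobenius-conjugate : ∀ {N n} (v : Vec ℤ N) (h g : Permutation′ n) → frobenius v (h ∙ (g ∙ h ⁻¹)) ≡ frobenius v g
frobenius-conjugate {N} {n} v h g = trans
  (∑ᵛ-bijection (λ x → 𝟙 ((x ∘ᵛ (h ∙ (g ∙ h ⁻¹))) ≟ᵛ x) * weight v x) (_∘ᵛ h ⁻¹) (_∘ᵛ h) (λ x → ∘ᵛ-inverseʳ x h) (λ x → ∘ᵛ-inverseˡ x h))
  (∑ᵛ-cong n (λ x → cong₂ _*_
    (𝟙-⇔ ((x ∘ᵛ h ⁻¹ ∘ᵛ (h ∙ (g ∙ h ⁻¹))) ≟ᵛ (x ∘ᵛ h ⁻¹)) ((x ∘ᵛ g) ≟ᵛ x)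
      (λ eq → ∘ᵛ-cancel (h ⁻¹) (trans (sym (move x)) eq)) (λ eq → trans (move x) (cong (_∘ᵛ h ⁻¹) eq)))
    (cong (λ b → E N (toList (v -ᵛ b))) (content-∘ᵛ x (h ⁻¹)))))
  where
  move : ∀ x → x ∘ᵛ h ⁻¹ ∘ᵛ (h ∙ (g ∙ h ⁻¹)) ≡ x ∘ᵛ g ∘ᵛ h ⁻¹
  move x = trans (∘ᵛ-∙ x (h ⁻¹) (h ∙ (g ∙ h ⁻¹))) (trans
    (∘ᵛ-cong x (h ⁻¹ ∙ (h ∙ (g ∙ h ⁻¹))) (g ∙ h ⁻¹) (λ i → Perm.inverseˡ h)) (sym (∘ᵛ-∙ x g (h ⁻¹))))

nth<length : ∀ l k → 0 < nth l k → k < length l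
nth<length (a ∷ l) zero    _ = s≤s z≤n
nth<length (a ∷ l) (suc k) p = s≤s (nth<length l k p)

nth-beyond : ∀ l k → length l ≤ k → nth l k ≡ 0
nth-beyond []      k       _       = refl
nth-beyond (a ∷ l) (suc k) (s≤s p) = nth-beyond l k p

-- The pairing of the Young symmetrizer with Frobenius's function

module Colourings (θ : Partition) (N : ℕ) (fits : length (parts θ) ≤ N) where

  open Young θ public

  θᵛ : Vec ℕ N
  θᵛ = tabulate (λ k → nth (parts θ) (toℕ k))

  v : Vec ℤ N
  v = shifted θᵛ

  row<N : ∀ i → row θ i < N
  row<N i = ℕₚ.<-≤-trans (nth<length (parts θ) (row θ i) (ℕₚ.≤-<-trans z≤n (cell-valid (parts θ) i))) fits

  rowColour : Fin n → Fin N
  rowColour i = fromℕ< (row<N i)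

  rowᵛ : Vec (Fin N) n
  rowᵛ = tabulate rowColour

  toℕ-rowᵛ : ∀ i → toℕ (lookup rowᵛ i) ≡ row θ i
  toℕ-rowᵛ i = trans (cong toℕ (Vecₚ.lookup∘tabulate rowColour i)) (Finₚ.toℕ-fromℕ< (row<N i))

  colourℕ : Vec (Fin N) n → Fin n → ℕ
  colourℕ x i = toℕ (lookup x i)

  occ-colourℕ : ∀ x k → occ ℕ._≟_ (colourℕ x) (toℕ k) ≡ lookup (content x) k
  occ-colourℕ x k = trans (occ-map _≟ᶠ_ ℕ._≟_ Finₚ.toℕ-injective (lookup x) k) (sym (Vecₚ.lookup∘tabulate (occ _≟ᶠ_ (lookup x)) k))

  lookup-θᵛ : ∀ k → lookup θᵛ k ≡ nth (parts θ) (toℕ k)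
  lookup-θᵛ = Vecₚ.lookup∘tabulate (λ k → nth (parts θ) (toℕ k))

  content-θᵛ : ∀ x → (∀ k → occ ℕ._≟_ (colourℕ x) k ≡ nth (parts θ) k) → content x ≡ θᵛ
  content-θᵛ x eq = vec-ext (λ k → trans (sym (occ-colourℕ x k)) (trans (eq (toℕ k)) (sym (lookup-θᵛ k))))

  content-rowᵛ : content rowᵛ ≡ θᵛ
  content-rowᵛ = content-θᵛ rowᵛ (λ k → trans (occ-cong ℕ._≟_ {y = row θ} toℕ-rowᵛ k) (occ-row (parts θ) k))

  weight-θᵛ : ∀ (x : Vec (Fin N) n) → content x ≡ θᵛ → weight v x ≡ 1ℚ
  weight-θᵛ x eq = trans (cong (λ b → E N (toList (v -ᵛ b))) eq) (E-self θᵛ)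

  lex : ∀ x → weight v x ≢ 0ℚ → ∀ k → (∀ i → i < k → occ ℕ._≟_ (colourℕ x) i ≡ nth (parts θ) i) → nth (parts θ) k ≤ occ ℕ._≟_ (colourℕ x) k
  lex x ≢0 k eq with k ℕ.<? N
  ... | no  k≮N = subst (_≤ occ ℕ._≟_ (colourℕ x) k) (sym (nth-beyond (parts θ) k (ℕₚ.≤-trans fits (ℕₚ.≮⇒≥ k≮N)))) z≤n
  ... | yes k<N = subst (λ j → nth (parts θ) j ≤ occ ℕ._≟_ (colourℕ x) j) (Finₚ.toℕ-fromℕ< k<N)
    (subst (_≤ occ ℕ._≟_ (colourℕ x) (toℕ k′)) (lookup-θᵛ k′) (subst (lookup θᵛ k′ ≤_) (sym (occ-colourℕ x k′))
      (LexAtLeast-lookup (content x) θᵛ (E≢0⇒lex θᵛ (content x) ≢0) k′ (λ d d<k → trans (sym (occ-colourℕ x d))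
        (trans (eq (toℕ d) (subst (toℕ d <_) (Finₚ.toℕ-fromℕ< k<N) d<k)) (sym (lookup-θᵛ d)))))))
    where k′ = fromℕ< k<N

  stabiliserSum : Vec (Fin N) n → ℚ
  stabiliserSum x = ∑ᴳ n (λ g → 𝟙 ((x ∘ᵛ g) ≟ᵛ x) * c g)

  columnCount : Vec (Fin N) n → ℚ
  columnCount x = ∑ᴳ n (λ q → 𝟙 (inColumns? q) * 𝟙 ((rowᵛ ∘ᵛ q) ≟ᵛ x))

  -- Exchanging two cells of equal colour in one column fixes `x`, so right multiplication by this
  -- transposition permutes the stabiliser while changing the sign of `c`.
  stabiliserSum-collision : ∀ x → Collision (colourℕ x) → stabiliserSum x ≡ 0ℚ
  stabiliserSum-collision x (i , j , i≢j , col≡ , x≡) = x≡-x⇒x≡0 (begin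
    stabiliserSum x
      ≡⟨ ∑ᴳ-right t (λ g → 𝟙 ((x ∘ᵛ g) ≟ᵛ x) * c g) (λ g g′ g≈g′ → cong₂ (λ y r → 𝟙 (y ≟ᵛ x) * r) (∘ᵛ-cong x g g′ g≈g′) (c-respects g g′ g≈g′)) ⟩
    ∑ᴳ n (λ g → 𝟙 ((x ∘ᵛ (g ∙ t)) ≟ᵛ x) * c (g ∙ t))
      ≡⟨ ∑ᴳ-cong {n} (λ g → trans (cong₂ _*_ (𝟙-⇔ ((x ∘ᵛ (g ∙ t)) ≟ᵛ x) ((x ∘ᵛ g) ≟ᵛ x)
             (λ eq → ∘ᵛ-cancel t (trans (∘ᵛ-∙ x g t) (trans eq (sym xt)))) (λ eq → trans (sym (∘ᵛ-∙ x g t)) (trans (cong (_∘ᵛ t) eq) xt)))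
           (trans (Covariant.covariant c-covariant t g (transpose-invariant (col θ) col≡)) (cong (_* c g) (sgn-transpose i≢j))))
           (solve 2 (λ u w → u :* (con (- 1ℚ) :* w) := (con (- 1ℚ)) :* (u :* w)) refl (𝟙 ((x ∘ᵛ g) ≟ᵛ x)) (c g))) ⟩
    ∑ᴳ n (λ g → - 1ℚ * (𝟙 ((x ∘ᵛ g) ≟ᵛ x) * c g))
      ≡⟨ sym (∑ᴳ-*ˡ (- 1ℚ) (λ g → 𝟙 ((x ∘ᵛ g) ≟ᵛ x) * c g)) ⟩
    - 1ℚ * stabiliserSum x
      ≡⟨ solve 1 (λ u → con (- 1ℚ) :* u := :- u) refl (stabiliserSum x) ⟩
    - stabiliserSum x ∎)
    where
    open ≡-Reasoning
    open +-*-Solver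
    t : Permutation′ n
    t = transpose i j
    xt : x ∘ᵛ t ≡ x
    xt = trans (Vecₚ.tabulate-cong (transpose-invariant (lookup x) (Finₚ.toℕ-injective x≡))) (Vecₚ.tabulate∘lookup x)

  -- The colouring gives the row of each image and `InColumns` its column. A cell is determined by
  -- the two, so no second column permutation produces `x`.
  columnCount-sorted : ∀ x q → InColumns q → rowᵛ ∘ᵛ q ≡ x → columnCount x ≡ 1ℚ
  columnCount-sorted x q q∈C rq≡x = trans
    (∑ᴳ-single {n} (λ g → 𝟙 (inColumns? g) * 𝟙 ((rowᵛ ∘ᵛ g) ≟ᵛ x))
      (λ g g′ g≈g′ → cong₂ (λ r y → r * 𝟙 (y ≟ᵛ x)) (𝟙-⇔ (inColumns? g) (inColumns? g′)
        (λ p i → trans (cong (col θ) (sym (g≈g′ i))) (p i)) (λ p i → trans (cong (col θ) (g≈g′ i)) (p i))) (∘ᵛ-cong rowᵛ g g′ g≈g′))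
      q (λ g g≉q → trans (sym (𝟙-× (inColumns? g) ((rowᵛ ∘ᵛ g) ≟ᵛ x))) (𝟙-no (inColumns? g ×-dec ((rowᵛ ∘ᵛ g) ≟ᵛ x))
        (λ (g∈C , rg≡x) → g≉q (λ i → cell-injective (parts θ) (cong₂ _,_
          (trans (sym (rowAt g i)) (trans (cong (λ y → colourℕ y i) (trans rg≡x (sym rq≡x))) (rowAt q i)))
          (trans (g∈C i) (sym (q∈C i)))))))))
    (cong₂ _*_ (𝟙-yes (inColumns? q) q∈C) (𝟙-yes ((rowᵛ ∘ᵛ q) ≟ᵛ x) rq≡x))
    where
    rowAt : ∀ g i → colourℕ (rowᵛ ∘ᵛ g) i ≡ row θ (g ⟨$⟩ʳ i)
    rowAt g i = trans (cong toℕ (Vecₚ.lookup∘tabulate (λ j → lookup rowᵛ (g ⟨$⟩ʳ j)) i)) (toℕ-rowᵛ (g ⟨$⟩ʳ i))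

  -- A collision annihilates the stabiliser sum. Without one, a nonzero weight makes the content
  -- lexicographically at least `θ`, so `sorting` exhibits `x` as a column rearrangement of `rowᵛ`
  -- and both factors are 1. A zero weight excludes such a rearrangement, because its content would
  -- be `θ` and its weight 1.
  weight-stabiliserSum : ∀ x → weight v x * stabiliserSum x ≡ columnCount x * stabiliserSum x
  weight-stabiliserSum x with collision? (colourℕ x)
  ... | yes col = trans (cong (weight v x *_) S≡0) (trans (ℚₚ.*-zeroʳ (weight v x)) (sym (trans (cong (columnCount x *_) S≡0) (ℚₚ.*-zeroʳ (columnCount x)))))
    where S≡0 = stabiliserSum-collision x col
  ... | no  none with weight v x ℚₚ.≟ 0ℚ
  ...   | yes w≡0 = cong (_* stabiliserSum x) (trans w≡0 (sym (∑ᴳ-zero {n} (λ g → trans (cong (𝟙 (inColumns? g) *_)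
      (𝟙-no ((rowᵛ ∘ᵛ g) ≟ᵛ x) (λ { refl → contradiction (trans (sym (weight-θᵛ x (trans (content-∘ᵛ rowᵛ g) content-rowᵛ))) w≡0) (λ ()) })))
      (ℚₚ.*-zeroʳ (𝟙 (inColumns? g)))))))
  ...   | no  w≢0 = cong (_* stabiliserSum x) (trans (weight-θᵛ x (content-θᵛ x (λ k → Placed.counts (placed k))))
      (sym (columnCount-sorted x sorting (λ i → cong proj₂ (proj₂ (rearrange i))) (vec-ext (λ i → Finₚ.toℕ-injective
        (trans (cong toℕ (Vecₚ.lookup∘tabulate (λ j → lookup rowᵛ (sorting ⟨$⟩ʳ j)) i)) (trans (toℕ-rowᵛ (sorting ⟨$⟩ʳ i)) (cong proj₁ (proj₂ (rearrange i))))))))))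
    where open Filling (parts θ) (decreasing θ) (colourℕ x) (column-injective (colourℕ x) none) (lex x w≢0)

  -- The stabiliser of `rowᵛ ∘ᵛ q` is the conjugate by `q` of the row group. Column covariance of
  -- `c` removes the trailing `q` at the cost of its sign.
  stabiliserSum-columns : ∀ q → InColumns q → stabiliserSum (rowᵛ ∘ᵛ q) ≡ sgn q * ∑ᴳ n (λ p → rows p * c (q ⁻¹ ∙ p))
  stabiliserSum-columns q q∈C = begin
    ∑ᴳ n (λ g → 𝟙 ((rowᵛ ∘ᵛ q ∘ᵛ g) ≟ᵛ (rowᵛ ∘ᵛ q)) * c g)
      ≡⟨ ∑ᴳ-bijection (λ g → 𝟙 ((rowᵛ ∘ᵛ q ∘ᵛ g) ≟ᵛ (rowᵛ ∘ᵛ q)) * c g)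
           (λ g g′ g≈g′ → cong₂ (λ y r → 𝟙 (y ≟ᵛ (rowᵛ ∘ᵛ q)) * r) (∘ᵛ-cong (rowᵛ ∘ᵛ q) g g′ g≈g′) (c-respects g g′ g≈g′))
           (λ p → q ⁻¹ ∙ (p ∙ q)) (λ g → q ∙ (g ∙ q ⁻¹))
           (λ g g′ g≈g′ i → cong (q ⟨$⟩ˡ_) (g≈g′ (q ⟨$⟩ʳ i))) (λ g g′ g≈g′ i → cong (q ⟨$⟩ʳ_) (g≈g′ (q ⟨$⟩ˡ i)))
           (λ g i → trans (Perm.inverseˡ q) (cong (g ⟨$⟩ʳ_) (Perm.inverseˡ q)))
           (λ g i → trans (Perm.inverseʳ q) (cong (g ⟨$⟩ʳ_) (Perm.inverseʳ q))) ⟩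
    ∑ᴳ n (λ p → 𝟙 ((rowᵛ ∘ᵛ q ∘ᵛ (q ⁻¹ ∙ (p ∙ q))) ≟ᵛ (rowᵛ ∘ᵛ q)) * c (q ⁻¹ ∙ (p ∙ q)))
      ≡⟨ ∑ᴳ-cong {n} (λ p → trans (cong₂ _*_
           (𝟙-⇔ ((rowᵛ ∘ᵛ q ∘ᵛ (q ⁻¹ ∙ (p ∙ q))) ≟ᵛ (rowᵛ ∘ᵛ q)) (inRows? p)
             (λ eq → fixed⇒inRows p (∘ᵛ-cancel q (trans (sym (move p)) eq))) (λ p∈R → trans (move p) (cong (_∘ᵛ q) (inRows⇒fixed p p∈R))))
           (trans (c-respects (q ⁻¹ ∙ (p ∙ q)) ((q ⁻¹ ∙ p) ∙ q) (λ i → refl)) (Covariant.covariant c-covariant q (q ⁻¹ ∙ p) q∈C)))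
           (solve 3 (λ r s w → r :* (s :* w) := s :* (r :* w)) refl (rows p) (sgn q) (c (q ⁻¹ ∙ p)))) ⟩
    ∑ᴳ n (λ p → sgn q * (rows p * c (q ⁻¹ ∙ p)))
      ≡⟨ sym (∑ᴳ-*ˡ (sgn q) (λ p → rows p * c (q ⁻¹ ∙ p))) ⟩
    sgn q * ∑ᴳ n (λ p → rows p * c (q ⁻¹ ∙ p)) ∎
    where
    open ≡-Reasoning
    open +-*-Solver
    move : ∀ p → rowᵛ ∘ᵛ q ∘ᵛ (q ⁻¹ ∙ (p ∙ q)) ≡ rowᵛ ∘ᵛ p ∘ᵛ q
    move p = trans (∘ᵛ-∙ rowᵛ q (q ⁻¹ ∙ (p ∙ q))) (trans
      (∘ᵛ-cong rowᵛ (q ∙ (q ⁻¹ ∙ (p ∙ q))) (p ∙ q) (λ i → Perm.inverseʳ q)) (sym (∘ᵛ-∙ rowᵛ p q)))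

    fixed⇒inRows : ∀ p → rowᵛ ∘ᵛ p ≡ rowᵛ → InRows p
    fixed⇒inRows p eq i = trans (sym (toℕ-rowᵛ (p ⟨$⟩ʳ i))) (trans (cong toℕ (trans
      (sym (Vecₚ.lookup∘tabulate (λ j → lookup rowᵛ (p ⟨$⟩ʳ j)) i)) (cong (λ y → lookup y i) eq))) (toℕ-rowᵛ i))

    inRows⇒fixed : ∀ p → InRows p → rowᵛ ∘ᵛ p ≡ rowᵛ
    inRows⇒fixed p p∈R = vec-ext (λ i → trans (Vecₚ.lookup∘tabulate (λ j → lookup rowᵛ (p ⟨$⟩ʳ j)) i)
      (Finₚ.toℕ-injective (trans (toℕ-rowᵛ (p ⟨$⟩ʳ i)) (trans (p∈R i) (sym (toℕ-rowᵛ i))))))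

  -- After the sum over colourings collapses to column rearrangements of `rowᵛ`, what remains is the
  -- convolution of `rows`, `columns` and `c` at the identity, that is `c ⋆ c` there.
  c-frobenius : ∑ᴳ n (λ g → c g * frobenius v g) ≡ κ
  c-frobenius = begin
    ∑ᴳ n (λ g → c g * frobenius v g)
      ≡⟨ ∑ᴳ-cong {n} (λ g → trans (∑ᵛ-*ˡ n (c g) (λ x → 𝟙 ((x ∘ᵛ g) ≟ᵛ x) * weight v x)) (∑ᵛ-cong n (λ x →
           solve 3 (λ r s w → r :* (s :* w) := w :* (s :* r)) refl (c g) (𝟙 ((x ∘ᵛ g) ≟ᵛ x)) (weight v x)))) ⟩
    ∑ᴳ n (λ g → ∑ᵛ n (λ x → weight v x * (𝟙 ((x ∘ᵛ g) ≟ᵛ x) * c g)))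
      ≡⟨ sym (∑ᵛ-∑ᴳ n (λ x g → weight v x * (𝟙 ((x ∘ᵛ g) ≟ᵛ x) * c g))) ⟩
    ∑ᵛ n (λ x → ∑ᴳ n (λ g → weight v x * (𝟙 ((x ∘ᵛ g) ≟ᵛ x) * c g)))
      ≡⟨ ∑ᵛ-cong n (λ x → trans (sym (∑ᴳ-*ˡ {n} (weight v x) (λ g → 𝟙 ((x ∘ᵛ g) ≟ᵛ x) * c g))) (weight-stabiliserSum x)) ⟩
    ∑ᵛ n (λ x → columnCount x * stabiliserSum x)
      ≡⟨ ∑ᵛ-cong n (λ x → ∑ᴳ-*ʳ {n} (stabiliserSum x) (λ q → 𝟙 (inColumns? q) * 𝟙 ((rowᵛ ∘ᵛ q) ≟ᵛ x))) ⟩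
    ∑ᵛ n (λ x → ∑ᴳ n (λ q → 𝟙 (inColumns? q) * 𝟙 ((rowᵛ ∘ᵛ q) ≟ᵛ x) * stabiliserSum x))
      ≡⟨ ∑ᵛ-∑ᴳ n (λ x q → 𝟙 (inColumns? q) * 𝟙 ((rowᵛ ∘ᵛ q) ≟ᵛ x) * stabiliserSum x) ⟩
    ∑ᴳ n (λ q → ∑ᵛ n (λ x → 𝟙 (inColumns? q) * 𝟙 ((rowᵛ ∘ᵛ q) ≟ᵛ x) * stabiliserSum x))
      ≡⟨ ∑ᴳ-cong {n} (λ q → trans (∑ᵛ-cong n (λ x → ℚₚ.*-assoc (𝟙 (inColumns? q)) (𝟙 ((rowᵛ ∘ᵛ q) ≟ᵛ x)) (stabiliserSum x)))
           (trans (sym (∑ᵛ-*ˡ n (𝟙 (inColumns? q)) (λ x → 𝟙 ((rowᵛ ∘ᵛ q) ≟ᵛ x) * stabiliserSum x))) (cong (𝟙 (inColumns? q) *_) (∑ᵛ-𝟙 n stabiliserSum (rowᵛ ∘ᵛ q))))) ⟩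
    ∑ᴳ n (λ q → 𝟙 (inColumns? q) * stabiliserSum (rowᵛ ∘ᵛ q))
      ≡⟨ ∑ᴳ-cong {n} (λ q → trans (𝟙-guard (inColumns? q) (stabiliserSum-columns q)) (trans
           (sym (ℚₚ.*-assoc (𝟙 (inColumns? q)) (sgn q) _)) (cong (_* ∑ᴳ n (λ p → rows p * c (q ⁻¹ ∙ p))) (sym (columns-𝟙 q))))) ⟩
    ∑ᴳ n (λ q → columns q * ∑ᴳ n (λ p → rows p * c (q ⁻¹ ∙ p)))
      ≡⟨ ∑ᴳ-cong {n} (λ q → trans (∑ᴳ-*ˡ {n} (columns q) (λ p → rows p * c (q ⁻¹ ∙ p))) (∑ᴳ-cong {n} (λ p →
           solve 3 (λ b a w → b :* (a :* w) := a :* (b :* w)) refl (columns q) (rows p) (c (q ⁻¹ ∙ p))))) ⟩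
    ∑ᴳ n (λ q → ∑ᴳ n (λ p → rows p * (columns q * c (q ⁻¹ ∙ p))))
      ≡⟨ ∑ᴳ-comm {n} (λ q p → rows p * (columns q * c (q ⁻¹ ∙ p))) ⟩
    ∑ᴳ n (λ p → ∑ᴳ n (λ q → rows p * (columns q * c (q ⁻¹ ∙ p))))
      ≡⟨ ∑ᴳ-cong {n} (λ p → sym (∑ᴳ-*ˡ {n} (rows p) (λ q → columns q * c (q ⁻¹ ∙ p)))) ⟩
    ∑ᴳ n (λ p → rows p * (columns ⋆ c) p)
      ≡⟨ ∑ᴳ-inverse {n} (λ p → rows p * (columns ⋆ c) p) (λ p p′ p≈p′ → cong₂ _*_ (rows-respects p p′ p≈p′) (⋆-respects columns c c-respects p p′ p≈p′)) ⟩
    ∑ᴳ n (λ p → rows (p ⁻¹) * (columns ⋆ c) (p ⁻¹))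
      ≡⟨ ∑ᴳ-cong {n} (λ p → cong₂ _*_ (rows-⁻¹ p) (⋆-respects columns c c-respects (p ⁻¹) (p ⁻¹ ∙ idₚ) (λ i → refl))) ⟩
    (rows ⋆ (columns ⋆ c)) idₚ
      ≡⟨ sym (⋆-assoc rows columns c columns-respects c-respects idₚ) ⟩
    κ ∎
    where
    open ≡-Reasoning
    open +-*-Solver

  classSum-frobenius : ∑ᴳ n (λ g → classSum g * frobenius v g) ≡ fromℕℚ (n !) * κ
  classSum-frobenius = trans (pairing (frobenius v) (frobenius-respects v) (frobenius-conjugate v)) (cong (fromℕℚ (n !) *_) (begin
    ∑ᴳ n (λ g → c (g ⁻¹) * frobenius v g)
      ≡⟨ ∑ᴳ-cong {n} (λ g → cong (c (g ⁻¹) *_) (sym (frobenius-⁻¹ v g))) ⟩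
    ∑ᴳ n (λ g → c (g ⁻¹) * frobenius v (g ⁻¹))
      ≡⟨ sym (∑ᴳ-inverse {n} (λ g → c g * frobenius v g) (λ g g′ g≈g′ → cong₂ _*_ (c-respects g g′ g≈g′) (frobenius-respects v g g′ g≈g′))) ⟩
    ∑ᴳ n (λ g → c g * frobenius v g)
      ≡⟨ c-frobenius ⟩
    κ ∎))
    where open ≡-Reasoning

-- Permutations carrying one word to another

matches? : ∀ {A : Set} → DecidableEquality A → ∀ {n} (x y : Fin n → A) (g : Permutation′ n) → Dec (∀ i → x (g ⟨$⟩ʳ i) ≡ y i)
matches? _≟_ x y g = all? (λ i → x (g ⟨$⟩ʳ i) ≟ y i)

-- The order of the stabiliser of the word y.
stabOrder : ∀ {A : Set} → DecidableEquality A → ∀ {n} → (Fin n → A) → ℚ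
stabOrder _≟_ {zero}  y = 1ℚ
stabOrder _≟_ {suc n} y = fromℕℚ (suc (occ _≟_ (y ∘ suc) (y zero))) * stabOrder _≟_ (y ∘ suc)

∑-𝟙 : ∀ {n} {P : Fin n → Set} (d : ∀ i → Dec (P i)) → (∑[ i < n ] 𝟙 (d i)) ≡ fromℕℚ (sumᶠ (λ i → isℕ (d i)))
∑-𝟙 {zero}  d = refl
∑-𝟙 {suc n} d with d zero
... | yes _ = cong (1ℚ +_) (∑-𝟙 (d ∘ suc))
... | no  _ = trans (ℚₚ.+-identityˡ _) (∑-𝟙 (d ∘ suc))

occ-remove : ∀ {A : Set} (_≟_ : DecidableEquality A) {n} (x : Fin (suc n) → A) j a →
  occ _≟_ x a ≡ isℕ (x j ≟ a) ℕ.+ occ _≟_ (x ∘ punchIn j) a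
occ-remove _≟_ x j a = sumᶠ-remove {i = j} (λ i → isℕ (x i ≟ a))

-- Position 0 may be sent to any occurrence of `y zero` in `x`. Deleting that occurrence from `x`
-- and the first letter from `y` preserves equality of contents.
matching-count : ∀ {A : Set} (_≟_ : DecidableEquality A) {n} (x y : Fin n → A) → (∀ a → occ _≟_ x a ≡ occ _≟_ y a) →
  ∑ᴳ n (λ g → 𝟙 (matches? _≟_ x y g)) ≡ stabOrder _≟_ y
matching-count _≟_ {zero}  x y same = refl
matching-count _≟_ {suc n} x y same = begin
  ∑ᴳ (suc n) (λ g → 𝟙 (matches? _≟_ x y g))
    ≡⟨ ∑ᴳ-suc {n} (λ g → 𝟙 (matches? _≟_ x y g)) ⟩
  (∑[ j < suc n ] ∑ᴳ n (λ g → 𝟙 (matches? _≟_ x y (insert zero j g))))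
    ≡⟨ sum-cong-≗ {suc n} (λ j → ∑ᴳ-cong {n} (λ g → trans
         (𝟙-⇔ (matches? _≟_ x y (insert zero j g)) ((x j ≟ y zero) ×-dec matches? _≟_ (x ∘ punchIn j) (y ∘ suc) g)
           (λ m → m zero , λ k → trans (cong x (sym (Perm.insert-punchIn zero j g k))) (m (suc k)))
           (λ { (m₀ , m) zero → m₀ ; (m₀ , m) (suc k) → trans (cong x (Perm.insert-punchIn zero j g k)) (m k) }))
         (𝟙-× (x j ≟ y zero) (matches? _≟_ (x ∘ punchIn j) (y ∘ suc) g)))) ⟩
  (∑[ j < suc n ] ∑ᴳ n (λ g → 𝟙 (x j ≟ y zero) * 𝟙 (matches? _≟_ (x ∘ punchIn j) (y ∘ suc) g)))
    ≡⟨ sum-cong-≗ {suc n} (λ j → trans (sym (∑ᴳ-*ˡ {n} (𝟙 (x j ≟ y zero)) (λ g → 𝟙 (matches? _≟_ (x ∘ punchIn j) (y ∘ suc) g))))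
         (𝟙-guard (x j ≟ y zero) (λ xj≡y₀ → matching-count _≟_ (x ∘ punchIn j) (y ∘ suc) (λ a → rest j xj≡y₀ a)))) ⟩
  (∑[ j < suc n ] (𝟙 (x j ≟ y zero) * stabOrder _≟_ (y ∘ suc)))
    ≡⟨ sym (*-distribʳ-sum {suc n} (stabOrder _≟_ (y ∘ suc)) (λ j → 𝟙 (x j ≟ y zero))) ⟩
  (∑[ j < suc n ] 𝟙 (x j ≟ y zero)) * stabOrder _≟_ (y ∘ suc)
    ≡⟨ cong (_* stabOrder _≟_ (y ∘ suc)) (trans (∑-𝟙 (λ j → x j ≟ y zero)) (cong fromℕℚ
         (trans (same (y zero)) (cong (ℕ._+ occ _≟_ (y ∘ suc) (y zero)) (isℕ-yes (y zero ≟ y zero) refl))))) ⟩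
  stabOrder _≟_ y ∎
  where
  open ≡-Reasoning
  rest : ∀ j → x j ≡ y zero → ∀ a → occ _≟_ (x ∘ punchIn j) a ≡ occ _≟_ (y ∘ suc) a
  rest j xj≡y₀ a = ℕₚ.+-cancelˡ-≡ (isℕ (y zero ≟ a)) _ _
    (trans (cong (λ b → isℕ (b ≟ a) ℕ.+ occ _≟_ (x ∘ punchIn j) a) (sym xj≡y₀)) (trans (sym (occ-remove _≟_ x j a)) (same a)))

-- Sums over compositions and over matrices with given row sums

inc : ∀ {n} → Fin n → Vec ℕ n → Vec ℕ n
inc i = λ γ → updateAt γ i suc

-- Summation over the vectors γ with N entries and sum b.
∑ᶜ : ∀ N → ℕ → (Vec ℕ N → ℚ) → ℚ
∑ᶜ zero    zero    V = V []
∑ᶜ zero    (suc b) V = 0ℚ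
∑ᶜ (suc N) zero    V = ∑ᶜ N zero (λ γ → V (0 ∷ γ))
∑ᶜ (suc N) (suc b) V = ∑ᶜ N (suc b) (λ γ → V (0 ∷ γ)) + ∑ᶜ (suc N) b (λ γ → V (inc zero γ))

∑ᶜ-cong : ∀ N b {V W : Vec ℕ N → ℚ} → (∀ γ → V γ ≡ W γ) → ∑ᶜ N b V ≡ ∑ᶜ N b W
∑ᶜ-cong zero    zero    eq = eq []
∑ᶜ-cong zero    (suc b) eq = refl
∑ᶜ-cong (suc N) zero    eq = ∑ᶜ-cong N zero (λ γ → eq (0 ∷ γ))
∑ᶜ-cong (suc N) (suc b) eq = cong₂ _+_ (∑ᶜ-cong N (suc b) (λ γ → eq (0 ∷ γ))) (∑ᶜ-cong (suc N) b (λ γ → eq (inc zero γ)))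

∑ᶜ-+ : ∀ N b (V W : Vec ℕ N → ℚ) → ∑ᶜ N b (λ γ → V γ + W γ) ≡ ∑ᶜ N b V + ∑ᶜ N b W
∑ᶜ-+ zero    zero    V W = refl
∑ᶜ-+ zero    (suc b) V W = refl
∑ᶜ-+ (suc N) zero    V W = ∑ᶜ-+ N zero (λ γ → V (0 ∷ γ)) (λ γ → W (0 ∷ γ))
∑ᶜ-+ (suc N) (suc b) V W = trans
  (cong₂ _+_ (∑ᶜ-+ N (suc b) (λ γ → V (0 ∷ γ)) (λ γ → W (0 ∷ γ))) (∑ᶜ-+ (suc N) b (λ γ → V (inc zero γ)) (λ γ → W (inc zero γ))))
  (solve 4 (λ p q r s → (p :+ q) :+ (r :+ s) := (p :+ r) :+ (q :+ s)) refl
    (∑ᶜ N (suc b) (λ γ → V (0 ∷ γ))) (∑ᶜ N (suc b) (λ γ → W (0 ∷ γ))) (∑ᶜ (suc N) b (λ γ → V (inc zero γ))) (∑ᶜ (suc N) b (λ γ → W (inc zero γ))))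
  where open +-*-Solver

∑ᶜ-*ˡ : ∀ N b r (V : Vec ℕ N → ℚ) → ∑ᶜ N b (λ γ → r * V γ) ≡ r * ∑ᶜ N b V
∑ᶜ-*ˡ zero    zero    r V = refl
∑ᶜ-*ˡ zero    (suc b) r V = sym (ℚₚ.*-zeroʳ r)
∑ᶜ-*ˡ (suc N) zero    r V = ∑ᶜ-*ˡ N zero r (λ γ → V (0 ∷ γ))
∑ᶜ-*ˡ (suc N) (suc b) r V = trans (cong₂ _+_ (∑ᶜ-*ˡ N (suc b) r (λ γ → V (0 ∷ γ))) (∑ᶜ-*ˡ (suc N) b r (λ γ → V (inc zero γ)))) (sym (ℚₚ.*-distribˡ-+ r _ _))

∑ᶜ-neg : ∀ N b (V : Vec ℕ N → ℚ) → ∑ᶜ N b (λ γ → - V γ) ≡ - ∑ᶜ N b V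
∑ᶜ-neg N b V = trans (∑ᶜ-cong N b (λ γ → solve 1 (λ x → :- x := con (- 1ℚ) :* x) refl (V γ)))
  (trans (∑ᶜ-*ˡ N b (- 1ℚ) V) (solve 1 (λ x → con (- 1ℚ) :* x := :- x) refl (∑ᶜ N b V)))
  where open +-*-Solver

∑ᶜ-zero : ∀ N b {V : Vec ℕ N → ℚ} → (∀ γ → V γ ≡ 0ℚ) → ∑ᶜ N b V ≡ 0ℚ
∑ᶜ-zero zero    zero    eq = eq []
∑ᶜ-zero zero    (suc b) eq = refl
∑ᶜ-zero (suc N) zero    eq = ∑ᶜ-zero N zero (λ γ → eq (0 ∷ γ))
∑ᶜ-zero (suc N) (suc b) eq = cong₂ _+_ (∑ᶜ-zero N (suc b) (λ γ → eq (0 ∷ γ))) (∑ᶜ-zero (suc N) b (λ γ → eq (inc zero γ)))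

∑ᶜ-at-zero : ∀ N (V : Vec ℕ N → ℚ) → ∑ᶜ N 0 V ≡ V (replicate N 0)
∑ᶜ-at-zero zero    V = refl
∑ᶜ-at-zero (suc N) V = ∑ᶜ-at-zero N (λ γ → V (0 ∷ γ))

-- Marking one unit: a vector of sum `suc b` arises by `inc d` with factor its own entry at `d`, and
-- these entries add up to `suc b`.
∑ᶜ-inc : ∀ N b (V : Vec ℕ N → ℚ) →
  ∑ᶜ N b (λ γ → ∑[ d < N ] (fromℕℚ (suc (lookup γ d)) * V (inc d γ))) ≡ fromℕℚ (suc b) * ∑ᶜ N (suc b) V
∑ᶜ-inc zero    zero    V = refl
∑ᶜ-inc zero    (suc b) V = sym (ℚₚ.*-zeroʳ (fromℕℚ (suc (suc b))))
∑ᶜ-inc (suc N) zero    V = begin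
  ∑ᶜ N 0 (λ γ → fromℕℚ 1 * V (1 ∷ γ) + ∑[ d < N ] (fromℕℚ (suc (lookup γ d)) * V (0 ∷ inc d γ)))
    ≡⟨ ∑ᶜ-+ N 0 (λ γ → fromℕℚ 1 * V (1 ∷ γ)) (λ γ → ∑[ d < N ] (fromℕℚ (suc (lookup γ d)) * V (0 ∷ inc d γ))) ⟩
  ∑ᶜ N 0 (λ γ → fromℕℚ 1 * V (1 ∷ γ)) + ∑ᶜ N 0 (λ γ → ∑[ d < N ] (fromℕℚ (suc (lookup γ d)) * V (0 ∷ inc d γ)))
    ≡⟨ cong₂ _+_ (∑ᶜ-*ˡ N 0 (fromℕℚ 1) (λ γ → V (1 ∷ γ))) (∑ᶜ-inc N 0 (λ γ → V (0 ∷ γ))) ⟩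
  fromℕℚ 1 * ∑ᶜ N 0 (λ γ → V (1 ∷ γ)) + fromℕℚ 1 * ∑ᶜ N 1 (λ γ → V (0 ∷ γ))
    ≡⟨ solve 3 (λ r p q → r :* p :+ r :* q := r :* (q :+ p)) refl (fromℕℚ 1) (∑ᶜ N 0 (λ γ → V (1 ∷ γ))) (∑ᶜ N 1 (λ γ → V (0 ∷ γ))) ⟩
  fromℕℚ 1 * (∑ᶜ N 1 (λ γ → V (0 ∷ γ)) + ∑ᶜ N 0 (λ γ → V (1 ∷ γ))) ∎
  where
  open ≡-Reasoning
  open +-*-Solver
∑ᶜ-inc (suc N) (suc b) V = begin
  ∑ᶜ N (suc b) (λ γ → fromℕℚ 1 * V (1 ∷ γ) + S γ) + ∑ᶜ (suc N) b (λ γ → ∑[ d < suc N ] (fromℕℚ (suc (lookup (inc zero γ) d)) * V (inc d (inc zero γ))))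
    ≡⟨ cong₂ _+_ (trans (∑ᶜ-+ N (suc b) (λ γ → fromℕℚ 1 * V (1 ∷ γ)) S) (cong₂ _+_ (∑ᶜ-*ˡ N (suc b) (fromℕℚ 1) (λ γ → V (1 ∷ γ))) (∑ᶜ-inc N (suc b) (λ γ → V (0 ∷ γ)))))
         (trans (∑ᶜ-cong (suc N) b regroup) (trans (∑ᶜ-+ (suc N) b (λ γ → V′ (inc zero γ)) (λ γ → ∑[ d < suc N ] (fromℕℚ (suc (lookup γ d)) * V′ (inc d γ))))
           (cong (∑ᶜ (suc N) b (λ γ → V′ (inc zero γ)) +_) (∑ᶜ-inc (suc N) b V′)))) ⟩
  (fromℕℚ 1 * p + fromℕℚ (suc (suc b)) * q) + (r + fromℕℚ (suc b) * (p + r))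
    ≡⟨ solve 4 (λ p q r k → ((con 1ℚ :+ con 0ℚ) :* p :+ (con 1ℚ :+ k) :* q) :+ (r :+ k :* (p :+ r)) := (con 1ℚ :+ k) :* (q :+ (p :+ r))) refl p q r (fromℕℚ (suc b)) ⟩
  fromℕℚ (suc (suc b)) * (q + (p + r)) ∎
  where
  open ≡-Reasoning
  open +-*-Solver
  V′ : Vec ℕ (suc N) → ℚ
  V′ γ = V (inc zero γ)
  S : Vec ℕ N → ℚ
  S γ = ∑[ d < N ] (fromℕℚ (suc (lookup γ d)) * V (0 ∷ inc d γ))
  p q r : ℚ
  p = ∑ᶜ N (suc b) (λ γ → V (1 ∷ γ))
  q = ∑ᶜ N (suc (suc b)) (λ γ → V (0 ∷ γ))
  r = ∑ᶜ (suc N) b (λ γ → V′ (inc zero γ))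
  regroup : ∀ γ → (∑[ d < suc N ] (fromℕℚ (suc (lookup (inc zero γ) d)) * V (inc d (inc zero γ)))) ≡
    V′ (inc zero γ) + ∑[ d < suc N ] (fromℕℚ (suc (lookup γ d)) * V′ (inc d γ))
  regroup (j ∷ γ) = solve 3 (λ k w s → (con 1ℚ :+ k) :* w :+ s := w :+ (k :* w :+ s)) refl
    (fromℕℚ (suc j)) (V (suc (suc j) ∷ γ)) (∑[ d < N ] (fromℕℚ (suc (lookup γ d)) * V (suc j ∷ inc d γ)))

-- Summation over the matrices with K rows, N columns and row sums bs.
∑ᴹ : ∀ {K} N → Vec ℕ K → (Vec (Vec ℕ N) K → ℚ) → ℚ
∑ᴹ N []       R = R []
∑ᴹ N (b ∷ bs) R = ∑ᶜ N b (λ γ → ∑ᴹ N bs (λ M → R (γ ∷ M)))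

∑ᴹ-+ : ∀ {K} N (bs : Vec ℕ K) R R′ → ∑ᴹ N bs (λ M → R M + R′ M) ≡ ∑ᴹ N bs R + ∑ᴹ N bs R′
∑ᴹ-+ N []       R R′ = refl
∑ᴹ-+ N (b ∷ bs) R R′ = trans (∑ᶜ-cong N b (λ γ → ∑ᴹ-+ N bs (λ M → R (γ ∷ M)) (λ M → R′ (γ ∷ M))))
  (∑ᶜ-+ N b (λ γ → ∑ᴹ N bs (λ M → R (γ ∷ M))) (λ γ → ∑ᴹ N bs (λ M → R′ (γ ∷ M))))

∑ᴹ-*ˡ : ∀ {K} N (bs : Vec ℕ K) r R → ∑ᴹ N bs (λ M → r * R M) ≡ r * ∑ᴹ N bs R
∑ᴹ-*ˡ N []       r R = refl
∑ᴹ-*ˡ N (b ∷ bs) r R = trans (∑ᶜ-cong N b (λ γ → ∑ᴹ-*ˡ N bs r (λ M → R (γ ∷ M)))) (∑ᶜ-*ˡ N b r (λ γ → ∑ᴹ N bs (λ M → R (γ ∷ M))))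

∑ᴹ-zero : ∀ {K} N (bs : Vec ℕ K) → ∑ᴹ N bs (λ M → 0ℚ) ≡ 0ℚ
∑ᴹ-zero N []       = refl
∑ᴹ-zero N (b ∷ bs) = ∑ᶜ-zero N b (λ γ → ∑ᴹ-zero N bs)

∑ᴹ-∑ : ∀ {K} N (bs : Vec ℕ K) {k} (R : Fin k → Vec (Vec ℕ N) K → ℚ) → ∑ᴹ N bs (λ M → ∑[ i < k ] R i M) ≡ ∑[ i < k ] ∑ᴹ N bs (R i)
∑ᴹ-∑ N bs {zero}  R = ∑ᴹ-zero N bs
∑ᴹ-∑ N bs {suc k} R = trans (∑ᴹ-+ N bs (R zero) (λ M → ∑[ i < k ] R (suc i) M)) (cong (∑ᴹ N bs (R zero) +_) (∑ᴹ-∑ N bs (R ∘ suc)))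

incᴹ : ∀ {K N} → Fin K → Fin N → Vec (Vec ℕ N) K → Vec (Vec ℕ N) K
incᴹ c d M = updateAt M c (inc d)

∑ᴹ-inc : ∀ {K} N (bs : Vec ℕ K) c R →
  ∑ᴹ N bs (λ M → ∑[ d < N ] (fromℕℚ (suc (lookup (lookup M c) d)) * R (incᴹ c d M))) ≡ fromℕℚ (suc (lookup bs c)) * ∑ᴹ N (inc c bs) R
∑ᴹ-inc N (b ∷ bs) zero R = trans
  (∑ᶜ-cong N b (λ γ → trans (∑ᴹ-∑ N bs (λ d M → fromℕℚ (suc (lookup γ d)) * R (inc d γ ∷ M)))
    (sum-cong-≗ {N} (λ d → ∑ᴹ-*ˡ N bs (fromℕℚ (suc (lookup γ d))) (λ M → R (inc d γ ∷ M))))))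
  (∑ᶜ-inc N b (λ γ → ∑ᴹ N bs (λ M → R (γ ∷ M))))
∑ᴹ-inc N (b ∷ bs) (suc c) R = trans
  (∑ᶜ-cong N b (λ γ → ∑ᴹ-inc N bs c (λ M → R (γ ∷ M))))
  (∑ᶜ-*ˡ N b (fromℕℚ (suc (lookup bs c))) (λ γ → ∑ᴹ N (inc c bs) (λ M → R (γ ∷ M))))

∑ᴹ-at-zero : ∀ K N R → ∑ᴹ N (replicate K 0) R ≡ R (replicate K (replicate N 0))
∑ᴹ-at-zero zero    N R = refl
∑ᴹ-at-zero (suc K) N R = trans (∑ᶜ-at-zero N _) (∑ᴹ-at-zero K N (λ M → R (replicate N 0 ∷ M)))

-- Pieri's rule

swapAt : ∀ {A : Set} {n} → Fin n → Vec A (suc n) → Vec A (suc n)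
swapAt zero    (a ∷ b ∷ u) = b ∷ a ∷ u
swapAt (suc i) (a ∷ u)     = a ∷ swapAt i u

swapAt-∸ : ∀ {n} (i : Fin n) (v : Vec ℤ (suc n)) γ → swapAt i (v -ᵛ γ) ≡ swapAt i v -ᵛ swapAt i γ
swapAt-∸ zero    (a ∷ b ∷ v) (j ∷ k ∷ γ) = refl
swapAt-∸ (suc i) (a ∷ v)     (j ∷ γ)     = cong (a ℤ.- ℤ.+ j ∷_) (swapAt-∸ i v γ)

zeroSecond : ∀ {N} → Vec ℕ (suc N) → Vec ℕ (suc (suc N))
zeroSecond (j ∷ γ) = j ∷ 0 ∷ γ

inc-zeroSecond : ∀ {N} (γ : Vec ℕ (suc N)) → inc zero (zeroSecond γ) ≡ zeroSecond (inc zero γ)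
inc-zeroSecond (j ∷ γ) = refl

swap-zeroSecond : ∀ {N} (γ : Vec ℕ (suc N)) → 0 ∷ γ ≡ swapAt zero (zeroSecond γ)
swap-zeroSecond (j ∷ γ) = refl

-- The recursion defining `∑ᶜ` treats the first entry specially. Having the same recursion for the
-- second entry is what makes the sum symmetric under exchanging the two.
∑ᶜ-second : ∀ N b (V : Vec ℕ (suc (suc N)) → ℚ) → ∑ᶜ (suc (suc N)) (suc b) V ≡
  ∑ᶜ (suc N) (suc b) (λ γ → V (zeroSecond γ)) + ∑ᶜ (suc (suc N)) b (λ γ → V (inc (suc zero) γ))
∑ᶜ-second N zero V = begin
  (p + q) + ∑ᶜ N 0 (λ γ → V (1 ∷ 0 ∷ γ))   ≡⟨ solve 3 (λ x y w → (x :+ y) :+ w := (x :+ w) :+ y) refl p q r ⟩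
  (p + r) + q ∎
  where
  open ≡-Reasoning
  open +-*-Solver
  p = ∑ᶜ N 1 (λ γ → V (0 ∷ 0 ∷ γ))
  q = ∑ᶜ N 0 (λ γ → V (0 ∷ 1 ∷ γ))
  r = ∑ᶜ N 0 (λ γ → V (1 ∷ 0 ∷ γ))
∑ᶜ-second N (suc b) V = begin
  (p + q) + ∑ᶜ (suc (suc N)) (suc b) (λ γ → V (inc zero γ))
    ≡⟨ cong ((p + q) +_) (∑ᶜ-second N b (λ γ → V (inc zero γ))) ⟩
  (p + q) + (∑ᶜ (suc N) (suc b) (λ γ → V (inc zero (zeroSecond γ))) + ∑ᶜ (suc (suc N)) b (λ γ → V (inc zero (inc (suc zero) γ))))
    ≡⟨ cong₂ (λ x y → (p + q) + (x + y)) (∑ᶜ-cong (suc N) (suc b) (λ γ → cong V (inc-zeroSecond γ))) (∑ᶜ-cong (suc (suc N)) b (λ { (j ∷ k ∷ γ) → refl })) ⟩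
  (p + q) + (r + s)
    ≡⟨ solve 4 (λ x y w t → (x :+ y) :+ (w :+ t) := (x :+ w) :+ (y :+ t)) refl p q r s ⟩
  (p + r) + (q + s) ∎
  where
  open ≡-Reasoning
  open +-*-Solver
  p = ∑ᶜ N (suc (suc b)) (λ γ → V (0 ∷ 0 ∷ γ))
  q = ∑ᶜ (suc N) (suc b) (λ γ → V (0 ∷ inc zero γ))
  r = ∑ᶜ (suc N) (suc b) (λ γ → V (zeroSecond (inc zero γ)))
  s = ∑ᶜ (suc (suc N)) b (λ γ → V (inc (suc zero) (inc zero γ)))

∑ᶜ-swapAt : ∀ N b (i : Fin N) (V : Vec ℕ (suc N) → ℚ) → ∑ᶜ (suc N) b V ≡ ∑ᶜ (suc N) b (λ γ → V (swapAt i γ))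
∑ᶜ-swapAt (suc N) zero    zero V = refl
∑ᶜ-swapAt (suc N) (suc b) zero V = begin
  ∑ᶜ (suc N) (suc b) (λ γ → V (0 ∷ γ)) + ∑ᶜ (suc (suc N)) b (λ γ → V (inc zero γ))
    ≡⟨ cong₂ _+_ (∑ᶜ-cong (suc N) (suc b) (λ γ → cong V (swap-zeroSecond γ))) (trans (∑ᶜ-swapAt (suc N) b zero (λ γ → V (inc zero γ))) (∑ᶜ-cong (suc (suc N)) b (λ { (j ∷ k ∷ γ) → refl }))) ⟩
  ∑ᶜ (suc N) (suc b) (λ γ → V (swapAt zero (zeroSecond γ))) + ∑ᶜ (suc (suc N)) b (λ γ → V (swapAt zero (inc (suc zero) γ)))
    ≡⟨ sym (∑ᶜ-second N b (λ γ → V (swapAt zero γ))) ⟩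
  ∑ᶜ (suc (suc N)) (suc b) (λ γ → V (swapAt zero γ)) ∎
  where open ≡-Reasoning
∑ᶜ-swapAt (suc N) zero    (suc i) V = ∑ᶜ-swapAt N zero i (λ γ → V (0 ∷ γ))
∑ᶜ-swapAt (suc N) (suc b) (suc i) V = cong₂ _+_ (∑ᶜ-swapAt N (suc b) i (λ γ → V (0 ∷ γ)))
  (trans (∑ᶜ-swapAt (suc N) b (suc i) (λ γ → V (inc zero γ))) (∑ᶜ-cong (suc (suc N)) b (λ { (j ∷ γ) → refl })))

Alternating : ∀ {N} → (Vec ℤ N → ℚ) → Set
Alternating {zero}  G = ⊤
Alternating {suc N} G = ∀ i u → G (swapAt i u) ≡ - G u

NonNegSupport : ∀ {N} → (Vec ℤ N → ℚ) → Set
NonNegSupport {N} G = ∀ u (i : Fin N) → lookup u i ℤ.< ℤ.+ 0 → G u ≡ 0ℚ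

∑ᶜ-alternating : ∀ N b {G : Vec ℤ N → ℚ} → Alternating G → Alternating (λ v → ∑ᶜ N b (λ γ → G (v -ᵛ γ)))
∑ᶜ-alternating zero    b alt = tt
∑ᶜ-alternating (suc N) b {G} alt i v = begin
  ∑ᶜ (suc N) b (λ γ → G (swapAt i v -ᵛ γ))
    ≡⟨ ∑ᶜ-swapAt N b i (λ γ → G (swapAt i v -ᵛ γ)) ⟩
  ∑ᶜ (suc N) b (λ γ → G (swapAt i v -ᵛ swapAt i γ))
    ≡⟨ ∑ᶜ-cong (suc N) b (λ γ → trans (cong G (sym (swapAt-∸ i v γ))) (alt i (v -ᵛ γ))) ⟩
  ∑ᶜ (suc N) b (λ γ → - G (v -ᵛ γ))
    ≡⟨ ∑ᶜ-neg (suc N) b (λ γ → G (v -ᵛ γ)) ⟩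
  - ∑ᶜ (suc N) b (λ γ → G (v -ᵛ γ)) ∎
  where open ≡-Reasoning

-ᵛ-negative : ∀ {N} (v : Vec ℤ N) γ i → lookup v i ℤ.< ℤ.+ 0 → lookup (v -ᵛ γ) i ℤ.< ℤ.+ 0
-ᵛ-negative v γ i neg = subst (ℤ._< ℤ.+ 0) (sym (Vecₚ.lookup-zipWith (λ a b → a ℤ.- ℤ.+ b) i v γ)) (ℤₚ.≤-<-trans (subst (lookup v i ℤ.- ℤ.+ lookup γ i ℤ.≤_) (ℤₚ.+-identityʳ (lookup v i)) (ℤₚ.+-monoʳ-≤ (lookup v i) (ℤₚ.neg-mono-≤ (ℤ.+≤+ (z≤n {lookup γ i}))))) neg)

∑ᶜ-support : ∀ N b {G : Vec ℤ N → ℚ} → NonNegSupport G → NonNegSupport (λ v → ∑ᶜ N b (λ γ → G (v -ᵛ γ)))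
∑ᶜ-support N b supp v i neg = ∑ᶜ-zero N b (λ γ → supp (v -ᵛ γ) i (-ᵛ-negative v γ i neg))

∑ᶜ-repeated : ∀ N b {G : Vec ℤ (suc (suc N)) → ℚ} → Alternating G → ∀ h w → ∑ᶜ (suc (suc N)) b (λ γ → G ((h ∷ h ∷ w) -ᵛ γ)) ≡ 0ℚ
∑ᶜ-repeated N b {G} alt h w = x≡-x⇒x≡0 (∑ᶜ-alternating (suc (suc N)) b {G} alt zero (h ∷ h ∷ w))

∑ᶜ-one : ∀ b (V : Vec ℕ 1 → ℚ) → ∑ᶜ 1 b V ≡ V (b ∷ [])
∑ᶜ-one zero    V = refl
∑ᶜ-one (suc b) V = trans (ℚₚ.+-identityˡ _) (∑ᶜ-one b (λ γ → V (inc zero γ)))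

Decreasing : ∀ {N} → Vec ℕ N → Set
Decreasing []           = ⊤
Decreasing (t ∷ [])     = ⊤
Decreasing (t ∷ s ∷ ts) = s ≤ t × Decreasing (s ∷ ts)

Decreasing-snoc : ∀ {N} (ts : Vec ℕ N) → Decreasing ts → Decreasing (ts Vec.∷ʳ 0)
Decreasing-snoc []           _       = tt
Decreasing-snoc (t ∷ [])     _       = z≤n , tt
Decreasing-snoc (t ∷ s ∷ ts) (p , d) = p , Decreasing-snoc (s ∷ ts) d

Decreasing-tail : ∀ {N} t (ts : Vec ℕ N) → Decreasing (t ∷ ts) → Decreasing ts
Decreasing-tail t []       _       = tt
Decreasing-tail t (s ∷ ts) (_ , d) = d

pos-suc-∸ : ∀ a j → ℤ.+ suc a ℤ.- ℤ.+ suc j ≡ ℤ.+ a ℤ.- ℤ.+ j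
pos-suc-∸ a j = trans (ℤₚ.m-n≡m⊖n (suc a) (suc j)) (trans (ℤₚ.[1+m]⊖[1+n]≡m⊖n a j) (sym (ℤₚ.m-n≡m⊖n a j)))

𝟙-suc : ∀ b t → 𝟙 (suc b ℕ.≟ suc t) ≡ 𝟙 (b ℕ.≟ t)
𝟙-suc b t = 𝟙-⇔ (suc b ℕ.≟ suc t) (b ℕ.≟ t) ℕₚ.suc-injective (cong suc)

-- Pieri: removing a horizontal strip of at least t₀ boxes from (t₀ ≥ t₁ ≥ …) is
-- possible only by removing the first row length, which leaves (t₁, t₂, …, 0).
pieri : ∀ N {G : Vec ℤ (suc N) → ℚ} → Alternating G → NonNegSupport G → ∀ t ts → Decreasing (t ∷ ts) → ∀ b → t ≤ b →
  ∑ᶜ (suc N) b (λ γ → G (shifted (t ∷ ts) -ᵛ γ)) ≡ 𝟙 (b ℕ.≟ t) * G (shifted (ts Vec.∷ʳ 0))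
pieri zero {G} alt supp t [] _ b t≤b = trans (∑ᶜ-one b (λ γ → G (shifted (t ∷ []) -ᵛ γ))) (final (b ℕ.≟ t))
  where
  final : (d : Dec (b ≡ t)) → G (ℤ.+ (t ℕ.+ 0) ℤ.- ℤ.+ b ∷ []) ≡ 𝟙 (b ℕ.≟ t) * G (ℤ.+ 0 ∷ [])
  final (yes refl) = trans (cong (λ a → G (a ∷ [])) (trans (cong (λ s → ℤ.+ s ℤ.- ℤ.+ t) (ℕₚ.+-identityʳ t)) (ℤₚ.+-inverseʳ (ℤ.+ t))))
    (sym (trans (cong (_* G (ℤ.+ 0 ∷ [])) (𝟙-yes (b ℕ.≟ t) refl)) (ℚₚ.*-identityˡ _)))
  final (no b≢t) = trans (supp (ℤ.+ (t ℕ.+ 0) ℤ.- ℤ.+ b ∷ []) zero negative)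
    (sym (trans (cong (_* G (ℤ.+ 0 ∷ [])) (𝟙-no (b ℕ.≟ t) b≢t)) (ℚₚ.*-zeroˡ (G (ℤ.+ 0 ∷ [])))))
    where
    negative : ℤ.+ (t ℕ.+ 0) ℤ.- ℤ.+ b ℤ.< ℤ.+ 0
    negative = subst (ℤ.+ (t ℕ.+ 0) ℤ.- ℤ.+ b ℤ.<_) (ℤₚ.+-inverseʳ (ℤ.+ b))
      (ℤₚ.+-monoˡ-< (ℤ.- ℤ.+ b) (ℤ.+<+ (subst (_< b) (sym (ℕₚ.+-identityʳ t)) (ℕₚ.≤∧≢⇒< t≤b (b≢t ∘ sym)))))
pieri (suc N) {G} alt supp t (s ∷ ts) (s≤t , dec) b t≤b =
  subst (λ t → t ≤ b → ∑ᶜ (suc (suc N)) b (λ γ → G (shifted (t ∷ s ∷ ts) -ᵛ γ)) ≡ 𝟙 (b ℕ.≟ t) * G (shifted ((s ∷ ts) Vec.∷ʳ 0)))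
    (ℕₚ.m∸n+n≡m s≤t) (rowDifference (t ℕ.∸ s) b) t≤b
  where
  open ≡-Reasoning
  target : ℚ
  target = G (shifted ((s ∷ ts) Vec.∷ʳ 0))

  tailSum : ∀ h b → s ≤ b → ∑ᶜ (suc N) b (λ γ → G (h ℤ.- ℤ.+ 0 ∷ (shifted (s ∷ ts) -ᵛ γ))) ≡ 𝟙 (b ℕ.≟ s) * G (h ∷ shifted (ts Vec.∷ʳ 0))
  tailSum h b s≤b = trans (∑ᶜ-cong (suc N) b (λ γ → cong (λ a → G (a ∷ (shifted (s ∷ ts) -ᵛ γ))) (ℤₚ.+-identityʳ h)))
    (pieri N {λ u → G (h ∷ u)} (λ i u → alt (suc i) (h ∷ u)) (λ u i → supp (h ∷ u) (suc i)) s ts dec b s≤b)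

  -- Induction on the excess `e` of the first row over the second. Either the first bead stays put,
  -- and by induction on `N` the others contribute only if `b ≡ s`, or it is lowered by one, which
  -- is the same problem with smaller `e` and `b`.
  rowDifference : ∀ e b → e ℕ.+ s ≤ b →
    ∑ᶜ (suc (suc N)) b (λ γ → G (shifted (e ℕ.+ s ∷ s ∷ ts) -ᵛ γ)) ≡ 𝟙 (b ℕ.≟ e ℕ.+ s) * target
  rowDifference zero zero s≤b = tailSum (ℤ.+ (s ℕ.+ suc N)) 0 s≤b
  -- With equal rows, lowering the first bead by one puts it on the second, and the alternating sum
  -- vanishes.
  rowDifference zero (suc b) s≤b = trans (cong₂ _+_ (tailSum (ℤ.+ (s ℕ.+ suc N)) (suc b) s≤b)
      (trans (∑ᶜ-cong (suc (suc N)) b (λ { (j ∷ γ) → cong (λ a → G (a ∷ (shifted (s ∷ ts) -ᵛ γ)))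
        (trans (cong (λ k → ℤ.+ k ℤ.- ℤ.+ suc j) (ℕₚ.+-suc s N)) (pos-suc-∸ (s ℕ.+ N) j)) }))
        (∑ᶜ-repeated N b {G} alt (ℤ.+ (s ℕ.+ N)) (shifted ts))))
    (ℚₚ.+-identityʳ _)
  rowDifference (suc e) (suc b) (s≤s e+s≤b) = begin
    ∑ᶜ (suc N) (suc b) (λ γ → G (h ℤ.- ℤ.+ 0 ∷ (shifted (s ∷ ts) -ᵛ γ))) + ∑ᶜ (suc (suc N)) b (λ γ → G (shifted (suc e ℕ.+ s ∷ s ∷ ts) -ᵛ inc zero γ))
      ≡⟨ cong₂ _+_ (trans (tailSum h (suc b) s≤1+b) (trans (cong (_* G (h ∷ shifted (ts Vec.∷ʳ 0))) (𝟙-no (suc b ℕ.≟ s) (λ eq → ℕₚ.<⇒≢ s<1+b (sym eq)))) (ℚₚ.*-zeroˡ (G (h ∷ shifted (ts Vec.∷ʳ 0))))))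
           (trans (∑ᶜ-cong (suc (suc N)) b (λ { (j ∷ γ) → cong (λ a → G (a ∷ (shifted (s ∷ ts) -ᵛ γ))) (pos-suc-∸ (e ℕ.+ s ℕ.+ suc N) j) }))
             (rowDifference e b e+s≤b)) ⟩
    0ℚ + 𝟙 (b ℕ.≟ e ℕ.+ s) * target
      ≡⟨ trans (ℚₚ.+-identityˡ _) (cong (_* target) (sym (𝟙-suc b (e ℕ.+ s)))) ⟩
    𝟙 (suc b ℕ.≟ suc e ℕ.+ s) * target ∎
    where
    h : ℤ
    h = ℤ.+ (suc e ℕ.+ s ℕ.+ suc N)
    s<1+b : s < suc b
    s<1+b = s≤s (ℕₚ.≤-trans (ℕₚ.m≤n+m s e) e+s≤b)
    s≤1+b : s ≤ suc b
    s≤1+b = ℕₚ.<⇒≤ s<1+b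

-- With `Eᵛ` and `shifted θ` this is the Kostka number of shape `θ` and content `bs`: the
-- coefficient of x^(θ+δ) in the Vandermonde product times the complete homogeneous functions of
-- degrees `bs`.
stripRows : ∀ {K N} → Vec ℕ K → (Vec ℤ N → ℚ) → Vec ℤ N → ℚ
stripRows         []       G v = G v
stripRows {N = N} (b ∷ bs) G v = ∑ᶜ N b (λ γ → stripRows bs G (v -ᵛ γ))

stripRows-alternating : ∀ {K N} (bs : Vec ℕ K) {G : Vec ℤ N → ℚ} → Alternating G → Alternating (stripRows bs G)
stripRows-alternating         []       alt = alt
stripRows-alternating {N = N} (b ∷ bs) {G} alt = ∑ᶜ-alternating N b {stripRows bs G} (stripRows-alternating bs alt)

stripRows-support : ∀ {K N} (bs : Vec ℕ K) {G : Vec ℤ N → ℚ} → NonNegSupport G → NonNegSupport (stripRows bs G)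
stripRows-support         []       supp = supp
stripRows-support {N = N} (b ∷ bs) {G} supp = ∑ᶜ-support N b {stripRows bs G} (stripRows-support bs supp)

Eᵛ : ∀ {N} → Vec ℤ N → ℚ
Eᵛ {N} u = E N (toList u)

swapAt-~ˢ : ∀ {A : Set} {n} (i : Fin n) (u : Vec A (suc n)) → toList u ~ˢ toList (swapAt i u)
swapAt-~ˢ zero    (a ∷ b ∷ u) = swap a b (toList u)
swapAt-~ˢ (suc i) (a ∷ u)     = skip a (swapAt-~ˢ i u)

Eᵛ-alternating : ∀ N → Alternating {N} Eᵛ
Eᵛ-alternating zero    = tt
Eᵛ-alternating (suc N) i u = E-~ˢ (swapAt-~ˢ i u)

Eᵛ-support : ∀ {N} → NonNegSupport {N} Eᵛ
Eᵛ-support {N} u i neg = E-inadmissible (λ (_ , rng) → ℤₚ.<⇒≱ neg (proj₁ (rangeAt u rng i)))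
  where
  rangeAt : ∀ {M} (u : Vec ℤ M) → All (InRange N) (toList u) → ∀ i → InRange N (lookup u i)
  rangeAt (a ∷ u) (p ∷ ps) zero    = p
  rangeAt (a ∷ u) (p ∷ ps) (suc i) = rangeAt u ps i

toList-∷ʳ : ∀ {N} (w : Vec ℕ N) a → toList (w Vec.∷ʳ a) ≡ toList w ++ a ∷ []
toList-∷ʳ []      a = refl
toList-∷ʳ (b ∷ w) a = cong (b ∷_) (toList-∷ʳ w a)

replicate-snoc : ∀ j → List.replicate j 0 ++ 0 ∷ [] ≡ List.replicate (suc j) 0
replicate-snoc zero    = refl
replicate-snoc (suc j) = cong (0 ∷_) (replicate-snoc j)

replicate-toList : ∀ {N} (w : Vec ℕ N) j → toList w ≡ List.replicate j 0 → w ≡ replicate N 0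
replicate-toList []      j       eq = refl
replicate-toList (a ∷ w) (suc j) eq = cong₂ _∷_ (Listₚ.∷-injectiveˡ eq) (replicate-toList w j (Listₚ.∷-injectiveʳ eq))

-- Unitriangularity of the Kostka numbers: by Pieri's rule each strip must remove exactly the length
-- of the current first row. The number of beads stays `N`, so every removal appends a zero, and `j`
-- counts the zeros appended so far.
stripRows-lex : ∀ {K N} (bs ts : Vec ℕ K) (w : Vec ℕ N) j → toList w ≡ toList ts ++ List.replicate j 0 → Decreasing w →
  LexAtLeast bs ts → stripRows bs Eᵛ (shifted w) ≡ 𝟙 (Vecₚ.≡-dec ℕ._≟_ bs ts)
stripRows-lex {N = N} [] [] w j pad dec lex = trans (cong (λ w → Eᵛ (shifted w)) (replicate-toList w j pad)) (E-staircase N)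
stripRows-lex {N = suc N} (b ∷ bs) (t ∷ ts) (t′ ∷ w) j pad dec (t≤b , lex) with Listₚ.∷-injectiveˡ pad
... | refl = begin
  ∑ᶜ (suc N) b (λ γ → stripRows bs Eᵛ (shifted (t ∷ w) -ᵛ γ))
    ≡⟨ pieri N {stripRows bs Eᵛ} (stripRows-alternating bs {Eᵛ} (Eᵛ-alternating (suc N))) (stripRows-support bs {Eᵛ} Eᵛ-support) t w dec b t≤b ⟩
  𝟙 (b ℕ.≟ t) * stripRows bs Eᵛ (shifted (w Vec.∷ʳ 0))
    ≡⟨ 𝟙-guard (b ℕ.≟ t) (λ b≡t → stripRows-lex bs ts (w Vec.∷ʳ 0) (suc j) pad′ (Decreasing-snoc w (Decreasing-tail t w dec)) (lex b≡t)) ⟩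
  𝟙 (b ℕ.≟ t) * 𝟙 (Vecₚ.≡-dec ℕ._≟_ bs ts)
    ≡⟨ trans (sym (𝟙-× (b ℕ.≟ t) (Vecₚ.≡-dec ℕ._≟_ bs ts))) (𝟙-⇔ ((b ℕ.≟ t) ×-dec (Vecₚ.≡-dec ℕ._≟_ bs ts)) (Vecₚ.≡-dec ℕ._≟_ (b ∷ bs) (t ∷ ts))
         (λ (p , q) → cong₂ _∷_ p q) (λ eq → Vecₚ.∷-injectiveˡ eq , Vecₚ.∷-injectiveʳ eq)) ⟩
  𝟙 (Vecₚ.≡-dec ℕ._≟_ (b ∷ bs) (t ∷ ts)) ∎
  where
  open ≡-Reasoning
  pad′ : toList (w Vec.∷ʳ 0) ≡ toList ts ++ List.replicate (suc j) 0
  pad′ = trans (toList-∷ʳ w 0) (trans (cong (_++ 0 ∷ []) (Listₚ.∷-injectiveʳ pad))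
    (trans (Listₚ.++-assoc (toList ts) (List.replicate j 0) (0 ∷ [])) (cong (toList ts ++_) (replicate-snoc j))))

-- Contingency tables of two words

_≟²_ : ∀ {K N} → DecidableEquality (Fin K × Fin N)
_≟²_ = Productₚ.≡-dec _≟ᶠ_ _≟ᶠ_

pairs : ∀ {K N n} → Vec (Fin K) n → Vec (Fin N) n → Fin n → Fin K × Fin N
pairs x y i = lookup x i , lookup y i

contingency : ∀ {K N n} → Vec (Fin K) n → Vec (Fin N) n → Vec (Vec ℕ N) K
contingency {K} {N} []      []      = replicate K (replicate N 0)
contingency         (c ∷ x) (d ∷ y) = incᴹ c d (contingency x y)

lookup-inc : ∀ {N} (c d : Fin N) b → lookup (inc c b) d ≡ isℕ (c ≟ᶠ d) ℕ.+ lookup b d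
lookup-inc c d b with c ≟ᶠ d
... | yes refl = Vecₚ.lookup∘updateAt c b
... | no  c≢d  = Vecₚ.lookup∘updateAt′ d c (c≢d ∘ sym) b

lookup-incᴹ : ∀ {K N} (c c′ : Fin K) (d d′ : Fin N) M →
  lookup (lookup (incᴹ c d M) c′) d′ ≡ isℕ ((c , d) ≟² (c′ , d′)) ℕ.+ lookup (lookup M c′) d′
lookup-incᴹ c c′ d d′ M = split (c ≟ᶠ c′) (d ≟ᶠ d′)
  where
  split : Dec (c ≡ c′) → Dec (d ≡ d′) → lookup (lookup (incᴹ c d M) c′) d′ ≡ isℕ ((c , d) ≟² (c′ , d′)) ℕ.+ lookup (lookup M c′) d′
  split (yes refl) d?         = trans (cong (λ γ → lookup γ d′) (Vecₚ.lookup∘updateAt c M)) (trans (lookup-inc d d′ (lookup M c))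
    (cong (ℕ._+ lookup (lookup M c) d′) (isℕ-⇔ (d ≟ᶠ d′) ((c , d) ≟² (c , d′)) (cong (c ,_)) (cong proj₂))))
  split (no c≢c′)  _          = trans (cong (λ γ → lookup γ d′) (Vecₚ.lookup∘updateAt′ c′ c (c≢c′ ∘ sym) M))
    (cong (ℕ._+ lookup (lookup M c′) d′) (sym (isℕ-no ((c , d) ≟² (c′ , d′)) (c≢c′ ∘ cong proj₁))))

lookup-contingency : ∀ {K N n} (x : Vec (Fin K) n) (y : Vec (Fin N) n) c d → lookup (lookup (contingency x y) c) d ≡ occ _≟²_ (pairs x y) (c , d)
lookup-contingency {K} {N} [] [] c d = trans (cong (λ γ → lookup γ d) (Vecₚ.lookup-replicate c (replicate N 0))) (Vecₚ.lookup-replicate d 0)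
lookup-contingency (c₀ ∷ x) (d₀ ∷ y) c d = trans (lookup-incᴹ c₀ c d₀ d (contingency x y))
  (cong (isℕ ((c₀ , d₀) ≟² (c , d)) ℕ.+_) (lookup-contingency x y c d))

content-[] : ∀ {N} → content {N} [] ≡ replicate N 0
content-[] = vec-ext (λ k → trans (Vecₚ.lookup∘tabulate (λ _ → 0) k) (sym (Vecₚ.lookup-replicate k 0)))

content-∷ : ∀ {N n} c (x : Vec (Fin N) n) → content (c ∷ x) ≡ inc c (content x)
content-∷ c x = vec-ext (λ d → trans (Vecₚ.lookup∘tabulate (occ _≟ᶠ_ (lookup (c ∷ x))) d)
  (sym (trans (lookup-inc c d (content x)) (cong (isℕ (c ≟ᶠ d) ℕ.+_) (Vecₚ.lookup∘tabulate (occ _≟ᶠ_ (lookup x)) d)))))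

-- Orbit and stabiliser: for fixed `x` the words `y` with a given table form one orbit of the
-- stabiliser of `x`, and the stabiliser of a point of it has order `stabOrder _≟²_ (pairs x y)`.
-- Thus each table receives the whole order of the stabiliser of `x`. The induction adds one
-- position at a time and needs only `∑ᴹ-inc`.
∑ᵛ-contingency : ∀ {K N} n (x : Vec (Fin K) n) (R : Vec (Vec ℕ N) K → ℚ) →
  ∑ᵛ n (λ y → stabOrder _≟²_ (pairs x y) * R (contingency x y)) ≡ stabOrder _≟ᶠ_ (lookup x) * ∑ᴹ N (content x) R
∑ᵛ-contingency {K} {N} zero [] R = cong (1ℚ *_) (sym (trans (cong (λ b → ∑ᴹ N b R) (content-[] {K})) (∑ᴹ-at-zero K N R)))
∑ᵛ-contingency {K} {N} (suc n) (c ∷ x) R = begin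
  (∑[ d < N ] ∑ᵛ n (λ y → fromℕℚ (suc (occ _≟²_ (pairs x y) (c , d))) * w y * R (incᴹ c d (contingency x y))))
    ≡⟨ sum-cong-≗ {N} (λ d → ∑ᵛ-cong n (λ y → trans
         (cong (λ k → fromℕℚ (suc k) * w y * R (incᴹ c d (contingency x y))) (sym (lookup-contingency x y c d)))
         (solve 3 (λ k s r → k :* s :* r := s :* (k :* r)) refl (fromℕℚ (suc (lookup (lookup (contingency x y) c) d))) (w y) (R (incᴹ c d (contingency x y)))))) ⟩
  (∑[ d < N ] ∑ᵛ n (λ y → w y * (fromℕℚ (suc (lookup (lookup (contingency x y) c) d)) * R (incᴹ c d (contingency x y)))))
    ≡⟨ sym (∑ᵛ-∑ n (λ y d → w y * (fromℕℚ (suc (lookup (lookup (contingency x y) c) d)) * R (incᴹ c d (contingency x y))))) ⟩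
  ∑ᵛ n (λ y → ∑[ d < N ] (w y * (fromℕℚ (suc (lookup (lookup (contingency x y) c) d)) * R (incᴹ c d (contingency x y)))))
    ≡⟨ ∑ᵛ-cong n (λ y → sym (*-distribˡ-sum {N} (w y) (λ d → fromℕℚ (suc (lookup (lookup (contingency x y) c) d)) * R (incᴹ c d (contingency x y))))) ⟩
  ∑ᵛ n (λ y → w y * R′ (contingency x y))
    ≡⟨ ∑ᵛ-contingency n x R′ ⟩
  stabOrder _≟ᶠ_ (lookup x) * ∑ᴹ N (content x) R′
    ≡⟨ cong (stabOrder _≟ᶠ_ (lookup x) *_) (∑ᴹ-inc N (content x) c R) ⟩
  stabOrder _≟ᶠ_ (lookup x) * (fromℕℚ (suc (lookup (content x) c)) * ∑ᴹ N (inc c (content x)) R)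
    ≡⟨ solve 3 (λ s k r → s :* (k :* r) := k :* s :* r) refl (stabOrder _≟ᶠ_ (lookup x)) (fromℕℚ (suc (lookup (content x) c))) (∑ᴹ N (inc c (content x)) R) ⟩
  fromℕℚ (suc (lookup (content x) c)) * stabOrder _≟ᶠ_ (lookup x) * ∑ᴹ N (inc c (content x)) R
    ≡⟨ cong₂ (λ k b → fromℕℚ (suc k) * stabOrder _≟ᶠ_ (lookup x) * ∑ᴹ N b R) (Vecₚ.lookup∘tabulate (occ _≟ᶠ_ (lookup x)) c) (sym (content-∷ c x)) ⟩
  stabOrder _≟ᶠ_ (lookup (c ∷ x)) * ∑ᴹ N (content (c ∷ x)) R ∎
  where
  open ≡-Reasoning
  open +-*-Solver
  w : Vec (Fin N) n → ℚ
  w y = stabOrder _≟²_ (pairs x y)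
  R′ : Vec (Vec ℕ N) K → ℚ
  R′ M = ∑[ d < N ] (fromℕℚ (suc (lookup (lookup M c) d)) * R (incᴹ c d M))

subtractRows : ∀ {K N} → Vec ℤ N → Vec (Vec ℕ N) K → Vec ℤ N
subtractRows v []      = v
subtractRows v (γ ∷ M) = subtractRows (v -ᵛ γ) M

∑ᴹ-subtractRows : ∀ {K N} (bs : Vec ℕ K) (G : Vec ℤ N → ℚ) v → ∑ᴹ N bs (λ M → G (subtractRows v M)) ≡ stripRows bs G v
∑ᴹ-subtractRows         []       G v = refl
∑ᴹ-subtractRows {N = N} (b ∷ bs) G v = ∑ᶜ-cong N b (λ γ → ∑ᴹ-subtractRows bs G (v -ᵛ γ))

lowerAt : ∀ {N} → Fin N → ℕ → Vec ℤ N → Vec ℤ N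
lowerAt c a v = updateAt v c (λ b → b ℤ.- ℤ.+ a)

lowerAt-∸ : ∀ {N} (c : Fin N) a v γ → lowerAt c a v -ᵛ γ ≡ lowerAt c a (v -ᵛ γ)
lowerAt-∸ zero    a (b ∷ v) (j ∷ γ) = cong (_∷ (v -ᵛ γ)) (solve 3 (λ x y w → x :- y :- w := x :- w :- y) refl b (ℤ.+ a) (ℤ.+ j))
  where open ℤ-Solver
lowerAt-∸ (suc c) a (b ∷ v) (j ∷ γ) = cong (b ℤ.- ℤ.+ j ∷_) (lowerAt-∸ c a v γ)

-ᵛ-inc : ∀ {N} (c : Fin N) (v : Vec ℤ N) γ → v -ᵛ inc c γ ≡ lowerAt c 1 (v -ᵛ γ)
-ᵛ-inc zero    (b ∷ v) (j ∷ γ) = cong (_∷ (v -ᵛ γ)) (trans (cong (λ k → b ℤ.- k) (ℤₚ.pos-+ 1 j)) (solve 2 (λ x y → x :- (con (ℤ.+ 1) :+ y) := x :- y :- con (ℤ.+ 1)) refl b (ℤ.+ j)))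
  where open ℤ-Solver
-ᵛ-inc (suc c) (b ∷ v) (j ∷ γ) = cong (b ℤ.- ℤ.+ j ∷_) (-ᵛ-inc c v γ)

-ᵛ-zero : ∀ {N} (v : Vec ℤ N) → v -ᵛ replicate N 0 ≡ v
-ᵛ-zero []      = refl
-ᵛ-zero (b ∷ v) = cong₂ _∷_ (ℤₚ.+-identityʳ b) (-ᵛ-zero v)

subtractRows-lowerAt : ∀ {K N} (d : Fin N) v (M : Vec (Vec ℕ N) K) → subtractRows (lowerAt d 1 v) M ≡ lowerAt d 1 (subtractRows v M)
subtractRows-lowerAt d v []      = refl
subtractRows-lowerAt d v (γ ∷ M) = trans (cong (λ u → subtractRows u M) (lowerAt-∸ d 1 v γ)) (subtractRows-lowerAt d (v -ᵛ γ) M)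

subtractRows-inc : ∀ {K N} (c : Fin K) (d : Fin N) v M → subtractRows v (incᴹ c d M) ≡ lowerAt d 1 (subtractRows v M)
subtractRows-inc zero    d v (γ ∷ M) = trans (cong (λ u → subtractRows u M) (-ᵛ-inc d v γ)) (subtractRows-lowerAt d (v -ᵛ γ) M)
subtractRows-inc (suc c) d v (γ ∷ M) = subtractRows-inc c d (v -ᵛ γ) M

subtractRows-zero : ∀ K {N} (v : Vec ℤ N) → subtractRows v (replicate K (replicate N 0)) ≡ v
subtractRows-zero zero    v = refl
subtractRows-zero (suc K) v = trans (cong (λ u → subtractRows u (replicate K _)) (-ᵛ-zero v)) (subtractRows-zero K v)

subtractRows-contingency : ∀ {K N n} v (x : Vec (Fin K) n) (y : Vec (Fin N) n) → subtractRows v (contingency x y) ≡ v -ᵛ content y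
subtractRows-contingency {K} {N} v [] [] = trans (subtractRows-zero K v) (sym (trans (cong (v -ᵛ_) (content-[] {N})) (-ᵛ-zero v)))
subtractRows-contingency v (c ∷ x) (d ∷ y) = trans (subtractRows-inc c d v (contingency x y))
  (trans (cong (lowerAt d 1) (subtractRows-contingency v x y)) (sym (trans (cong (v -ᵛ_) (content-∷ d y)) (-ᵛ-inc d v (content y)))))

toList-tabulate-nth : ∀ N l → length l ≤ N → ∃[ j ] toList (tabulate {n = N} (λ k → nth l (toℕ k))) ≡ l ++ List.replicate j 0
toList-tabulate-nth N       []      _       = N , trans (cong toList (vec-ext {ys = replicate N 0} (λ k → trans (Vecₚ.lookup∘tabulate (λ _ → 0) k) (sym (Vecₚ.lookup-replicate k 0))))) (Vecₚ.toList-replicate N 0)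
toList-tabulate-nth (suc N) (a ∷ l) (s≤s p) with toList-tabulate-nth N l p
... | j , eq = j , cong (a ∷_) eq

Decreasing-tabulate : ∀ N (T : ℕ → ℕ) → (∀ {i j} → i ≤ j → T j ≤ T i) → Decreasing {N} (tabulate (λ k → T (toℕ k)))
Decreasing-tabulate zero          T mono = tt
Decreasing-tabulate (suc zero)    T mono = tt
Decreasing-tabulate (suc (suc N)) T mono = mono z≤n , Decreasing-tabulate (suc N) (T ∘ suc) (mono ∘ s≤s)

∑ᴳ-+ : ∀ {n} (f h : Permutation′ n → ℚ) → ∑ᴳ n (λ g → f g + h g) ≡ ∑ᴳ n f + ∑ᴳ n h
∑ᴳ-+ {n} f h = ∑-distrib-+ (f ∘ perm n) (h ∘ perm n)

-- The norm of Frobenius's function, and its equality with the character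

module FrobeniusNorm (θ : Partition) (N : ℕ) (fits : length (parts θ) ≤ N) where

  open Colourings θ N fits public

  jointStabiliser : Vec (Fin N) n → Vec (Fin N) n → ℚ
  jointStabiliser x y = ∑ᴳ n (λ g → 𝟙 ((x ∘ᵛ g) ≟ᵛ x) * 𝟙 ((y ∘ᵛ g) ≟ᵛ y))

  jointStabiliser-order : ∀ x y → jointStabiliser x y ≡ stabOrder _≟²_ (pairs x y)
  jointStabiliser-order x y = trans
    (∑ᴳ-cong {n} (λ g → trans (sym (𝟙-× ((x ∘ᵛ g) ≟ᵛ x) ((y ∘ᵛ g) ≟ᵛ y)))
      (𝟙-⇔ (((x ∘ᵛ g) ≟ᵛ x) ×-dec ((y ∘ᵛ g) ≟ᵛ y)) (matches? _≟²_ (pairs x y) (pairs x y) g)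
        (λ (p , q) i → cong₂ _,_ (at x g p i) (at y g q i))
        (λ m → vec-ext (λ i → trans (Vecₚ.lookup∘tabulate (λ j → lookup x (g ⟨$⟩ʳ j)) i) (cong proj₁ (m i)))
             , vec-ext (λ i → trans (Vecₚ.lookup∘tabulate (λ j → lookup y (g ⟨$⟩ʳ j)) i) (cong proj₂ (m i)))))))
    (matching-count _≟²_ (pairs x y) (pairs x y) (λ _ → refl))
    where
    at : ∀ (z : Vec (Fin N) n) g → z ∘ᵛ g ≡ z → ∀ i → lookup z (g ⟨$⟩ʳ i) ≡ lookup z i
    at z g eq i = trans (sym (Vecₚ.lookup∘tabulate (λ j → lookup z (g ⟨$⟩ʳ j)) i)) (cong (λ u → lookup u i) eq)

  rowMatches : Vec (Fin N) n → ℚ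
  rowMatches x = ∑ᴳ n (λ g → 𝟙 ((rowᵛ ∘ᵛ g) ≟ᵛ x))

  rowMatches-same : ∀ x → content x ≡ θᵛ → rowMatches x ≡ stabOrder _≟ᶠ_ (lookup x)
  rowMatches-same x eq = trans
    (∑ᴳ-cong {n} (λ g → 𝟙-⇔ ((rowᵛ ∘ᵛ g) ≟ᵛ x) (matches? _≟ᶠ_ (lookup rowᵛ) (lookup x) g)
      (λ p i → trans (sym (Vecₚ.lookup∘tabulate (λ j → lookup rowᵛ (g ⟨$⟩ʳ j)) i)) (cong (λ u → lookup u i) p))
      (λ m → vec-ext (λ i → trans (Vecₚ.lookup∘tabulate (λ j → lookup rowᵛ (g ⟨$⟩ʳ j)) i) (m i)))))
    (matching-count _≟ᶠ_ (lookup rowᵛ) (lookup x) (λ a → trans (sym (Vecₚ.lookup∘tabulate (occ _≟ᶠ_ (lookup rowᵛ)) a))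
      (trans (cong (λ b → lookup b a) (trans content-rowᵛ (sym eq))) (Vecₚ.lookup∘tabulate (occ _≟ᶠ_ (lookup x)) a))))

  rowMatches-different : ∀ x → content x ≢ θᵛ → rowMatches x ≡ 0ℚ
  rowMatches-different x neq = ∑ᴳ-zero {n} (λ g → 𝟙-no ((rowᵛ ∘ᵛ g) ≟ᵛ x) (λ { refl → neq (trans (content-∘ᵛ rowᵛ g) content-rowᵛ) }))

  stabiliserAverage : Vec (Fin N) n → ℚ
  stabiliserAverage x = ∑ᴳ n (λ g → 𝟙 ((x ∘ᵛ g) ≟ᵛ x) * frobenius v g)

  -- A sum over the stabiliser of `x` counts, for each `y`, the permutations fixing both words.
  -- Grouping the `y` by contingency table with `x`, whose column sums are the content of `y`,
  -- leaves a Kostka number.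
  stabiliserAverage-strip : ∀ x → stabiliserAverage x ≡ stabOrder _≟ᶠ_ (lookup x) * stripRows (content x) Eᵛ v
  stabiliserAverage-strip x = begin
    ∑ᴳ n (λ g → 𝟙 ((x ∘ᵛ g) ≟ᵛ x) * ∑ᵛ n (λ y → 𝟙 ((y ∘ᵛ g) ≟ᵛ y) * weight v y))
      ≡⟨ ∑ᴳ-cong {n} (λ g → trans (∑ᵛ-*ˡ n (𝟙 ((x ∘ᵛ g) ≟ᵛ x)) (λ y → 𝟙 ((y ∘ᵛ g) ≟ᵛ y) * weight v y))
           (∑ᵛ-cong n (λ y → sym (ℚₚ.*-assoc (𝟙 ((x ∘ᵛ g) ≟ᵛ x)) (𝟙 ((y ∘ᵛ g) ≟ᵛ y)) (weight v y))))) ⟩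
    ∑ᴳ n (λ g → ∑ᵛ n (λ y → 𝟙 ((x ∘ᵛ g) ≟ᵛ x) * 𝟙 ((y ∘ᵛ g) ≟ᵛ y) * weight v y))
      ≡⟨ sym (∑ᵛ-∑ᴳ n (λ y g → 𝟙 ((x ∘ᵛ g) ≟ᵛ x) * 𝟙 ((y ∘ᵛ g) ≟ᵛ y) * weight v y)) ⟩
    ∑ᵛ n (λ y → ∑ᴳ n (λ g → 𝟙 ((x ∘ᵛ g) ≟ᵛ x) * 𝟙 ((y ∘ᵛ g) ≟ᵛ y) * weight v y))
      ≡⟨ ∑ᵛ-cong n (λ y → trans (sym (∑ᴳ-*ʳ {n} (weight v y) (λ g → 𝟙 ((x ∘ᵛ g) ≟ᵛ x) * 𝟙 ((y ∘ᵛ g) ≟ᵛ y))))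
           (cong₂ _*_ (jointStabiliser-order x y) (cong Eᵛ (sym (subtractRows-contingency v x y))))) ⟩
    ∑ᵛ n (λ y → stabOrder _≟²_ (pairs x y) * Eᵛ (subtractRows v (contingency x y)))
      ≡⟨ ∑ᵛ-contingency n x (λ M → Eᵛ (subtractRows v M)) ⟩
    stabOrder _≟ᶠ_ (lookup x) * ∑ᴹ N (content x) (λ M → Eᵛ (subtractRows v M))
      ≡⟨ cong (stabOrder _≟ᶠ_ (lookup x) *_) (∑ᴹ-subtractRows (content x) Eᵛ v) ⟩
    stabOrder _≟ᶠ_ (lookup x) * stripRows (content x) Eᵛ v ∎
    where open ≡-Reasoning

  stripRows-content : ∀ (x : Vec (Fin N) n) → weight v x ≢ 0ℚ → stripRows (content x) Eᵛ v ≡ 𝟙 (Vecₚ.≡-dec ℕ._≟_ (content x) θᵛ)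
  stripRows-content x w≢0 = stripRows-lex (content x) θᵛ θᵛ 0 (sym (Listₚ.++-identityʳ (toList θᵛ)))
    (Decreasing-tabulate N (nth (parts θ)) (nth-decreasing (decreasing θ))) (E≢0⇒lex θᵛ (content x) w≢0)

  -- A nonzero weight puts the content in the lexicographic range where the Kostka number is 1 for
  -- content `θ` and 0 otherwise. For content `θ` the stabiliser of `x` has as many elements as the
  -- set of permutations taking `rowᵛ` to `x`.
  weight-average : ∀ x → weight v x * stabiliserAverage x ≡ rowMatches x
  weight-average x with Vecₚ.≡-dec ℕ._≟_ (content x) θᵛ | weight v x ℚₚ.≟ 0ℚ
  ... | yes same | yes w≡0 = contradiction (trans (sym (weight-θᵛ x same)) w≡0) (λ ())
  ... | yes same | no  w≢0 = trans (cong₂ _*_ (weight-θᵛ x same) (trans (stabiliserAverage-strip x)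
      (cong (stabOrder _≟ᶠ_ (lookup x) *_) (trans (stripRows-content x w≢0) (𝟙-yes (Vecₚ.≡-dec ℕ._≟_ (content x) θᵛ) same)))))
    (trans (solve 1 (λ s → con 1ℚ :* (s :* con 1ℚ) := s) refl (stabOrder _≟ᶠ_ (lookup x))) (sym (rowMatches-same x same)))
    where open +-*-Solver
  ... | no  diff | yes w≡0 = trans (cong (_* stabiliserAverage x) w≡0) (trans (ℚₚ.*-zeroˡ (stabiliserAverage x)) (sym (rowMatches-different x diff)))
  ... | no  diff | no  w≢0 = trans (cong (weight v x *_) (trans (stabiliserAverage-strip x) (trans
      (cong (stabOrder _≟ᶠ_ (lookup x) *_) (trans (stripRows-content x w≢0) (𝟙-no (Vecₚ.≡-dec ℕ._≟_ (content x) θᵛ) diff)))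
      (ℚₚ.*-zeroʳ (stabOrder _≟ᶠ_ (lookup x)))))) (trans (ℚₚ.*-zeroʳ (weight v x)) (sym (rowMatches-different x diff)))

  -- Once the weights are averaged, each `g` is counted exactly once, by the colouring `rowᵛ ∘ᵛ g`.
  frobenius-norm : ∑ᴳ n (λ g → frobenius v g * frobenius v g) ≡ fromℕℚ (n !)
  frobenius-norm = begin
    ∑ᴳ n (λ g → ∑ᵛ n (λ x → 𝟙 ((x ∘ᵛ g) ≟ᵛ x) * weight v x) * frobenius v g)
      ≡⟨ ∑ᴳ-cong {n} (λ g → trans (∑ᵛ-*ʳ n (frobenius v g) (λ x → 𝟙 ((x ∘ᵛ g) ≟ᵛ x) * weight v x)) (∑ᵛ-cong n (λ x →
           solve 3 (λ s w f → s :* w :* f := w :* (s :* f)) refl (𝟙 ((x ∘ᵛ g) ≟ᵛ x)) (weight v x) (frobenius v g)))) ⟩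
    ∑ᴳ n (λ g → ∑ᵛ n (λ x → weight v x * (𝟙 ((x ∘ᵛ g) ≟ᵛ x) * frobenius v g)))
      ≡⟨ sym (∑ᵛ-∑ᴳ n (λ x g → weight v x * (𝟙 ((x ∘ᵛ g) ≟ᵛ x) * frobenius v g))) ⟩
    ∑ᵛ n (λ x → ∑ᴳ n (λ g → weight v x * (𝟙 ((x ∘ᵛ g) ≟ᵛ x) * frobenius v g)))
      ≡⟨ ∑ᵛ-cong n (λ x → trans (sym (∑ᴳ-*ˡ {n} (weight v x) (λ g → 𝟙 ((x ∘ᵛ g) ≟ᵛ x) * frobenius v g))) (weight-average x)) ⟩
    ∑ᵛ n (λ x → ∑ᴳ n (λ g → 𝟙 ((rowᵛ ∘ᵛ g) ≟ᵛ x)))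
      ≡⟨ ∑ᵛ-∑ᴳ n (λ x g → 𝟙 ((rowᵛ ∘ᵛ g) ≟ᵛ x)) ⟩
    ∑ᴳ n (λ g → ∑ᵛ n (λ x → 𝟙 ((rowᵛ ∘ᵛ g) ≟ᵛ x)))
      ≡⟨ ∑ᴳ-cong {n} (λ g → trans (∑ᵛ-cong n (λ x → sym (ℚₚ.*-identityʳ (𝟙 ((rowᵛ ∘ᵛ g) ≟ᵛ x))))) (∑ᵛ-𝟙 n (λ _ → 1ℚ) (rowᵛ ∘ᵛ g))) ⟩
    fromℕℚ (n !) ∎
    where
    open ≡-Reasoning
    open +-*-Solver

  -- classSum and κ * frobenius v have the same norm and this norm is also their inner product.
  φ≡frobenius : ∀ g → φ g ≡ frobenius v g
  φ≡frobenius g = *-cancelˡ-≢0 κ≢0 (begin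
    κ * φ g               ≡⟨ trace-formula g ⟩
    classSum g            ≡⟨ classSum-respects g (perm n (index g)) (λ i → sym (perm-index g i)) ⟩
    classSum g′           ≡⟨ solve 2 (λ a x → a := (a :+ :- x) :+ x) refl (classSum g′) (κ * X g′) ⟩
    D g′ + κ * X g′       ≡⟨ cong (_+ κ * X g′) (∑-squares≡0 (λ k → D (perm n k)) norm≡0 (index g)) ⟩
    0ℚ + κ * X g′         ≡⟨ ℚₚ.+-identityˡ (κ * X g′) ⟩
    κ * X g′              ≡⟨ cong (κ *_) (frobenius-respects v g′ g (perm-index g)) ⟩
    κ * X g ∎)
    where
    open ≡-Reasoning
    open +-*-Solver
    g′ : Permutation′ n
    g′ = perm n (index g)
    X D : Permutation′ n → ℚ
    X = frobenius v
    D h = classSum h + - (κ * X h)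
    norm≡0 : ∑ᴳ n (λ h → D h * D h) ≡ 0ℚ
    norm≡0 = begin
      ∑ᴳ n (λ h → D h * D h)
        ≡⟨ ∑ᴳ-cong {n} (λ h → solve 3 (λ a k x → (a :+ :- (k :* x)) :* (a :+ :- (k :* x)) := a :* a :+ ((:- (k :+ k)) :* (a :* x) :+ (k :* k) :* (x :* x))) refl (classSum h) κ (X h)) ⟩
      ∑ᴳ n (λ h → classSum h * classSum h + (- (κ + κ) * (classSum h * X h) + κ * κ * (X h * X h)))
        ≡⟨ trans (∑ᴳ-+ {n} (λ h → classSum h * classSum h) (λ h → - (κ + κ) * (classSum h * X h) + κ * κ * (X h * X h)))
             (cong (∑ᴳ n (λ h → classSum h * classSum h) +_) (trans (∑ᴳ-+ {n} (λ h → - (κ + κ) * (classSum h * X h)) (λ h → κ * κ * (X h * X h))) (cong₂ _+_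
             (sym (∑ᴳ-*ˡ {n} (- (κ + κ)) (λ h → classSum h * X h))) (sym (∑ᴳ-*ˡ {n} (κ * κ) (λ h → X h * X h)))))) ⟩
      ∑ᴳ n (λ h → classSum h * classSum h) + (- (κ + κ) * ∑ᴳ n (λ h → classSum h * X h) + κ * κ * ∑ᴳ n (λ h → X h * X h))
        ≡⟨ cong₂ _+_ classSum-norm (cong₂ _+_ (cong (- (κ + κ) *_) classSum-frobenius) (cong (κ * κ *_) frobenius-norm)) ⟩
      fromℕℚ (n !) * (κ * κ) + (- (κ + κ) * (fromℕℚ (n !) * κ) + κ * κ * fromℕℚ (n !))
        ≡⟨ solve 2 (λ f k → f :* (k :* k) :+ ((:- (k :+ k)) :* (f :* k) :+ k :* k :* f) := con 0ℚ) refl (fromℕℚ (n !)) κ ⟩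
      0ℚ ∎

-- The Murnaghan–Nakayama rule

cycles-↑ˡ : ∀ a l i → cycles (a ∷ l) ⟨$⟩ʳ (i ↑ˡ sum l) ≡ (rotation a ⟨$⟩ʳ i) ↑ˡ sum l
cycles-↑ˡ a l i rewrite Finₚ.splitAt-↑ˡ a i (sum l) = refl

cycles-↑ʳ : ∀ a l j → cycles (a ∷ l) ⟨$⟩ʳ (a ↑ʳ j) ≡ a ↑ʳ (cycles l ⟨$⟩ʳ j)
cycles-↑ʳ a l j rewrite Finₚ.splitAt-↑ʳ a (sum l) j = refl

punchIn-last : ∀ {a} (k : Fin a) → punchIn (fromℕ a) k ≡ Fin.inject₁ k
punchIn-last zero    = refl
punchIn-last (suc k) = cong suc (punchIn-last k)

rotation-inject₁ : ∀ a (k : Fin a) → rotation (suc a) ⟨$⟩ʳ Fin.inject₁ k ≡ suc k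
rotation-inject₁ a k = trans (cong (rotation (suc a) ⟨$⟩ʳ_) (sym (punchIn-last k))) (Perm.insert-punchIn (fromℕ a) zero idₚ k)

constant : ∀ {A : Set} a (f : Fin (suc a) → A) → (∀ k → f (suc k) ≡ f (Fin.inject₁ k)) → ∀ i → f i ≡ f zero
constant a       f step zero    = refl
constant (suc a) f step (suc i) = trans (constant a (f ∘ suc) (step ∘ suc) i) (step zero)

lookup-∘ᵛ : ∀ {A : Set} {n} (x : Vec A n) g i → lookup (x ∘ᵛ g) i ≡ lookup x (g ⟨$⟩ʳ i)
lookup-∘ᵛ x g = Vecₚ.lookup∘tabulate (λ i → lookup x (g ⟨$⟩ʳ i))

-- A word fixed by a full cycle is constant.
∑ᵛ-rotation : ∀ {N} a (F : Vec (Fin N) (suc a) → ℚ) →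
  ∑ᵛ (suc a) (λ y → 𝟙 ((y ∘ᵛ rotation (suc a)) ≟ᵛ y) * F y) ≡ ∑[ c < N ] F (replicate (suc a) c)
∑ᵛ-rotation {N} a F = sum-cong-≗ {N} (λ c → trans
  (∑ᵛ-single a (replicate a c) (λ y y≢ → trans (cong (_* F (c ∷ y)) (𝟙-no (((c ∷ y) ∘ᵛ rotation (suc a)) ≟ᵛ (c ∷ y))
    (λ fixed → y≢ (vec-ext (λ i → trans (allEqual c y fixed i) (sym (Vecₚ.lookup-replicate i c))))))) (ℚₚ.*-zeroˡ (F (c ∷ y)))))
  (trans (cong (_* F (replicate (suc a) c)) (𝟙-yes ((replicate (suc a) c ∘ᵛ rotation (suc a)) ≟ᵛ replicate (suc a) c)
    (vec-ext (λ i → trans (lookup-∘ᵛ (replicate (suc a) c) (rotation (suc a)) i) (trans (Vecₚ.lookup-replicate (rotation (suc a) ⟨$⟩ʳ i) c) (sym (Vecₚ.lookup-replicate i c)))))))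
    (ℚₚ.*-identityˡ (F (replicate (suc a) c)))))
  where
  allEqual : ∀ c (y : Vec (Fin N) a) → (c ∷ y) ∘ᵛ rotation (suc a) ≡ c ∷ y → ∀ i → lookup y i ≡ c
  allEqual c y fixed i = constant a (lookup (c ∷ y)) (λ k → trans
    (cong (lookup (c ∷ y)) (sym (rotation-inject₁ a k)))
    (trans (sym (lookup-∘ᵛ (c ∷ y) (rotation (suc a)) (Fin.inject₁ k))) (cong (λ z → lookup z (Fin.inject₁ k)) fixed))) (suc i)

fixed-++ : ∀ {N} a l (y : Vec (Fin N) a) (z : Vec (Fin N) (sum l)) →
  𝟙 (((y Vec.++ z) ∘ᵛ cycles (a ∷ l)) ≟ᵛ (y Vec.++ z)) ≡ 𝟙 ((y ∘ᵛ rotation a) ≟ᵛ y) * 𝟙 ((z ∘ᵛ cycles l) ≟ᵛ z)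
fixed-++ a l y z = trans
  (𝟙-⇔ (((y Vec.++ z) ∘ᵛ cycles (a ∷ l)) ≟ᵛ (y Vec.++ z)) (((y ∘ᵛ rotation a) ≟ᵛ y) ×-dec ((z ∘ᵛ cycles l) ≟ᵛ z))
    (λ eq → vec-ext (λ i → trans (sym (atˡ i)) (trans (cong (λ w → lookup w (i ↑ˡ sum l)) eq) (Vecₚ.lookup-++ˡ y z i)))
          , vec-ext (λ j → trans (sym (atʳ j)) (trans (cong (λ w → lookup w (a ↑ʳ j)) eq) (Vecₚ.lookup-++ʳ y z j))))
    (λ (p , q) → vec-ext (λ k → both p q k (view a (sum l) k))))
  (𝟙-× ((y ∘ᵛ rotation a) ≟ᵛ y) ((z ∘ᵛ cycles l) ≟ᵛ z))
  where
  g = cycles (a ∷ l)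
  atˡ : ∀ i → lookup ((y Vec.++ z) ∘ᵛ g) (i ↑ˡ sum l) ≡ lookup (y ∘ᵛ rotation a) i
  atˡ i = trans (lookup-∘ᵛ (y Vec.++ z) g (i ↑ˡ sum l)) (trans (cong (lookup (y Vec.++ z)) (cycles-↑ˡ a l i))
    (trans (Vecₚ.lookup-++ˡ y z (rotation a ⟨$⟩ʳ i)) (sym (lookup-∘ᵛ y (rotation a) i))))
  atʳ : ∀ j → lookup ((y Vec.++ z) ∘ᵛ g) (a ↑ʳ j) ≡ lookup (z ∘ᵛ cycles l) j
  atʳ j = trans (lookup-∘ᵛ (y Vec.++ z) g (a ↑ʳ j)) (trans (cong (lookup (y Vec.++ z)) (cycles-↑ʳ a l j))
    (trans (Vecₚ.lookup-++ʳ y z (cycles l ⟨$⟩ʳ j)) (sym (lookup-∘ᵛ z (cycles l) j))))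
  both : y ∘ᵛ rotation a ≡ y → z ∘ᵛ cycles l ≡ z → ∀ k → View a (sum l) k → lookup ((y Vec.++ z) ∘ᵛ g) k ≡ lookup (y Vec.++ z) k
  both p q _ (left i)  = trans (atˡ i) (trans (cong (λ w → lookup w i) p) (sym (Vecₚ.lookup-++ˡ y z i)))
  both p q _ (right j) = trans (atʳ j) (trans (cong (λ w → lookup w j) q) (sym (Vecₚ.lookup-++ʳ y z j)))

lowerAt-zero : ∀ {N} (c : Fin N) v → lowerAt c 0 v ≡ v
lowerAt-zero c v = Vecₚ.updateAt-id-local c v (ℤₚ.+-identityʳ (lookup v c))

lowerAt-suc : ∀ {N} (c : Fin N) a v → lowerAt c 1 (lowerAt c a v) ≡ lowerAt c (suc a) v
lowerAt-suc c a v = Vecₚ.updateAt-updateAt-local c v (trans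
  (solve 2 (λ x y → x :- y :- con (ℤ.+ 1) := x :- (con (ℤ.+ 1) :+ y)) refl (lookup v c) (ℤ.+ a))
  (cong (λ k → lookup v c ℤ.- k) (sym (ℤₚ.pos-+ 1 a))))
  where open ℤ-Solver

-- A cycle of length `a` in the single colour `c` is absorbed into the beads by lowering bead `c`,
-- so the remaining cycles see a problem of the same form.
content-replicate : ∀ {N m} a (c : Fin N) (v : Vec ℤ N) (z : Vec (Fin N) m) → v -ᵛ content (replicate a c Vec.++ z) ≡ lowerAt c a v -ᵛ content z
content-replicate zero    c v z = cong (_-ᵛ content z) (sym (lowerAt-zero c v))
content-replicate (suc a) c v z = begin
  v -ᵛ content (c ∷ (replicate a c Vec.++ z))               ≡⟨ cong (v -ᵛ_) (content-∷ c (replicate a c Vec.++ z)) ⟩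
  v -ᵛ inc c (content (replicate a c Vec.++ z))             ≡⟨ -ᵛ-inc c v (content (replicate a c Vec.++ z)) ⟩
  lowerAt c 1 (v -ᵛ content (replicate a c Vec.++ z))       ≡⟨ cong (lowerAt c 1) (content-replicate a c v z) ⟩
  lowerAt c 1 (lowerAt c a v -ᵛ content z)                  ≡⟨ sym (lowerAt-∸ c 1 (lowerAt c a v) (content z)) ⟩
  lowerAt c 1 (lowerAt c a v) -ᵛ content z                  ≡⟨ cong (_-ᵛ content z) (lowerAt-suc c a v) ⟩
  lowerAt c (suc a) v -ᵛ content z ∎
  where open ≡-Reasoning

frobenius-∷ : ∀ {N} (v : Vec ℤ N) a l → frobenius v (cycles (suc a ∷ l)) ≡ ∑[ c < N ] frobenius (lowerAt c (suc a) v) (cycles l)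
frobenius-∷ {N} v a l = begin
  ∑ᵛ (suc a ℕ.+ sum l) (λ x → 𝟙 ((x ∘ᵛ cycles (suc a ∷ l)) ≟ᵛ x) * weight v x)
    ≡⟨ ∑ᵛ-++ (suc a) (λ x → 𝟙 ((x ∘ᵛ cycles (suc a ∷ l)) ≟ᵛ x) * weight v x) ⟩
  ∑ᵛ (suc a) (λ y → ∑ᵛ (sum l) (λ z → 𝟙 (((y Vec.++ z) ∘ᵛ cycles (suc a ∷ l)) ≟ᵛ (y Vec.++ z)) * weight v (y Vec.++ z)))
    ≡⟨ ∑ᵛ-cong (suc a) (λ y → trans (∑ᵛ-cong (sum l) (λ z → trans (cong (_* weight v (y Vec.++ z)) (fixed-++ (suc a) l y z))
         (ℚₚ.*-assoc (𝟙 ((y ∘ᵛ rotation (suc a)) ≟ᵛ y)) (𝟙 ((z ∘ᵛ cycles l) ≟ᵛ z)) (weight v (y Vec.++ z)))))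
         (sym (∑ᵛ-*ˡ (sum l) (𝟙 ((y ∘ᵛ rotation (suc a)) ≟ᵛ y)) (λ z → 𝟙 ((z ∘ᵛ cycles l) ≟ᵛ z) * weight v (y Vec.++ z))))) ⟩
  ∑ᵛ (suc a) (λ y → 𝟙 ((y ∘ᵛ rotation (suc a)) ≟ᵛ y) * ∑ᵛ (sum l) (λ z → 𝟙 ((z ∘ᵛ cycles l) ≟ᵛ z) * weight v (y Vec.++ z)))
    ≡⟨ ∑ᵛ-rotation a (λ y → ∑ᵛ (sum l) (λ z → 𝟙 ((z ∘ᵛ cycles l) ≟ᵛ z) * weight v (y Vec.++ z))) ⟩
  (∑[ c < N ] ∑ᵛ (sum l) (λ z → 𝟙 ((z ∘ᵛ cycles l) ≟ᵛ z) * weight v (replicate (suc a) c Vec.++ z)))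
    ≡⟨ sum-cong-≗ {N} (λ c → ∑ᵛ-cong (sum l) (λ z → cong (λ u → 𝟙 ((z ∘ᵛ cycles l) ≟ᵛ z) * E N (toList u)) (content-replicate (suc a) c v z))) ⟩
  (∑[ c < N ] frobenius (lowerAt c (suc a) v) (cycles l)) ∎
  where open ≡-Reasoning

-- Summation over the ways of subtracting a from one entry.
∑↓ : ℕ → List ℤ → (List ℤ → ℚ) → ℚ
∑↓ a []      F = 0ℚ
∑↓ a (b ∷ u) F = F (b ℤ.- ℤ.+ a ∷ u) + ∑↓ a u (λ w → F (b ∷ w))

-- The Murnaghan–Nakayama rule on sets of beads: removing a rim hook of size a
-- lowers one bead by a.
mn : ℕ → List ℤ → List ℕ → ℚ
mn N u []      = E N u
mn N u (a ∷ l) = ∑↓ a u (λ w → mn N w l)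

∑↓-cong : ∀ a u {F F′ : List ℤ → ℚ} → (∀ w → F w ≡ F′ w) → ∑↓ a u F ≡ ∑↓ a u F′
∑↓-cong a []      eq = refl
∑↓-cong a (b ∷ u) eq = cong₂ _+_ (eq (b ℤ.- ℤ.+ a ∷ u)) (∑↓-cong a u (λ w → eq (b ∷ w)))

∑↓-toList : ∀ {N} a (v : Vec ℤ N) F → (∑[ c < N ] F (toList (lowerAt c a v))) ≡ ∑↓ a (toList v) F
∑↓-toList a []      F = refl
∑↓-toList a (b ∷ v) F = cong (F (b ℤ.- ℤ.+ a ∷ toList v) +_) (∑↓-toList a v (λ w → F (b ∷ w)))

frobenius-cycles : ∀ {N} l → All NonZero l → (v : Vec ℤ N) → frobenius v (cycles l) ≡ mn N (toList v) l
frobenius-cycles {N} []      [] v = trans (ℚₚ.*-identityˡ _) (cong (λ u → E N (toList u)) (trans (cong (v -ᵛ_) (content-[] {N})) (-ᵛ-zero v)))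
frobenius-cycles {N} (suc a ∷ l) (_ ∷ pos) v = trans (frobenius-∷ v a l)
  (trans (sum-cong-≗ {N} (λ c → frobenius-cycles l pos (lowerAt c (suc a) v))) (∑↓-toList (suc a) v (λ w → mn N w l)))

unique-length : ∀ {A : Set} {xs ys : List A} → Unique xs → (∀ {x} → x ∈ xs → x ∈ ys) → length xs ≤ length ys
unique-length {xs = []}     _  _  = z≤n
unique-length {xs = x ∷ xs} (x∉ ∷ uniq) sub with ∈ₚ.∈-∃++ (sub (here refl))
... | ys₁ , ys₂ , refl = subst (suc (length xs) ≤_) (sym (↭ₚ.↭-length (↭ₚ.shift x ys₁ ys₂)))
  (s≤s (unique-length uniq (λ {y} y∈xs → without (↭ₚ.∈-resp-↭ (↭ₚ.shift x ys₁ ys₂) (sub (there y∈xs))) (All.lookup x∉ y∈xs))))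
  where
  without : ∀ {y zs} → y ∈ x ∷ zs → x ≢ y → y ∈ zs
  without (here refl) x≢y = contradiction refl x≢y
  without (there p)   _   = p

unique-↭ : ∀ {A : Set} {xs ys : List A} → Unique xs → (∀ {x} → x ∈ xs → x ∈ ys) → length ys ≤ length xs → xs ↭ ys
unique-↭ {xs = []} {[]} _ _ _ = ↭-refl
unique-↭ {xs = x ∷ xs} (x∉ ∷ uniq) sub len with ∈ₚ.∈-∃++ (sub (here refl))
... | ys₁ , ys₂ , refl = ↭-trans (↭.prep x (unique-↭ uniq
    (λ {y} y∈xs → without (↭ₚ.∈-resp-↭ (↭ₚ.shift x ys₁ ys₂) (sub (there y∈xs))) (All.lookup x∉ y∈xs))
    (ℕ.s≤s⁻¹ (subst (_≤ suc (length xs)) (↭ₚ.↭-length (↭ₚ.shift x ys₁ ys₂)) len)))) (↭-sym (↭ₚ.shift x ys₁ ys₂))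
  where
  without : ∀ {y zs} → y ∈ x ∷ zs → x ≢ y → y ∈ zs
  without (here refl) x≢y = contradiction refl x≢y
  without (there p)   _   = p

staircase : ℕ → List ℤ
staircase N = toList (shifted (replicate N 0))

∈-staircase : ∀ N {a} → InRange N a → a ∈ staircase N
∈-staircase (suc N) {ℤ.+ k} (p , ℤ.+<+ (s≤s k≤N)) with k ℕ.≟ N
... | yes refl = here refl
... | no  k≢N  = there (∈-staircase N (p , ℤ.+<+ (ℕₚ.≤∧≢⇒< k≤N k≢N)))

length-staircase : ∀ N → length (staircase N) ≡ N
length-staircase N = Vecₚ.length-toList (shifted (replicate N 0))

E≢0⇒↭ : ∀ {N u} → E N u ≢ 0ℚ → u ↭ staircase N
E≢0⇒↭ {N} {u} ≢0 with E≢0 {N} {u} ≢0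
... | (len , rng) , V≢0 = unique-↭ (vandermonde≢0 u V≢0) (λ x∈u → ∈-staircase N (All.lookup rng x∈u))
  (ℕₚ.≤-reflexive (trans (length-staircase N) (sym len)))

sumℤ : List ℤ → ℤ
sumℤ = foldr ℤ._+_ (ℤ.+ 0)

sumℤ-↭ : ∀ {u w} → u ↭ w → sumℤ u ≡ sumℤ w
sumℤ-↭ ↭.refl         = refl
sumℤ-↭ (↭.prep a p)   = cong (λ k → a ℤ.+ k) (sumℤ-↭ p)
sumℤ-↭ {_} {_ ∷ _ ∷ w} (↭.swap a b p) = trans (cong (λ k → a ℤ.+ (b ℤ.+ k)) (sumℤ-↭ p)) (solve 3 (λ x y s → x :+ (y :+ s) := y :+ (x :+ s)) refl a b (sumℤ w))
  where open ℤ-Solver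
sumℤ-↭ (↭.trans p q)  = trans (sumℤ-↭ p) (sumℤ-↭ q)

∑↓-zero : ∀ a u {F : List ℤ → ℚ} → (∀ w → sumℤ w ℤ.+ ℤ.+ a ≡ sumℤ u → F w ≡ 0ℚ) → ∑↓ a u F ≡ 0ℚ
∑↓-zero a []      eq = refl
∑↓-zero a (b ∷ u) eq = cong₂ _+_
  (eq (b ℤ.- ℤ.+ a ∷ u) (solve 3 (λ x y s → (x :- y :+ s) :+ y := x :+ s) refl b (ℤ.+ a) (sumℤ u)))
  (∑↓-zero a u (λ w p → eq (b ∷ w) (trans (ℤₚ.+-assoc b (sumℤ w) (ℤ.+ a)) (cong (λ k → b ℤ.+ k) p))))
  where open ℤ-Solver

-- Every removal lowers the sum of the beads by the part removed, and `E N` is nonzero only on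
-- rearrangements of the staircase. This matches the convention that the character is 0 for unequal
-- sizes.
mn-degree : ∀ N u l → sumℤ u ≢ sumℤ (staircase N) ℤ.+ ℤ.+ sum l → mn N u l ≡ 0ℚ
mn-degree N u []      neq = decidable-stable (E N u ℚₚ.≟ 0ℚ) (λ ≢0 → neq (trans (sumℤ-↭ (E≢0⇒↭ {N} {u} ≢0)) (sym (ℤₚ.+-identityʳ _))))
mn-degree N u (a ∷ l) neq = ∑↓-zero a u (λ w p → mn-degree N w l (λ eq → neq (trans (sym p) (trans (cong (λ k → k ℤ.+ ℤ.+ a) eq)
  (trans (solve 3 (λ s x y → s :+ y :+ x := s :+ (x :+ y)) refl (sumℤ (staircase N)) (ℤ.+ a) (ℤ.+ sum l)) (cong (λ k → sumℤ (staircase N) ℤ.+ k) (sym (ℤₚ.pos-+ a (sum l)))))))))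
  where open ℤ-Solver

sumℤ-shifted : ∀ {N} (ts : Vec ℕ N) → sumℤ (toList (shifted ts)) ≡ sumℤ (staircase N) ℤ.+ ℤ.+ sum (toList ts)
sumℤ-shifted []       = refl
sumℤ-shifted {suc N} (t ∷ ts) = begin
  ℤ.+ (t ℕ.+ N) ℤ.+ sumℤ (toList (shifted ts))
    ≡⟨ cong₂ ℤ._+_ (ℤₚ.pos-+ t N) (sumℤ-shifted ts) ⟩
  ℤ.+ t ℤ.+ ℤ.+ N ℤ.+ (sumℤ (staircase N) ℤ.+ ℤ.+ sum (toList ts))
    ≡⟨ solve 4 (λ x y s r → x :+ y :+ (s :+ r) := (y :+ s) :+ (x :+ r)) refl (ℤ.+ t) (ℤ.+ N) (sumℤ (staircase N)) (ℤ.+ sum (toList ts)) ⟩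
  (ℤ.+ N ℤ.+ sumℤ (staircase N)) ℤ.+ (ℤ.+ t ℤ.+ ℤ.+ sum (toList ts))
    ≡⟨ cong (λ k → (ℤ.+ N ℤ.+ sumℤ (staircase N)) ℤ.+ k) (sym (ℤₚ.pos-+ t (sum (toList ts)))) ⟩
  (ℤ.+ N ℤ.+ sumℤ (staircase N)) ℤ.+ ℤ.+ (t ℕ.+ sum (toList ts)) ∎
  where
  open ≡-Reasoning
  open ℤ-Solver

beads : ℕ → Partition → List ℤ
beads N θ = toList (shifted {N} (tabulate (λ k → nth (parts θ) (toℕ k))))

sum-padded : ∀ l j → sum (l ++ List.replicate j 0) ≡ sum l
sum-padded []      zero    = refl
sum-padded []      (suc j) = sum-padded [] j
sum-padded (a ∷ l) j       = cong (a ℕ.+_) (sum-padded l j)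

sumℤ-beads : ∀ N θ → length (parts θ) ≤ N → sumℤ (beads N θ) ≡ sumℤ (staircase N) ℤ.+ ℤ.+ ∣ θ ∣
sumℤ-beads N θ fits = trans (sumℤ-shifted {N} (tabulate (λ k → nth (parts θ) (toℕ k)))) (cong (λ s → sumℤ (staircase N) ℤ.+ ℤ.+ s)
  (trans (cong sum (proj₂ (toList-tabulate-nth N (parts θ) fits))) (sum-padded (parts θ) (proj₁ (toList-tabulate-nth N (parts θ) fits)))))

ℤ-+-cancelˡ : ∀ i {j k} → i ℤ.+ j ≡ i ℤ.+ k → j ≡ k
ℤ-+-cancelˡ i {j} {k} eq = trans (shift j) (trans (cong (λ s → s ℤ.- i) eq) (sym (shift k)))
  where
  open ℤ-Solver
  shift : ∀ j → j ≡ i ℤ.+ j ℤ.- i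
  shift = solve 2 (λ x y → y := x :+ y :- x) refl i

frobenius-subst : ∀ {N m n} (v : Vec ℤ N) (eq : m ≡ n) g → frobenius v (subst Permutation′ eq g) ≡ frobenius v g
frobenius-subst v refl g = refl

murnaghan-nakayama : ∀ N θ α → length (parts θ) ≤ N → χ θ α ≡ mn N (beads N θ) (parts α)
murnaghan-nakayama N θ α fits with ∣ α ∣ ℕ.≟ ∣ θ ∣
... | yes eq = trans (φ≡frobenius (subst Permutation′ eq (cycles (parts α))))
  (trans (frobenius-subst v eq (cycles (parts α))) (frobenius-cycles (parts α) (positive α) v))
  where open FrobeniusNorm θ N fits
... | no  neq = sym (mn-degree N (beads N θ) (parts α) (λ eq → neq (sym (ℤₚ.+-injective (ℤ-+-cancelˡ (sumℤ (staircase N)) (trans (sym (sumℤ-beads N θ fits)) eq))))))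

-- Residue classes of beads

place : ℕ → ℕ → ℤ → ℤ
place m r t = ℤ.+ m ℤ.* t ℤ.+ ℤ.+ r

place-< : ∀ {m i j t t′} → i < m → t ℤ.< t′ → place m i t ℤ.< place m j t′
place-< {m} {i} {j} {t} {t′} i<m t<t′ = begin-strict
  ℤ.+ m ℤ.* t ℤ.+ ℤ.+ i     <⟨ ℤₚ.+-monoʳ-< (ℤ.+ m ℤ.* t) (ℤ.+<+ i<m) ⟩
  ℤ.+ m ℤ.* t ℤ.+ ℤ.+ m     ≡⟨ solve 2 (λ x y → x :* y :+ x := x :* (con (ℤ.+ 1) :+ y)) refl (ℤ.+ m) t ⟩
  ℤ.+ m ℤ.* ℤ.suc t         ≤⟨ ℤₚ.*-monoˡ-≤-nonNeg (ℤ.+ m) (ℤₚ.i<j⇒suc[i]≤j t<t′) ⟩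
  ℤ.+ m ℤ.* t′              ≡⟨ sym (ℤₚ.+-identityʳ (ℤ.+ m ℤ.* t′)) ⟩
  ℤ.+ m ℤ.* t′ ℤ.+ ℤ.+ 0    ≤⟨ ℤₚ.+-monoʳ-≤ (ℤ.+ m ℤ.* t′) (ℤ.+≤+ z≤n) ⟩
  ℤ.+ m ℤ.* t′ ℤ.+ ℤ.+ j    ∎
  where
  open ℤₚ.≤-Reasoning
  open ℤ-Solver

place-injective : ∀ {m i j t t′} → i < m → j < m → place m i t ≡ place m j t′ → i ≡ j × t ≡ t′
place-injective {m} {i} {j} {t} {t′} i<m j<m eq with ℤₚ.<-cmp t t′
... | tri< t<t′ _ _ = contradiction eq (ℤₚ.<⇒≢ (place-< {m} {i} {j} i<m t<t′))
... | tri≈ _ refl _ = ℤₚ.+-injective (ℤ-+-cancelˡ (ℤ.+ m ℤ.* t) eq) , refl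
... | tri> _ _ t′<t = contradiction (sym eq) (ℤₚ.<⇒≢ (place-< {m} {j} {i} j<m t′<t))

place-zero : ∀ m k → place m 0 (ℤ.+ k) ≡ ℤ.+ (m ℕ.* k)
place-zero m k = trans (ℤₚ.+-identityʳ _) (sym (ℤₚ.pos-* m k))

place-0≤ : ∀ {m r t} → r < m → ℤ.+ 0 ℤ.≤ place m r t → ℤ.+ 0 ℤ.≤ t
place-0≤ {m} {r} {t} r<m 0≤p = ℤₚ.≮⇒≥ (λ t<0 → ℤₚ.<⇒≱ (subst (place m r t ℤ.<_) (trans (place-zero m 0) (cong (λ k → ℤ.+ k) (ℕₚ.*-zeroʳ m))) (place-< {m} {r} {0} r<m t<0)) 0≤p)

0≤-place : ∀ {m r t} → ℤ.+ 0 ℤ.≤ t → ℤ.+ 0 ℤ.≤ place m r t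
0≤-place {m} {r} {ℤ.+ k} _ = subst (ℤ.+ 0 ℤ.≤_) (trans (ℤₚ.pos-+ (m ℕ.* k) r) (cong (λ s → s ℤ.+ ℤ.+ r) (ℤₚ.pos-* m k))) (ℤ.+≤+ z≤n)

place-range : ∀ {m r K t} → r < m → InRange (m ℕ.* K) (place m r t) → InRange K t
place-range {m} {r} {K} {t} r<m (0≤p , p<) = place-0≤ {m} {r} r<m 0≤p , ℤₚ.≰⇒> (λ K≤t → ℤₚ.<⇒≱ p< (begin
  ℤ.+ (m ℕ.* K)             ≡⟨ sym (place-zero m K) ⟩
  ℤ.+ m ℤ.* ℤ.+ K ℤ.+ ℤ.+ 0 ≤⟨ ℤₚ.+-mono-≤ (ℤₚ.*-monoˡ-≤-nonNeg (ℤ.+ m) K≤t) (ℤ.+≤+ z≤n) ⟩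
  place m r t               ∎))
  where open ℤₚ.≤-Reasoning

range-place : ∀ {m r K t} → r < m → InRange K t → InRange (m ℕ.* K) (place m r t)
range-place {m} {r} {K} {t} r<m (0≤t , t<K) = 0≤-place {m} {r} 0≤t , subst (place m r t ℤ.<_) (place-zero m K) (place-< {m} {r} {0} r<m t<K)

sg-scale : ∀ m .{{_ : NonZero m}} a → sg (ℤ.+ m ℤ.* a) ≡ sg a
sg-scale m       (ℤ.+ zero)  = cong sg (ℤₚ.*-zeroʳ (ℤ.+ m))
sg-scale (suc m) (ℤ.+ suc k) = refl
sg-scale (suc m) -[1+ k ]    = refl

sg-place : ∀ m .{{_ : NonZero m}} r t t′ → sg (place m r t ℤ.- place m r t′) ≡ sg (t ℤ.- t′)
sg-place m r t t′ = trans (cong sg (solve 4 (λ x y w z → (x :* y :+ z) :- (x :* w :+ z) := x :* (y :- w)) refl (ℤ.+ m) t t′ (ℤ.+ r))) (sg-scale m (t ℤ.- t′))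
  where open ℤ-Solver

signs-++ : ∀ a xs ys → signs a (xs ++ ys) ≡ signs a xs * signs a ys
signs-++ a []       ys = sym (ℚₚ.*-identityˡ (signs a ys))
signs-++ a (b ∷ xs) ys = trans (cong (sg (a ℤ.- b) *_) (signs-++ a xs ys)) (sym (ℚₚ.*-assoc (sg (a ℤ.- b)) (signs a xs) (signs a ys)))

crossSigns : List ℤ → List ℤ → ℚ
crossSigns []       ys = 1ℚ
crossSigns (a ∷ xs) ys = signs a ys * crossSigns xs ys

vandermonde-++ : ∀ xs ys → vandermonde (xs ++ ys) ≡ vandermonde xs * crossSigns xs ys * vandermonde ys
vandermonde-++ []       ys = sym (trans (cong (_* vandermonde ys) (ℚₚ.*-identityˡ 1ℚ)) (ℚₚ.*-identityˡ (vandermonde ys)))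
vandermonde-++ (a ∷ xs) ys = trans (cong₂ _*_ (signs-++ a xs ys) (vandermonde-++ xs ys))
  (solve 5 (λ s t v w u → s :* t :* (v :* w :* u) := s :* v :* (t :* w) :* u) refl (signs a xs) (signs a ys) (vandermonde xs) (crossSigns xs ys) (vandermonde ys))
  where open +-*-Solver

signs-↭ : ∀ a {u w} → u ↭ w → signs a u ≡ signs a w
signs-↭ a ↭.refl         = refl
signs-↭ a (↭.prep b p)   = cong (sg (a ℤ.- b) *_) (signs-↭ a p)
signs-↭ a {_} {_ ∷ _ ∷ w} (↭.swap b c p) = trans (cong (λ s → sg (a ℤ.- b) * (sg (a ℤ.- c) * s)) (signs-↭ a p))
  (solve 3 (λ x y s → x :* (y :* s) := y :* (x :* s)) refl (sg (a ℤ.- b)) (sg (a ℤ.- c)) (signs a w))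
  where open +-*-Solver
signs-↭ a (↭.trans p q)  = trans (signs-↭ a p) (signs-↭ a q)

crossSigns-↭ʳ : ∀ xs {u w} → u ↭ w → crossSigns xs u ≡ crossSigns xs w
crossSigns-↭ʳ []       p = refl
crossSigns-↭ʳ (a ∷ xs) p = cong₂ _*_ (signs-↭ a p) (crossSigns-↭ʳ xs p)

crossSigns-↭ˡ : ∀ {xs xs′} ys → xs ↭ xs′ → crossSigns xs ys ≡ crossSigns xs′ ys
crossSigns-↭ˡ ys ↭.refl         = refl
crossSigns-↭ˡ ys (↭.prep a p)   = cong (signs a ys *_) (crossSigns-↭ˡ ys p)
crossSigns-↭ˡ {_} {_ ∷ _ ∷ xs} ys (↭.swap a b p) = trans (cong (λ s → signs a ys * (signs b ys * s)) (crossSigns-↭ˡ ys p))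
  (solve 3 (λ x y s → x :* (y :* s) := y :* (x :* s)) refl (signs a ys) (signs b ys) (crossSigns xs ys))
  where open +-*-Solver
crossSigns-↭ˡ ys (↭.trans p q)  = trans (crossSigns-↭ˡ ys p) (crossSigns-↭ˡ ys q)

-- An abacus read runner by runner: the entries of successive lists are the heights of beads on
-- runners `r`, `suc r`, and so on.
blocks : ∀ {k} → ℕ → ℕ → Vec (List ℤ) k → List ℤ
blocks m r []      = []
blocks m r (u ∷ U) = map (place m r) u ++ blocks m (suc r) U

signs-place : ∀ m .{{_ : NonZero m}} r t u → signs (place m r t) (map (place m r) u) ≡ signs t u
signs-place m r t []      = refl
signs-place m r t (s ∷ u) = cong₂ _*_ (sg-place m r t s) (signs-place m r t u)

vandermonde-place : ∀ m .{{_ : NonZero m}} r u → vandermonde (map (place m r) u) ≡ vandermonde u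
vandermonde-place m r []      = refl
vandermonde-place m r (t ∷ u) = cong₂ _*_ (signs-place m r t u) (vandermonde-place m r u)

-- The product of the signs between different runners when every runner carries the staircase of `K`
-- beads.
blockSign : ℕ → ℕ → ℕ → ℕ → ℚ
blockSign m K r zero    = 1ℚ
blockSign m K r (suc k) = crossSigns (map (place m r) (staircase K)) (blocks m (suc r) (replicate k (staircase K))) * blockSign m K (suc r) k

blocks-↭ : ∀ m r {k K} {U : Vec (List ℤ) k} → Allᵛ (_↭ staircase K) U → blocks m r U ↭ blocks m r (replicate k (staircase K))
blocks-↭ m r []       = ↭-refl
blocks-↭ m r (p ∷ ps) = ↭ₚ.++⁺ (↭ₚ.map⁺ (place m r) p) (blocks-↭ m (suc r) ps)

vandermondes : ∀ {k} → Vec (List ℤ) k → ℚ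
vandermondes []      = 1ℚ
vandermondes (u ∷ U) = vandermonde u * vandermondes U

-- The signs between two runners are symmetric in the beads of each runner, so they depend only on
-- the sets of beads, which are those of the staircase. The signs within a runner are unaffected by
-- `place`.
vandermonde-blocks : ∀ m .{{_ : NonZero m}} K r {k} (U : Vec (List ℤ) k) → Allᵛ (_↭ staircase K) U →
  vandermonde (blocks m r U) ≡ blockSign m K r k * vandermondes U
vandermonde-blocks m K r [] [] = refl
vandermonde-blocks m K r {suc k} (u ∷ U) (p ∷ ps) = begin
  vandermonde (map (place m r) u ++ blocks m (suc r) U)
    ≡⟨ vandermonde-++ (map (place m r) u) (blocks m (suc r) U) ⟩
  vandermonde (map (place m r) u) * crossSigns (map (place m r) u) (blocks m (suc r) U) * vandermonde (blocks m (suc r) U)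
    ≡⟨ cong₂ _*_ (cong₂ _*_ (vandermonde-place m r u) (trans (crossSigns-↭ˡ (blocks m (suc r) U) (↭ₚ.map⁺ (place m r) p))
         (crossSigns-↭ʳ (map (place m r) (staircase K)) (blocks-↭ m (suc r) ps)))) (vandermonde-blocks m K (suc r) U ps) ⟩
  vandermonde u * s * (blockSign m K (suc r) k * vandermondes U)
    ≡⟨ solve 4 (λ v s b w → v :* s :* (b :* w) := s :* b :* (v :* w)) refl (vandermonde u) s (blockSign m K (suc r) k) (vandermondes U) ⟩
  s * blockSign m K (suc r) k * (vandermonde u * vandermondes U) ∎
  where
  open ≡-Reasoning
  open +-*-Solver
  s : ℚ
  s = crossSigns (map (place m r) (staircase K)) (blocks m (suc r) (replicate k (staircase K)))

IsSign : ℚ → Set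
IsSign s = s ≡ 1ℚ ⊎ s ≡ - 1ℚ

IsSign-* : ∀ {s t} → IsSign s → IsSign t → IsSign (s * t)
IsSign-* (inj₁ refl) (inj₁ refl) = inj₁ refl
IsSign-* (inj₁ refl) (inj₂ refl) = inj₂ refl
IsSign-* (inj₂ refl) (inj₁ refl) = inj₂ refl
IsSign-* (inj₂ refl) (inj₂ refl) = inj₁ refl

sg-isSign : ∀ {a b} → a ≢ b → IsSign (sg (a ℤ.- b))
sg-isSign {a} {b} a≢b with a ℤ.- b in eq
... | ℤ.+ zero  = contradiction (ℤₚ.i-j≡0⇒i≡j a b eq) a≢b
... | ℤ.+ suc _ = inj₁ refl
... | -[1+ _ ]  = inj₂ refl

signs-isSign : ∀ {a} u → All (a ≢_) u → IsSign (signs a u)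
signs-isSign []      []       = inj₁ refl
signs-isSign (b ∷ u) (p ∷ ps) = IsSign-* (sg-isSign p) (signs-isSign u ps)

blocks-avoid : ∀ {m i} r {k t} (U : Vec (List ℤ) k) → i < r → r ℕ.+ k ≤ m → All (place m i t ≢_) (blocks m r U)
blocks-avoid r [] i<r _ = []
blocks-avoid {m} {i} r {suc k} {t} (u ∷ U) i<r r+k≤m = Allₚ.++⁺
  (Allₚ.map⁺ (All.universal (λ s eq → ℕₚ.<⇒≢ i<r (proj₁ (place-injective {m} {i} {r} (ℕₚ.<-trans i<r r<m) r<m eq))) u))
  (blocks-avoid (suc r) U (ℕₚ.<-trans i<r ℕₚ.≤-refl) (subst (_≤ m) (ℕₚ.+-suc r k) r+k≤m))
  where
  r<m : r < m
  r<m = ℕₚ.<-≤-trans (ℕₚ.m<m+n r (s≤s z≤n)) r+k≤m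

crossSigns-isSign : ∀ {m} r {k} u (U : Vec (List ℤ) k) → suc r ℕ.+ k ≤ m → IsSign (crossSigns (map (place m r) u) (blocks m (suc r) U))
crossSigns-isSign r []      U _   = inj₁ refl
crossSigns-isSign r (t ∷ u) U r+k = IsSign-* (signs-isSign (blocks _ (suc r) U) (blocks-avoid (suc r) U ℕₚ.≤-refl r+k)) (crossSigns-isSign r u U r+k)

blockSign-isSign : ∀ m K r k → r ℕ.+ k ≤ m → IsSign (blockSign m K r k)
blockSign-isSign m K r zero    _   = inj₁ refl
blockSign-isSign m K r (suc k) r+k = IsSign-* (crossSigns-isSign r (staircase K) (replicate k (staircase K)) r+k′) (blockSign-isSign m K (suc r) k r+k′)
  where
  r+k′ : suc r ℕ.+ k ≤ m
  r+k′ = subst (_≤ m) (ℕₚ.+-suc r k) r+k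

zipMN : ∀ {k} → ℕ → Vec (List ℤ) k → Vec (List ℕ) k → ℚ
zipMN K []      []      = 1ℚ
zipMN K (u ∷ U) (p ∷ t) = mn K u p * zipMN K U t

blocks-admissible : ∀ {m K} r {k} (U : Vec (List ℤ) k) → r ℕ.+ k ≤ m → Allᵛ (Admissible K) U →
  length (blocks m r U) ≡ k ℕ.* K × All (InRange (m ℕ.* K)) (blocks m r U)
blocks-admissible r [] _ [] = refl , []
blocks-admissible {m} {K} r {suc k} (u ∷ U) r+k ((len , rng) ∷ adms) with blocks-admissible {m} {K} (suc r) U (subst (_≤ m) (ℕₚ.+-suc r k) r+k) adms
... | lens , rngs = trans (Listₚ.length-++ (map (place m r) u)) (cong₂ ℕ._+_ (trans (Listₚ.length-map (place m r) u) len) lens)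
  , Allₚ.++⁺ (Allₚ.map⁺ (All.map (range-place {m} {r} {K} (ℕₚ.<-≤-trans (ℕₚ.m<m+n r (s≤s z≤n)) r+k)) rng)) rngs

-- A nonzero Vandermonde sign makes the heights on each runner distinct, and the range leaves only
-- `K` possible heights.
blocks-length≤ : ∀ {m} .{{_ : NonZero m}} {K} r {k} (U : Vec (List ℤ) k) → r ℕ.+ k ≤ m → All (InRange (m ℕ.* K)) (blocks m r U) → vandermonde (blocks m r U) ≢ 0ℚ →
  Allᵛ (λ u → length u ≤ K × All (InRange K) u × vandermonde u ≢ 0ℚ) U
blocks-length≤ r [] _ _ _ = []
blocks-length≤ {m} {K} r {suc k} (u ∷ U) r+k rngs V≢0 = (len , rng , Vu≢0) ∷
  blocks-length≤ {m} {K} (suc r) U (subst (_≤ m) (ℕₚ.+-suc r k) r+k) (Allₚ.++⁻ʳ (map (place m r) u) rngs) (proj₂ factors)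
  where
  factors : vandermonde (map (place m r) u) * crossSigns (map (place m r) u) (blocks m (suc r) U) ≢ 0ℚ × vandermonde (blocks m (suc r) U) ≢ 0ℚ
  factors = *-nonZero (λ eq → V≢0 (trans (vandermonde-++ (map (place m r) u) (blocks m (suc r) U)) eq))
  Vu≢0 : vandermonde u ≢ 0ℚ
  Vu≢0 eq = proj₁ (*-nonZero {vandermonde (map (place m r) u)} (proj₁ factors)) (trans (vandermonde-place m r u) eq)
  rng : All (InRange K) u
  rng = All.map (place-range {m} {r} {K} (ℕₚ.<-≤-trans (ℕₚ.m<m+n r (s≤s z≤n)) r+k)) (Allₚ.map⁻ (Allₚ.++⁻ˡ (map (place m r) u) rngs))
  len : length u ≤ K
  len = subst (length u ≤_) (length-staircase K) (unique-length (vandermonde≢0 u Vu≢0) (λ x∈u → ∈-staircase K (All.lookup rng x∈u)))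

sizes : ∀ {k} → Vec (List ℤ) k → ℕ
sizes []      = 0
sizes (u ∷ U) = length u ℕ.+ sizes U

length-blocks : ∀ m r {k} (U : Vec (List ℤ) k) → length (blocks m r U) ≡ sizes U
length-blocks m r []      = refl
length-blocks m r (u ∷ U) = trans (Listₚ.length-++ (map (place m r) u)) (cong₂ ℕ._+_ (Listₚ.length-map (place m r) u) (length-blocks m (suc r) U))

sizes≤ : ∀ {K k} {U : Vec (List ℤ) k} → Allᵛ (λ u → length u ≤ K) U → sizes U ≤ k ℕ.* K
sizes≤ []       = z≤n
sizes≤ (p ∷ ps) = ℕₚ.+-mono-≤ p (sizes≤ ps)

sizes-full : ∀ {K k} {U : Vec (List ℤ) k} → Allᵛ (λ u → length u ≤ K) U → sizes U ≡ k ℕ.* K → Allᵛ (λ u → length u ≡ K) U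
sizes-full [] _ = []
sizes-full {K} {suc k} {u ∷ U} (p ∷ ps) eq = ℕₚ.≤-antisym p K≤len ∷ sizes-full ps (ℕₚ.≤-antisym (sizes≤ ps) kK≤)
  where
  K≤len : K ≤ length u
  K≤len = ℕₚ.+-cancelʳ-≤ (k ℕ.* K) K (length u) (subst (_≤ length u ℕ.+ k ℕ.* K) eq (ℕₚ.+-monoʳ-≤ (length u) (sizes≤ ps)))
  kK≤ : k ℕ.* K ≤ sizes U
  kK≤ = ℕₚ.+-cancelˡ-≤ K (k ℕ.* K) (sizes U) (subst (_≤ K ℕ.+ sizes U) eq (ℕₚ.+-monoˡ-≤ (sizes U) p))

vandermondes-E : ∀ {K k} {U : Vec (List ℤ) k} → Allᵛ (λ u → E K u ≢ 0ℚ) U → vandermondes U ≡ zipMN K U (replicate k [])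
vandermondes-E []       = refl
vandermondes-E {K} {U = u ∷ U} (p ∷ ps) = cong₂ _*_ (sym (E-admissible (proj₁ (E≢0 {K} {u} p)))) (vandermondes-E ps)

zipMN-vanish : ∀ {K k} (U : Vec (List ℤ) k) → ¬ Allᵛ (λ u → E K u ≢ 0ℚ) U → zipMN K U (replicate k []) ≡ 0ℚ
zipMN-vanish []      none = contradiction [] none
zipMN-vanish {K} {suc k} (u ∷ U) none with E K u ℚₚ.≟ 0ℚ
... | yes E≡0 = trans (cong (_* zipMN K U (replicate k [])) E≡0) (ℚₚ.*-zeroˡ (zipMN K U (replicate k [])))
... | no  E≢0′ = trans (cong (E K u *_) (zipMN-vanish U (λ all → none (E≢0′ ∷ all)))) (ℚₚ.*-zeroʳ (E K u))

-- If the left side is nonzero, no runner has more than `K` beads while the total is `m ℕ.* K`, so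
-- every runner has exactly `K`. Hence nonvanishing can be tested runner by runner, and there the
-- sign factors.
E-blocks : ∀ m .{{_ : NonZero m}} K (U : Vec (List ℤ) m) → E (m ℕ.* K) (blocks m 0 U) ≡ blockSign m K 0 m * zipMN K U (replicate m [])
E-blocks m K U with Allᵛ.all? (λ u → ¬? (E K u ℚₚ.≟ 0ℚ)) U
... | yes all = trans (E-admissible (blocks-admissible 0 U ℕₚ.≤-refl (Allᵛ.map (λ {u} p → proj₁ (E≢0 {K} {u} p)) all)))
  (trans (vandermonde-blocks m K 0 U (Allᵛ.map (λ {u} p → E≢0⇒↭ {K} {u} p) all)) (cong (blockSign m K 0 m *_) (vandermondes-E all)))
... | no  notAll = trans (decidable-stable (E (m ℕ.* K) (blocks m 0 U) ℚₚ.≟ 0ℚ) (λ ≢0 → notAll (nonVanishing ≢0)))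
  (sym (trans (cong (blockSign m K 0 m *_) (zipMN-vanish U notAll)) (ℚₚ.*-zeroʳ (blockSign m K 0 m))))
  where
  nonVanishing : E (m ℕ.* K) (blocks m 0 U) ≢ 0ℚ → Allᵛ (λ u → E K u ≢ 0ℚ) U
  nonVanishing ≢0 with E≢0 {m ℕ.* K} {blocks m 0 U} ≢0
  ... | (len , rngs) , V≢0 = Allᵛ.map (λ { {u} ((_ , rng , Vu≢0) , full) eq → Vu≢0 (trans (sym (E-admissible (full , rng))) eq) })
      (Allᵛ.zip (bounds , sizes-full (Allᵛ.map proj₁ bounds) (trans (sym (length-blocks m 0 U)) len)))
    where bounds = blocks-length≤ {m} {K} 0 U ℕₚ.≤-refl rngs V≢0

-- Summation over the ways of distributing the entries of a list into k lists.
assign : ∀ {k} → List ℕ → (Vec (List ℕ) k → ℚ) → ℚ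
assign {k} []      Ψ = Ψ (replicate k [])
assign {k} (a ∷ l) Ψ = ∑[ r < k ] assign l (λ t → Ψ (updateAt t r (a ∷_)))

assign-cong : ∀ {k} l {Ψ Ψ′ : Vec (List ℕ) k → ℚ} → (∀ t → Ψ t ≡ Ψ′ t) → assign l Ψ ≡ assign l Ψ′
assign-cong {k} []      eq = eq (replicate k [])
assign-cong {k} (a ∷ l) eq = sum-cong-≗ {k} (λ r → assign-cong l (λ t → eq (updateAt t r (a ∷_))))

assign-+ : ∀ {k} l (Ψ Ψ′ : Vec (List ℕ) k → ℚ) → assign l (λ t → Ψ t + Ψ′ t) ≡ assign l Ψ + assign l Ψ′
assign-+     []      Ψ Ψ′ = refl
assign-+ {k} (a ∷ l) Ψ Ψ′ = trans (sum-cong-≗ {k} (λ r → assign-+ l (λ t → Ψ (updateAt t r (a ∷_))) (λ t → Ψ′ (updateAt t r (a ∷_)))))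
  (∑-distrib-+ (λ r → assign l (λ t → Ψ (updateAt t r (a ∷_)))) (λ r → assign l (λ t → Ψ′ (updateAt t r (a ∷_)))))

assign-zero : ∀ {k} l {Ψ : Vec (List ℕ) k → ℚ} → (∀ t → Ψ t ≡ 0ℚ) → assign l Ψ ≡ 0ℚ
assign-zero {k} []      eq = eq (replicate k [])
assign-zero {k} (a ∷ l) eq = ∑-zero (λ r → assign-zero l (λ t → eq (updateAt t r (a ∷_))))

∑↓-assign : ∀ {k} a u l (Ψ : List ℤ → Vec (List ℕ) k → ℚ) → ∑↓ a u (λ w → assign l (Ψ w)) ≡ assign l (λ t → ∑↓ a u (λ w → Ψ w t))
∑↓-assign a []      l Ψ = sym (assign-zero l (λ t → refl))
∑↓-assign a (b ∷ u) l Ψ = trans (cong (assign l (Ψ (b ℤ.- ℤ.+ a ∷ u)) +_) (∑↓-assign a u l (λ w → Ψ (b ∷ w))))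
  (sym (assign-+ l (Ψ (b ℤ.- ℤ.+ a ∷ u)) (λ t → ∑↓ a u (λ w → Ψ (b ∷ w) t))))

∑↓-*ˡ : ∀ a u r F → ∑↓ a u (λ w → r * F w) ≡ r * ∑↓ a u F
∑↓-*ˡ a []      r F = sym (ℚₚ.*-zeroʳ r)
∑↓-*ˡ a (b ∷ u) r F = trans (cong (r * F (b ℤ.- ℤ.+ a ∷ u) +_) (∑↓-*ˡ a u r (λ w → F (b ∷ w)))) (sym (ℚₚ.*-distribˡ-+ r _ _))

∑↓-*ʳ : ∀ a u r F → ∑↓ a u (λ w → F w * r) ≡ ∑↓ a u F * r
∑↓-*ʳ a u r F = trans (∑↓-cong a u (λ w → ℚₚ.*-comm (F w) r)) (trans (∑↓-*ˡ a u r F) (ℚₚ.*-comm r (∑↓ a u F)))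

∑↓-++ : ∀ a xs ys F → ∑↓ a (xs ++ ys) F ≡ ∑↓ a xs (λ w → F (w ++ ys)) + ∑↓ a ys (λ w → F (xs ++ w))
∑↓-++ a []       ys F = sym (ℚₚ.+-identityˡ (∑↓ a ys F))
∑↓-++ a (b ∷ xs) ys F = trans (cong (F (b ℤ.- ℤ.+ a ∷ xs ++ ys) +_) (∑↓-++ a xs ys (λ w → F (b ∷ w)))) (sym (ℚₚ.+-assoc (F (b ℤ.- ℤ.+ a ∷ xs ++ ys)) _ _))

-- Lowering a bead by `m ℕ.* a` keeps it on its runner and lowers its height by `a`.
∑↓-place : ∀ m r a u F → ∑↓ (m ℕ.* a) (map (place m r) u) F ≡ ∑↓ a u (λ w → F (map (place m r) w))
∑↓-place m r a []      F = refl
∑↓-place m r a (t ∷ u) F = cong₂ _+_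
  (cong (λ b → F (b ∷ map (place m r) u)) (trans (cong (λ k → place m r t ℤ.- k) (ℤₚ.pos-* m a))
    (solve 4 (λ x y w z → (x :* y :+ z) :- x :* w := x :* (y :- w) :+ z) refl (ℤ.+ m) t (ℤ.+ a) (ℤ.+ r))))
  (∑↓-place m r a u (λ w → F (place m r t ∷ w)))
  where open ℤ-Solver

∑↓-blocks : ∀ m r a {k} (U : Vec (List ℤ) k) F →
  ∑↓ (m ℕ.* a) (blocks m r U) F ≡ ∑[ i < k ] ∑↓ a (lookup U i) (λ w → F (blocks m r (updateAt U i (λ _ → w))))
∑↓-blocks m r a []      F = refl
∑↓-blocks m r a (u ∷ U) F = trans (∑↓-++ (m ℕ.* a) (map (place m r) u) (blocks m (suc r) U) F) (cong₂ _+_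
  (∑↓-place m r a u (λ w → F (w ++ blocks m (suc r) U))) (∑↓-blocks m (suc r) a U (λ w → F (map (place m r) u ++ w))))

zipMN-∷ : ∀ {k} K (U : Vec (List ℤ) k) t i a → zipMN K U (updateAt t i (a ∷_)) ≡ ∑↓ a (lookup U i) (λ w → zipMN K (updateAt U i (λ _ → w)) t)
zipMN-∷ K (u ∷ U) (p ∷ t) zero    a = sym (∑↓-*ʳ a u (zipMN K U t) (λ w → mn K w p))
zipMN-∷ K (u ∷ U) (p ∷ t) (suc i) a = trans (cong (mn K u p *_) (zipMN-∷ K U t i a)) (sym (∑↓-*ˡ a (lookup U i) (mn K u p) (λ w → zipMN K (updateAt U i (λ _ → w)) t)))

-- Each part chooses the runner on which it is removed. The sign relating the runners appears only
-- when all parts are gone, so it is the same for every sequence of choices.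
mn-blocks : ∀ m .{{_ : NonZero m}} K l (U : Vec (List ℤ) m) → mn (m ℕ.* K) (blocks m 0 U) (map (m ℕ.*_) l) ≡ blockSign m K 0 m * assign l (zipMN K U)
mn-blocks m K []      U = E-blocks m K U
mn-blocks m K (a ∷ l) U = begin
  ∑↓ (m ℕ.* a) (blocks m 0 U) (λ w → mn (m ℕ.* K) w (map (m ℕ.*_) l))
    ≡⟨ ∑↓-blocks m 0 a U (λ w → mn (m ℕ.* K) w (map (m ℕ.*_) l)) ⟩
  (∑[ i < m ] ∑↓ a (lookup U i) (λ w → mn (m ℕ.* K) (blocks m 0 (updateAt U i (λ _ → w))) (map (m ℕ.*_) l)))
    ≡⟨ sum-cong-≗ {m} (λ i → trans (∑↓-cong a (lookup U i) (λ w → mn-blocks m K l (updateAt U i (λ _ → w))))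
         (∑↓-*ˡ a (lookup U i) s (λ w → assign l (zipMN K (updateAt U i (λ _ → w)))))) ⟩
  (∑[ i < m ] (s * ∑↓ a (lookup U i) (λ w → assign l (zipMN K (updateAt U i (λ _ → w))))))
    ≡⟨ sym (*-distribˡ-sum {m} s (λ i → ∑↓ a (lookup U i) (λ w → assign l (zipMN K (updateAt U i (λ _ → w)))))) ⟩
  s * (∑[ i < m ] ∑↓ a (lookup U i) (λ w → assign l (zipMN K (updateAt U i (λ _ → w)))))
    ≡⟨ cong (s *_) (sum-cong-≗ {m} (λ i → trans (∑↓-assign a (lookup U i) l (λ w → zipMN K (updateAt U i (λ _ → w))))
         (assign-cong l (λ t → sym (zipMN-∷ K U t i a))))) ⟩
  s * (∑[ i < m ] assign l (λ t → zipMN K U (updateAt t i (a ∷_)))) ∎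
  where
  open ≡-Reasoning
  s : ℚ
  s = blockSign m K 0 m

-- Reordering beads, and sorting them by residue

∑↓-~ˢ : ∀ a {u u′} {F : List ℤ → ℚ} → (∀ {w w′} → w ~ˢ w′ → F w′ ≡ - F w) → u ~ˢ u′ → ∑↓ a u′ F ≡ - ∑↓ a u F
∑↓-~ˢ a {F = F} alt (swap b c u) = begin
  F (c ℤ.- ℤ.+ a ∷ b ∷ u) + (F (c ∷ b ℤ.- ℤ.+ a ∷ u) + ∑↓ a u (λ w → F (c ∷ b ∷ w)))
    ≡⟨ cong₂ _+_ (alt (swap b (c ℤ.- ℤ.+ a) u)) (cong₂ _+_ (alt (swap (b ℤ.- ℤ.+ a) c u)) (trans (∑↓-cong a u (λ w → alt (swap b c w))) (∑↓-neg a u (λ w → F (b ∷ c ∷ w))))) ⟩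
  - F (b ∷ c ℤ.- ℤ.+ a ∷ u) + (- F (b ℤ.- ℤ.+ a ∷ c ∷ u) + - ∑↓ a u (λ w → F (b ∷ c ∷ w)))
    ≡⟨ solve 3 (λ x y s → :- x :+ (:- y :+ :- s) := :- (y :+ (x :+ s))) refl (F (b ∷ c ℤ.- ℤ.+ a ∷ u)) (F (b ℤ.- ℤ.+ a ∷ c ∷ u)) (∑↓ a u (λ w → F (b ∷ c ∷ w))) ⟩
  - (F (b ℤ.- ℤ.+ a ∷ c ∷ u) + (F (b ∷ c ℤ.- ℤ.+ a ∷ u) + ∑↓ a u (λ w → F (b ∷ c ∷ w)))) ∎
  where
  open ≡-Reasoning
  open +-*-Solver
  ∑↓-neg : ∀ a u F → ∑↓ a u (λ w → - F w) ≡ - ∑↓ a u F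
  ∑↓-neg a []      F = refl
  ∑↓-neg a (b ∷ u) F = trans (cong (- F (b ℤ.- ℤ.+ a ∷ u) +_) (∑↓-neg a u (λ w → F (b ∷ w)))) (sym (ℚₚ.neg-distrib-+ (F (b ℤ.- ℤ.+ a ∷ u)) _))
∑↓-~ˢ a {F = F} alt (skip b {u} {u′} s) = trans
  (cong₂ _+_ (alt (skip (b ℤ.- ℤ.+ a) s)) (∑↓-~ˢ a (λ p → alt (skip b p)) s))
  (sym (ℚₚ.neg-distrib-+ (F (b ℤ.- ℤ.+ a ∷ u)) (∑↓ a u (λ w → F (b ∷ w)))))

mn-~ˢ : ∀ N l {u u′} → u ~ˢ u′ → mn N u′ l ≡ - mn N u l
mn-~ˢ N []      s = E-~ˢ s
mn-~ˢ N (a ∷ l) s = ∑↓-~ˢ a (mn-~ˢ N l) s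

data _~*_ {A : Set} : List A → List A → Set where
  done : ∀ {u} → u ~* u
  step : ∀ {u u′ w} → u ~ˢ u′ → u′ ~* w → u ~* w

~*-trans : ∀ {A : Set} {u v w : List A} → u ~* v → v ~* w → u ~* w
~*-trans done       q = q
~*-trans (step s p) q = step s (~*-trans p q)

~*-skip : ∀ {A : Set} (a : A) {u w} → u ~* w → (a ∷ u) ~* (a ∷ w)
~*-skip a done       = done
~*-skip a (step s p) = step (skip a s) (~*-skip a p)

↭⇒~* : ∀ {A : Set} {u w : List A} → u ↭ w → u ~* w
↭⇒~* ↭.refl         = done
↭⇒~* (↭.prep a p)   = ~*-skip a (↭⇒~* p)
↭⇒~* (↭.swap a b p) = step (swap a b _) (~*-skip b (~*-skip a (↭⇒~* p)))
↭⇒~* (↭.trans p q)  = ~*-trans (↭⇒~* p) (↭⇒~* q)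

-- The sign is read off the chain of exchanges alone, before `N` and `l` are given. This uniformity
-- is what makes the sign in the theorem independent of the cycle type.
mn-~* : ∀ {u w} → u ~* w → ∃[ s ] IsSign s × (∀ N l → mn N u l ≡ s * mn N w l)
mn-~* done = 1ℚ , inj₁ refl , λ N l → sym (ℚₚ.*-identityˡ (mn N _ l))
mn-~* {u} (step {u′ = u′} {w} t p) with mn-~* p
... | s , sign , eq = - 1ℚ * s , IsSign-* (inj₂ refl) sign , λ N l → begin
  mn N u l                     ≡⟨ solve 1 (λ x → x := con (- 1ℚ) :* (:- x)) refl (mn N u l) ⟩
  - 1ℚ * (- mn N u l)          ≡⟨ cong (- 1ℚ *_) (trans (sym (mn-~ˢ N l t)) (eq N l)) ⟩
  - 1ℚ * (s * mn N w l)        ≡⟨ sym (ℚₚ.*-assoc (- 1ℚ) s (mn N w l)) ⟩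
  - 1ℚ * s * mn N w l ∎
  where
  open ≡-Reasoning
  open +-*-Solver

residue : ∀ m .{{_ : NonZero m}} → ℤ → Fin m
residue m b = fromℕ< (ℤ.n%ℕd<d b m)

divide-place : ∀ m .{{_ : NonZero m}} b → b ≡ place m (toℕ (residue m b)) (b ℤ./ℕ m)
divide-place m b = trans (ℤ.a≡a%ℕn+[a/ℕn]*n b m) (trans
  (solve 3 (λ x y z → x :+ y :* z := z :* y :+ x) refl (ℤ.+ (b ℤ.%ℕ m)) (b ℤ./ℕ m) (ℤ.+ m))
  (cong (λ r → place m r (b ℤ./ℕ m)) (sym (Finₚ.toℕ-fromℕ< (ℤ.n%ℕd<d b m)))))
  where open ℤ-Solver

classes : ∀ m .{{_ : NonZero m}} → List ℤ → Vec (List ℤ) m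
classes m []      = replicate m []
classes m (b ∷ β) = updateAt (classes m β) (residue m b) (b ℤ./ℕ m ∷_)

blocks-insert : ∀ m r {k} (U : Vec (List ℤ) k) i q → blocks m r (updateAt U i (q ∷_)) ↭ place m (r ℕ.+ toℕ i) q ∷ blocks m r U
blocks-insert m r (u ∷ U) zero    q = ↭.↭-reflexive (cong (λ s → place m s q ∷ map (place m r) u ++ blocks m (suc r) U) (sym (ℕₚ.+-identityʳ r)))
blocks-insert m r (u ∷ U) (suc i) q = ↭-trans (↭ₚ.++⁺ˡ (map (place m r) u) (blocks-insert m (suc r) U i q))
  (↭-trans (↭ₚ.shift _ (map (place m r) u) (blocks m (suc r) U)) (↭.↭-reflexive (cong (λ s → place m s q ∷ map (place m r) u ++ blocks m (suc r) U) (sym (ℕₚ.+-suc r (toℕ i))))))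

blocks-empty : ∀ m r k → blocks m r (replicate k []) ≡ []
blocks-empty m r zero    = refl
blocks-empty m r (suc k) = blocks-empty m (suc r) k

classes-↭ : ∀ m .{{_ : NonZero m}} β → β ↭ blocks m 0 (classes m β)
classes-↭ m []      = ↭.↭-reflexive (sym (blocks-empty m 0 m))
classes-↭ m (b ∷ β) = ↭-trans (↭.prep b (classes-↭ m β)) (↭-trans (↭.↭-reflexive (cong (_∷ blocks m 0 (classes m β)) (divide-place m b)))
  (↭-sym (blocks-insert m 0 (classes m β) (residue m b) (b ℤ./ℕ m))))

∈-blocks⁺ : ∀ m r {k} (U : Vec (List ℤ) k) i {t} → t ∈ lookup U i → place m (r ℕ.+ toℕ i) t ∈ blocks m r U
∈-blocks⁺ m r (u ∷ U) zero    {t} t∈u = ∈ₚ.∈-++⁺ˡ (subst (λ s → place m s t ∈ map (place m r) u) (sym (ℕₚ.+-identityʳ r)) (∈ₚ.∈-map⁺ (place m r) t∈u))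
∈-blocks⁺ m r (u ∷ U) (suc i) {t} t∈U = ∈ₚ.∈-++⁺ʳ (map (place m r) u) (subst (λ s → place m s t ∈ blocks m (suc r) U) (sym (ℕₚ.+-suc r (toℕ i))) (∈-blocks⁺ m (suc r) U i t∈U))

∈-blocks⁻ : ∀ m r {k} (U : Vec (List ℤ) k) {x} → x ∈ blocks m r U → ∃[ i ] ∃[ t ] t ∈ lookup U i × x ≡ place m (r ℕ.+ toℕ i) t
∈-blocks⁻ m r (u ∷ U) x∈ with ∈ₚ.∈-++⁻ (map (place m r) u) x∈
... | inj₁ x∈u with ∈ₚ.∈-map⁻ (place m r) x∈u
...   | t , t∈u , eq = zero , t , t∈u , trans eq (cong (λ s → place m s t) (sym (ℕₚ.+-identityʳ r)))
∈-blocks⁻ m r (u ∷ U) x∈ | inj₂ x∈U with ∈-blocks⁻ m (suc r) U x∈U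
... | i , t , t∈ , eq = suc i , t , t∈ , trans eq (cong (λ s → place m s t) (sym (ℕₚ.+-suc r (toℕ i))))

∈-classes⁻ : ∀ m .{{_ : NonZero m}} β i {t} → t ∈ lookup (classes m β) i → place m (toℕ i) t ∈ β
∈-classes⁻ m β i t∈ = ↭ₚ.∈-resp-↭ (↭-sym (classes-↭ m β)) (∈-blocks⁺ m 0 (classes m β) i t∈)

∈-classes⁺ : ∀ m .{{_ : NonZero m}} β i {t} → place m (toℕ i) t ∈ β → t ∈ lookup (classes m β) i
∈-classes⁺ m β i {t} p∈ with ∈-blocks⁻ m 0 (classes m β) (↭ₚ.∈-resp-↭ (classes-↭ m β) p∈)
... | j , s , s∈ , eq with place-injective {m} (Finₚ.toℕ<n i) (Finₚ.toℕ<n j) eq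
...   | i≡j , refl rewrite Finₚ.toℕ-injective i≡j = s∈

-- Beads and charge sets

StrictlyDecreasing : List ℤ → Set
StrictlyDecreasing = AllPairs (λ a b → b ℤ.< a)

place-<⁻ : ∀ {m r t t′} → r < m → place m r t ℤ.< place m r t′ → t ℤ.< t′
place-<⁻ {m} {r} {t} {t′} r<m p< = ℤₚ.≰⇒> λ t′≤t → case-≤ (ℤₚ.<-cmp t′ t) t′≤t
  where
  case-≤ : _ → t′ ℤ.≤ t → ⊥
  case-≤ (tri< t′<t _ _) _ = ℤₚ.<-asym p< (place-< {m} {r} {r} r<m t′<t)
  case-≤ (tri≈ _ refl _) _ = ℤₚ.<-irrefl refl p<
  case-≤ (tri> _ _ t<t′) q = ℤₚ.<⇒≱ t<t′ q

classes-decreasing : ∀ m .{{_ : NonZero m}} β → StrictlyDecreasing β → ∀ i → StrictlyDecreasing (lookup (classes m β) i)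
classes-decreasing m []      _        i = subst StrictlyDecreasing (sym (Vecₚ.lookup-replicate i [])) []
classes-decreasing m (b ∷ β) (b> ∷ d) i with i ≟ᶠ residue m b
... | yes refl = subst StrictlyDecreasing (sym (Vecₚ.lookup∘updateAt (residue m b) (classes m β)))
  (All.tabulate (λ {t} t∈ → place-<⁻ {m} (Finₚ.toℕ<n (residue m b)) (subst (place m (toℕ (residue m b)) t ℤ.<_) (divide-place m b) (All.lookup b> (∈-classes⁻ m β (residue m b) t∈))))
    ∷ classes-decreasing m β d (residue m b))
... | no  i≢r = subst StrictlyDecreasing (sym (Vecₚ.lookup∘updateAt′ i (residue m b) i≢r (classes m β))) (classes-decreasing m β d i)

shifted-bound : ∀ {N} t (ts : Vec ℕ N) → Decreasing (t ∷ ts) → All (ℤ._< ℤ.+ (t ℕ.+ N)) (toList (shifted ts))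
shifted-bound         t []       _         = []
shifted-bound {suc N} t (s ∷ ts) (s≤t , d) = bound ∷ All.map (λ a< → ℤₚ.<-trans a< bound) (shifted-bound s ts d)
  where
  bound : ℤ.+ (s ℕ.+ N) ℤ.< ℤ.+ (t ℕ.+ suc N)
  bound = ℤ.+<+ (subst (s ℕ.+ N <_) (sym (ℕₚ.+-suc t N)) (s≤s (ℕₚ.+-monoˡ-≤ N s≤t)))

shifted-decreasing : ∀ {N} (ts : Vec ℕ N) → Decreasing ts → StrictlyDecreasing (toList (shifted ts))
shifted-decreasing []       _ = []
shifted-decreasing (t ∷ ts) d = shifted-bound t ts d ∷ shifted-decreasing ts (Decreasing-tail t ts d)

beads-decreasing : ∀ N θ → StrictlyDecreasing (beads N θ)
beads-decreasing N θ = shifted-decreasing {N} (tabulate (λ k → nth (parts θ) (toℕ k))) (Decreasing-tabulate N (nth (parts θ)) (nth-decreasing (decreasing θ)))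

decreasing-unique : ∀ {u} → StrictlyDecreasing u → Unique u
decreasing-unique = AllPairs.map (λ b<a a≡b → ℤₚ.<⇒≢ b<a (sym a≡b))

decreasing-ext : ∀ {xs ys} → StrictlyDecreasing xs → StrictlyDecreasing ys → (∀ {a} → a ∈ xs → a ∈ ys) → (∀ {a} → a ∈ ys → a ∈ xs) → xs ≡ ys
decreasing-ext {[]}     {[]}     _ _ _ _ = refl
decreasing-ext {[]}     {y ∷ ys} _ _ _ to = contradiction (to (here refl)) (λ ())
decreasing-ext {x ∷ xs} {[]}     _ _ from _ = contradiction (from (here refl)) (λ ())
decreasing-ext {x ∷ xs} {y ∷ ys} (x> ∷ dx) (y> ∷ dy) from to = cong₂ _∷_ x≡y (decreasing-ext dx dy
  (λ a∈ → strip (from (there a∈)) (λ a≡y → ℤₚ.<⇒≢ (All.lookup x> a∈) (trans a≡y (sym x≡y))))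
  (λ a∈ → strip (to (there a∈)) (λ a≡x → ℤₚ.<⇒≢ (All.lookup y> a∈) (trans a≡x x≡y))))
  where
  strip : ∀ {a b zs} → a ∈ b ∷ zs → a ≢ b → a ∈ zs
  strip (here eq)  neq = contradiction eq neq
  strip (there a∈) _   = a∈
  below : ∀ {a b zs} → All (ℤ._< b) zs → a ∈ b ∷ zs → a ℤ.≤ b
  below b> (here refl) = ℤₚ.≤-refl
  below b> (there a∈)  = ℤₚ.<⇒≤ (All.lookup b> a∈)
  x≡y : x ≡ y
  x≡y = ℤₚ.≤-antisym (below y> (from (here refl))) (below x> (to (here refl)))

lookup-shifted : ∀ {N} (ts : Vec ℕ N) k → lookup (shifted ts) k ≡ ℤ.+ lookup ts k ℤ.- ℤ.+ suc (toℕ k) ℤ.+ ℤ.+ N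
lookup-shifted {suc N} (t ∷ ts) zero    = trans (ℤₚ.pos-+ t N) (trans
  (solve 2 (λ x y → x :+ y := x :- con (ℤ.+ 1) :+ (con (ℤ.+ 1) :+ y)) refl (ℤ.+ t) (ℤ.+ N))
  (cong (λ s → ℤ.+ t ℤ.- ℤ.+ 1 ℤ.+ s) (sym (ℤₚ.pos-+ 1 N))))
  where open ℤ-Solver
lookup-shifted {suc N} (t ∷ ts) (suc k) = trans (lookup-shifted ts k) (trans
  (solve 3 (λ x y z → x :- y :+ z := x :- (con (ℤ.+ 1) :+ y) :+ (con (ℤ.+ 1) :+ z)) refl (ℤ.+ lookup ts k) (ℤ.+ suc (toℕ k)) (ℤ.+ N))
  (cong₂ (λ s s′ → ℤ.+ lookup ts k ℤ.- s ℤ.+ s′) (sym (ℤₚ.pos-+ 1 (suc (toℕ k)))) (sym (ℤₚ.pos-+ 1 N))))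
  where open ℤ-Solver

∈-toList⁺ : ∀ {A : Set} {N} (v : Vec A N) k → lookup v k ∈ toList v
∈-toList⁺ (a ∷ v) zero    = here refl
∈-toList⁺ (a ∷ v) (suc k) = there (∈-toList⁺ v k)

∈-toList⁻ : ∀ {A : Set} {N} (v : Vec A N) {a} → a ∈ toList v → ∃[ k ] lookup v k ≡ a
∈-toList⁻ (a ∷ v) (here refl) = zero , refl
∈-toList⁻ (a ∷ v) (there a∈) with ∈-toList⁻ v a∈
... | k , eq = suc k , eq

shifted-nonNegative : ∀ {N} (ts : Vec ℕ N) → All (ℤ.+ 0 ℤ.≤_) (toList (shifted ts))
shifted-nonNegative []       = []
shifted-nonNegative (t ∷ ts) = ℤ.+≤+ z≤n ∷ shifted-nonNegative ts

i+j-j : ∀ i j → i ℤ.+ j ℤ.- j ≡ i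
i+j-j = solve 2 (λ x y → x :+ y :- y := x) refl
  where open ℤ-Solver

-- With `∈-beads⁺`: translated down by `N`, the beads are the elements of `𝕊 θ` at or above `-N`.
∈-beads⁻ : ∀ N θ {x} → x ∈ beads N θ → ℤ.+ 0 ℤ.≤ x × 𝕊 θ (x ℤ.- ℤ.+ N)
∈-beads⁻ N θ {x} x∈ with ∈-toList⁻ (shifted θᵛ) x∈
  where θᵛ = tabulate (λ (k : Fin N) → nth (parts θ) (toℕ k))
... | k , eq = All.lookup (shifted-nonNegative θᵛ) x∈ , toℕ k , (begin
  x ℤ.- ℤ.+ N                                                              ≡⟨ cong (λ y → y ℤ.- ℤ.+ N) (trans (sym eq) (lookup-shifted θᵛ k)) ⟩
  ℤ.+ lookup θᵛ k ℤ.- ℤ.+ suc (toℕ k) ℤ.+ ℤ.+ N ℤ.- ℤ.+ N                  ≡⟨ i+j-j (ℤ.+ lookup θᵛ k ℤ.- ℤ.+ suc (toℕ k)) (ℤ.+ N) ⟩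
  ℤ.+ lookup θᵛ k ℤ.- ℤ.+ suc (toℕ k)                                      ≡⟨ cong (λ y → ℤ.+ y ℤ.- ℤ.+ suc (toℕ k)) (Vecₚ.lookup∘tabulate (λ j → nth (parts θ) (toℕ j)) k) ⟩
  ℤ.+ nth (parts θ) (toℕ k) ℤ.- ℤ.+ suc (toℕ k) ∎)
  where
  open ≡-Reasoning
  θᵛ = tabulate (λ (k : Fin N) → nth (parts θ) (toℕ k))

∈-beads⁺ : ∀ N θ {x} → length (parts θ) ≤ N → ℤ.+ 0 ℤ.≤ x → 𝕊 θ (x ℤ.- ℤ.+ N) → x ∈ beads N θ
∈-beads⁺ N θ {x} fits 0≤x (k , eq) with k ℕ.<? N
... | yes k<N = subst (_∈ beads N θ) (begin
  lookup (shifted θᵛ) k′                                                   ≡⟨ lookup-shifted θᵛ k′ ⟩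
  ℤ.+ lookup θᵛ k′ ℤ.- ℤ.+ suc (toℕ k′) ℤ.+ ℤ.+ N                          ≡⟨ cong (λ y → ℤ.+ y ℤ.- ℤ.+ suc (toℕ k′) ℤ.+ ℤ.+ N) (Vecₚ.lookup∘tabulate (λ j → nth (parts θ) (toℕ j)) k′) ⟩
  ℤ.+ nth (parts θ) (toℕ k′) ℤ.- ℤ.+ suc (toℕ k′) ℤ.+ ℤ.+ N                ≡⟨ cong (λ j → ℤ.+ nth (parts θ) j ℤ.- ℤ.+ suc j ℤ.+ ℤ.+ N) (Finₚ.toℕ-fromℕ< k<N) ⟩
  ℤ.+ nth (parts θ) k ℤ.- ℤ.+ suc k ℤ.+ ℤ.+ N                              ≡⟨ cong (λ y → y ℤ.+ ℤ.+ N) (sym eq) ⟩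
  x ℤ.- ℤ.+ N ℤ.+ ℤ.+ N                                                    ≡⟨ i-j+j x (ℤ.+ N) ⟩
  x ∎) (∈-toList⁺ (shifted θᵛ) k′)
  where
  open ≡-Reasoning
  k′ = fromℕ< k<N
  θᵛ = tabulate (λ (k : Fin N) → nth (parts θ) (toℕ k))
... | no k≮N = contradiction 0≤x (ℤₚ.<⇒≱ x<0)
  where
  N≤k : N ≤ k
  N≤k = ℕₚ.≮⇒≥ k≮N
  x<0 : x ℤ.< ℤ.+ 0
  x<0 = subst (ℤ._< ℤ.+ 0) (i-j+j x (ℤ.+ N)) (subst (λ y → y ℤ.+ ℤ.+ N ℤ.< ℤ.+ 0) (sym (trans eq (cong (λ y → ℤ.+ y ℤ.- ℤ.+ suc k) (nth-beyond (parts θ) k (ℕₚ.≤-trans fits N≤k)))))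
    (subst (ℤ.- ℤ.+ suc k ℤ.+ ℤ.+ N ℤ.<_) (ℤₚ.+-inverseˡ (ℤ.+ suc k)) (ℤₚ.+-monoʳ-< (ℤ.- ℤ.+ suc k) (ℤ.+<+ (s≤s N≤k)))))

𝕊-below : ∀ θ N {a} → length (parts θ) ≤ N → a ℤ.< ℤ.- ℤ.+ N → 𝕊 θ a
𝕊-below θ N {ℤ.+ j} fits a< = contradiction (ℤₚ.<-≤-trans a< (ℤₚ.neg-mono-≤ (ℤ.+≤+ (z≤n {N})))) (λ { (ℤ.+<+ ()) })
𝕊-below θ N { -[1+ j ]} fits a< = j , cong (λ y → ℤ.+ y ℤ.- ℤ.+ suc j) (sym (nth-beyond (parts θ) j (ℕₚ.≤-trans fits N≤j)))
  where
  N≤j : N ≤ j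
  N≤j = ℕ.s≤s⁻¹ (ℤₚ.drop‿+<+ (subst (ℤ._< ℤ.+ suc j) (ℤₚ.neg-involutive (ℤ.+ N)) (ℤₚ.neg-mono-< a<)))

nth-positive : ∀ {l} → All NonZero l → ∀ k → k < length l → 0 < nth l k
nth-positive (p ∷ _)  zero    _       = ℕ.>-nonZero⁻¹ _ {{p}}
nth-positive (_ ∷ ps) (suc k) (s≤s q) = nth-positive ps k q

-- Together with `𝕊-below` this makes minus the number of parts the least integer outside `𝕊 θ`, so
-- the number of parts can be bounded from the set alone.
𝕊-gap : ∀ θ → ¬ 𝕊 θ (ℤ.- ℤ.+ length (parts θ))
𝕊-gap θ (k , eq) with k ℕ.<? length (parts θ)
... | yes k<L = ℕₚ.<⇒≱ (ℕₚ.+-mono-≤ (nth-positive (positive θ) k k<L) k<L) (ℕₚ.≤-reflexive (ℤₚ.+-injective balance))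
  where
  open ℤ-Solver
  L = length (parts θ)
  balance : ℤ.+ (nth (parts θ) k ℕ.+ L) ≡ ℤ.+ suc k
  balance = begin
    ℤ.+ (nth (parts θ) k ℕ.+ L)                            ≡⟨ ℤₚ.pos-+ (nth (parts θ) k) L ⟩
    ℤ.+ nth (parts θ) k ℤ.+ ℤ.+ L                          ≡⟨ solve 3 (λ x y z → x :+ y := (x :- z) :+ (y :+ z)) refl (ℤ.+ nth (parts θ) k) (ℤ.+ L) (ℤ.+ suc k) ⟩
    (ℤ.+ nth (parts θ) k ℤ.- ℤ.+ suc k) ℤ.+ (ℤ.+ L ℤ.+ ℤ.+ suc k)   ≡⟨ cong (λ s → s ℤ.+ (ℤ.+ L ℤ.+ ℤ.+ suc k)) (sym eq) ⟩
    ℤ.- ℤ.+ L ℤ.+ (ℤ.+ L ℤ.+ ℤ.+ suc k)                    ≡⟨ solve 2 (λ y z → :- y :+ (y :+ z) := z) refl (ℤ.+ L) (ℤ.+ suc k) ⟩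
    ℤ.+ suc k ∎
    where open ≡-Reasoning
... | no k≮L = ℕₚ.<⇒≢ (s≤s (ℕₚ.≮⇒≥ k≮L)) (ℤₚ.+-injective (ℤₚ.neg-injective (trans eq (cong (λ y → ℤ.+ y ℤ.- ℤ.+ suc k) (nth-beyond (parts θ) k (ℕₚ.≮⇒≥ k≮L))))))

length-filters : ∀ {A : Set} {P : A → Set} (P? : ∀ a → Dec (P a)) xs → length (filter P? xs) ℕ.+ length (filter (¬? ∘ P?) xs) ≡ length xs
length-filters P? []       = refl
length-filters P? (a ∷ xs) with does (P? a)
... | true  = cong suc (length-filters P? xs)
... | false = trans (ℕₚ.+-suc (length (filter P? xs)) _) (cong suc (length-filters P? xs))

staircase-decreasing : ∀ K → StrictlyDecreasing (staircase K)
staircase-decreasing K = shifted-decreasing (replicate K 0) (zeros K)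
  where
  zeros : ∀ K → Decreasing (replicate K 0)
  zeros zero          = tt
  zeros (suc zero)    = tt
  zeros (suc (suc K)) = z≤n , zeros (suc K)

module Splitting (m : ℕ) .{{_ : NonZero m}} (K : ℕ) (θ : Partition) (fits : length (parts θ) ≤ m ℕ.* K) where

  U : Vec (List ℤ) m
  U = classes m (beads (m ℕ.* K) θ)

  -- A shift by `m ℕ.* K` preserves residues and becomes a shift by `K` on each runner, the same for
  -- all of them. This is why the number of beads is a multiple of `m`.
  recentre : ∀ r t → place m r t ℤ.- ℤ.+ (m ℕ.* K) ≡ ℤ.+ m ℤ.* (t ℤ.- ℤ.+ K) ℤ.+ ℤ.+ r
  recentre r t = trans (cong (λ s → place m r t ℤ.- s) (ℤₚ.pos-* m K))
    (solve 4 (λ x y w z → (x :* y :+ z) :- x :* w := x :* (y :- w) :+ z) refl (ℤ.+ m) t (ℤ.+ K) (ℤ.+ r))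
    where open ℤ-Solver

  ∈U⁻ : ∀ r {t} → t ∈ lookup U r → ℤ.+ 0 ℤ.≤ t × splitSet m (𝕊 θ) r (t ℤ.- ℤ.+ K)
  ∈U⁻ r {t} t∈ with ∈-beads⁻ (m ℕ.* K) θ (∈-classes⁻ m (beads (m ℕ.* K) θ) r t∈)
  ... | 0≤p , s = place-0≤ {m} {toℕ r} (Finₚ.toℕ<n r) 0≤p , subst (𝕊 θ) (recentre (toℕ r) t) s

  ∈U⁺ : ∀ r {t} → ℤ.+ 0 ℤ.≤ t → splitSet m (𝕊 θ) r (t ℤ.- ℤ.+ K) → t ∈ lookup U r
  ∈U⁺ r {t} 0≤t s = ∈-classes⁺ m (beads (m ℕ.* K) θ) r
    (∈-beads⁺ (m ℕ.* K) θ fits (0≤-place {m} {toℕ r} 0≤t) (subst (𝕊 θ) (sym (recentre (toℕ r) t)) s))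

  U-decreasing : ∀ r → StrictlyDecreasing (lookup U r)
  U-decreasing = classes-decreasing m (beads (m ℕ.* K) θ) (beads-decreasing (m ℕ.* K) θ)

  split-below : ∀ r {a} → a ℤ.< ℤ.- ℤ.+ K → splitSet m (𝕊 θ) r a
  split-below r {a} a< = 𝕊-below θ (m ℕ.* K) fits (subst (place m (toℕ r) a ℤ.<_)
    (trans (ℤₚ.+-identityʳ _) (trans (sym (ℤₚ.neg-distribʳ-* (ℤ.+ m) (ℤ.+ K))) (cong (λ s → ℤ.- s) (sym (ℤₚ.pos-* m K)))))
    (place-< {m} {toℕ r} {0} (Finₚ.toℕ<n r) a<))

  module _ {θs : Vec Partition m} (split : IsSplit m θ θs) where

    -- A component with more than `K` parts would have a gap below `-K`, where the split set of `θ`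
    -- contains every integer.
    split-fits : ∀ r → length (parts (lookup θs r)) ≤ K
    split-fits r = ℕₚ.≮⇒≥ (λ K<L → 𝕊-gap (lookup θs r) (Equivalence.from (split r _) (split-below r (ℤₚ.neg-mono-< (ℤ.+<+ K<L)))))

    U-beads : ∀ r → lookup U r ≡ beads K (lookup θs r)
    U-beads r = decreasing-ext (U-decreasing r) (beads-decreasing K (lookup θs r))
      (λ t∈ → let 0≤t , s = ∈U⁻ r t∈ in ∈-beads⁺ K (lookup θs r) (split-fits r) 0≤t (Equivalence.from (split r _) s))
      (λ t∈ → let 0≤t , s = ∈-beads⁻ K (lookup θs r) t∈ in ∈U⁺ r 0≤t (Equivalence.to (split r _) s))

  -- With t = a + K, the pair of counts compares { t ∈ U : t ≥ K } with { 0 ≤ t < K : t ∉ U }.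
  balanced⇒splittable : (∀ r → length (lookup U r) ≡ K) → Splittable m θ
  balanced⇒splittable full r = length (filter high? u)
    , (map lower (filter high? u) , Uniqueₚ.map⁺ lower-injective (Uniqueₚ.filter⁺ high? unique)
      , Listₚ.length-map lower (filter high? u) , λ a → mk⇔ high-to (λ (0≤a , s) → high-from 0≤a s))
    , (map lower (filter absent? (staircase K)) , Uniqueₚ.map⁺ lower-injective (Uniqueₚ.filter⁺ absent? (decreasing-unique (staircase-decreasing K)))
      , trans (Listₚ.length-map lower (filter absent? (staircase K))) counts , λ a → mk⇔ absent-to (λ (a<0 , ¬s) → absent-from a<0 ¬s))
    where
    u = lookup U r

    unique : Unique u
    unique = decreasing-unique (U-decreasing r)

    lower : ℤ → ℤ
    lower t = t ℤ.- ℤ.+ K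

    lower-injective : ∀ {s t} → lower s ≡ lower t → s ≡ t
    lower-injective {s} {t} eq = trans (sym (i-j+j s (ℤ.+ K))) (trans (cong (λ y → y ℤ.+ ℤ.+ K) eq) (i-j+j t (ℤ.+ K)))

    low? : ∀ t → Dec (t ℤ.< ℤ.+ K)
    low? t = t ℤ.<? ℤ.+ K
    high? : ∀ t → Dec (¬ t ℤ.< ℤ.+ K)
    high? = ¬? ∘ low?
    present? : ∀ t → Dec (t ∈ u)
    present? t = t ∈? u
    absent? : ∀ t → Dec (t ∉ u)
    absent? = ¬? ∘ present?

    staircase-range : ∀ {t} → t ∈ staircase K → InRange K t
    staircase-range t∈ = All.lookup (shifted-zero-bound K) t∈

    common : length (filter low? u) ≡ length (filter present? (staircase K))
    common = ℕₚ.≤-antisym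
      (unique-length (Uniqueₚ.filter⁺ low? unique) (λ t∈ → let t∈u , t<K = ∈ₚ.∈-filter⁻ low? {xs = u} t∈ in
        ∈ₚ.∈-filter⁺ present? (∈-staircase K (proj₁ (∈U⁻ r t∈u) , t<K)) t∈u))
      (unique-length (Uniqueₚ.filter⁺ present? (decreasing-unique (staircase-decreasing K))) (λ t∈ → let t∈s , t∈u = ∈ₚ.∈-filter⁻ present? {xs = staircase K} t∈ in
        ∈ₚ.∈-filter⁺ low? t∈u (proj₂ (staircase-range t∈s))))

    counts : length (filter absent? (staircase K)) ≡ length (filter high? u)
    counts = ℕₚ.+-cancelˡ-≡ (length (filter present? (staircase K))) _ _ (begin
      length (filter present? (staircase K)) ℕ.+ length (filter absent? (staircase K))   ≡⟨ length-filters present? (staircase K) ⟩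
      length (staircase K)                                                               ≡⟨ trans (length-staircase K) (sym (full r)) ⟩
      length u                                                                           ≡⟨ sym (length-filters low? u) ⟩
      length (filter low? u) ℕ.+ length (filter high? u)                                 ≡⟨ cong (ℕ._+ length (filter high? u)) common ⟩
      length (filter present? (staircase K)) ℕ.+ length (filter high? u) ∎)
      where open ≡-Reasoning

    lower-raise : ∀ a → lower (a ℤ.+ ℤ.+ K) ≡ a
    lower-raise a = i+j-j a (ℤ.+ K)

    high-to : ∀ {a} → a ∈ map lower (filter high? u) → ℤ.+ 0 ℤ.≤ a × splitSet m (𝕊 θ) r a
    high-to a∈ with ∈ₚ.∈-map⁻ lower a∈
    ... | t , t∈ , refl with ∈ₚ.∈-filter⁻ high? {xs = u} t∈
    ...   | t∈u , t≮K = ℤₚ.i≤j⇒0≤j-i (ℤₚ.≮⇒≥ t≮K) , proj₂ (∈U⁻ r t∈u)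

    high-from : ∀ {a} → ℤ.+ 0 ℤ.≤ a → splitSet m (𝕊 θ) r a → a ∈ map lower (filter high? u)
    high-from {a} 0≤a s = subst (_∈ map lower (filter high? u)) (lower-raise a) (∈ₚ.∈-map⁺ lower (∈ₚ.∈-filter⁺ high?
      (∈U⁺ r (ℤₚ.+-mono-≤ 0≤a (ℤ.+≤+ z≤n)) (subst (splitSet m (𝕊 θ) r) (sym (lower-raise a)) s))
      (ℤₚ.≤⇒≯ (subst (ℤ._≤ a ℤ.+ ℤ.+ K) (ℤₚ.+-identityˡ (ℤ.+ K)) (ℤₚ.+-monoˡ-≤ (ℤ.+ K) 0≤a)))))

    absent-to : ∀ {a} → a ∈ map lower (filter absent? (staircase K)) → a ℤ.< ℤ.+ 0 × ¬ splitSet m (𝕊 θ) r a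
    absent-to a∈ with ∈ₚ.∈-map⁻ lower a∈
    ... | t , t∈ , refl with ∈ₚ.∈-filter⁻ absent? {xs = staircase K} t∈
    ...   | t∈s , t∉u = subst (lower t ℤ.<_) (ℤₚ.+-inverseʳ (ℤ.+ K)) (ℤₚ.+-monoˡ-< (ℤ.- ℤ.+ K) (proj₂ (staircase-range t∈s)))
      , λ s → t∉u (∈U⁺ r (proj₁ (staircase-range t∈s)) s)

    absent-from : ∀ {a} → a ℤ.< ℤ.+ 0 → ¬ splitSet m (𝕊 θ) r a → a ∈ map lower (filter absent? (staircase K))
    absent-from {a} a<0 ¬s = subst (_∈ map lower (filter absent? (staircase K))) (lower-raise a) (∈ₚ.∈-map⁺ lower (∈ₚ.∈-filter⁺ absent?
      (∈-staircase K (0≤t , subst (a ℤ.+ ℤ.+ K ℤ.<_) (ℤₚ.+-identityˡ (ℤ.+ K)) (ℤₚ.+-monoˡ-< (ℤ.+ K) a<0)))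
      (λ t∈u → ¬s (subst (splitSet m (𝕊 θ) r) (lower-raise a) (proj₂ (∈U⁻ r t∈u))))))
      where
      -- All integers below `-K` belong to the split set, so a missing one shows up in the window of
      -- the staircase after raising by `K`.
      0≤t : ℤ.+ 0 ℤ.≤ a ℤ.+ ℤ.+ K
      0≤t = ℤₚ.≮⇒≥ (λ t<0 → ¬s (split-below r (unshift (ℤₚ.+-monoˡ-< (ℤ.- ℤ.+ K) t<0))))
        where
        unshift : a ℤ.+ ℤ.+ K ℤ.- ℤ.+ K ℤ.< ℤ.+ 0 ℤ.- ℤ.+ K → a ℤ.< ℤ.- ℤ.+ K
        unshift p = subst (a ℤ.<_) (ℤₚ.+-identityˡ (ℤ.- ℤ.+ K)) (subst (ℤ._< ℤ.+ 0 ℤ.- ℤ.+ K) (i+j-j a (ℤ.+ K)) p)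

-- Distributing the parts of a partition

fromℚᵘ-* : ∀ p q → ℚ.fromℚᵘ (p ℚᵘ.* q) ≡ ℚ.fromℚᵘ p * ℚ.fromℚᵘ q
fromℚᵘ-* p q = ℚₚ.toℚᵘ-injective (ℚᵘₚ.≃-trans (ℚₚ.toℚᵘ-fromℚᵘ (p ℚᵘ.* q)) (ℚᵘₚ.≃-sym (ℚᵘₚ.≃-trans
  (ℚₚ.toℚᵘ-homo-* (ℚ.fromℚᵘ p) (ℚ.fromℚᵘ q)) (ℚᵘₚ.*-cong (ℚₚ.toℚᵘ-fromℚᵘ p) (ℚₚ.toℚᵘ-fromℚᵘ q)))))

fromℚᵘ-+ : ∀ p q → ℚ.fromℚᵘ (p ℚᵘ.+ q) ≡ ℚ.fromℚᵘ p + ℚ.fromℚᵘ q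
fromℚᵘ-+ p q = ℚₚ.toℚᵘ-injective (ℚᵘₚ.≃-trans (ℚₚ.toℚᵘ-fromℚᵘ (p ℚᵘ.+ q)) (ℚᵘₚ.≃-sym (ℚᵘₚ.≃-trans
  (ℚₚ.toℚᵘ-homo-+ (ℚ.fromℚᵘ p) (ℚ.fromℚᵘ q)) (ℚᵘₚ.+-cong (ℚₚ.toℚᵘ-fromℚᵘ p) (ℚₚ.toℚᵘ-fromℚᵘ q)))))

ι : ℕ → ℚ
ι n = ℤ.+ n / 1

ι-* : ∀ a b → ι (a ℕ.* b) ≡ ι a * ι b
ι-* a b = trans (cong (λ k → ℚ.fromℚᵘ (ℚᵘ.mkℚᵘ k 0)) (ℤₚ.pos-* a b)) (fromℚᵘ-* (ℚᵘ.mkℚᵘ (ℤ.+ a) 0) (ℚᵘ.mkℚᵘ (ℤ.+ b) 0))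

ι-+ : ∀ a b → ι (a ℕ.+ b) ≡ ι a + ι b
ι-+ a b = trans (cong (λ k → ℚ.fromℚᵘ (ℚᵘ.mkℚᵘ k 0)) (trans (ℤₚ.pos-+ a b)
  (sym (cong₂ ℤ._+_ (ℤₚ.*-identityʳ (ℤ.+ a)) (ℤₚ.*-identityʳ (ℤ.+ b)))))) (fromℚᵘ-+ (ℚᵘ.mkℚᵘ (ℤ.+ a) 0) (ℚᵘ.mkℚᵘ (ℤ.+ b) 0))

ι-inverse : ∀ n .{{_ : NonZero n}} → ι n * (ℤ.+ 1 / n) ≡ 1ℚ
ι-inverse (suc n) = trans (sym (fromℚᵘ-* (ℚᵘ.mkℚᵘ (ℤ.+ suc n) 0) (ℚᵘ.mkℚᵘ (ℤ.+ 1) n)))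
  (ℚₚ.fromℚᵘ-cong {ℚᵘ.mkℚᵘ (ℤ.+ suc n) 0 ℚᵘ.* ℚᵘ.mkℚᵘ (ℤ.+ 1) n} {ℚᵘ.1ℚᵘ} (ℚᵘ.*≡* (begin
    ℤ.+ suc n ℤ.* ℤ.+ 1 ℤ.* ℤ.+ 1   ≡⟨ trans (ℤₚ.*-identityʳ (ℤ.+ suc n ℤ.* ℤ.+ 1)) (ℤₚ.*-identityʳ (ℤ.+ suc n)) ⟩
    ℤ.+ suc n                       ≡⟨ cong (λ k → ℤ.+ suc k) (sym (ℕₚ.+-identityʳ n)) ⟩
    ℤ.+ suc (n ℕ.+ 0)               ≡⟨ sym (ℤₚ.*-identityˡ (ℤ.+ suc (n ℕ.+ 0))) ⟩
    ℤ.+ 1 ℤ.* ℤ.+ suc (n ℕ.+ 0) ∎)))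
  where open ≡-Reasoning

-- The junk value at 0 is never used: parts are positive.
inv : ℕ → ℚ
inv zero    = 0ℚ
inv (suc n) = ℤ.+ 1 / suc n

ι-inv : ∀ n .{{_ : NonZero n}} → ι n * inv n ≡ 1ℚ
ι-inv (suc n) = ι-inverse (suc n)

count : ℕ → List ℕ → ℕ
count a l = length (filter (a ℕ.≟_) l)

count-here : ∀ a l → count a (a ∷ l) ≡ suc (count a l)
count-here a l = cong length (Listₚ.filter-accept (a ℕ.≟_) {a} {l} refl)

count-there : ∀ {a b} l → a ≢ b → count a (b ∷ l) ≡ count a l
count-there {a} {b} l a≢b = cong length (Listₚ.filter-reject (a ℕ.≟_) {b} {l} a≢b)

count-++ : ∀ a xs ys → count a (xs ++ ys) ≡ count a xs ℕ.+ count a ys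
count-++ a xs ys = trans (cong length (Listₚ.filter-++ (a ℕ.≟_) xs ys)) (Listₚ.length-++ (filter (a ℕ.≟_) xs))

count-↭ : ∀ a {xs ys} → xs ↭ ys → count a xs ≡ count a ys
count-↭ a p = ↭ₚ.↭-length (↭ₚ.filter-↭ (a ℕ.≟_) p)

-- The recursion satisfied by z: adjoining a part `a` multiplies it by `a` and by the new
-- multiplicity of `a`.
zList : List ℕ → ℕ
zList []      = 1
zList (a ∷ l) = a ℕ.* suc (count a l) ℕ.* zList l

zList⁻¹ : List ℕ → ℚ
zList⁻¹ []      = 1ℚ
zList⁻¹ (a ∷ l) = inv (a ℕ.* suc (count a l)) * zList⁻¹ l

zList-inverse : ∀ {l} → All NonZero l → ι (zList l) * zList⁻¹ l ≡ 1ℚ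
zList-inverse []                   = refl
zList-inverse {a ∷ l} (a≢0 ∷ pos) = begin
  ι (a ℕ.* suc (count a l) ℕ.* zList l) * (inv (a ℕ.* suc (count a l)) * zList⁻¹ l)
    ≡⟨ cong (_* (inv (a ℕ.* suc (count a l)) * zList⁻¹ l)) (ι-* (a ℕ.* suc (count a l)) (zList l)) ⟩
  ι x * ι (zList l) * (inv x * zList⁻¹ l)
    ≡⟨ solve 4 (λ p q r s → p :* q :* (r :* s) := (p :* r) :* (q :* s)) refl (ι x) (ι (zList l)) (inv x) (zList⁻¹ l) ⟩
  (ι x * inv x) * (ι (zList l) * zList⁻¹ l)
    ≡⟨ cong₂ _*_ (ι-inv x {{ℕₚ.m*n≢0 a (suc (count a l)) {{a≢0}}}}) (zList-inverse pos) ⟩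
  1ℚ ∎
  where
  open ≡-Reasoning
  open +-*-Solver
  x : ℕ
  x = a ℕ.* suc (count a l)

product-change : ∀ (f g : ℕ → ℕ) x j xs → Unique xs → j ∈ xs → f j ≡ x ℕ.* g j → (∀ i → i ≢ j → f i ≡ g i) →
  product (map f xs) ≡ x ℕ.* product (map g xs)
product-change f g x j (i ∷ xs) (i∉ ∷ uniq) (here refl) at off = trans
  (cong₂ ℕ._*_ at (cong product (Listₚ.map-cong-local (All.map (λ {k} i≢k → off k (i≢k ∘ sym)) i∉)))) (ℕₚ.*-assoc x (g i) _)
product-change f g x j (i ∷ xs) (i∉ ∷ uniq) (there j∈) at off = begin
  f i ℕ.* product (map f xs)           ≡⟨ cong₂ ℕ._*_ (off i (All.lookup i∉ j∈)) (product-change f g x j xs uniq j∈ at off) ⟩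
  g i ℕ.* (x ℕ.* product (map g xs))   ≡⟨ sym (ℕₚ.*-assoc (g i) x _) ⟩
  g i ℕ.* x ℕ.* product (map g xs)     ≡⟨ cong (ℕ._* product (map g xs)) (ℕₚ.*-comm (g i) x) ⟩
  x ℕ.* g i ℕ.* product (map g xs)     ≡⟨ ℕₚ.*-assoc x (g i) _ ⟩
  x ℕ.* (g i ℕ.* product (map g xs)) ∎
  where open ≡-Reasoning

zFactor : List ℕ → ℕ → ℕ
zFactor l i = suc i ^ count (suc i) l ℕ.* count (suc i) l !

-- The range of the product stays fixed while parts are removed. A removed part changes the factor
-- at its own index only, and absent parts contribute 1.
product-zFactor : ∀ M l → All NonZero l → All (_≤ M) l → product (map (zFactor l) (upTo M)) ≡ zList l
product-zFactor M [] _ _ = ones (upTo M)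
  where
  ones : ∀ is → product (map (zFactor []) is) ≡ 1
  ones []       = refl
  ones (i ∷ is) = trans (ℕₚ.+-identityʳ _) (ones is)
product-zFactor M (suc j ∷ l) (_ ∷ pos) (j<M ∷ bounds) = trans
  (product-change (zFactor (suc j ∷ l)) (zFactor l) (suc j ℕ.* suc c) j (upTo M) (Uniqueₚ.upTo⁺ M) (∈ₚ.∈-upTo⁺ j<M)
    (trans (cong (λ k → suc j ^ k ℕ.* k !) (count-here (suc j) l)) (regroup (suc j) (suc j ^ c) (suc c) (c !)))
    (λ i i≢j → cong (λ k → suc i ^ k ℕ.* k !) (count-there {suc i} {suc j} l (i≢j ∘ ℕₚ.suc-injective))))
  (cong (suc j ℕ.* suc c ℕ.*_) (product-zFactor M l pos bounds))
  where
  c : ℕ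
  c = count (suc j) l
  regroup : ∀ p q r s → p ℕ.* q ℕ.* (r ℕ.* s) ≡ p ℕ.* r ℕ.* (q ℕ.* s)
  regroup p q r s = ℕₚ.[m*n]*[o*p]≡[m*o]*[n*p] p q r s

≤-sum : ∀ l → All (_≤ sum l) l
≤-sum []      = []
≤-sum (a ∷ l) = ℕₚ.m≤m+n a (sum l) ∷ All.map (λ p → ℕₚ.≤-trans p (ℕₚ.m≤n+m (sum l) a)) (≤-sum l)

length≤sum : ∀ {l} → All NonZero l → length l ≤ sum l
length≤sum []           = z≤n
length≤sum {a ∷ l} (p ∷ ps) = ℕₚ.+-mono-≤ (ℕ.>-nonZero⁻¹ a {{p}}) (length≤sum ps)

z-zList : ∀ μ → z μ ≡ zList (parts μ)
z-zList μ = product-zFactor ∣ μ ∣ (parts μ) (positive μ) (≤-sum (parts μ))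

z⁻¹-zList : ∀ μ → z⁻¹ μ ≡ zList⁻¹ (parts μ)
z⁻¹-zList μ = *-cancelˡ-≢0 {ι (z μ)} (λ eq → contradiction (trans (sym (trans (cong (_* z⁻¹ μ) eq) (ℚₚ.*-zeroˡ (z⁻¹ μ)))) inverse) (λ ()))
  (trans inverse (sym (trans (cong (λ k → ι k * zList⁻¹ (parts μ)) (z-zList μ)) (zList-inverse (positive μ)))))
  where
  inverse : ι (z μ) * z⁻¹ μ ≡ 1ℚ
  inverse = ι-inverse (z μ) {{z≢0 μ}}

∑ₗ-cong : ∀ {A : Set} (xs : List A) {F G : A → ℚ} → (∀ {x} → x ∈ xs → F x ≡ G x) → ∑ₗ xs F ≡ ∑ₗ xs G
∑ₗ-cong []       eq = refl
∑ₗ-cong (x ∷ xs) eq = cong₂ _+_ (eq (here refl)) (∑ₗ-cong xs (eq ∘ there))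

∑ₗ-*ˡ : ∀ {A : Set} (xs : List A) r (F : A → ℚ) → ∑ₗ xs (λ x → r * F x) ≡ r * ∑ₗ xs F
∑ₗ-*ˡ []       r F = sym (ℚₚ.*-zeroʳ r)
∑ₗ-*ˡ (x ∷ xs) r F = trans (cong (r * F x +_) (∑ₗ-*ˡ xs r F)) (sym (ℚₚ.*-distribˡ-+ r (F x) (∑ₗ xs F)))

∑ₗ-∑ : ∀ {A : Set} (xs : List A) {k} (F : A → Fin k → ℚ) → ∑ₗ xs (λ x → ∑[ r < k ] F x r) ≡ ∑[ r < k ] ∑ₗ xs (λ x → F x r)
∑ₗ-∑ []       {k} F = sym (sum-replicate-zero k)
∑ₗ-∑ (x ∷ xs) {k} F = trans (cong ((∑[ r < k ] F x r) +_) (∑ₗ-∑ xs F)) (sym (∑-distrib-+ (F x) (λ r → ∑ₗ xs (λ y → F y r))))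

∑ₗ-↭ : ∀ {A : Set} {xs ys : List A} (F : A → ℚ) → xs ↭ ys → ∑ₗ xs F ≡ ∑ₗ ys F
∑ₗ-↭ F ↭.refl         = refl
∑ₗ-↭ F (↭.prep x p)   = cong (F x +_) (∑ₗ-↭ F p)
∑ₗ-↭ {ys = _ ∷ _ ∷ ys} F (↭.swap x y p) = trans (cong (λ s → F x + (F y + s)) (∑ₗ-↭ F p))
  (solve 3 (λ a b s → a :+ (b :+ s) := b :+ (a :+ s)) refl (F x) (F y) (∑ₗ ys F))
  where open +-*-Solver
∑ₗ-↭ F (↭.trans p q)  = trans (∑ₗ-↭ F p) (∑ₗ-↭ F q)

∑ₗ-map : ∀ {A B : Set} (f : A → B) xs (F : B → ℚ) → ∑ₗ (map f xs) F ≡ ∑ₗ xs (F ∘ f)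
∑ₗ-map f []       F = refl
∑ₗ-map f (x ∷ xs) F = cong (F (f x) +_) (∑ₗ-map f xs F)

∑ₗ-zero : ∀ {A : Set} (xs : List A) {F : A → ℚ} → (∀ {x} → x ∈ xs → F x ≡ 0ℚ) → ∑ₗ xs F ≡ 0ℚ
∑ₗ-zero []       eq = refl
∑ₗ-zero (x ∷ xs) eq = cong₂ _+_ (eq (here refl)) (∑ₗ-zero xs (eq ∘ there))

Unique-resp-↭ : ∀ {A : Set} {us ws : List A} → us ↭ ws → Unique us → Unique ws
Unique-resp-↭ ↭.refl         u = u
Unique-resp-↭ (↭.prep a q)   (a∉ ∷ u) = ↭ₚ.All-resp-↭ q a∉ ∷ Unique-resp-↭ q u
Unique-resp-↭ (↭.swap a b q) ((a≢b ∷ a∉) ∷ b∉ ∷ u) = ((a≢b ∘ sym) ∷ ↭ₚ.All-resp-↭ q b∉) ∷ ↭ₚ.All-resp-↭ q a∉ ∷ Unique-resp-↭ q u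
Unique-resp-↭ (↭.trans q r)  u = Unique-resp-↭ r (Unique-resp-↭ q u)

-- Allowing elements outside the image when `F` vanishes there is what discards the tuples in which
-- a chosen component lacks the part being removed.
∑ₗ-image : ∀ {A B : Set} (f : A → B) {xs ys} (F : B → ℚ) → Unique xs → Unique ys →
  (∀ {x} → x ∈ xs → f x ∈ ys) → (∀ {x x′} → f x ≡ f x′ → x ≡ x′) →
  (∀ {y} → y ∈ ys → F y ≡ 0ℚ ⊎ (∃[ x ] x ∈ xs × f x ≡ y)) → ∑ₗ ys F ≡ ∑ₗ xs (F ∘ f)
∑ₗ-image f {[]} {ys} F _ _ into inj onto = ∑ₗ-zero ys (λ y∈ → noPreimage (onto y∈))
  where
  noPreimage : ∀ {y} → F y ≡ 0ℚ ⊎ (∃[ x ] x ∈ [] × f x ≡ y) → F y ≡ 0ℚ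
  noPreimage (inj₁ eq) = eq
∑ₗ-image f {x ∷ xs} {ys} F (x∉ ∷ uxs) uys into inj onto with ∈ₚ.∈-∃++ (into (here refl))
... | ys₁ , ys₂ , refl = trans (∑ₗ-↭ F shift) (cong (F (f x) +_) (∑ₗ-image f F uxs urest into′ inj onto′))
  where
  shift : ys₁ ++ f x ∷ ys₂ ↭ f x ∷ ys₁ ++ ys₂
  shift = ↭ₚ.shift (f x) ys₁ ys₂
  uniq : Unique (f x ∷ ys₁ ++ ys₂)
  uniq = Unique-resp-↭ shift uys
  urest : Unique (ys₁ ++ ys₂)
  urest = AllPairs.tail uniq
  strip : ∀ {y} → y ∈ f x ∷ ys₁ ++ ys₂ → y ≢ f x → y ∈ ys₁ ++ ys₂
  strip (here eq)  neq = contradiction eq neq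
  strip (there y∈) _   = y∈
  into′ : ∀ {x′} → x′ ∈ xs → f x′ ∈ ys₁ ++ ys₂
  into′ x′∈ = strip (↭ₚ.∈-resp-↭ shift (into (there x′∈))) (λ eq → All.lookup x∉ x′∈ (sym (inj eq)))
  onto′ : ∀ {y} → y ∈ ys₁ ++ ys₂ → F y ≡ 0ℚ ⊎ (∃[ x′ ] x′ ∈ xs × f x′ ≡ y)
  onto′ y∈ with onto (↭ₚ.∈-resp-↭ (↭-sym shift) (there y∈))
  ... | inj₁ eq = inj₁ eq
  ... | inj₂ (x′ , there x′∈ , eq) = inj₂ (x′ , x′∈ , eq)
  ... | inj₂ (x′ , here refl , eq) = contradiction eq (All.lookup (AllPairs.head uniq) y∈)

concatᵛ : ∀ {A : Set} {k} → Vec (List A) k → List A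
concatᵛ []      = []
concatᵛ (p ∷ t) = p ++ concatᵛ t

concatᵛ-insert : ∀ {A : Set} {k} (t : Vec (List A) k) r a → concatᵛ (updateAt t r (a ∷_)) ↭ a ∷ concatᵛ t
concatᵛ-insert (p ∷ t) zero    a = ↭-refl
concatᵛ-insert (p ∷ t) (suc r) a = ↭-trans (↭ₚ.++⁺ˡ p (concatᵛ-insert t r a)) (↭ₚ.shift a p (concatᵛ t))

∈-concatᵛ : ∀ {A : Set} {k} (t : Vec (List A) k) r {a} → a ∈ lookup t r → a ∈ concatᵛ t
∈-concatᵛ (p ∷ t) zero    a∈ = ∈ₚ.∈-++⁺ˡ a∈
∈-concatᵛ (p ∷ t) (suc r) a∈ = ∈ₚ.∈-++⁺ʳ p (∈-concatᵛ t r a∈)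

concatᵛ-empty : ∀ {A : Set} {k} (t : Vec (List A) k) → concatᵛ t ↭ [] → t ≡ replicate k []
concatᵛ-empty []           _ = refl
concatᵛ-empty ([] ∷ t)     p = cong ([] ∷_) (concatᵛ-empty t p)
concatᵛ-empty ((a ∷ q) ∷ t) p = contradiction (↭ₚ.↭-empty-inv p) (λ ())

concatᵛ-replicate : ∀ {A : Set} k → concatᵛ {A} (replicate k []) ≡ []
concatᵛ-replicate zero    = refl
concatᵛ-replicate (suc k) = concatᵛ-replicate k

IsPartition : List ℕ → Set
IsPartition p = Linked _≥_ p × All NonZero p

record Splits {k} (l : List ℕ) (t : Vec (List ℕ) k) : Set where
  constructor splits
  field
    components : ∀ r → IsPartition (lookup t r)
    union      : concatᵛ t ↭ l

zProduct⁻¹ : ∀ {k} → Vec (List ℕ) k → ℚ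
zProduct⁻¹ []      = 1ℚ
zProduct⁻¹ (p ∷ t) = zList⁻¹ p * zProduct⁻¹ t

zProduct⁻¹-insert : ∀ {k} (t : Vec (List ℕ) k) r a → zProduct⁻¹ (updateAt t r (a ∷_)) ≡ inv (a ℕ.* suc (count a (lookup t r))) * zProduct⁻¹ t
zProduct⁻¹-insert (p ∷ t) zero    a = ℚₚ.*-assoc (inv (a ℕ.* suc (count a p))) (zList⁻¹ p) (zProduct⁻¹ t)
zProduct⁻¹-insert (p ∷ t) (suc r) a = trans (cong (zList⁻¹ p *_) (zProduct⁻¹-insert t r a))
  (solve 3 (λ x y w → x :* (y :* w) := y :* (x :* w)) refl (zList⁻¹ p) (inv (a ℕ.* suc (count a (lookup t r)))) (zProduct⁻¹ t))
  where open +-*-Solver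

zProduct⁻¹-empty : ∀ k → zProduct⁻¹ (replicate k []) ≡ 1ℚ
zProduct⁻¹-empty zero    = refl
zProduct⁻¹-empty (suc k) = trans (ℚₚ.*-identityˡ _) (zProduct⁻¹-empty k)

ι-count-concatᵛ : ∀ {k} (t : Vec (List ℕ) k) a → ι (count a (concatᵛ t)) ≡ ∑[ r < k ] ι (count a (lookup t r))
ι-count-concatᵛ []      a = refl
ι-count-concatᵛ (p ∷ t) a = trans (cong ι (count-++ a p (concatᵛ t))) (trans (ι-+ (count a p) (count a (concatᵛ t))) (cong (ι (count a p) +_) (ι-count-concatᵛ t a)))

∷-IsPartition : ∀ {a p} → NonZero a → All (_≤ a) p → IsPartition p → IsPartition (a ∷ p)
∷-IsPartition {a} {[]}    a≢0 _         (d , pos) = [-] , a≢0 ∷ pos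
∷-IsPartition {a} {b ∷ p} a≢0 (b≤a ∷ _) (d , pos) = b≤a ∷ d , a≢0 ∷ pos

IsPartition-tail : ∀ {a p} → IsPartition (a ∷ p) → IsPartition p
IsPartition-tail (d , _ ∷ pos) = Linked.tail d , pos

IsPartition-bound : ∀ {a p} → IsPartition (a ∷ p) → All (_≤ a) p
IsPartition-bound (d , _) = AllPairs.head (Linkedₚ.Linked⇒AllPairs (λ p q → ℕₚ.≤-trans q p) d)

count≡0 : ∀ a p → All (a ≢_) p → count a p ≡ 0
count≡0 a []      []       = refl
count≡0 a (b ∷ p) (n ∷ ns) = trans (count-there p n) (count≡0 a p ns)

updateAt-∷-injective : ∀ {k} r {a : ℕ} {t t′ : Vec (List ℕ) k} → updateAt t r (a ∷_) ≡ updateAt t′ r (a ∷_) → t ≡ t′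
updateAt-∷-injective zero    {t = p ∷ t} {p′ ∷ t′} eq = cong₂ _∷_ (Listₚ.∷-injectiveʳ (Vecₚ.∷-injectiveˡ eq)) (Vecₚ.∷-injectiveʳ eq)
updateAt-∷-injective (suc r) {t = p ∷ t} {p′ ∷ t′} eq = cong₂ _∷_ (Vecₚ.∷-injectiveˡ eq) (updateAt-∷-injective r (Vecₚ.∷-injectiveʳ eq))

Splits-insert : ∀ {k a l} → IsPartition (a ∷ l) → (t : Vec (List ℕ) k) → Splits l t → ∀ r → Splits (a ∷ l) (updateAt t r (a ∷_))
Splits-insert {k} {a} {l} al t (splits comp union) r = splits comp′ (↭-trans (concatᵛ-insert t r a) (↭.prep a union))
  where
  comp′ : ∀ s → IsPartition (lookup (updateAt t r (a ∷_)) s)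
  comp′ s with s ≟ᶠ r
  ... | yes refl = subst IsPartition (sym (Vecₚ.lookup∘updateAt s t)) (∷-IsPartition (All.head (proj₂ al))
    (All.tabulate (λ b∈ → All.lookup (IsPartition-bound al) (↭ₚ.∈-resp-↭ union (∈-concatᵛ t s b∈)))) (comp s))
  ... | no  s≢r  = subst IsPartition (sym (Vecₚ.lookup∘updateAt′ s r s≢r t)) (comp s)

-- No entry of the tuple exceeds `a`, so `a` occurs in a component only if it is its head, and
-- removing the head leaves a splitting of `l`.
Splits-remove : ∀ {k a l} → IsPartition (a ∷ l) → (t : Vec (List ℕ) k) → Splits (a ∷ l) t → ∀ r →
  count a (lookup t r) ≡ 0 ⊎ (∃[ t′ ] Splits l t′ × updateAt t′ r (a ∷_) ≡ t)
Splits-remove {k} {a} {l} al t (splits comp union) r with lookup t r in eq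
... | []    = inj₁ refl
... | b ∷ p with b ℕ.≟ a
...   | yes refl = inj₂ (t′ , splits comp′ (↭ₚ.drop-∷ (↭-trans (↭-sym (concatᵛ-insert t′ r a)) (subst (λ s → concatᵛ s ↭ a ∷ l) (sym restore) union))) , restore)
  where
  t′ : Vec (List ℕ) k
  t′ = updateAt t r (λ _ → p)
  restore : updateAt t′ r (a ∷_) ≡ t
  restore = trans merged (Vecₚ.updateAt-id-local r t (sym eq))
    where
    merged : updateAt (updateAt t r (λ _ → p)) r (a ∷_) ≡ updateAt t r (λ _ → a ∷ p)
    merged = Vecₚ.updateAt-updateAt-local r t refl
  comp′ : ∀ s → IsPartition (lookup t′ s)
  comp′ s with s ≟ᶠ r
  ... | yes refl = subst IsPartition (sym (Vecₚ.lookup∘updateAt s t)) (IsPartition-tail (subst IsPartition eq (comp s)))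
  ... | no  s≢r  = subst IsPartition (sym (Vecₚ.lookup∘updateAt′ s r s≢r t)) (comp s)
...   | no b≢a = inj₁ (count≡0 a (b ∷ p) ((b≢a ∘ sym) ∷ All.map (λ c≤b a≡c → b≢a (ℕₚ.≤-antisym b≤a (subst (_≤ b) (sym a≡c) c≤b))) (IsPartition-bound (subst IsPartition eq (comp r)))))
  where
  b≤a : b ≤ a
  b≤a with ↭ₚ.∈-resp-↭ union (∈-concatᵛ t r (subst (b ∈_) (sym eq) (here refl)))
  ... | here refl = ℕₚ.≤-refl
  ... | there b∈  = All.lookup (IsPartition-bound al) b∈

record Enumerates {k} (l : List ℕ) (T : List (Vec (List ℕ) k)) : Set where
  field
    unique   : Unique T
    sound    : ∀ {t} → t ∈ T → Splits l t
    complete : ∀ {t} → Splits l t → t ∈ T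

-- A tuple arises from a choice of r for the largest part a in count a (t r) of
-- count a l ways, and these two counts are the ratios of the z's.
assign-sum : ∀ {k} (tuples : List ℕ → List (Vec (List ℕ) k)) → (∀ {l} → IsPartition l → Enumerates l (tuples l)) →
  ∀ l → IsPartition l → (Ψ : Vec (List ℕ) k → ℚ) → assign l Ψ ≡ ι (zList l) * ∑ₗ (tuples l) (λ t → zProduct⁻¹ t * Ψ t)
assign-sum {k} tuples enum [] part Ψ = sym (trans (ℚₚ.*-identityˡ _) (trans
  -- The tuple of empty lists is the only splitting of the empty list, so the sum is compared with
  -- one over a single point.
  (∑ₗ-image {A = ⊤} (λ _ → replicate k []) {tt ∷ []} (λ t → zProduct⁻¹ t * Ψ t) ([] ∷ []) unique
    (λ _ → complete (splits (λ r → subst IsPartition (sym (Vecₚ.lookup-replicate r [])) ([] , [])) (↭.↭-reflexive (concatᵛ-replicate k))))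
    (λ _ → refl) (λ t∈ → inj₂ (tt , here refl , sym (concatᵛ-empty _ (Splits.union (sound t∈))))))
  (trans (ℚₚ.+-identityʳ _) (trans (cong (_* Ψ (replicate k [])) (zProduct⁻¹-empty k)) (ℚₚ.*-identityˡ (Ψ (replicate k [])))))))
  where open Enumerates (enum part)
assign-sum {k} tuples enum (a ∷ l) part Ψ = sym (begin
  ι (a ℕ.* suc (count a l) ℕ.* zList l) * ∑ₗ T F
    ≡⟨ cong (_* ∑ₗ T F) (trans (ι-* (a ℕ.* suc (count a l)) (zList l)) (cong (_* ι (zList l)) (ι-* a (suc (count a l))))) ⟩
  ι a * ι (suc (count a l)) * ι (zList l) * ∑ₗ T F
    ≡⟨ solve 4 (λ p q r s → p :* q :* r :* s := r :* (q :* p :* s)) refl (ι a) (ι (suc (count a l))) (ι (zList l)) (∑ₗ T F) ⟩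
  ι (zList l) * (ι (suc (count a l)) * ι a * ∑ₗ T F)
    ≡⟨ cong (ι (zList l) *_) (sym (∑ₗ-*ˡ T (ι (suc (count a l)) * ι a) F)) ⟩
  ι (zList l) * ∑ₗ T (λ t → ι (suc (count a l)) * ι a * F t)
    ≡⟨ cong (ι (zList l) *_) (∑ₗ-cong T (λ {t} t∈ → distribute t (sound t∈))) ⟩
  ι (zList l) * ∑ₗ T (λ t → ∑[ r < k ] (ι (count a (lookup t r)) * ι a * F t))
    ≡⟨ cong (ι (zList l) *_) (∑ₗ-∑ T (λ t r → ι (count a (lookup t r)) * ι a * F t)) ⟩
  ι (zList l) * (∑[ r < k ] ∑ₗ T (λ t → ι (count a (lookup t r)) * ι a * F t))
    -- Tuples without `a` in component `r` are annihilated by the factor `count a`. Every other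
    -- tuple comes from exactly one splitting of `l` by putting `a` in front of component `r`.
    ≡⟨ cong (ι (zList l) *_) (sum-cong-≗ {k} (λ r → trans
         (∑ₗ-image (λ t → updateAt t r (a ∷_)) (λ t → ι (count a (lookup t r)) * ι a * F t) (Enumerates.unique enum′) unique
           (λ t∈ → complete (Splits-insert part _ (Enumerates.sound enum′ t∈) r)) (updateAt-∷-injective r) (λ {t} t∈ → preimage r t (sound t∈)))
         (∑ₗ-cong T′ (λ {t} _ → cancel r t)))) ⟩
  ι (zList l) * (∑[ r < k ] ∑ₗ T′ (λ t → zProduct⁻¹ t * Ψ (updateAt t r (a ∷_))))
    ≡⟨ *-distribˡ-sum {k} (ι (zList l)) (λ r → ∑ₗ T′ (λ t → zProduct⁻¹ t * Ψ (updateAt t r (a ∷_)))) ⟩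
  (∑[ r < k ] (ι (zList l) * ∑ₗ T′ (λ t → zProduct⁻¹ t * Ψ (updateAt t r (a ∷_)))))
    ≡⟨ sum-cong-≗ {k} (λ r → sym (assign-sum tuples enum l (IsPartition-tail part) (λ t → Ψ (updateAt t r (a ∷_))))) ⟩
  assign (a ∷ l) Ψ ∎)
  where
  open ≡-Reasoning
  open +-*-Solver
  open Enumerates (enum part)
  enum′ : Enumerates l (tuples l)
  enum′ = enum (IsPartition-tail part)
  T T′ : List (Vec (List ℕ) k)
  T = tuples (a ∷ l)
  T′ = tuples l
  F : Vec (List ℕ) k → ℚ
  F t = zProduct⁻¹ t * Ψ t

  distribute : ∀ t → Splits (a ∷ l) t → ι (suc (count a l)) * ι a * F t ≡ ∑[ r < k ] (ι (count a (lookup t r)) * ι a * F t)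
  distribute t (splits _ union) = begin
    ι (suc (count a l)) * ι a * F t                           ≡⟨ cong (λ c → ι c * ι a * F t) (sym (trans (count-↭ a union) (count-here a l))) ⟩
    ι (count a (concatᵛ t)) * ι a * F t                       ≡⟨ cong (λ s → s * ι a * F t) (ι-count-concatᵛ t a) ⟩
    (∑[ r < k ] ι (count a (lookup t r))) * ι a * F t         ≡⟨ trans (ℚₚ.*-assoc (∑[ r < k ] ι (count a (lookup t r))) (ι a) (F t)) (*-distribʳ-sum {k} (ι a * F t) (λ r → ι (count a (lookup t r)))) ⟩
    (∑[ r < k ] (ι (count a (lookup t r)) * (ι a * F t)))     ≡⟨ sum-cong-≗ {k} (λ r → sym (ℚₚ.*-assoc (ι (count a (lookup t r))) (ι a) (F t))) ⟩
    (∑[ r < k ] (ι (count a (lookup t r)) * ι a * F t)) ∎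

  preimage : ∀ r t → Splits (a ∷ l) t → ι (count a (lookup t r)) * ι a * F t ≡ 0ℚ ⊎ (∃[ t′ ] t′ ∈ T′ × updateAt t′ r (a ∷_) ≡ t)
  preimage r t sp with Splits-remove part t sp r
  ... | inj₁ none = inj₁ (trans (cong (λ c → ι c * ι a * F t) none) (trans (cong (_* F t) (ℚₚ.*-zeroˡ (ι a))) (ℚₚ.*-zeroˡ (F t))))
  ... | inj₂ (t′ , sp′ , eq) = inj₂ (t′ , Enumerates.complete enum′ sp′ , eq)

  cancel : ∀ r t → ι (count a (lookup (updateAt t r (a ∷_)) r)) * ι a * F (updateAt t r (a ∷_)) ≡ zProduct⁻¹ t * Ψ (updateAt t r (a ∷_))
  cancel r t = begin
    ι (count a (lookup t⁺ r)) * ι a * (zProduct⁻¹ t⁺ * Ψ t⁺)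
      ≡⟨ cong₂ (λ c w → ι c * ι a * (w * Ψ t⁺)) (trans (cong (count a) (Vecₚ.lookup∘updateAt r t)) (count-here a (lookup t r))) (zProduct⁻¹-insert t r a) ⟩
    ι (suc c) * ι a * (inv (a ℕ.* suc c) * zProduct⁻¹ t * Ψ t⁺)
      ≡⟨ solve 5 (λ p q i w y → p :* q :* (i :* w :* y) := (q :* p :* i) :* (w :* y)) refl (ι (suc c)) (ι a) (inv (a ℕ.* suc c)) (zProduct⁻¹ t) (Ψ t⁺) ⟩
    ι a * ι (suc c) * inv (a ℕ.* suc c) * (zProduct⁻¹ t * Ψ t⁺)
      ≡⟨ cong (_* (zProduct⁻¹ t * Ψ t⁺)) (trans (cong (_* inv (a ℕ.* suc c)) (sym (ι-* a (suc c)))) (ι-inv (a ℕ.* suc c) {{ℕₚ.m*n≢0 a (suc c) {{All.head (proj₂ part)}}}})) ⟩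
    1ℚ * (zProduct⁻¹ t * Ψ t⁺)
      ≡⟨ ℚₚ.*-identityˡ (zProduct⁻¹ t * Ψ t⁺) ⟩
    zProduct⁻¹ t * Ψ t⁺ ∎
    where
    t⁺ = updateAt t r (a ∷_)
    c = count a (lookup t r)

-- The enumeration of splittings is complete and without repetition

NonZero-irrelevant : ∀ {a} (p q : NonZero a) → p ≡ q
NonZero-irrelevant {suc a} p q = refl

partition-ext : ∀ {μ ν} → parts μ ≡ parts ν → μ ≡ ν
partition-ext {mkPartition l d p} {mkPartition .l d′ p′} refl =
  cong₂ (mkPartition l) (Linked.irrelevant ℕₚ.≤-irrelevant d d′) (All.irrelevant NonZero-irrelevant p p′)

decreasing-↭⇒≡ : ∀ {xs ys} → Linked _≥_ xs → Linked _≥_ ys → xs ↭ ys → xs ≡ ys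
decreasing-↭⇒≡ {[]}     {ys}     _  _  p = sym (↭ₚ.↭-empty-inv (↭-sym p))
decreasing-↭⇒≡ {x ∷ xs} {[]}     _  _  p = contradiction (↭ₚ.↭-empty-inv p) (λ ())
decreasing-↭⇒≡ {x ∷ xs} {y ∷ ys} dx dy p with ℕₚ.≤-antisym (below dy (↭ₚ.∈-resp-↭ p (here refl))) (below dx (↭ₚ.∈-resp-↭ (↭-sym p) (here refl)))
  where
  below : ∀ {a b l} → Linked _≥_ (b ∷ l) → a ∈ b ∷ l → a ≤ b
  below d (here refl) = ℕₚ.≤-refl
  below d (there a∈)  = All.lookup (AllPairs.head (Linkedₚ.Linked⇒AllPairs (λ p q → ℕₚ.≤-trans q p) d)) a∈
... | refl = cong (x ∷_) (decreasing-↭⇒≡ (Linked.tail dx) (Linked.tail dy) (↭ₚ.drop-∷ p))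

∈-mapMaybe⁺ : ∀ {A B : Set} (f : A → Maybe B) {xs x y} → x ∈ xs → f x ≡ just y → y ∈ mapMaybe f xs
∈-mapMaybe⁺ f {x ∷ xs} (here refl) eq rewrite eq = here refl
∈-mapMaybe⁺ f {x′ ∷ xs} (there x∈) eq with f x′
... | just _  = there (∈-mapMaybe⁺ f x∈ eq)
... | nothing = ∈-mapMaybe⁺ f x∈ eq

∈-mapMaybe⁻ : ∀ {A B : Set} (f : A → Maybe B) {xs y} → y ∈ mapMaybe f xs → ∃[ x ] x ∈ xs × f x ≡ just y
∈-mapMaybe⁻ f {x ∷ xs} y∈ with f x in eq
∈-mapMaybe⁻ f {x ∷ xs} (here refl) | just _ = x , here refl , eq
∈-mapMaybe⁻ f {x ∷ xs} (there y∈)  | just _ with ∈-mapMaybe⁻ f y∈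
... | x′ , x′∈ , eq′ = x′ , there x′∈ , eq′
∈-mapMaybe⁻ f {x ∷ xs} y∈ | nothing with ∈-mapMaybe⁻ f y∈
... | x′ , x′∈ , eq′ = x′ , there x′∈ , eq′

mapMaybe-unique : ∀ {A B : Set} (f : A → Maybe B) → (∀ {x x′ y} → f x ≡ just y → f x′ ≡ just y → x ≡ x′) → ∀ {xs} → Unique xs → Unique (mapMaybe f xs)
mapMaybe-unique f inj {[]}     []        = []
mapMaybe-unique f inj {x ∷ xs} (x∉ ∷ u) with f x in eq
... | nothing = mapMaybe-unique f inj u
... | just y  = All.tabulate (λ {y′} y′∈ y≡y′ → distinct y≡y′ (∈-mapMaybe⁻ f y′∈)) ∷ mapMaybe-unique f inj u
  where
  distinct : ∀ {y′} → y ≡ y′ → ∃[ x′ ] x′ ∈ xs × f x′ ≡ just y′ → ⊥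
  distinct refl (x′ , x′∈ , eq′) = All.lookup x∉ x′∈ (inj eq eq′)

toPartition-parts : ∀ l {ν} → toPartition l ≡ just ν → parts ν ≡ l
toPartition-parts l eq with linked? _≥?_ l | All.all? ℕₚ.nonZero? l
toPartition-parts l refl | yes d | yes p = refl

toPartition-complete : ∀ ν → toPartition (parts ν) ≡ just ν
toPartition-complete ν with linked? _≥?_ (parts ν) | All.all? ℕₚ.nonZero? (parts ν)
... | yes d | yes p = cong just (partition-ext refl)
... | yes d | no ¬p = contradiction (positive ν) ¬p
... | no ¬d | _     = contradiction (decreasing ν) ¬d

∈-listsUpTo : ∀ es n {l} → length l ≤ n → All (_∈ es) l → l ∈ listsUpTo es n
∈-listsUpTo es zero    {[]}    _       _        = here refl
∈-listsUpTo es (suc n) {[]}    _       _        = here refl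
∈-listsUpTo es (suc n) {a ∷ l} (s≤s p) (a∈ ∷ q) = there (∈ₚ.∈-cartesianProductWith⁺ _∷_ a∈ (∈-listsUpTo es n p q))

listsUpTo-unique : ∀ {es} → Unique es → ∀ n → Unique (listsUpTo es n)
listsUpTo-unique      u zero    = [] ∷ []
listsUpTo-unique {es} u (suc n) = All.tabulate (λ l∈ → nonempty (∈ₚ.∈-cartesianProductWith⁻ _∷_ es (listsUpTo es n) l∈))
  ∷ Uniqueₚ.cartesianProductWith⁺ _∷_ Listₚ.∷-injective u (listsUpTo-unique u n)
  where
  nonempty : ∀ {l} → ∃[ a ] ∃[ l′ ] a ∈ es × l′ ∈ listsUpTo es n × l ≡ a ∷ l′ → [] ≢ l
  nonempty (_ , _ , _ , _ , refl) ()

partitionsInSquare-unique : ∀ n → Unique (partitionsInSquare n)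
partitionsInSquare-unique n = mapMaybe-unique toPartition (λ {l} {l′} eq eq′ → trans (sym (toPartition-parts l eq)) (toPartition-parts l′ eq′))
  (listsUpTo-unique (Uniqueₚ.upTo⁺ (suc n)) n)

∈-partitionsInSquare : ∀ n ν → length (parts ν) ≤ n → All (_≤ n) (parts ν) → ν ∈ partitionsInSquare n
∈-partitionsInSquare n ν len bound = ∈-mapMaybe⁺ toPartition (∈-listsUpTo (upTo (suc n)) n len (All.map (∈ₚ.∈-upTo⁺ ∘ s≤s) bound)) (toPartition-complete ν)

tuples-unique : ∀ {A : Set} k {xs : List A} → Unique xs → Unique (tuples k xs)
tuples-unique zero    u = [] ∷ []
tuples-unique (suc k) u = Uniqueₚ.cartesianProductWith⁺ _∷_ (λ { refl → refl , refl }) u (tuples-unique k u)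

∈-tuples : ∀ {A : Set} {k} {xs : List A} (t : Vec A k) → (∀ r → lookup t r ∈ xs) → t ∈ tuples k xs
∈-tuples []      _  = here refl
∈-tuples (a ∷ t) a∈ = ∈ₚ.∈-cartesianProductWith⁺ _∷_ (a∈ zero) (∈-tuples t (a∈ ∘ suc))

⨄-↭ : ∀ {k} (ts : Vec Partition k) → parts (⨄ ts) ↭ concatᵛ (Vec.map parts ts)
⨄-↭ []       = ↭-refl
⨄-↭ (μ ∷ ts) = ↭-trans (↭ₚ.merge-↭ _≥?_ (parts μ) (parts (⨄ ts))) (↭ₚ.++⁺ˡ (parts μ) (⨄-↭ ts))

-- Indexed by a list, so that the induction in `assign-sum` can pass to the tail. At `parts μ` it is
-- by definition the image of `splittings m μ` under `Vec.map parts`.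
splittingLists : ∀ m → List ℕ → List (Vec (List ℕ) m)
splittingLists m l = map (Vec.map parts) (filter (λ t → Listₚ.≡-dec ℕ._≟_ (parts (⨄ t)) l) (tuples m (partitionsInSquare (sum l))))

length-concatᵛ : ∀ {A : Set} {k} (t : Vec (List A) k) r → length (lookup t r) ≤ length (concatᵛ t)
length-concatᵛ (p ∷ t) zero    = subst (length p ≤_) (sym (Listₚ.length-++ p)) (ℕₚ.m≤m+n (length p) _)
length-concatᵛ (p ∷ t) (suc r) = ℕₚ.≤-trans (length-concatᵛ t r) (subst (length (concatᵛ t) ≤_) (sym (Listₚ.length-++ p)) (ℕₚ.m≤n+m _ (length p)))

map-parts-injective : ∀ {k} {ts ts′ : Vec Partition k} → Vec.map parts ts ≡ Vec.map parts ts′ → ts ≡ ts′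
map-parts-injective {ts = []}     {[]}       _  = refl
map-parts-injective {ts = μ ∷ ts} {μ′ ∷ ts′} eq = cong₂ _∷_ (partition-ext (Vecₚ.∷-injectiveˡ eq)) (map-parts-injective (Vecₚ.∷-injectiveʳ eq))

splittingLists-enumerates : ∀ m {l} → IsPartition l → Enumerates l (splittingLists m l)
splittingLists-enumerates m {l} (dec , pos) = record
  { unique   = Uniqueₚ.map⁺ map-parts-injective (Uniqueₚ.filter⁺ union? (tuples-unique m (partitionsInSquare-unique (sum l))))
  ; sound    = sound
  ; complete = complete
  }
  where
  union? : (t : Vec Partition m) → Dec (parts (⨄ t) ≡ l)
  union? t = Listₚ.≡-dec ℕ._≟_ (parts (⨄ t)) l

  sound : ∀ {t} → t ∈ splittingLists m l → Splits l t
  sound t∈ with ∈ₚ.∈-map⁻ (Vec.map parts) t∈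
  ... | ts , ts∈ , refl with ∈ₚ.∈-filter⁻ union? {xs = tuples m (partitionsInSquare (sum l))} ts∈
  ...   | _ , eq = splits (λ r → subst IsPartition (sym (Vecₚ.lookup-map r parts ts)) (decreasing (lookup ts r) , positive (lookup ts r)))
    (↭-trans (↭-sym (⨄-↭ ts)) (↭.↭-reflexive eq))

  complete : ∀ {t} → Splits l t → t ∈ splittingLists m l
  complete {t} (splits comp union) = subst (_∈ splittingLists m l) map-parts (∈ₚ.∈-map⁺ (Vec.map parts) (∈ₚ.∈-filter⁺ union? member
    (decreasing-↭⇒≡ (decreasing (⨄ ts)) dec (↭-trans (⨄-↭ ts) (↭-trans (↭.↭-reflexive (cong concatᵛ map-parts)) union)))))
    where
    component : Fin m → Partition
    component r = mkPartition (lookup t r) (proj₁ (comp r)) (proj₂ (comp r))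
    ts : Vec Partition m
    ts = tabulate component
    map-parts : Vec.map parts ts ≡ t
    map-parts = vec-ext (λ r → trans (Vecₚ.lookup-map r parts ts) (cong parts (Vecₚ.lookup∘tabulate component r)))
    -- A component has no more parts than `l`, hence at most `sum l` since parts are positive, and
    -- each of its parts is a part of `l`. So it lies in the enumerated square.
    member : ts ∈ tuples m (partitionsInSquare (sum l))
    member = ∈-tuples ts (λ r → subst (_∈ partitionsInSquare (sum l)) (sym (Vecₚ.lookup∘tabulate component r)) (∈-partitionsInSquare (sum l) (component r)
      (ℕₚ.≤-trans (length-concatᵛ t r) (ℕₚ.≤-trans (ℕₚ.≤-reflexive (↭ₚ.↭-length union)) (length≤sum pos)))
      (All.tabulate (λ a∈ → All.lookup (≤-sum l) (↭ₚ.∈-resp-↭ union (∈-concatᵛ t r a∈))))))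

∑↓-zero-length : ∀ a u {F : List ℤ → ℚ} → (∀ w → length w ≡ length u → F w ≡ 0ℚ) → ∑↓ a u F ≡ 0ℚ
∑↓-zero-length a []      eq = refl
∑↓-zero-length a (b ∷ u) eq = cong₂ _+_ (eq (b ℤ.- ℤ.+ a ∷ u) refl) (∑↓-zero-length a u (λ w p → eq (b ∷ w) (cong suc p)))

-- Lowering beads preserves their number, and `E K` requires exactly `K`. This is the source of the
-- vanishing for unsplittable partitions.
mn-length : ∀ K u l → length u ≢ K → mn K u l ≡ 0ℚ
mn-length K u []      neq = E-inadmissible {K} {u} (neq ∘ proj₁)
mn-length K u (a ∷ l) neq = ∑↓-zero-length a u (λ w p → mn-length K w l (λ eq → neq (trans (sym p) eq)))

zipMN-zero : ∀ {k} K (U : Vec (List ℤ) k) t r → length (lookup U r) ≢ K → zipMN K U t ≡ 0ℚ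
zipMN-zero K (u ∷ U) (p ∷ t) zero    neq = trans (cong (_* zipMN K U t) (mn-length K u p neq)) (ℚₚ.*-zeroˡ (zipMN K U t))
zipMN-zero K (u ∷ U) (p ∷ t) (suc r) neq = trans (cong (mn K u p *_) (zipMN-zero K U t r neq)) (ℚₚ.*-zeroʳ (mn K u p))

zipMN-prod : ∀ {k} K (U : Vec (List ℤ) k) (μs : Vec Partition k) (χs : Fin k → ℚ) → (∀ i → χs i ≡ mn K (lookup U i) (parts (lookup μs i))) →
  zProduct⁻¹ (Vec.map parts μs) * zipMN K U (Vec.map parts μs) ≡ ∏[ i < k ] (χs i * z⁻¹ (lookup μs i))
zipMN-prod K []      []       χs eq = refl
zipMN-prod K (u ∷ U) (μ ∷ μs) χs eq = trans
  (solve 4 (λ a b c d → a :* b :* (c :* d) := (c :* a) :* (b :* d)) refl (zList⁻¹ (parts μ)) (zProduct⁻¹ (Vec.map parts μs)) (mn K u (parts μ)) (zipMN K U (Vec.map parts μs)))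
  (cong₂ _*_ (cong₂ _*_ (sym (eq zero)) (sym (z⁻¹-zList μ))) (zipMN-prod K U μs (χs ∘ suc) (eq ∘ suc)))
  where open +-*-Solver

-- The sign of θ, the vanishing criterion and the split formula

module Main (m : ℕ) .{{_ : NonZero m}} (θ : Partition) where

  -- Large enough for `m ℕ.* K` beads to accommodate all parts of `θ`, and chosen from `θ` alone, as
  -- the sign must be.
  K : ℕ
  K = ∣ θ ∣

  fits : length (parts θ) ≤ m ℕ.* K
  fits = ℕₚ.≤-trans (length≤sum (positive θ)) (ℕₚ.m≤n*m K m)

  open Splitting m K θ fits

  private
    sorting : ∃[ s ] IsSign s × (∀ N l → mn N (beads (m ℕ.* K) θ) l ≡ s * mn N (blocks m 0 U) l)
    sorting = mn-~* (↭⇒~* (classes-↭ m (beads (m ℕ.* K) θ)))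

  -- The sign of sorting the beads of `θ` by residue, times the constant sign between the residue
  -- classes.
  sgnθ : ℚ
  sgnθ = proj₁ sorting * blockSign m K 0 m

  sgnθ-isSign : IsSign sgnθ
  sgnθ-isSign = IsSign-* (proj₁ (proj₂ sorting)) (blockSign-isSign m K 0 m ℕₚ.≤-refl)

  χ-assign : ∀ μ → χ θ (scale m μ) ≡ sgnθ * assign (parts μ) (zipMN K U)
  χ-assign μ = begin
    χ θ (scale m μ)
      ≡⟨ murnaghan-nakayama (m ℕ.* K) θ (scale m μ) fits ⟩
    mn (m ℕ.* K) (beads (m ℕ.* K) θ) (map (m ℕ.*_) (parts μ))
      ≡⟨ proj₂ (proj₂ sorting) (m ℕ.* K) (map (m ℕ.*_) (parts μ)) ⟩
    proj₁ sorting * mn (m ℕ.* K) (blocks m 0 U) (map (m ℕ.*_) (parts μ))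
      ≡⟨ cong (proj₁ sorting *_) (mn-blocks m K (parts μ) U) ⟩
    proj₁ sorting * (blockSign m K 0 m * assign (parts μ) (zipMN K U))
      ≡⟨ sym (ℚₚ.*-assoc (proj₁ sorting) (blockSign m K 0 m) (assign (parts μ) (zipMN K U))) ⟩
    sgnθ * assign (parts μ) (zipMN K U) ∎
    where open ≡-Reasoning

  -- By `balanced⇒splittable` some runner has a number of beads other than `K`, and that runner
  -- contributes a zero factor to every assignment of the parts.
  vanishing : ¬ Splittable m θ → ∀ μ → χ θ (scale m μ) ≡ 0ℚ
  vanishing unsplit μ with all? (λ r → length (lookup U r) ℕ.≟ K)
  ... | yes balanced = contradiction (balanced⇒splittable balanced) unsplit
  ... | no  unbalanced with Finₚ.¬∀⟶∃¬ m (λ r → length (lookup U r) ≡ K) (λ r → length (lookup U r) ℕ.≟ K) unbalanced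
  ...   | r , neq = trans (χ-assign μ) (trans (cong (sgnθ *_) (assign-zero (parts μ) (λ t → zipMN-zero K U t r neq))) (ℚₚ.*-zeroʳ sgnθ))

  splitFormula : ∀ θs → IsSplit m θ θs → ∀ μ → χ θ (scale m μ) ≡ ι (z μ) * sgnθ *
    ∑ₗ (splittings m μ) (λ μs → ∏[ i < m ] (χ (lookup θs i) (lookup μs i) * z⁻¹ (lookup μs i)))
  splitFormula θs split μ = begin
    χ θ (scale m μ)
      ≡⟨ χ-assign μ ⟩
    sgnθ * assign (parts μ) (zipMN K U)
      ≡⟨ cong (sgnθ *_) (assign-sum (splittingLists m) (splittingLists-enumerates m) (parts μ) (decreasing μ , positive μ) (zipMN K U)) ⟩
    sgnθ * (ι (zList (parts μ)) * ∑ₗ (map (Vec.map parts) (splittings m μ)) (λ t → zProduct⁻¹ t * zipMN K U t))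
      ≡⟨ cong₂ (λ x s → sgnθ * (ι x * s)) (sym (z-zList μ)) (trans (∑ₗ-map (Vec.map parts) (splittings m μ) (λ t → zProduct⁻¹ t * zipMN K U t))
           (∑ₗ-cong (splittings m μ) (λ {μs} _ → zipMN-prod K U μs (λ i → χ (lookup θs i) (lookup μs i)) (component μs)))) ⟩
    sgnθ * (ι (z μ) * S)
      ≡⟨ solve 3 (λ s x y → s :* (x :* y) := x :* s :* y) refl sgnθ (ι (z μ)) S ⟩
    ι (z μ) * sgnθ * S ∎
    where
    open ≡-Reasoning
    open +-*-Solver
    S : ℚ
    S = ∑ₗ (splittings m μ) (λ μs → ∏[ i < m ] (χ (lookup θs i) (lookup μs i) * z⁻¹ (lookup μs i)))
    component : ∀ (μs : Vec Partition m) i → χ (lookup θs i) (lookup μs i) ≡ mn K (lookup U i) (parts (lookup μs i))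
    component μs i = trans (murnaghan-nakayama K (lookup θs i) (lookup μs i) (split-fits {θs} split i))
      (cong (λ u → mn K u (parts (lookup μs i))) (sym (U-beads {θs} split i)))

open import Data.Integer using (+_)
open import Data.Nat using () renaming (_*_ to _*ℕ_)

mainTheorem3 : (m n : ℕ) .{{_ : NonZero m}} .{{_ : NonZero n}} (θ : Partition) → θ ⊢ m *ℕ n →
    (¬ Splittable m θ → (μ : Partition) → μ ⊢ n → χ θ (scale m μ) ≡ 0ℚ)
    ×
    (Splittable m θ → ∃[ sgnθ ] ((sgnθ ≡ 1ℚ ⊎ sgnθ ≡ - 1ℚ) ×
    ((θs : Vec Partition m) → IsSplit m θ θs → (μ : Partition) → μ ⊢ n →
    χ θ (scale m μ) ≡ (+ z μ / 1) * sgnθ *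
    ∑ₗ (splittings m μ) (λ μs → ∏[ i < m ] (χ (lookup θs i) (lookup μs i) * z⁻¹ (lookup μs i))))))
mainTheorem3 m n θ _ =
  (λ unsplit μ _ → vanishing unsplit μ) , (λ _ → sgnθ , sgnθ-isSign , λ θs split μ _ → splitFormula θs split μ)
  where open Main m θ
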